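{- Let $m\ge5$ be a prime, $k$ a positive integer, $r$ an odd positive integer with $r<m^k$, and $\ell$ a prime different from $2$, $3$ and $m$. Then there exists a (explicitly computable) positive integer $K$ such that \[ p_r\!\left(\frac{m^k\ell^{2\mu K-1}n+r}{24}\right)\equiv 0\pmod{m^k} \] for all positive integers $\mu$ and all positive integers $n$ relatively prime to $\ell$. Moreover, there exists a positive integer $M$ such that \[ p_r\!\left(\frac{m^k\ell^{i}n+r}{24}\right)\equiv p_r\!\left(\frac{m^k\ell^{2M+i}n+r}{24}\right)\pmod{m^k} \] for all nonnegative integers $i$ and $n$.
   Context: $p_r(n)$ denotes the number of $r$-component multipartitions of $n$, i.e. the number of $r$-tuples of partitions whose weights sum to $n$; equivalently $\sum_{n\ge0}p_r(n)q^n=\prod_{n\ge1}(1-q^n)^{ -r}$. By convention $p_r(x)=0$ whenever $x$ is not a nonnegative integer. -}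

module Defs where

open import Data.Nat using (ℕ; zero; suc; _+_; _*_; _∸_; _≤?_; _^_; _%_; _/_)
open import Data.Nat.Divisibility using (_∣?_)
open import Relation.Nullary using (yes; no)
open import Relation.Binary.PropositionalEquality using (_≡_)
open import Data.Integer as ℤ using (ℤ; +_)
open import Data.Integer.Divisibility as ℤD using ()

sumTo : ℕ → (ℕ → ℕ) → ℕ
sumTo zero    f = f 0
sumTo (suc n) f = sumTo n f + f (suc n)

-- number of partitions of n into parts of size at most k
-- (sum over the multiplicity j of the part k)
partsLe : ℕ → ℕ → ℕ
partsLe zero    zero    = 1
partsLe (suc n) zero    = 0
partsLe n       (suc k) = sumTo n λ j → term j
  where
  term : ℕ → ℕ
  term j with j * suc k ≤? n
  ... | yes _ = partsLe (n ∸ j * suc k) k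
  ... | no  _ = 0

partitions : ℕ → ℕ
partitions n = partsLe n n

-- p_r(n): number of r-tuples of partitions with total weight n
-- (the first component has weight a, the remaining r-1 components weight n - a)
multipartitions : ℕ → ℕ → ℕ
multipartitions zero    zero    = 1
multipartitions zero    (suc n) = 0
multipartitions (suc r) n = sumTo n λ a → partitions a * multipartitions r (n ∸ a)

-- p_r(N / 24), with the convention p_r(x) = 0 when x is not a nonnegative integer
pr24 : ℕ → ℕ → ℕ
pr24 r N with 24 ∣? N
... | yes _ = multipartitions r (N / 24)
... | no  _ = 0

Odd : ℕ → Set
Odd r = r % 2 ≡ 1

_≡_[mod_] : ℕ → ℕ → ℕ → Set
a ≡ b [mod n ] = (+ n) ℤD.∣ ((+ a) ℤ.- (+ b))

-- Put η = q ∏ (1 − q^(24n)), and let X and Y be the sums of q^(6x²) over the even and the odd x.  The duplication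
-- formulas for X and Y give Ramanujan's differential equations for e = E2, E4 and E6, and E4³ − E6² = 1728 η²⁴, so
-- that modular forms of level one are polynomials in E4 and E6.  Modulo powers of m, Bol operators applied to η show
-- that D = q d/dq preserves these forms.  Since Σ p_r(N/24) q^N = q^r η^(-r), powers of D − r whose exponent is a
-- multiple of φ(m^k) then project to the N with m^k | N − r, and division by a power of η²⁴ yields a form P with
-- p_r((m^k x + r)/24) congruent to the coefficient of q^(m^k x) in η^s P.
--
-- The series η^s P is a combination of theta series F(N) = #{x ≡ c mod 12, Q(x) = N} in n variables.  Counting the
-- ℓ-neighbours Q_v of Q, F(ℓ²N) = Σ_v F_v(N) + const · F(N) − ℓ^(n−2) F(N/ℓ²) for ℓ | N.  By Hermite reduction
-- finitely many pairs (Q , c) occur, so modulo m^k this is an invertible recurrence on a finite set, hence purely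
-- periodic in the exponent of ℓ.  If ℓ ∤ N, the sequence F(N/ℓ) = 0, F(ℓN), F(ℓ³N), … vanishes at all multiples of
-- the period.
module Submission where

open import Data.Nat as N using (ℕ; zero; suc; z≤n; s≤s)
import Data.Nat.Properties as NP
import Data.Nat.Divisibility as ND
open import Data.Integer as Z using (ℤ; +_; -[1+_])
import Data.Integer.Properties as ZP
open import Data.Integer.Tactic.RingSolver renaming (solve-∀ to ring) using ()
open import Data.Maybe using (Maybe; just; nothing)
open import Data.Product using (Σ; ∃; _×_; _,_; proj₁; proj₂)
open import Data.Sum using (_⊎_; inj₁; inj₂)
open import Data.Empty using (⊥; ⊥-elim)
open import Relation.Nullary using (¬_; Dec; yes; no)
open import Relation.Binary.PropositionalEquality
 using (_≡_; _≢_; refl; sym; trans; cong; cong₂; subst; module ≡-Reasoning)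
open import Function using (_∘_)
open import Level using (0ℓ)
open import Algebra.Bundles using (CommutativeRing)
import Algebra.Solver.Ring as RingSolver
import Algebra.Solver.Ring.AlmostCommutativeRing as ACR
import Relation.Binary.Reasoning.Setoid as SetoidReasoning
open import Data.List as List using (List; []; _∷_; _++_)
open import Data.Vec as Vec using (Vec; []; _∷_)
import Data.Vec.Properties as Vecₚ
open import Relation.Binary.Definitions using (DecidableEquality)
import Data.Nat.DivMod as NM
open import Data.Nat.Tactic.RingSolver renaming (solve-∀ to ringN) using ()
open import Defs
open import Data.Nat.Primality as Prime using (Prime)
open import Data.Fin as Fin using (Fin; zero; suc; toℕ)
import Data.Fin.Properties as Finₚ
open import Relation.Nullary.Decidable using (from-yes)
import Data.Integer.DivMod as ZM
open import Data.Nat.Base using (_!)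
open import Data.Bool using (Bool; true; false; not)
import Data.Nat.Coprimality as Coprime
open import Relation.Nullary.Decidable using (decidable-stable)

-- A modular form is handled formally, as an integral polynomial in E4 and E6 together with a
-- weight. The obstacle is `e` = E2, which D produces and which is no such polynomial. It becomes
-- one modulo m^L as follows. The exponents of η are squares x², so η - D^K η with 2K = m^L (m - 1)
-- loses the x prime to m and is ±η(q^(m²)) modulo m^L; two Bol operators write it as η g with a
-- form g. Its logarithmic derivative gives e g + D g ≡ m² e(q^(m²)) g, hence knowing e modulo m^L
-- determines it modulo m^(L+2). Division by g is possible because g^(m^L) is a unit times a power
-- of η^24 modulo m^L, and division by m because a form divisible as a series is divisible as a
-- form. On the arithmetic side, lattice bases and the relations among theta series are obtained
-- only up to double negation; this suffices because the final congruences are decidable. The period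
-- itself is explicit, the factorial of a number of states, and serves both as K and as M.

module Series where

 -- Congruences of integers and the rings of formal power series

 open Z using (_+_; _*_; -_; _-_)

 -- The quotient is kept as data, so that closure under the ring operations is a polynomial
 -- identity. Modulus 0 is equality, so `Mod (+ 0)` also serves for exact identities.
 record Mod (M a b : ℤ) : Set where
  constructor mod
  field
   quo : ℤ
   eq  : a ≡ b + quo * M

 module _ {M : ℤ} where

  ≡⇒Mod : ∀ {a b} → a ≡ b → Mod M a b
  ≡⇒Mod {a} refl = mod (+ 0) (h a)
   where h : ∀ a → a ≡ a + + 0
         h = ring

  Mod-refl : ∀ {a} → Mod M a a
  Mod-refl = ≡⇒Mod refl

  Mod-sym : ∀ {a b} → Mod M a b → Mod M b a
  Mod-sym {b = b} (mod k refl) = mod (- k) (h b k M)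
   where h : ∀ b k M → b ≡ b + k * M + (- k) * M
         h = ring

  Mod-tr : ∀ {a b c} → Mod M a b → Mod M b c → Mod M a c
  Mod-tr {c = c} (mod k refl) (mod l refl) = mod (l + k) (h c k l M)
   where h : ∀ c k l M → c + l * M + k * M ≡ c + (l + k) * M
         h = ring

  Mod-+ : ∀ {a b c d} → Mod M a b → Mod M c d → Mod M (a + c) (b + d)
  Mod-+ {b = b} {d = d} (mod k refl) (mod l refl) = mod (k + l) (h b d k l M)
   where h : ∀ b d k l M → b + k * M + (d + l * M) ≡ b + d + (k + l) * M
         h = ring

  Mod-* : ∀ {a b c d} → Mod M a b → Mod M c d → Mod M (a * c) (b * d)
  Mod-* {b = b} {d = d} (mod k refl) (mod l refl) = mod (k * d + b * l + k * l * M) (h b d k l M)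
   where h : ∀ b d k l M → (b + k * M) * (d + l * M) ≡ b * d + (k * d + b * l + k * l * M) * M
         h = ring

  Mod-neg : ∀ {a b} → Mod M a b → Mod M (- a) (- b)
  Mod-neg {b = b} (mod k refl) = mod (- k) (h b k M)
   where h : ∀ b k M → - (b + k * M) ≡ - b + (- k) * M
         h = ring

  Mod-multiple : ∀ k → Mod M (k * M) (+ 0)
  Mod-multiple k = mod k (h k M)
   where h : ∀ k M → k * M ≡ + 0 + k * M
         h = ring

 Mod-0⇒≡ : ∀ {a b} → Mod (+ 0) a b → a ≡ b
 Mod-0⇒≡ {b = b} (mod k refl) = h b k
  where h : ∀ b k → b + k * + 0 ≡ b
        h = ring

 Mod-weaken : ∀ {M a b} N → Mod (N * M) a b → Mod M a b
 Mod-weaken {M} {b = b} N (mod k refl) = mod (k * N) (h b k N M)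
  where h : ∀ b k N M → b + k * (N * M) ≡ b + k * N * M
        h = ring

 Mod-scale : ∀ {M a b} N → Mod M a b → Mod (N * M) (N * a) (N * b)
 Mod-scale {M} {b = b} N (mod k refl) = mod k (h b k N M)
  where h : ∀ b k N M → N * (b + k * M) ≡ N * b + k * (N * M)
        h = ring

 Mod-- : ∀ {M a b} → Mod M a b → Mod M (a - b) (+ 0)
 Mod-- {M} {b = b} (mod k refl) = mod k (h b k M)
  where h : ∀ b k M → b + k * M - b ≡ + 0 + k * M
        h = ring

 Ser : Set
 Ser = ℕ → ℤ

 infixl 6 _⊕_ _⊝_
 infixl 7 _·_
 infix 8 ⊖_

 tl : Ser → Ser
 tl f n = f (suc n)

 const : ℤ → Ser
 const c zero    = c
 const c (suc _) = + 0

 opaque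

  _⊕_ : Ser → Ser → Ser
  (f ⊕ g) n = f n + g n

  ⊖_ : Ser → Ser
  (⊖ f) n = - f n

  -- The Cauchy product, by f · g = f 0 g + q (tl f · g).
  _·_ : Ser → Ser → Ser
  (f · g) zero    = f 0 * g 0
  (f · g) (suc n) = f 0 * g (suc n) + (tl f · g) n

  ·-cong-≡ : ∀ {f f' g g'} n → (∀ i → i N.≤ n → f i ≡ f' i) → (∀ i → i N.≤ n → g i ≡ g' i) →
       (f · g) n ≡ (f' · g') n
  ·-cong-≡ zero    p q = cong₂ _*_ (p 0 z≤n) (q 0 z≤n)
  ·-cong-≡ (suc n) p q = cong₂ _+_ (cong₂ _*_ (p 0 z≤n) (q (suc n) NP.≤-refl))
   (·-cong-≡ n (λ i i≤n → p (suc i) (s≤s i≤n)) (λ i i≤n → q i (NP.m≤n⇒m≤1+n i≤n)))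

  ·-tlʳ : ∀ f g n → (f · g) (suc n) ≡ f (suc n) * g 0 + (f · tl g) n
  ·-tlʳ f g zero    = ZP.+-comm (f 0 * g 1) (f 1 * g 0)
  ·-tlʳ f g (suc n) rewrite ·-tlʳ (tl f) g n =
   h (f 0 * g (suc (suc n))) (f (suc (suc n)) * g 0) ((tl f · tl g) n)
   where h : ∀ a b c → a + (b + c) ≡ b + (a + c)
         h = ring

  ·-comm-≡ : ∀ f g n → (f · g) n ≡ (g · f) n
  ·-comm-≡ f g zero    = ZP.*-comm (f 0) (g 0)
  ·-comm-≡ f g (suc n) = trans (cong₂ _+_ (ZP.*-comm (f 0) (g (suc n))) (·-comm-≡ (tl f) g n))
                (sym (·-tlʳ g f n))

  ·-distribʳ-≡ : ∀ f g h n → ((g ⊕ h) · f) n ≡ (g · f ⊕ h · f) n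
  ·-distribʳ-≡ f g h zero    = ZP.*-distribʳ-+ (f 0) (g 0) (h 0)
  ·-distribʳ-≡ f g h (suc n) rewrite ·-distribʳ-≡ f (tl g) (tl h) n =
   r (g 0) (h 0) (f (suc n)) ((tl g · f) n) ((tl h · f) n)
   where r : ∀ a b c d e → (a + b) * c + (d + e) ≡ a * c + d + (b * c + e)
         r = ring

  scale-·-≡ : ∀ c f g n → ((λ i → c * f i) · g) n ≡ c * (f · g) n
  scale-·-≡ c f g zero    = ZP.*-assoc c (f 0) (g 0)
  scale-·-≡ c f g (suc n) rewrite scale-·-≡ c (tl f) g n =
   r c (f 0) (g (suc n)) ((tl f · g) n)
   where r : ∀ c a b d → c * a * b + c * d ≡ c * (a * b + d)
         r = ring

  ·-assoc-≡ : ∀ f g h n → ((f · g) · h) n ≡ (f · (g · h)) n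
  ·-assoc-≡ f g h zero    = ZP.*-assoc (f 0) (g 0) (h 0)
  ·-assoc-≡ f g h (suc n) = begin
   f 0 * g 0 * h (suc n) + (tl (f · g) · h) n
    ≡⟨ cong (_+_ (f 0 * g 0 * h (suc n))) (·-distribʳ-≡ h (λ i → f 0 * g (suc i)) (tl f · g) n) ⟩
   f 0 * g 0 * h (suc n) + (((λ i → f 0 * g (suc i)) · h) n + ((tl f · g) · h) n)
    ≡⟨ cong (_+_ (f 0 * g 0 * h (suc n))) (cong₂ _+_ (scale-·-≡ (f 0) (tl g) h n) (·-assoc-≡ (tl f) g h n)) ⟩
   f 0 * g 0 * h (suc n) + (f 0 * (tl g · h) n + (tl f · (g · h)) n)
    ≡⟨ r (f 0) (g 0) (h (suc n)) ((tl g · h) n) ((tl f · (g · h)) n) ⟩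
   f 0 * (g 0 * h (suc n) + (tl g · h) n) + (tl f · (g · h)) n ∎
   where open ≡-Reasoning
         r : ∀ a b c d e → a * b * c + (a * d + e) ≡ a * (b * c + d) + e
         r = ring

  0-·-≡ : ∀ {f} g n → (∀ i → i N.≤ n → f i ≡ + 0) → (f · g) n ≡ + 0
  0-·-≡ {f} g zero p rewrite p 0 z≤n = ZP.*-zeroˡ (g 0)
  0-·-≡ {f} g (suc n) p rewrite p 0 z≤n | 0-·-≡ {tl f} g n (λ i i≤n → p (suc i) (s≤s i≤n)) = refl

  const-·-≡ : ∀ c f n → (const c · f) n ≡ c * f n
  const-·-≡ c f zero    = refl
  const-·-≡ c f (suc n) rewrite 0-·-≡ {tl (const c)} f n (λ _ _ → refl) = ZP.+-identityʳ (c * f (suc n))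

 _⊝_ : Ser → Ser → Ser
 f ⊝ g = f ⊕ ⊖ g

 record SMod (M : ℤ) (f g : Ser) : Set where
  constructor smod
  field
   at : ∀ n → Mod M (f n) (g n)
 open SMod public

 ≡⇒SMod : ∀ {M f g} → (∀ n → f n ≡ g n) → SMod M f g
 ≡⇒SMod p = smod λ n → ≡⇒Mod (p n)

 SMod-0⇒≡ : ∀ {f g} → SMod (+ 0) f g → ∀ n → f n ≡ g n
 SMod-0⇒≡ p n = Mod-0⇒≡ (at p n)

 exact : ∀ {M f g} → SMod (+ 0) f g → SMod M f g
 exact p = ≡⇒SMod (SMod-0⇒≡ p)

 opaque
  unfolding _⊕_ _·_ ⊖_

  ·-cong-Mod : ∀ {M f f' g g'} n → (∀ i → i N.≤ n → Mod M (f i) (f' i)) →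
        (∀ i → i N.≤ n → Mod M (g i) (g' i)) → Mod M ((f · g) n) ((f' · g') n)
  ·-cong-Mod zero    p q = Mod-* (p 0 z≤n) (q 0 z≤n)
  ·-cong-Mod (suc n) p q = Mod-+ (Mod-* (p 0 z≤n) (q (suc n) NP.≤-refl))
   (·-cong-Mod n (λ i i≤n → p (suc i) (s≤s i≤n)) (λ i i≤n → q i (NP.m≤n⇒m≤1+n i≤n)))

  ⊕-at : ∀ f g n → (f ⊕ g) n ≡ f n + g n
  ⊕-at f g n = refl

  ⊖-at : ∀ f n → (⊖ f) n ≡ - f n
  ⊖-at f n = refl

  ·-at-0 : ∀ f g → (f · g) 0 ≡ f 0 * g 0
  ·-at-0 f g = refl

  ⊕-cong-SMod : ∀ {M f f' g g'} → SMod M f f' → SMod M g g' → SMod M (f ⊕ g) (f' ⊕ g')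
  ⊕-cong-SMod p q = smod λ n → Mod-+ (at p n) (at q n)

  ⊖-cong-SMod : ∀ {M f f'} → SMod M f f' → SMod M (⊖ f) (⊖ f')
  ⊖-cong-SMod p = smod λ n → Mod-neg (at p n)

  ⊕-assoc-≡ : ∀ f g h n → (f ⊕ g ⊕ h) n ≡ (f ⊕ (g ⊕ h)) n
  ⊕-assoc-≡ f g h n = ZP.+-assoc (f n) (g n) (h n)

  ⊕-comm-≡ : ∀ f g n → (f ⊕ g) n ≡ (g ⊕ f) n
  ⊕-comm-≡ f g n = ZP.+-comm (f n) (g n)

  ⊕-identityˡ-≡ : ∀ f n → (const (+ 0) ⊕ f) n ≡ f n
  ⊕-identityˡ-≡ f zero    = ZP.+-identityˡ (f 0)
  ⊕-identityˡ-≡ f (suc n) = ZP.+-identityˡ (f (suc n))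

  ⊕-inverseˡ-≡ : ∀ f n → (⊖ f ⊕ f) n ≡ const (+ 0) n
  ⊕-inverseˡ-≡ f zero    = ZP.+-inverseˡ (f 0)
  ⊕-inverseˡ-≡ f (suc n) = ZP.+-inverseˡ (f (suc n))

  ·-distribˡ-≡ : ∀ f g h n → (f · (g ⊕ h)) n ≡ (f · g ⊕ f · h) n
  ·-distribˡ-≡ f g h n = trans (·-comm-≡ f (g ⊕ h) n)
   (trans (·-distribʳ-≡ f g h n) (cong₂ _+_ (·-comm-≡ g f n) (·-comm-≡ h f n)))

  const-+ : ∀ {M} a b → SMod M (const (a + b)) (const a ⊕ const b)
  const-+ a b = ≡⇒SMod λ { zero → refl ; (suc n) → refl }

  const-* : ∀ {M} a b → SMod M (const (a * b)) (const a · const b)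
  const-* a b = ≡⇒SMod λ { zero → refl ; (suc n) → sym (trans (const-·-≡ a (const b) (suc n)) (ZP.*-zeroʳ a)) }

  const-neg : ∀ {M} a → SMod M (const (- a)) (⊖ const a)
  const-neg a = ≡⇒SMod λ { zero → refl ; (suc n) → refl }

 -- One ring structure for each modulus on the same carrier. Modulus 0 gives ℤ[[q]] itself, and
 -- `exact` carries its identities to every other modulus.
 seriesRing : ℤ → CommutativeRing 0ℓ 0ℓ
 seriesRing M = record
  { Carrier = Ser
  ; _≈_ = SMod M
  ; _+_ = _⊕_
  ; _*_ = _·_
  ; -_ = ⊖_
  ; 0# = const (+ 0)
  ; 1# = const (+ 1)
  ; isCommutativeRing = record
   { isRing = record
    { +-isAbelianGroup = record
     { isGroup = record
      { isMonoid = record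
       { isSemigroup = record
        { isMagma = record
         { isEquivalence = record
          { refl  = smod λ n → Mod-refl
          ; sym   = λ p → smod λ n → Mod-sym (at p n)
          ; trans = λ p q → smod λ n → Mod-tr (at p n) (at q n) }
         ; ∙-cong = ⊕-cong-SMod }
        ; assoc = λ f g h → ≡⇒SMod (⊕-assoc-≡ f g h) }
       ; identity = (λ f → ≡⇒SMod (⊕-identityˡ-≡ f))
            , (λ f → ≡⇒SMod λ n → trans (⊕-comm-≡ f _ n) (⊕-identityˡ-≡ f n)) }
      ; inverse = (λ f → ≡⇒SMod (⊕-inverseˡ-≡ f))
           , (λ f → ≡⇒SMod λ n → trans (⊕-comm-≡ f _ n) (⊕-inverseˡ-≡ f n))
      ; ⁻¹-cong = ⊖-cong-SMod }
     ; comm = λ f g → ≡⇒SMod (⊕-comm-≡ f g) }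
    ; *-cong = λ p q → smod λ n → ·-cong-Mod n (λ i _ → at p i) (λ i _ → at q i)
    ; *-assoc = λ f g h → ≡⇒SMod (·-assoc-≡ f g h)
    ; *-identity = (λ f → ≡⇒SMod (oneˡ f)) , (λ f → ≡⇒SMod λ n → trans (·-comm-≡ f (const (+ 1)) n) (oneˡ f n))
    ; distrib = (λ f g h → ≡⇒SMod (·-distribˡ-≡ f g h))
         , (λ f g h → ≡⇒SMod (·-distribʳ-≡ f g h)) }
   ; *-comm = λ f g → ≡⇒SMod (·-comm-≡ f g) } }
  where
  oneˡ : ∀ f n → (const (+ 1) · f) n ≡ f n
  oneˡ f n = trans (const-·-≡ (+ 1) f n) (ZP.*-identityˡ (f n))

 module SR (M : ℤ) where
  open CommutativeRing (seriesRing M) public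
   using (setoid; _≈_; *-comm; *-assoc; *-identityˡ; *-identityʳ;
      +-identityˡ; +-identityʳ; distribˡ; distribʳ; zeroˡ; zeroʳ; commutativeSemiring)
   renaming (+-cong to +c; *-cong to *c; -‿cong to -c; refl to rfl; sym to sm; trans to tr)

  const≟ : ∀ a b → Maybe (const a ≈ const b)
  const≟ a b with a Z.≟ b
  ... | yes refl = just rfl
  ... | no _     = nothing

  constants : Z.+-*-rawRing ACR.-Raw-AlmostCommutative⟶ ACR.fromCommutativeRing (seriesRing M)
  constants = record { ⟦_⟧ = const ; +-homo = const-+ ; *-homo = const-* ; -‿homo = const-neg
           ; 0-homo = CommutativeRing.refl (seriesRing M) ; 1-homo = CommutativeRing.refl (seriesRing M) }

  open RingSolver Z.+-*-rawRing (ACR.fromCommutativeRing (seriesRing M)) constants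
   const≟ public
   using (solve; _:=_; _:+_; _:*_; _:-_; :-_; _:^_; con)
  module ≈-Reasoning = SetoidReasoning setoid

open Series

-- Calculus of power series: powers, the derivation D, order, substitution, inverses

module Operators where

 open Z using (_+_; _*_; -_; _-_)

 module E = SR (+ 0)

 infix 4 _≋_
 _≋_ : Ser → Ser → Set
 f ≋ g = SMod (+ 0) f g

 ≡⇒≋ : ∀ {f g} → (∀ n → f n ≡ g n) → f ≋ g
 ≡⇒≋ = ≡⇒SMod

 infixr 8 _↑_
 _↑_ : Ser → ℕ → Ser
 f ↑ zero  = const (+ 1)
 f ↑ suc n = f · f ↑ n

 module _ {M : ℤ} where
  open SR M

  ↑-cong : ∀ {f g} n → f ≈ g → f ↑ n ≈ g ↑ n
  ↑-cong zero    p = rfl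
  ↑-cong (suc n) p = *c p (↑-cong n p)

  ↑-+ : ∀ f m n → f ↑ (m N.+ n) ≈ f ↑ m · f ↑ n
  ↑-+ f zero    n = sm (*-identityˡ (f ↑ n))
  ↑-+ f (suc m) n = tr (*c rfl (↑-+ f m n)) (sm (*-assoc f (f ↑ m) (f ↑ n)))

  ·-↑ : ∀ f g n → (f · g) ↑ n ≈ f ↑ n · g ↑ n
  ·-↑ f g zero    = sm (*-identityˡ _)
  ·-↑ f g (suc n) = tr (*c rfl (·-↑ f g n))
   (solve 4 (λ a b c d → a :* b :* (c :* d) := a :* c :* (b :* d)) rfl f g (f ↑ n) (g ↑ n))

  1-↑ : ∀ n → const (+ 1) ↑ n ≈ const (+ 1)
  1-↑ zero    = rfl
  1-↑ (suc n) = tr (*-identityˡ _) (1-↑ n)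

  ↑-* : ∀ f m n → f ↑ (m N.* n) ≈ (f ↑ n) ↑ m
  ↑-* f zero    n = rfl
  ↑-* f (suc m) n = tr (↑-+ f n (m N.* n)) (*c rfl (↑-* f m n))

 const-↑ : ∀ {M} a n → SMod M (const a ↑ n) (const (a Z.^ n))
 const-↑ {M} a zero    = SR.rfl M
 const-↑ {M} a (suc n) = tr (*c rfl (const-↑ a n)) (sm (const-* a (a Z.^ n)))
  where open SR M

 Mod⇒const : ∀ {M a b} → Mod M a b → SMod M (const a) (const b)
 Mod⇒const p = smod λ { zero → p ; (suc n) → Mod-refl }

 D : Ser → Ser
 D f n = + n * f n

 module _ {M : ℤ} where
  open SR M

  D-cong : ∀ {f g} → f ≈ g → D f ≈ D g
  D-cong p = smod λ n → Mod-* {a = + n} {+ n} Mod-refl (at p n)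

  opaque
   unfolding _⊕_ ⊖_

   D-⊕ : ∀ f g → D (f ⊕ g) ≈ D f ⊕ D g
   D-⊕ f g = ≡⇒SMod λ n → ZP.*-distribˡ-+ (+ n) (f n) (g n)

   D-⊖ : ∀ f → D (⊖ f) ≈ ⊖ D f
   D-⊖ f = ≡⇒SMod λ n → sym (ZP.neg-distribʳ-* (+ n) (f n))

  D-const : ∀ c → D (const c) ≈ const (+ 0)
  D-const c = ≡⇒SMod λ { zero → refl ; (suc n) → ZP.*-zeroʳ (+ suc n) }

 -- This is q^(-s) D (q^s f). Dropping the constant term of f raises s by one, which makes the
 -- product rule provable by induction.
 Dₛ : ℤ → Ser → Ser
 Dₛ s f n = (s + + n) * f n

 opaque
  unfolding _⊕_ _·_

  Dₛ-· : ∀ s t f g n → Dₛ (s + t) (f · g) n ≡ (Dₛ s f · g ⊕ f · Dₛ t g) n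
  Dₛ-· s t f g zero    = h s t (f 0) (g 0)
   where h : ∀ s t a b → (s + t + + 0) * (a * b) ≡ (s + + 0) * a * b + a * ((t + + 0) * b)
         h = ring
  Dₛ-· s t f g (suc n) = begin
   (s + t + + suc n) * (f 0 * g (suc n) + (tl f · g) n)
    ≡⟨ r1 s t (+ n) (f 0) (g (suc n)) ((tl f · g) n) ⟩
   (s + + 0) * f 0 * g (suc n) + f 0 * ((t + (+ 1 + + n)) * g (suc n)) + (s + + 1 + t + + n) * (tl f · g) n
    ≡⟨ cong (_+_ ((s + + 0) * f 0 * g (suc n) + f 0 * ((t + (+ 1 + + n)) * g (suc n)))) (Dₛ-· (s + + 1) t (tl f) g n) ⟩
   (s + + 0) * f 0 * g (suc n) + f 0 * ((t + (+ 1 + + n)) * g (suc n)) +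
    ((Dₛ (s + + 1) (tl f) · g) n + (tl f · Dₛ t g) n)
    ≡⟨ cong (λ z → (s + + 0) * f 0 * g (suc n) + f 0 * ((t + (+ 1 + + n)) * g (suc n)) + (z + (tl f · Dₛ t g) n))
      (·-cong-≡ {g = g} n (λ i _ → r2 s (+ i) (f (suc i))) (λ _ _ → refl)) ⟩
   (s + + 0) * f 0 * g (suc n) + f 0 * ((t + (+ 1 + + n)) * g (suc n)) +
    ((tl (Dₛ s f) · g) n + (tl f · Dₛ t g) n)
    ≡⟨ r3 ((s + + 0) * f 0 * g (suc n)) (f 0 * ((t + (+ 1 + + n)) * g (suc n))) ((tl (Dₛ s f) · g) n) ((tl f · Dₛ t g) n) ⟩
   (s + + 0) * f 0 * g (suc n) + (tl (Dₛ s f) · g) n + (f 0 * ((t + (+ 1 + + n)) * g (suc n)) + (tl f · Dₛ t g) n) ∎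
   where
   open ≡-Reasoning
   r1 : ∀ s t n a b c → (s + t + (+ 1 + n)) * (a * b + c) ≡
     (s + + 0) * a * b + a * ((t + (+ 1 + n)) * b) + (s + + 1 + t + n) * c
   r1 = ring
   r2 : ∀ s i a → (s + + 1 + i) * a ≡ (s + (+ 1 + i)) * a
   r2 = ring
   r3 : ∀ a b c d → a + b + (c + d) ≡ a + c + (b + d)
   r3 = ring

  D-· : ∀ {M} f g → SMod M (D (f · g)) (D f · g ⊕ f · D g)
  D-· f g = ≡⇒SMod λ n → begin
   + n * (f · g) n                    ≡⟨ cong (_* (f · g) n) (sym (ZP.+-identityˡ (+ n))) ⟩
   (+ 0 + + n) * (f · g) n            ≡⟨ Dₛ-· (+ 0) (+ 0) f g n ⟩
   (Dₛ (+ 0) f · g ⊕ f · Dₛ (+ 0) g) n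
    ≡⟨ cong₂ _+_ (·-cong-≡ {g = g} n (λ i _ → e f i) (λ _ _ → refl))
          (·-cong-≡ {f} n (λ _ _ → refl) (λ i _ → e g i)) ⟩
   (D f · g ⊕ f · D g) n ∎
   where open ≡-Reasoning
         e : ∀ f i → Dₛ (+ 0) f i ≡ D f i
         e f i = cong (_* f i) (ZP.+-identityˡ (+ i))

 module _ {M : ℤ} where
  open SR M

  D-const-· : ∀ c f → D (const c · f) ≈ const c · D f
  D-const-· c f = tr (D-· (const c) f) (tr (+c (*c (D-const c) rfl) rfl)
   (solve 2 (λ c y → con (+ 0) :* y :+ c := c) rfl (const c · D f) f))

  D-↑ : ∀ f n → D (f ↑ suc n) ≈ const (+ suc n) · f ↑ n · D f
  D-↑ f zero    = tr (D-· f (const (+ 1))) (tr (+c rfl (*c rfl (D-const (+ 1))))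
   (solve 2 (λ f d → d :* con (+ 1) :+ f :* con (+ 0) := con (+ 1) :* con (+ 1) :* d) rfl f (D f)))
  D-↑ f (suc n) = tr (D-· f (f ↑ suc n)) (tr (+c rfl (*c rfl (D-↑ f n)))
   (tr (solve 4 (λ f d p c → d :* (f :* p) :+ f :* (c :* p :* d) := (con (+ 1) :+ c) :* (f :* p) :* d) rfl
    f (D f) (f ↑ n) (const (+ suc n)))
   (*c (*c (sm (const-+ (+ 1) (+ suc n))) rfl) rfl)))

 sh : ℕ → Ser → Ser
 sh zero    f n       = f n
 sh (suc k) f zero    = + 0
 sh (suc k) f (suc n) = sh k f n

 q^ : ℕ → Ser
 q^ k = sh k (const (+ 1))

 drop : ℕ → Ser → Ser
 drop k f n = f (k N.+ n)

 sh-at : ∀ k f n → sh k f (k N.+ n) ≡ f n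
 sh-at zero    f n = refl
 sh-at (suc k) f n = sh-at k f n

 sh-below : ∀ k f n → n N.< k → sh k f n ≡ + 0
 sh-below (suc k) f zero    _       = refl
 sh-below (suc k) f (suc n) (s≤s p) = sh-below k f n p

 opaque
  unfolding _·_

  sh-· : ∀ k f g n → (sh k f · g) n ≡ sh k (f · g) n
  sh-· zero    f g n       = refl
  sh-· (suc k) f g zero    = ZP.*-zeroˡ (g 0)
  sh-· (suc k) f g (suc n) = begin
   + 0 * g (suc n) + (sh k f · g) n ≡⟨ cong₂ _+_ (ZP.*-zeroˡ (g (suc n))) (sh-· k f g n) ⟩
   + 0 + sh k (f · g) n             ≡⟨ ZP.+-identityˡ _ ⟩
   sh k (f · g) n ∎
   where open ≡-Reasoning

 sh-cong-≡ : ∀ k {f g} → (∀ n → f n ≡ g n) → ∀ n → sh k f n ≡ sh k g n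
 sh-cong-≡ zero    p n       = p n
 sh-cong-≡ (suc k) p zero    = refl
 sh-cong-≡ (suc k) p (suc n) = sh-cong-≡ k p n

 q^-· : ∀ {M} k f → SMod M (q^ k · f) (sh k f)
 q^-· k f = ≡⇒SMod λ n → trans (sh-· k (const (+ 1)) f n)
  (sh-cong-≡ k (λ i → trans (const-·-≡ (+ 1) f i) (ZP.*-identityˡ (f i))) n)

 sh-sh : ∀ j k f n → sh j (sh k f) n ≡ sh (j N.+ k) f n
 sh-sh zero    k f n       = refl
 sh-sh (suc j) k f zero    = refl
 sh-sh (suc j) k f (suc n) = sh-sh j k f n

 q^-+ : ∀ {M} j k → SMod M (q^ j · q^ k) (q^ (j N.+ k))
 q^-+ {M} j k = SR.tr M (q^-· j (q^ k)) (≡⇒SMod (sh-sh j k _))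

 q^-≢ : ∀ k n → k ≢ n → q^ k n ≡ + 0
 q^-≢ zero    zero    p = ⊥-elim (p refl)
 q^-≢ zero    (suc n) p = refl
 q^-≢ (suc k) zero    p = refl
 q^-≢ (suc k) (suc n) p = q^-≢ k n (p ∘ cong suc)

 q^-≡ : ∀ k → q^ k k ≡ + 1
 q^-≡ zero    = refl
 q^-≡ (suc k) = q^-≡ k

 D-q^ : ∀ {M} k → SMod M (D (q^ k)) (const (+ k) · q^ k)
 D-q^ k = ≡⇒SMod λ n → trans (h n (n N.≟ k)) (sym (const-·-≡ (+ k) (q^ k) n))
  where h : ∀ n → Dec (n ≡ k) → + n * q^ k n ≡ + k * q^ k n
        h n (yes refl) = refl
        h n (no p) rewrite q^-≢ k n (p ∘ sym) = trans (ZP.*-zeroʳ (+ n)) (sym (ZP.*-zeroʳ (+ k)))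

 Ord : ℤ → ℕ → Ser → Set
 Ord M k f = ∀ n → n N.< k → Mod M (f n) (+ 0)

 Ord-⇒ : ∀ {M} k {f} → Ord M k f → SMod M f (q^ k · drop k f)
 Ord-⇒ {M} k {f} o = smod λ n → Mod-tr (h k f o n) (Mod-sym (at (q^-· {M} k (drop k f)) n))
  where h : ∀ k f → Ord M k f → ∀ n → Mod M (f n) (sh k (drop k f) n)
        h zero    f o n       = Mod-refl
        h (suc k) f o zero    = o 0 (s≤s z≤n)
        h (suc k) f o (suc n) = h k (tl f) (λ n p → o (suc n) (s≤s p)) n

 Ord-⇐ : ∀ {M} k {f g} → SMod M f (q^ k · g) → Ord M k f
 Ord-⇐ {M} k {f} {g} p n n<k =
  Mod-tr (at p n) (Mod-tr (at (q^-· {M} k g) n) (≡⇒Mod (sh-below k g n n<k)))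

 q^-cancel : ∀ {M} k {f g} → SMod M (q^ k · f) (q^ k · g) → SMod M f g
 q^-cancel {M} k {f} {g} p = smod λ n → subst2 (sh-at k f n) (sh-at k g n)
   (Mod-tr (Mod-sym (at (q^-· {M} k f) (k N.+ n))) (Mod-tr (at p (k N.+ n)) (at (q^-· {M} k g) (k N.+ n))))
  where subst2 : ∀ {a a' b b'} → a ≡ a' → b ≡ b' → Mod M a b → Mod M a' b'
        subst2 refl refl x = x

 module _ {M : ℤ} where
  open SR M

  Ord-·-⇒ : ∀ k l {f g} → Ord M k f → Ord M l g → f · g ≈ q^ (k N.+ l) · (drop k f · drop l g)
  Ord-·-⇒ k l {f} {g} o o' = tr (*c (Ord-⇒ k o) (Ord-⇒ l o'))
   (tr (solve 4 (λ a b c d → a :* b :* (c :* d) := a :* c :* (b :* d)) rfl (q^ k) (drop k f) (q^ l) (drop l g))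
    (*c (q^-+ k l) rfl))

  Ord-· : ∀ k l {f g} → Ord M k f → Ord M l g → Ord M (k N.+ l) (f · g)
  Ord-· k l o o' = Ord-⇐ (k N.+ l) (Ord-·-⇒ k l o o')

  opaque
   unfolding _·_

   leading-· : ∀ k l {f g} → Ord M k f → Ord M l g → Mod M ((f · g) (k N.+ l)) (f k * g l)
   leading-· k l {f} {g} o o' = Mod-tr (at (Ord-·-⇒ k l o o') (k N.+ l))
    (Mod-tr (at (q^-· {M} (k N.+ l) (drop k f · drop l g)) (k N.+ l))
     (≡⇒Mod (trans (cong (sh (k N.+ l) _) (sym (NP.+-identityʳ (k N.+ l))))
      (trans (sh-at (k N.+ l) _ 0) (cong₂ (λ i j → f i * g j) (NP.+-identityʳ k) (NP.+-identityʳ l))))))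

 -- The substitution q ↦ q^(d+1).  W d j f is q^j f(q^(d+1)).

 W : ℕ → ℕ → Ser → Ser
 W d zero    f zero    = f 0
 W d zero    f (suc n) = W d d (tl f) n
 W d (suc j) f zero    = + 0
 W d (suc j) f (suc n) = W d j f n

 sub : ℕ → Ser → Ser
 sub d = W d 0

 W-at : ∀ d j f k → W d j f (j N.+ k N.* suc d) ≡ f k
 W-at d (suc j) f k       = W-at d j f k
 W-at d zero    f zero    = refl
 W-at d zero    f (suc k) = W-at d d (tl f) k

 -- The second alternative speaks of all f at once, so that one distinction of cases settles an
 -- identity between several series.
 W-view : ∀ d j n → (∃ λ k → n ≡ j N.+ k N.* suc d) ⊎ (∀ f → W d j f n ≡ + 0)
 W-view d zero    zero    = inj₁ (0 , refl)
 W-view d zero    (suc n) with W-view d d n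
 ... | inj₁ (k , refl) = inj₁ (suc k , refl)
 ... | inj₂ p          = inj₂ λ f → p (tl f)
 W-view d (suc j) zero    = inj₂ λ f → refl
 W-view d (suc j) (suc n) with W-view d j n
 ... | inj₁ (k , refl) = inj₁ (k , refl)
 ... | inj₂ p          = inj₂ p

 sub-at : ∀ d f k → sub d f (k N.* suc d) ≡ f k
 sub-at d = W-at d 0

 sub-rel : ∀ d (R : ℤ → ℤ → Set) {f g} → R (+ 0) (+ 0) → (∀ n → R (f n) (g n)) → ∀ n → R (sub d f n) (sub d g n)
 sub-rel d R {f} {g} z p n with W-view d 0 n
 ... | inj₁ (k , refl) rewrite sub-at d f k | sub-at d g k = p k
 ... | inj₂ h rewrite h f | h g = z

 sub-≡ : ∀ d f (h : ℕ → ℤ) → (∀ k → f k ≡ h (k N.* suc d)) → (∀ n → ¬ (∃ λ k → n ≡ k N.* suc d) → + 0 ≡ h n) →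
     ∀ n → sub d f n ≡ h n
 sub-≡ d f h p z n with W-view d 0 n
 ... | inj₁ (k , refl) = trans (sub-at d f k) (p k)
 ... | inj₂ e = trans (e f) (z' (W-view' n))
  where
  W-view' : ∀ n → (∃ λ k → n ≡ k N.* suc d) ⊎ ¬ (∃ λ k → n ≡ k N.* suc d)
  W-view' n with suc d ND.∣? n
  ... | yes (ND.divides k e) = inj₁ (k , e)
  ... | no ¬p = inj₂ λ (k , e) → ¬p (ND.divides k e)
  z' : (∃ λ k → n ≡ k N.* suc d) ⊎ ¬ (∃ λ k → n ≡ k N.* suc d) → + 0 ≡ h n
  z' (inj₂ q) = z n q
  -- Were n a multiple of the step although every substituted series vanishes there, f k itself
  -- would be 0.
  z' (inj₁ (k , refl)) = trans (trans (sym (e (const (h (k N.* suc d))))) (u k e)) (p k)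
   where u : ∀ k → (∀ f → W d 0 f (k N.* suc d) ≡ + 0) → W d 0 (const (h (k N.* suc d))) (k N.* suc d) ≡ f k
         u k e = trans (e _) (trans (sym (e f)) (sub-at d f k))

 module _ {M : ℤ} (d : ℕ) where
  open SR M

  sub-cong : ∀ {f g} → f ≈ g → sub d f ≈ sub d g
  sub-cong p = smod (sub-rel d (Mod M) Mod-refl (at p))

  opaque
   unfolding _⊕_ ⊖_

   sub-⊕ : ∀ f g → sub d (f ⊕ g) ≈ sub d f ⊕ sub d g
   sub-⊕ f g = ≡⇒SMod h
    where h : ∀ n → sub d (f ⊕ g) n ≡ (sub d f ⊕ sub d g) n
          h n with W-view d 0 n
          ... | inj₁ (k , refl) rewrite sub-at d (f ⊕ g) k | sub-at d f k | sub-at d g k = refl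
          ... | inj₂ p rewrite p (f ⊕ g) | p f | p g = refl

   sub-⊖ : ∀ f → sub d (⊖ f) ≈ ⊖ sub d f
   sub-⊖ f = ≡⇒SMod h
    where h : ∀ n → sub d (⊖ f) n ≡ (⊖ sub d f) n
          h n with W-view d 0 n
          ... | inj₁ (k , refl) rewrite sub-at d (⊖ f) k | sub-at d f k = refl
          ... | inj₂ p rewrite p (⊖ f) | p f = refl

 opaque
  unfolding _⊕_ _·_

  W-add : ∀ d j f g n → W d j (f ⊕ g) n ≡ (W d j f ⊕ W d j g) n
  W-add d zero    f g zero    = refl
  W-add d zero    f g (suc n) = W-add d d (tl f) (tl g) n
  W-add d (suc j) f g zero    = refl
  W-add d (suc j) f g (suc n) = W-add d j f g n

  W-scale : ∀ d j c f n → W d j (λ i → c * f i) n ≡ c * W d j f n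
  W-scale d zero    c f zero    = refl
  W-scale d zero    c f (suc n) = W-scale d d c (tl f) n
  W-scale d (suc j) c f zero    = sym (ZP.*-zeroʳ c)
  W-scale d (suc j) c f (suc n) = W-scale d j c f n

  W-· : ∀ d j f g n → (W d j f · W d 0 g) n ≡ W d j (f · g) n
  W-· d zero    f g zero    = refl
  W-· d zero    f g (suc n) = begin
   f 0 * W d d (tl g) n + (W d d (tl f) · W d 0 g) n
    ≡⟨ cong₂ _+_ (sym (W-scale d d (f 0) (tl g) n)) (W-· d d (tl f) g n) ⟩
   W d d (λ i → f 0 * g (suc i)) n + W d d (tl f · g) n
    ≡⟨ sym (W-add d d (λ i → f 0 * g (suc i)) (tl f · g) n) ⟩
   W d d (tl (f · g)) n ∎
   where open ≡-Reasoning
  W-· d (suc j) f g zero    = ZP.*-zeroˡ (g 0)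
  W-· d (suc j) f g (suc n) = trans (cong₂ _+_ (ZP.*-zeroˡ (W d 0 g (suc n))) (W-· d j f g n)) (ZP.+-identityˡ _)

 module _ {M : ℤ} (d : ℕ) where
  open SR M

  sub-· : ∀ f g → sub d (f · g) ≈ sub d f · sub d g
  sub-· f g = ≡⇒SMod λ n → sym (W-· d 0 f g n)

  sub-const : ∀ c → sub d (const c) ≈ const c
  sub-const c = ≡⇒SMod (sub-≡ d (const c) (const c) (λ { zero → refl ; (suc k) → refl }) z)
   where z : ∀ n → ¬ (∃ λ k → n ≡ k N.* suc d) → + 0 ≡ const c n
         z zero    p = ⊥-elim (p (0 , refl))
         z (suc n) p = refl

  sub-↑ : ∀ f n → sub d (f ↑ n) ≈ sub d f ↑ n
  sub-↑ f zero    = sub-const (+ 1)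
  sub-↑ f (suc n) = tr (sub-· f (f ↑ n)) (*c rfl (sub-↑ f n))

  D-sub : ∀ f → D (sub d f) ≈ const (+ suc d) · sub d (D f)
  D-sub f = ≡⇒SMod λ n → trans (h n) (sym (const-·-≡ (+ suc d) (sub d (D f)) n))
   where h : ∀ n → D (sub d f) n ≡ + suc d * sub d (D f) n
         h n with W-view d 0 n
         ... | inj₁ (k , refl) rewrite sub-at d f k | sub-at d (D f) k =
            trans (cong (_* f k) (ZP.pos-* k (suc d))) (r (+ k) (+ suc d) (f k))
          where r : ∀ k d x → k * d * x ≡ d * (k * x)
                r = ring
         ... | inj₂ p rewrite p f | p (D f) = trans (ZP.*-zeroʳ (+ n)) (sym (ZP.*-zeroʳ (+ suc d)))

  sub-q^ : ∀ k → sub d (q^ k) ≈ q^ (k N.* suc d)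
  sub-q^ k = ≡⇒SMod (sub-≡ d (q^ k) (q^ (k N.* suc d)) (λ i → h i (i N.≟ k)) z)
   where
   h : ∀ i → Dec (i ≡ k) → q^ k i ≡ q^ (k N.* suc d) (i N.* suc d)
   h i (yes refl) = trans (q^-≡ k) (sym (q^-≡ (k N.* suc d)))
   h i (no p) = trans (q^-≢ k i (p ∘ sym))
    (sym (q^-≢ (k N.* suc d) (i N.* suc d) λ e → p (sym (NP.*-cancelʳ-≡ k i (suc d) e))))
   z : ∀ n → ¬ (∃ λ k → n ≡ k N.* suc d) → + 0 ≡ q^ (k N.* suc d) n
   z n p = sym (q^-≢ _ n λ e → p (k , sym e))

 sub-sub : ∀ {M} c d e → suc c N.* suc d ≡ suc e → ∀ f → SMod M (sub c (sub d f)) (sub e f)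
 sub-sub c d e p f = ≡⇒SMod λ n → sym (sub-≡ e f (sub c (sub d f)) at' off n)
  where
  at' : ∀ k → f k ≡ sub c (sub d f) (k N.* suc e)
  at' k = sym (trans (cong (sub c (sub d f)) (trans (cong (k N.*_) (trans (sym p) (NP.*-comm (suc c) (suc d)))) (sym (NP.*-assoc k (suc d) (suc c)))))
       (trans (sub-at c (sub d f) (k N.* suc d)) (sub-at d f k)))
  off : ∀ n → ¬ (∃ λ k → n ≡ k N.* suc e) → + 0 ≡ sub c (sub d f) n
  off n q with W-view c 0 n
  ... | inj₂ h = sym (h (sub d f))
  ... | inj₁ (k , refl) with W-view d 0 k
  ... | inj₂ h = sym (trans (sub-at c (sub d f) k) (h f))
  ... | inj₁ (l , refl) = ⊥-elim (q (l , trans (NP.*-assoc l (suc d) (suc c)) (cong (l N.*_) (trans (NP.*-comm (suc d) (suc c)) p))))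

 geom : Ser → ℕ → Ser
 geom u zero    = const (+ 1)
 geom u (suc n) = const (+ 1) ⊕ u · geom u n

 -- 1/f as the geometric series in u = 1 - f. If f 0 = 1, then u has no constant term and the powers
 -- beyond u^n do not reach the n-th coefficient.
 inv : Ser → Ser
 inv f n = geom (const (+ 1) ⊝ f) n n

 geom-telescope : ∀ u n → (const (+ 1) ⊝ u) · geom u n ≋ const (+ 1) ⊝ u ↑ suc n
 geom-telescope u zero    = solve 1 (λ u → (con (+ 1) :- u) :* con (+ 1) := con (+ 1) :- u :* con (+ 1)) rfl u
  where open E
 geom-telescope u (suc n) = begin
  (const (+ 1) ⊝ u) · (const (+ 1) ⊕ u · geom u n)
   ≈⟨ solve 2 (λ u g → (con (+ 1) :- u) :* (con (+ 1) :+ u :* g) := con (+ 1) :- u :+ u :* ((con (+ 1) :- u) :* g)) rfl u (geom u n) ⟩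
  const (+ 1) ⊝ u ⊕ u · ((const (+ 1) ⊝ u) · geom u n)
   ≈⟨ +c rfl (*c rfl (geom-telescope u n)) ⟩
  const (+ 1) ⊝ u ⊕ u · (const (+ 1) ⊝ u ↑ suc n)
   ≈⟨ solve 2 (λ u g → con (+ 1) :- u :+ u :* (con (+ 1) :- g) := con (+ 1) :- u :* g) rfl u (u ↑ suc n) ⟩
  const (+ 1) ⊝ u · u ↑ suc n ∎
  where open E
        open ≈-Reasoning

 opaque
  unfolding _⊕_ _·_ ⊖_

  geom-stable : ∀ u → u 0 ≡ + 0 → ∀ m n i → i N.≤ m → i N.≤ n → geom u m i ≡ geom u n i
  geom-stable u p zero    zero    i       a b = refl
  geom-stable u p zero    (suc n) zero    a b rewrite p = sym (cong (_+_ (+ 1)) (ZP.*-zeroˡ (geom u n 0)))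
  geom-stable u p (suc m) zero    zero    a b rewrite p = cong (_+_ (+ 1)) (ZP.*-zeroˡ (geom u m 0))
  geom-stable u p (suc m) (suc n) zero    a b rewrite p =
   cong (_+_ (+ 1)) (trans (ZP.*-zeroˡ (geom u m 0)) (sym (ZP.*-zeroˡ (geom u n 0))))
  geom-stable u p (suc m) (suc n) (suc i) (s≤s a) (s≤s b) rewrite p =
   cong (_+_ (+ 0)) (cong₂ _+_ (trans (ZP.*-zeroˡ (geom u m (suc i))) (sym (ZP.*-zeroˡ (geom u n (suc i)))))
    (·-cong-≡ {tl u} {tl u} i (λ _ _ → refl)
     (λ j j≤i → geom-stable u p m n j (NP.≤-trans j≤i a) (NP.≤-trans j≤i b))))

 Ord-↑ : ∀ {M} k n {f} → Ord M k f → Ord M (n N.* k) (f ↑ n)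
 Ord-↑ k zero    o i ()
 Ord-↑ k (suc n) o = Ord-· k (n N.* k) o (Ord-↑ k n o)

 opaque
  unfolding _⊕_ _·_ ⊖_

  inv-· : ∀ {M} f → f 0 ≡ + 1 → SMod M (f · inv f) (const (+ 1))
  inv-· f p = ≡⇒SMod λ n → begin
   (f · inv f) n        ≡⟨ ·-cong-≡ {f} n (λ _ _ → refl) (λ i i≤n → geom-stable u u0 i n i NP.≤-refl i≤n) ⟩
   (f · geom u n) n     ≡⟨ ·-cong-≡ {g = geom u n} n (λ i _ → sym (f≡ i)) (λ _ _ → refl) ⟩
   ((const (+ 1) ⊝ u) · geom u n) n ≡⟨ SMod-0⇒≡ (geom-telescope u n) n ⟩
   const (+ 1) n - (u ↑ suc n) n
    ≡⟨ cong (λ z → const (+ 1) n - z) (Mod-0⇒≡ (Ord-↑ {+ 0} 1 (suc n) (λ { zero _ → ≡⇒Mod u0 ; (suc _) (s≤s ()) }) n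
      (subst (n N.<_) (sym (NP.*-identityʳ (suc n))) NP.≤-refl))) ⟩
   const (+ 1) n - + 0  ≡⟨ ZP.+-identityʳ _ ⟩
   const (+ 1) n ∎
   where
   open ≡-Reasoning
   u : Ser
   u = const (+ 1) ⊝ f
   u0 : u 0 ≡ + 0
   u0 = cong (λ z → + 1 - z) p
   f≡ : ∀ i → (const (+ 1) ⊝ u) i ≡ f i
   f≡ i = h (const (+ 1) i) (f i)
    where h : ∀ a b → a - (a - b) ≡ b
          h = ring

 module _ {M : ℤ} where
  open SR M

  unit-cancel : ∀ u v {f g} → u · v ≈ const (+ 1) → u · f ≈ u · g → f ≈ g
  unit-cancel u v {f} {g} i p = begin
   f           ≈⟨ sm (*-identityˡ f) ⟩
   const (+ 1) · f ≈⟨ *c (sm i) rfl ⟩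
   u · v · f   ≈⟨ solve 3 (λ u v f → u :* v :* f := v :* (u :* f)) rfl u v f ⟩
   v · (u · f) ≈⟨ *c rfl p ⟩
   v · (u · g) ≈⟨ solve 3 (λ u v f → v :* (u :* f) := u :* v :* f) rfl u v g ⟩
   u · v · g   ≈⟨ *c i rfl ⟩
   const (+ 1) · g ≈⟨ *-identityˡ g ⟩
   g ∎
   where open ≈-Reasoning

  unit1-cancel : ∀ u {f g} → u 0 ≡ + 1 → u · f ≈ u · g → f ≈ g
  unit1-cancel u p = unit-cancel u (inv u) (inv-· u p)

open Operators

-- Finite sums with Iverson brackets, and theta series over ℤⁿ

module ThetaSeries where

 open Z using (_+_; _*_; -_; _-_)

 private variable
  A B C : Set
  P Q R : Set

 [_] : Dec P → ℤ
 [ yes _ ] = + 1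
 [ no _ ]  = + 0

 []-yes : (d : Dec P) → P → [ d ] ≡ + 1
 []-yes (yes _) p = refl
 []-yes (no ¬p) p = ⊥-elim (¬p p)

 []-no : (d : Dec P) → ¬ P → [ d ] ≡ + 0
 []-no (yes p) ¬p = ⊥-elim (¬p p)
 []-no (no _)  ¬p = refl

 []-⇔ : (d : Dec P) (e : Dec Q) → (P → Q) → (Q → P) → [ d ] ≡ [ e ]
 []-⇔ (yes p) e f g = sym ([]-yes e (f p))
 []-⇔ (no ¬p) e f g = sym ([]-no e (¬p ∘ g))

 []-× : (d : Dec P) (e : Dec Q) (r : Dec R) → (P → Q → R) → (R → P × Q) → [ d ] * [ e ] ≡ [ r ]
 []-× (yes p) (yes q) r f g = sym ([]-yes r (f p q))
 []-× (yes p) (no ¬q) r f g = sym ([]-no r (¬q ∘ proj₂ ∘ g))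
 []-× (no ¬p) e       r f g = sym ([]-no r (¬p ∘ proj₁ ∘ g))

 []-cong-* : (d : Dec P) {a b : ℤ} → (P → a ≡ b) → [ d ] * a ≡ [ d ] * b
 []-cong-* (yes p) f = cong (_*_ (+ 1)) (f p)
 []-cong-* (no ¬p) f = refl

 sumL : List A → (A → ℤ) → ℤ
 sumL []       f = + 0
 sumL (x ∷ xs) f = f x + sumL xs f

 sumL-cong : ∀ (xs : List A) {f g} → (∀ x → f x ≡ g x) → sumL xs f ≡ sumL xs g
 sumL-cong []       p = refl
 sumL-cong (x ∷ xs) p = cong₂ _+_ (p x) (sumL-cong xs p)

 sumL-Mod : ∀ {M} (xs : List A) {f g} → (∀ x → Mod M (f x) (g x)) → Mod M (sumL xs f) (sumL xs g)
 sumL-Mod []       p = Mod-refl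
 sumL-Mod (x ∷ xs) p = Mod-+ (p x) (sumL-Mod xs p)

 sumL-0 : ∀ (xs : List A) {f} → (∀ x → f x ≡ + 0) → sumL xs f ≡ + 0
 sumL-0 []       p = refl
 sumL-0 (x ∷ xs) p rewrite p x | sumL-0 xs p = refl

 sumL-+ : ∀ (xs : List A) f g → sumL xs (λ x → f x + g x) ≡ sumL xs f + sumL xs g
 sumL-+ []       f g = refl
 sumL-+ (x ∷ xs) f g rewrite sumL-+ xs f g = h (f x) (g x) (sumL xs f) (sumL xs g)
  where h : ∀ a b c d → a + b + (c + d) ≡ a + c + (b + d)
        h = ring

 sumL-*ˡ : ∀ (xs : List A) c f → sumL xs (λ x → c * f x) ≡ c * sumL xs f
 sumL-*ˡ []       c f = sym (ZP.*-zeroʳ c)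
 sumL-*ˡ (x ∷ xs) c f rewrite sumL-*ˡ xs c f = sym (ZP.*-distribˡ-+ c (f x) (sumL xs f))

 sumL-*ʳ : ∀ (xs : List A) c f → sumL xs (λ x → f x * c) ≡ sumL xs f * c
 sumL-*ʳ xs c f = trans (sumL-cong xs λ x → ZP.*-comm (f x) c) (trans (sumL-*ˡ xs c f) (ZP.*-comm c (sumL xs f)))

 sumL-swap : ∀ (xs : List A) (ys : List B) (f : A → B → ℤ) →
       sumL xs (λ x → sumL ys (f x)) ≡ sumL ys (λ y → sumL xs (λ x → f x y))
 sumL-swap []       ys f = sym (sumL-0 ys λ _ → refl)
 sumL-swap (x ∷ xs) ys f = trans (cong (_+_ (sumL ys (f x))) (sumL-swap xs ys f))
                 (sym (sumL-+ ys (f x) λ y → sumL xs λ x → f x y))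

 sumL-++ : ∀ (xs ys : List A) f → sumL (xs ++ ys) f ≡ sumL xs f + sumL ys f
 sumL-++ []       ys f = sym (ZP.+-identityˡ _)
 sumL-++ (x ∷ xs) ys f = trans (cong (_+_ (f x)) (sumL-++ xs ys f)) (sym (ZP.+-assoc (f x) _ _))

 sumL-map : ∀ (g : A → B) xs f → sumL (List.map g xs) f ≡ sumL xs (f ∘ g)
 sumL-map g []       f = refl
 sumL-map g (x ∷ xs) f = cong (_+_ (f (g x))) (sumL-map g xs f)

 -- Enumerates xs y says that y occurs exactly once in xs.

 module _ (_≟_ : DecidableEquality A) where

  Enumerates : List A → A → Set
  Enumerates xs y = sumL xs (λ x → [ x ≟ y ]) ≡ + 1

  sumL-δ : ∀ xs y (f : A → ℤ) → Enumerates xs y → sumL xs (λ x → [ x ≟ y ] * f x) ≡ f y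
  sumL-δ xs y f e = begin
   sumL xs (λ x → [ x ≟ y ] * f x) ≡⟨ sumL-cong xs (λ x → []-cong-* (x ≟ y) (cong f)) ⟩
   sumL xs (λ x → [ x ≟ y ] * f y) ≡⟨ sumL-*ʳ xs (f y) _ ⟩
   sumL xs (λ x → [ x ≟ y ]) * f y ≡⟨ cong (_* f y) e ⟩
   + 1 * f y                       ≡⟨ ZP.*-identityˡ (f y) ⟩
   f y ∎
   where open ≡-Reasoning

 module _ (_≟1_ : DecidableEquality A) (_≟2_ : DecidableEquality B) where

  -- Change of variables y = g x in a sum of f, where everything only needs to hold on the support of f.
  sumL-bijection : ∀ xs ys (g : A → B) (g⁻ : B → A) (f : B → ℤ) →
   (∀ x → f (g x) ≢ + 0 → Enumerates _≟2_ ys (g x) × g⁻ (g x) ≡ x) →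
   (∀ y → f y ≢ + 0 → Enumerates _≟1_ xs (g⁻ y) × g (g⁻ y) ≡ y) →
   sumL xs (f ∘ g) ≡ sumL ys f
  sumL-bijection xs ys g g⁻ f p q = begin
   sumL xs (f ∘ g)
    ≡⟨ sumL-cong xs (λ x → onx x (f (g x) Z.≟ + 0)) ⟩
   sumL xs (λ x → sumL ys λ y → [ y ≟2 g x ] * f y)
    ≡⟨ sumL-swap xs ys _ ⟩
   sumL ys (λ y → sumL xs λ x → [ y ≟2 g x ] * f y)
    ≡⟨ sumL-cong ys (λ y → ony y (f y Z.≟ + 0)) ⟩
   sumL ys f ∎
   where
   open ≡-Reasoning
   onx : ∀ x → Dec (f (g x) ≡ + 0) → f (g x) ≡ sumL ys λ y → [ y ≟2 g x ] * f y
   onx x (yes z) = trans z (sym (sumL-0 ys λ y →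
    trans ([]-cong-* (y ≟2 g x) (λ { refl → z })) (ZP.*-zeroʳ [ y ≟2 g x ])))
   onx x (no nz) = sym (sumL-δ _≟2_ ys (g x) f (proj₁ (p x nz)))
   ony : ∀ y → Dec (f y ≡ + 0) → (sumL xs λ x → [ y ≟2 g x ] * f y) ≡ f y
   ony y (yes z) = trans (sumL-0 xs λ x → trans (cong (_*_ [ y ≟2 g x ]) z) (ZP.*-zeroʳ [ y ≟2 g x ])) (sym z)
   ony y (no nz) = begin
    sumL xs (λ x → [ y ≟2 g x ] * f y) ≡⟨ sumL-*ʳ xs (f y) _ ⟩
    sumL xs (λ x → [ y ≟2 g x ]) * f y
     ≡⟨ cong (_* f y) (sumL-cong xs λ x → []-⇔ (y ≟2 g x) (x ≟1 g⁻ y)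
       (λ { refl → sym (proj₂ (p x nz)) }) (λ { refl → sym (proj₂ (q y nz)) })) ⟩
    sumL xs (λ x → [ x ≟1 g⁻ y ]) * f y ≡⟨ cong (_* f y) (proj₁ (q y nz)) ⟩
    + 1 * f y ≡⟨ ZP.*-identityˡ (f y) ⟩
    f y ∎

 rangeℤ : ℕ → List ℤ
 rangeℤ zero    = + 0 ∷ []
 rangeℤ (suc K) = + suc K ∷ -[1+ K ] ∷ rangeℤ K

 cart : List A → List B → List (A × B)
 cart []       ys = []
 cart (x ∷ xs) ys = List.map (x ,_) ys ++ cart xs ys

 sumL-cart : ∀ (xs : List A) (ys : List B) f → sumL (cart xs ys) f ≡ sumL xs λ x → sumL ys λ y → f (x , y)
 sumL-cart []       ys f = refl
 sumL-cart (x ∷ xs) ys f = trans (sumL-++ (List.map (x ,_) ys) (cart xs ys) f)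
                 (cong₂ _+_ (sumL-map (x ,_) ys f) (sumL-cart xs ys f))

 vecs : List A → ∀ n → List (Vec A n)
 vecs xs zero    = [] ∷ []
 vecs xs (suc n) = List.map (λ (x , v) → x ∷ v) (cart xs (vecs xs n))

 sumL-vecs : ∀ (xs : List A) n f → sumL (vecs xs (suc n)) f ≡ sumL xs λ x → sumL (vecs xs n) λ v → f (x ∷ v)
 sumL-vecs xs n f = trans (sumL-map _ (cart xs (vecs xs n)) f) (sumL-cart xs (vecs xs n) _)

 data AllV (P : A → Set) : ∀ {n} → Vec A n → Set where
  []  : AllV P []
  _∷_ : ∀ {n x} {v : Vec A n} → P x → AllV P v → AllV P (x ∷ v)

 vecs-enumerates : (_≟_ : DecidableEquality A) → ∀ xs {n} (v : Vec A n) → AllV (Enumerates _≟_ xs) v →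
          Enumerates (Vecₚ.≡-dec _≟_) (vecs xs n) v
 vecs-enumerates _≟_ xs []      [] = refl
 vecs-enumerates _≟_ xs {suc n} (y ∷ v) (e ∷ es) = begin
  sumL (vecs xs (suc n)) (λ w → [ Vecₚ.≡-dec _≟_ w (y ∷ v) ])
   ≡⟨ sumL-vecs xs n _ ⟩
  sumL xs (λ x → sumL (vecs xs n) λ w → [ Vecₚ.≡-dec _≟_ (x ∷ w) (y ∷ v) ])
   ≡⟨ sumL-cong xs (λ x → trans (sumL-cong (vecs xs n) λ w → sym
     ([]-× (x ≟ y) (Vecₚ.≡-dec _≟_ w v) (Vecₚ.≡-dec _≟_ (x ∷ w) (y ∷ v)) (λ { refl refl → refl }) (λ { refl → refl , refl })))
     (sumL-*ˡ (vecs xs n) [ x ≟ y ] _)) ⟩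
  sumL xs (λ x → [ x ≟ y ] * sumL (vecs xs n) λ w → [ Vecₚ.≡-dec _≟_ w v ])
   ≡⟨ sumL-*ʳ xs _ _ ⟩
  sumL xs (λ x → [ x ≟ y ]) * sumL (vecs xs n) (λ w → [ Vecₚ.≡-dec _≟_ w v ])
   ≡⟨ cong₂ _*_ e (vecs-enumerates _≟_ xs v es) ⟩
  + 1 ∎
  where open ≡-Reasoning

 private
  rangeℤ-∉ : ∀ K y → K N.< Z.∣ y ∣ → sumL (rangeℤ K) (λ x → [ x Z.≟ y ]) ≡ + 0
  rangeℤ-∉ zero    y p = trans (ZP.+-identityʳ _) ([]-no (+ 0 Z.≟ y) λ { refl → NP.<-irrefl refl p })
  rangeℤ-∉ (suc K) y p
   rewrite []-no (+ suc K Z.≟ y) (λ { refl → NP.<-irrefl refl p })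
      | []-no (-[1+ K ] Z.≟ y) (λ { refl → NP.<-irrefl refl p })
      | rangeℤ-∉ K y (NP.<-trans NP.≤-refl p) = refl

  range-step : ∀ K y → Dec (Z.∣ y ∣ ≡ suc K) → Z.∣ y ∣ N.≤ suc K →
   (Z.∣ y ∣ N.≤ K → sumL (rangeℤ K) (λ x → [ x Z.≟ y ]) ≡ + 1) →
   [ + suc K Z.≟ y ] + ([ -[1+ K ] Z.≟ y ] + sumL (rangeℤ K) (λ x → [ x Z.≟ y ])) ≡ + 1
  range-step K (+ _) (yes refl) p ih
   rewrite []-yes (+ suc K Z.≟ + suc K) refl | []-no (-[1+ K ] Z.≟ + suc K) (λ ())
      | rangeℤ-∉ K (+ suc K) NP.≤-refl = refl
  range-step K -[1+ _ ] (yes refl) p ih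
   rewrite []-no (+ suc K Z.≟ -[1+ K ]) (λ ()) | []-yes (-[1+ K ] Z.≟ -[1+ K ]) refl
      | rangeℤ-∉ K -[1+ K ] NP.≤-refl = refl
  range-step K y (no ≢) p ih
   rewrite []-no (+ suc K Z.≟ y) (λ { refl → ≢ refl }) | []-no (-[1+ K ] Z.≟ y) (λ { refl → ≢ refl })
      | ih (NP.≤-pred (NP.≤∧≢⇒< p ≢)) = refl

 rangeℤ-enumerates : ∀ K y → Z.∣ y ∣ N.≤ K → Enumerates Z._≟_ (rangeℤ K) y
 rangeℤ-enumerates zero    (+ zero) p = refl
 rangeℤ-enumerates (suc K) y p = range-step K y (Z.∣ y ∣ N.≟ suc K) p (rangeℤ-enumerates K y)

 _≟ⱽ_ : ∀ {n} → DecidableEquality (Vec ℤ n)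
 _≟ⱽ_ = Vecₚ.≡-dec Z._≟_

 box : ∀ n → ℕ → List (Vec ℤ n)
 box n K = vecs (rangeℤ K) n

 InBox : ∀ {n} → ℕ → Vec ℤ n → Set
 InBox K = AllV λ x → Z.∣ x ∣ N.≤ K

 box-enumerates : ∀ {n} K (v : Vec ℤ n) → InBox K v → Enumerates _≟ⱽ_ (box n K) v
 box-enumerates K v p = vecs-enumerates Z._≟_ (rangeℤ K) v (go p)
  where go : ∀ {n} {v : Vec ℤ n} → InBox K v → AllV (Enumerates Z._≟_ (rangeℤ K)) v
        go []      = []
        go (p ∷ ps) = rangeℤ-enumerates K _ p ∷ go ps

 InBox-mono : ∀ {n K L} {v : Vec ℤ n} → K N.≤ L → InBox K v → InBox L v
 InBox-mono K≤L []       = []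
 InBox-mono K≤L (p ∷ ps) = NP.≤-trans p K≤L ∷ InBox-mono K≤L ps

 box-extend : ∀ n {K L} (f : Vec ℤ n → ℤ) → (∀ v → f v ≢ + 0 → InBox K v) → (∀ v → f v ≢ + 0 → InBox L v) →
       sumL (box n K) f ≡ sumL (box n L) f
 box-extend n {K} {L} f p q = sumL-bijection _≟ⱽ_ _≟ⱽ_ (box n K) (box n L) (λ v → v) (λ v → v) f
  (λ v nz → box-enumerates L v (q v nz) , refl) (λ v nz → box-enumerates K v (p v nz) , refl)

 poly : List A → (A → ℕ) → (A → ℤ) → Ser
 poly []       e w = const (+ 0)
 poly (x ∷ xs) e w = const (w x) · q^ (e x) ⊕ poly xs e w

 poly-at : ∀ (xs : List A) e w N → poly xs e w N ≡ sumL xs λ x → [ e x N.≟ N ] * w x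
 poly-at []       e w zero    = refl
 poly-at []       e w (suc N) = refl
 poly-at (x ∷ xs) e w N = trans (⊕-at _ _ N) (cong₂ _+_
  (trans (const-·-≡ (w x) (q^ (e x)) N) (h (e x N.≟ N))) (poly-at xs e w N))
  where h : (d : Dec (e x ≡ N)) → w x * q^ (e x) N ≡ [ d ] * w x
        h (yes refl) = trans (cong (_*_ (w x)) (q^-≡ (e x))) (ZP.*-comm (w x) (+ 1))
        h (no p)     = trans (cong (_*_ (w x)) (q^-≢ (e x) N p)) (ZP.*-zeroʳ (w x))

 poly-· : ∀ (xs : List A) (ys : List B) e e' w w' →
     poly xs e w · poly ys e' w' ≋ poly (cart xs ys) (λ (x , y) → e x N.+ e' y) (λ (x , y) → w x * w' y)
 poly-· []       ys e e' w w' = E.zeroˡ _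
 poly-· (x ∷ xs) ys e e' w w' = begin
  (const (w x) · q^ (e x) ⊕ poly xs e w) · poly ys e' w' ≈⟨ distribʳ _ _ _ ⟩
  const (w x) · q^ (e x) · poly ys e' w' ⊕ poly xs e w · poly ys e' w'
   ≈⟨ +c (single ys) (poly-· xs ys e e' w w') ⟩
  poly (List.map (x ,_) ys) _ _ ⊕ poly (cart xs ys) _ _
   ≈⟨ poly-++ (List.map (x ,_) ys) ⟩
  poly (List.map (x ,_) ys ++ cart xs ys) _ _ ∎
  where
  open E
  open ≈-Reasoning
  poly-++ : ∀ zs {zs'} {e : A → ℕ} {w} → poly {A = A} zs e w ⊕ poly zs' e w ≋ poly (zs ++ zs') e w
  poly-++ []       = +-identityˡ _
  poly-++ (z ∷ zs) = tr (solve 3 (λ a b c → a :+ b :+ c := a :+ (b :+ c)) rfl _ _ _)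
               (+c rfl (poly-++ zs))
  single : ∀ ys → const (w x) · q^ (e x) · poly ys e' w' ≋
      poly (List.map (x ,_) ys) (λ (x , y) → e x N.+ e' y) (λ (x , y) → w x * w' y)
  single []       = zeroʳ _
  single (y ∷ ys) = begin
   const (w x) · q^ (e x) · (const (w' y) · q^ (e' y) ⊕ poly ys e' w')
    ≈⟨ solve 5 (λ a b c d p → a :* b :* (c :* d :+ p) := a :* c :* (b :* d) :+ a :* b :* p) rfl
      (const (w x)) (q^ (e x)) (const (w' y)) (q^ (e' y)) (poly ys e' w') ⟩
   const (w x) · const (w' y) · (q^ (e x) · q^ (e' y)) ⊕ const (w x) · q^ (e x) · poly ys e' w'
    ≈⟨ +c (*c (sm (const-* (w x) (w' y))) (q^-+ (e x) (e' y))) (single ys) ⟩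
   const (w x * w' y) · q^ (e x N.+ e' y) ⊕ poly (List.map (x ,_) ys) _ _ ∎

 -- Theta series Σ_v w(v) q^(e(v)) over ℤⁿ for a proper exponent function e.

 Proper : ∀ {n} → (Vec ℤ n → ℕ) → Set
 Proper e = ∀ v → InBox (e v) v

 θ : ∀ n → (Vec ℤ n → ℕ) → (Vec ℤ n → ℤ) → Ser
 θ n e w N = sumL (box n N) λ v → [ e v N.≟ N ] * w v

 []*-≢0 : (d : Dec P) {a : ℤ} → [ d ] * a ≢ + 0 → P
 []*-≢0 (yes p) nz = p
 []*-≢0 (no ¬p) nz = ⊥-elim (nz refl)

 -- Properness confines the vectors with e v = N to the box of radius N, so one larger box can serve
 -- for all coefficients up to K.
 θ-box : ∀ n {e} → Proper e → ∀ w K N → N N.≤ K → θ n e w N ≡ sumL (box n K) λ v → [ e v N.≟ N ] * w v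
 θ-box n {e} pr w K N N≤K = box-extend n _ (λ v nz → inb v ([]*-≢0 (e v N.≟ N) nz))
  (λ v nz → InBox-mono N≤K (inb v ([]*-≢0 (e v N.≟ N) nz)))
  where inb : ∀ v {N} → e v ≡ N → InBox N v
        inb v refl = pr v

 θ-poly : ∀ n {e} → Proper e → ∀ w K N → N N.≤ K → θ n e w N ≡ poly (box n K) e w N
 θ-poly n pr w K N N≤K = trans (θ-box n pr w K N N≤K) (sym (poly-at (box n K) _ w N))

 -- Up to q^N both factors agree with polynomials over boxes of radius N, for which the product is a
 -- finite double sum.
 θ-· : ∀ n {e1 : Vec ℤ 1 → ℕ} {e2 : Vec ℤ n → ℕ} → Proper e1 → Proper e2 → ∀ w1 w2 →
    θ 1 e1 w1 · θ n e2 w2 ≋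
    θ (suc n) (λ v → e1 (Vec.head v ∷ []) N.+ e2 (Vec.tail v)) (λ v → w1 (Vec.head v ∷ []) * w2 (Vec.tail v))
 θ-· n {e1} {e2} p1 p2 w1 w2 = ≡⇒≋ λ N → begin
  (θ 1 e1 w1 · θ n e2 w2) N
   ≡⟨ ·-cong-≡ N (λ i i≤N → θ-poly 1 p1 w1 N i i≤N) (λ i i≤N → θ-poly n p2 w2 N i i≤N) ⟩
  (poly (box 1 N) e1 w1 · poly (box n N) e2 w2) N
   ≡⟨ SMod-0⇒≡ (poly-· (box 1 N) (box n N) e1 e2 w1 w2) N ⟩
  poly (cart (box 1 N) (box n N)) _ _ N
   ≡⟨ trans (poly-at (cart (box 1 N) (box n N)) _ _ N) (sumL-cart (box 1 N) (box n N) _) ⟩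
  sumL (box 1 N) (λ u → sumL (box n N) λ v → [ e1 u N.+ e2 v N.≟ N ] * (w1 u * w2 v))
   ≡⟨ trans (sumL-vecs (rangeℤ N) 0 _) (sumL-cong (rangeℤ N) λ x → ZP.+-identityʳ _) ⟩
  sumL (rangeℤ N) (λ x → sumL (box n N) λ v → [ e1 (x ∷ []) N.+ e2 v N.≟ N ] * (w1 (x ∷ []) * w2 v))
   ≡⟨ sym (sumL-vecs (rangeℤ N) n _) ⟩
  θ (suc n) (λ v → e1 (Vec.head v ∷ []) N.+ e2 (Vec.tail v)) (λ v → w1 (Vec.head v ∷ []) * w2 (Vec.tail v)) N ∎
  where open ≡-Reasoning

open ThetaSeries

-- The theta series X and Y and their duplication formulas

module Duplication where

 open Z using (_+_; _*_; -_; _-_)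

 Even Odd' : ℤ → Set
 Even x = ∃ λ k → x ≡ + 2 * k
 Odd' x = ∃ λ k → x ≡ + 2 * k + + 1

 parity : ∀ x → Even x ⊎ Odd' x
 parity (+ n) = go n
  where
  go : ∀ n → Even (+ n) ⊎ Odd' (+ n)
  go zero = inj₁ (+ 0 , refl)
  go (suc n) with go n
  ... | inj₁ (k , p) = inj₂ (k , trans (ZP.+-comm (+ 1) (+ n)) (cong (_+ + 1) p))
  ... | inj₂ (k , p) = inj₁ (k + + 1 , trans (cong (_+_ (+ 1)) p) (h k))
   where h : ∀ k → + 1 + (+ 2 * k + + 1) ≡ + 2 * (k + + 1)
         h = ring
 parity -[1+ n ] with parity (+ suc n)
 ... | inj₁ (k , p) = inj₁ (- k , trans (cong -_ p) (h k))
  where h : ∀ k → - (+ 2 * k) ≡ + 2 * - k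
        h = ring
 ... | inj₂ (k , p) = inj₂ (- k - + 1 , trans (cong -_ p) (h k))
  where h : ∀ k → - (+ 2 * k + + 1) ≡ + 2 * (- k - + 1) + + 1
        h = ring

 even≢odd : ∀ k l → + 2 * k ≢ + 2 * l + + 1
 even≢odd k l p = 2n≢1 {Z.∣ k - l ∣} (subst (λ z → z ≡ 1) (ZP.abs-* (+ 2) (k - l)) (cong Z.∣_∣ eq))
  where
  eq : + 2 * (k - l) ≡ + 1
  eq = trans (h k l) (trans (cong (_- + 2 * l) p) (h' (+ 2 * l)))
   where h : ∀ k l → + 2 * (k - l) ≡ + 2 * k - + 2 * l
         h = ring
         h' : ∀ a → a + + 1 - a ≡ + 1
         h' = ring
  2n≢1 : ∀ {n} → 2 N.* n ≢ 1
  2n≢1 {zero}  ()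
  2n≢1 {suc n} e with trans (sym (NP.+-suc (suc n) (n N.+ 0))) e
  ... | ()

 private
  half-ev : ∀ {x} → Even x ⊎ Odd' x → ℤ × ℤ
  half-ev (inj₁ (k , _)) = k , + 1
  half-ev (inj₂ (k , _)) = k , + 0

 half ev od : ℤ → ℤ
 half x = proj₁ (half-ev (parity x))
 ev x = proj₂ (half-ev (parity x))
 od x = + 1 - ev x

 ev-even : ∀ k → ev (+ 2 * k) ≡ + 1
 ev-even k with parity (+ 2 * k)
 ... | inj₁ _       = refl
 ... | inj₂ (l , p) = ⊥-elim (even≢odd k l p)

 ev-odd : ∀ k → ev (+ 2 * k + + 1) ≡ + 0
 ev-odd k with parity (+ 2 * k + + 1)
 ... | inj₁ (l , p) = ⊥-elim (even≢odd l k (sym p))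
 ... | inj₂ _       = refl

 half-even : ∀ k → half (+ 2 * k) ≡ k
 half-even k with parity (+ 2 * k)
 ... | inj₁ (l , p) = sym (ZP.*-cancelˡ-≡ (+ 2) k l p)
 ... | inj₂ (l , p) = ⊥-elim (even≢odd k l p)

 private
  e+e : ∀ k l → + 2 * k + + 2 * l ≡ + 2 * (k + l)
  e+e = ring
  e-e : ∀ k l → + 2 * k - + 2 * l ≡ + 2 * (k - l)
  e-e = ring
  e+o : ∀ k l → + 2 * k + (+ 2 * l + + 1) ≡ + 2 * (k + l) + + 1
  e+o = ring
  o+e : ∀ k l → + 2 * k + + 1 + + 2 * l ≡ + 2 * (k + l) + + 1
  o+e = ring
  o+o : ∀ k l → + 2 * k + + 1 + (+ 2 * l + + 1) ≡ + 2 * (k + l + + 1)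
  o+o = ring
  o-o : ∀ k l → + 2 * k + + 1 - (+ 2 * l + + 1) ≡ + 2 * (k - l)
  o-o = ring
  diff+2v : ∀ u v → u + v ≡ u - v + + 2 * v
  diff+2v = ring

 -- u + v and u - v have equal parity, which is even exactly when u and v agree in parity. This is
 -- the weight that `rot` produces in X².
 ev-sum : ∀ u v → ev (u + v) * ev (u - v) ≡ ev u * ev v + od u * od v
 ev-sum u v with parity u | parity v
 ... | inj₁ (k , refl) | inj₁ (l , refl) =
  cong₂ _*_ (trans (cong ev (e+e k l)) (ev-even (k + l))) (trans (cong ev (e-e k l)) (ev-even (k - l)))
 ... | inj₁ (k , refl) | inj₂ (l , refl) =
  trans (cong (_* ev (+ 2 * k - (+ 2 * l + + 1))) (trans (cong ev (e+o k l)) (ev-odd (k + l)))) refl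
 ... | inj₂ (k , refl) | inj₁ (l , refl) =
  trans (cong (_* ev (+ 2 * k + + 1 - + 2 * l)) (trans (cong ev (o+e k l)) (ev-odd (k + l)))) refl
 ... | inj₂ (k , refl) | inj₂ (l , refl) =
  cong₂ _*_ (trans (cong ev (o+o k l)) (ev-even (k + l + + 1))) (trans (cong ev (o-o k l)) (ev-even (k - l)))

 ev-diff : ∀ u v → ev (u + v) ≡ ev (u - v)
 ev-diff u v with parity (u - v)
 ... | inj₁ (k , p) = trans (cong ev (trans (diff+2v u v) (trans (cong (_+ + 2 * v) p) (e+e k v)))) (ev-even (k + v))
 ... | inj₂ (k , p) = trans (cong ev (trans (diff+2v u v) (trans (cong (_+ + 2 * v) p) (o+e k v)))) (ev-odd (k + v))

 ev-idem : ∀ x → ev x * ev x ≡ ev x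
 ev-idem x with parity x
 ... | inj₁ _ = refl
 ... | inj₂ _ = refl

 od-sum : ∀ u v → od (u + v) * od (u - v) ≡ ev u * od v + od u * ev v
 od-sum u v = begin
  (+ 1 - ev (u + v)) * (+ 1 - ev (u - v)) ≡⟨ h (ev (u + v)) (ev (u - v)) ⟩
  + 1 - ev (u + v) - ev (u - v) + ev (u + v) * ev (u - v)
   ≡⟨ cong (λ z → + 1 - ev (u + v) - z + ev (u + v) * z) (sym (ev-diff u v)) ⟩
  + 1 - ev (u + v) - ev (u + v) + ev (u + v) * ev (u + v)
   ≡⟨ trans (cong (_+_ (+ 1 - ev (u + v) - ev (u + v))) (ev-idem (u + v))) (h3 (ev (u + v))) ⟩
  + 1 - ev (u + v)
   ≡⟨ cong (λ z → + 1 - z) (trans (sym (ev-idem (u + v))) (trans (cong (_*_ (ev (u + v))) (ev-diff u v)) (ev-sum u v))) ⟩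
  + 1 - (ev u * ev v + od u * od v) ≡⟨ h2 (ev u) (ev v) ⟩
  ev u * od v + od u * ev v ∎
  where
  open ≡-Reasoning
  h : ∀ a b → (+ 1 - a) * (+ 1 - b) ≡ + 1 - a - b + a * b
  h = ring
  h3 : ∀ a → + 1 - a - a + a ≡ + 1 - a
  h3 = ring
  h2 : ∀ a b → + 1 - (a * b + (+ 1 - a) * (+ 1 - b)) ≡ a * (+ 1 - b) + (+ 1 - a) * b
  h2 = ring

 sq : ℤ → ℕ
 sq x = Z.∣ x ∣ N.* Z.∣ x ∣

 +sq : ∀ x → + sq x ≡ x * x
 +sq (+ n)    = ZP.pos-* n n
 +sq -[1+ n ] = refl

 ∣x∣≤a*sq : ∀ a x → 1 N.≤ a → Z.∣ x ∣ N.≤ a N.* sq x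
 ∣x∣≤a*sq (suc a) x _ = NP.≤-trans (h Z.∣ x ∣) (NP.m≤m+n (sq x) (a N.* sq x))
  where h : ∀ n → n N.≤ n N.* n
        h zero    = z≤n
        h (suc n) = NP.m≤m+n (suc n) (n N.* suc n)

 e1 : ℕ → Vec ℤ 1 → ℕ
 e1 a v = a N.* sq (Vec.head v)

 th : ℕ → (ℤ → ℤ) → Ser
 th a w = θ 1 (e1 a) (w ∘ Vec.head)

 e1-proper : ∀ {a} → 1 N.≤ a → Proper (e1 a)
 e1-proper {a} p (x ∷ []) = ∣x∣≤a*sq a x p ∷ []

 sub-th : ∀ d a w → 1 N.≤ a → sub d (th a w) ≋ th (suc d N.* a) w
 sub-th d a w 1≤a = ≡⇒≋ (sub-≡ d (th a w) (th (suc d N.* a) w) on off)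
  where
  on : ∀ k → th a w k ≡ th (suc d N.* a) w (k N.* suc d)
  on k = trans (θ-box 1 (e1-proper 1≤a) (w ∘ Vec.head) (k N.* suc d) k (NP.m≤m*n k (suc d)))
   (sumL-cong (box 1 (k N.* suc d)) λ v → cong (_* w (Vec.head v))
    ([]-⇔ (e1 a v N.≟ k) (e1 (suc d N.* a) v N.≟ k N.* suc d)
     (λ p → trans (NP.*-assoc (suc d) a (sq (Vec.head v))) (trans (cong (suc d N.*_) p) (NP.*-comm (suc d) k)))
     (λ p → NP.*-cancelˡ-≡ _ k (suc d)
         (trans (sym (NP.*-assoc (suc d) a (sq (Vec.head v)))) (trans p (NP.*-comm k (suc d)))))))
  off : ∀ n → ¬ (∃ λ k → n ≡ k N.* suc d) → + 0 ≡ th (suc d N.* a) w n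
  off n p = sym (sumL-0 (box 1 n) λ v → cong (_* w (Vec.head v)) ([]-no (e1 (suc d N.* a) v N.≟ n) λ q →
   p (a N.* sq (Vec.head v) , trans (sym q) (trans (NP.*-assoc (suc d) a _) (NP.*-comm (suc d) _)))))

 e2 : ℕ → Vec ℤ 2 → ℕ
 e2 a v = e1 a (Vec.head v ∷ []) N.+ e1 a (Vec.tail v)

 w2 : (ℤ → ℤ) → (ℤ → ℤ) → Vec ℤ 2 → ℤ
 w2 w w' v = w (Vec.head v) * w' (Vec.head (Vec.tail v))

 th-· : ∀ a w w' → 1 N.≤ a → th a w · th a w' ≋ θ 2 (e2 a) (w2 w w')
 th-· a w w' p = θ-· 1 (e1-proper p) (e1-proper p) (w ∘ Vec.head) (w' ∘ Vec.head)

 e2-proper : ∀ {a} → 1 N.≤ a → Proper (e2 a)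
 e2-proper {a} p (x ∷ y ∷ []) = NP.≤-trans (∣x∣≤a*sq a x p) (NP.m≤m+n _ _)
              ∷ NP.≤-trans (∣x∣≤a*sq a y p) (NP.m≤n+m _ (a N.* sq x)) ∷ []

 -- The substitution (x , y) = (u + v , u − v) doubles x² + y².
 private
  rot rot⁻ : Vec ℤ 2 → Vec ℤ 2
  rot (u ∷ v ∷ []) = u + v ∷ u - v ∷ []
  rot⁻ (x ∷ y ∷ []) = half (x + y) ∷ half (x - y) ∷ []

  rot⁻-rot : ∀ v → rot⁻ (rot v) ≡ v
  rot⁻-rot (u ∷ v ∷ []) = cong₂ (λ a b → a ∷ b ∷ [])
   (trans (cong half (h1 u v)) (half-even u)) (trans (cong half (h2 u v)) (half-even v))
   where h1 : ∀ u v → u + v + (u - v) ≡ + 2 * u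
         h1 = ring
         h2 : ∀ u v → u + v - (u - v) ≡ + 2 * v
         h2 = ring

  rot-rot⁻ : ∀ x y → Even (x - y) → rot (rot⁻ (x ∷ y ∷ [])) ≡ x ∷ y ∷ []
  rot-rot⁻ x y (k , p) = cong₂ (λ a b → a ∷ b ∷ []) e3 e4
   where
   q : x ≡ y + + 2 * k
   q = trans (h x y) (cong (_+_ y) p)
    where h : ∀ x y → x ≡ y + (x - y)
          h = ring
   s1 : half (x + y) ≡ y + k
   s1 = trans (cong half (trans (cong (_+ y) q) (h y k))) (half-even (y + k))
    where h : ∀ y k → y + + 2 * k + y ≡ + 2 * (y + k)
          h = ring
   s2 : half (x - y) ≡ k
   s2 = trans (cong half p) (half-even k)
   e3 : half (x + y) + half (x - y) ≡ x
   e3 = trans (cong₂ _+_ s1 s2) (trans (h y k) (sym q))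
    where h : ∀ y k → y + k + k ≡ y + + 2 * k
          h = ring
   e4 : half (x + y) - half (x - y) ≡ y
   e4 = trans (cong₂ _-_ s1 s2) (h y k)
    where h : ∀ y k → y + k - k ≡ y
          h = ring

  e2-rot : ∀ a v → e2 a (rot v) ≡ e2 (2 N.* a) v
  e2-rot a (u ∷ v ∷ []) = ZP.+-injective (begin
   + (a N.* sq (u + v) N.+ a N.* sq (u - v))
    ≡⟨ cong₂ _+_ (trans (ZP.pos-* a _) (cong (_*_ (+ a)) (+sq (u + v)))) (trans (ZP.pos-* a _) (cong (_*_ (+ a)) (+sq (u - v)))) ⟩
   + a * ((u + v) * (u + v)) + + a * ((u - v) * (u - v)) ≡⟨ h (+ a) u v ⟩
   + 2 * + a * (u * u) + + 2 * + a * (v * v)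
    ≡⟨ cong₂ _+_ (e u) (e v) ⟩
   + (2 N.* a N.* sq u N.+ 2 N.* a N.* sq v) ∎)
   where
   open ≡-Reasoning
   h : ∀ a u v → a * ((u + v) * (u + v)) + a * ((u - v) * (u - v)) ≡ + 2 * a * (u * u) + + 2 * a * (v * v)
   h = ring
   e : ∀ u → + 2 * + a * (u * u) ≡ + (2 N.* a N.* sq u)
   e u = sym (trans (ZP.pos-* (2 N.* a) (sq u)) (cong₂ _*_ (ZP.pos-* 2 a) (+sq u)))

 *-≢0 : ∀ {a b} → a * b ≢ + 0 → b ≢ + 0
 *-≢0 {a} nz refl = nz (ZP.*-zeroʳ a)

 -- The hypothesis places the support of w(x) w'(y) among the pairs of equal parity, which are
 -- exactly the image of `rot`.
 duplicate : ∀ a w w' → 1 N.≤ a → (∀ x y → w x * w' y ≢ + 0 → Even (x - y)) →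
       th a w · th a w' ≋ θ 2 (e2 (2 N.* a)) (w2 w w' ∘ rot)
 duplicate a w w' 1≤a ew = E.tr (th-· a w w' 1≤a) (≡⇒≋ λ N → sym (begin
  θ 2 (e2 (2 N.* a)) (w2 w w' ∘ rot) N
   ≡⟨ sumL-cong (box 2 N) (λ v → cong (_* w2 w w' (rot v)) ([]-⇔ (e2 (2 N.* a) v N.≟ N) (e2 a (rot v) N.≟ N)
     (λ p → trans (e2-rot a v) p) (λ p → trans (sym (e2-rot a v)) p))) ⟩
  sumL (box 2 N) (λ v → [ e2 a (rot v) N.≟ N ] * w2 w w' (rot v))
   ≡⟨ sumL-bijection _≟ⱽ_ _≟ⱽ_ (box 2 N) (box 2 N) rot rot⁻ (λ v → [ e2 a v N.≟ N ] * w2 w w' v)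
     (λ v nz → box-enumerates N (rot v) (inb a 1≤a (rot v) ([]*-≢0 (e2 a (rot v) N.≟ N) nz)) , rot⁻-rot v)
     (λ v nz → ony N v nz) ⟩
  θ 2 (e2 a) (w2 w w') N ∎))
  where
  open ≡-Reasoning
  inb : ∀ a → 1 N.≤ a → ∀ v {N} → e2 a v ≡ N → InBox N v
  inb a p v refl = e2-proper p v
  ony : ∀ N v → [ e2 a v N.≟ N ] * w2 w w' v ≢ + 0 → Enumerates _≟ⱽ_ (box 2 N) (rot⁻ v) × rot (rot⁻ v) ≡ v
  ony N (x ∷ y ∷ []) nz = box-enumerates N _ (inb (2 N.* a) (NP.≤-trans 1≤a (NP.m≤m+n a _)) _
    (trans (sym (e2-rot a (rot⁻ (x ∷ y ∷ [])))) (trans (cong (e2 a) rr) ([]*-≢0 (e2 a (x ∷ y ∷ []) N.≟ N) nz)))) , rr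
   where rr : rot (rot⁻ (x ∷ y ∷ [])) ≡ x ∷ y ∷ []
         rr = rot-rot⁻ x y (ew x y (*-≢0 {[ e2 a (x ∷ y ∷ []) N.≟ N ]} nz))

 opaque
  unfolding _⊕_

  θ-⊕ : ∀ n e w w' → θ n e (λ v → w v + w' v) ≋ θ n e w ⊕ θ n e w'
  θ-⊕ n e w w' = ≡⇒≋ λ N → trans (sumL-cong (box n N) λ v → ZP.*-distribˡ-+ [ e v N.≟ N ] (w v) (w' v))
                (sumL-+ (box n N) _ _)

 θ-cong : ∀ n e {w w'} → (∀ v → w v ≡ w' v) → θ n e w ≋ θ n e w'
 θ-cong n e p = ≡⇒≋ λ N → sumL-cong (box n N) λ v → cong (_*_ [ e v N.≟ N ]) (p v)

 opaque

  -- Jacobi's θ₃ and θ₂ in the nome q^24: x = 2k gives q^(24k²) and x = 2k + 1 gives q^(24(k+1/2)²).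
  X Y : Ser
  X = th 6 ev
  Y = th 6 od

  X-th : ∀ n → X n ≡ th 6 ev n
  X-th n = refl

  Y-th : ∀ n → Y n ≡ th 6 od n
  Y-th n = refl

 X2 Y2 : Ser
 X2 = sub 1 X
 Y2 = sub 1 Y

 private
  same-parity-ev : ∀ x y → ev x * ev y ≢ + 0 → Even (x - y)
  same-parity-ev x y nz with parity x | parity y
  ... | inj₁ (k , refl) | inj₁ (l , refl) = k - l , h k l
   where h : ∀ k l → + 2 * k - + 2 * l ≡ + 2 * (k - l)
         h = ring
  ... | inj₁ _ | inj₂ _ = ⊥-elim (nz refl)
  ... | inj₂ _ | inj₁ _ = ⊥-elim (nz refl)
  ... | inj₂ _ | inj₂ _ = ⊥-elim (nz refl)

  same-parity-od : ∀ x y → od x * od y ≢ + 0 → Even (x - y)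
  same-parity-od x y nz with parity x | parity y
  ... | inj₂ (k , refl) | inj₂ (l , refl) = k - l , h k l
   where h : ∀ k l → + 2 * k + + 1 - (+ 2 * l + + 1) ≡ + 2 * (k - l)
         h = ring
  ... | inj₁ _ | inj₂ _ = ⊥-elim (nz refl)
  ... | inj₂ _ | inj₁ _ = ⊥-elim (nz refl)
  ... | inj₁ _ | inj₁ _ = ⊥-elim (nz refl)

  1≤6 : 1 N.≤ 6
  1≤6 = s≤s z≤n
  1≤12 : 1 N.≤ 12
  1≤12 = s≤s z≤n

  rank2 : ∀ w w' → θ 2 (e2 12) (w2 w w') ≋ sub 1 (th 6 w) · sub 1 (th 6 w')
  rank2 w w' = E.sm (E.tr (E.*c (sub-th 1 6 w 1≤6) (sub-th 1 6 w' 1≤6)) (th-· 12 w w' 1≤12))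

 opaque
  unfolding X Y

  X-duplication : X · X ≋ X2 · X2 ⊕ Y2 · Y2
  X-duplication = begin
   X · X                               ≈⟨ duplicate 6 ev ev 1≤6 same-parity-ev ⟩
   θ 2 (e2 12) (w2 ev ev ∘ rot)        ≈⟨ θ-cong 2 (e2 12) (λ { (u ∷ v ∷ []) → ev-sum u v }) ⟩
   θ 2 (e2 12) (λ v → w2 ev ev v + w2 od od v) ≈⟨ θ-⊕ 2 (e2 12) (w2 ev ev) (w2 od od) ⟩
   θ 2 (e2 12) (w2 ev ev) ⊕ θ 2 (e2 12) (w2 od od) ≈⟨ +c (rank2 ev ev) (rank2 od od) ⟩
   X2 · X2 ⊕ Y2 · Y2 ∎
   where open E
         open ≈-Reasoning

  Y-duplication : Y · Y ≋ const (+ 2) · (X2 · Y2)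
  Y-duplication = begin
   Y · Y                               ≈⟨ duplicate 6 od od 1≤6 same-parity-od ⟩
   θ 2 (e2 12) (w2 od od ∘ rot)        ≈⟨ θ-cong 2 (e2 12) (λ { (u ∷ v ∷ []) → od-sum u v }) ⟩
   θ 2 (e2 12) (λ v → w2 ev od v + w2 od ev v) ≈⟨ θ-⊕ 2 (e2 12) (w2 ev od) (w2 od ev) ⟩
   θ 2 (e2 12) (w2 ev od) ⊕ θ 2 (e2 12) (w2 od ev) ≈⟨ +c (rank2 ev od) (rank2 od ev) ⟩
   X2 · Y2 ⊕ Y2 · X2 ≈⟨ solve 2 (λ x y → x :* y :+ y :* x := con (+ 2) :* (x :* y)) rfl X2 Y2 ⟩
   const (+ 2) · (X2 · Y2) ∎
   where open E
         open ≈-Reasoning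

  X-0 : X 0 ≡ + 1
  X-0 = refl

 opaque
  unfolding X Y

  Ord-Y : Ord (+ 0) 6 Y
  Ord-Y 0 _ = ≡⇒Mod refl
  Ord-Y 1 _ = ≡⇒Mod refl
  Ord-Y 2 _ = ≡⇒Mod refl
  Ord-Y 3 _ = ≡⇒Mod refl
  Ord-Y 4 _ = ≡⇒Mod refl
  Ord-Y 5 _ = ≡⇒Mod refl
  Ord-Y (suc (suc (suc (suc (suc (suc n)))))) (s≤s (s≤s (s≤s (s≤s (s≤s (s≤s ()))))))

  Y-6 : Y 6 ≡ + 2
  Y-6 = refl

open Duplication

-- The Wronskian of X and Y, and the series e = E2

module Wronskian where

 open Z using (_+_; _*_; -_; _-_)

 module _ {M : ℤ} where

  Ord-⊕ : ∀ k {f g} → Ord M k f → Ord M k g → Ord M k (f ⊕ g)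
  Ord-⊕ k {f} {g} o o' n n<k = Mod-tr (≡⇒Mod (⊕-at f g n)) (Mod-+ (o n n<k) (o' n n<k))

  Ord-⊖ : ∀ k {f} → Ord M k f → Ord M k (⊖ f)
  Ord-⊖ k {f} o n n<k = Mod-tr (≡⇒Mod (⊖-at f n)) (Mod-neg (o n n<k))

  Ord-cong : ∀ k {f g} → SMod M f g → Ord M k f → Ord M k g
  Ord-cong k p o n n<k = Mod-tr (Mod-sym (at p n)) (o n n<k)

  Ord-0 : ∀ {f} → Ord M 0 f
  Ord-0 n ()

  Ord-D : ∀ k {f} → Ord M k f → Ord M k (D f)
  Ord-D k o n n<k = Mod-tr (Mod-* {a = + n} {+ n} Mod-refl (o n n<k)) (≡⇒Mod (ZP.*-zeroʳ (+ n)))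

  Ord-·ˡ : ∀ k {f g} → Ord M k g → Ord M k (f · g)
  Ord-·ˡ k {f} {g} o = Ord-· 0 k {f} {g} Ord-0 o

  Ord-suc : ∀ k {f} → Ord M k f → Mod M (f k) (+ 0) → Ord M (suc k) f
  Ord-suc k o p n (s≤s n≤k) with NP.m≤n⇒m<n∨m≡n n≤k
  ... | inj₁ n<k  = o n n<k
  ... | inj₂ refl = p

  Ord-weaken : ∀ {j k f} → j N.≤ k → Ord M k f → Ord M j f
  Ord-weaken j≤k o n n<j = o n (NP.<-≤-trans n<j j≤k)

 ↑-at-0 : ∀ f n → (f ↑ n) 0 ≡ f 0 Z.^ n
 ↑-at-0 f zero    = refl
 ↑-at-0 f (suc n) = trans (·-at-0 f (f ↑ n)) (cong (_*_ (f 0)) (↑-at-0 f n))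

 all-Ord⇒0 : ∀ {M f} → (∀ n → Ord M n f) → SMod M f (const (+ 0))
 all-Ord⇒0 o = smod λ n → Mod-tr (o (suc n) n NP.≤-refl) (≡⇒Mod (z n))
  where z : ∀ n → + 0 ≡ const (+ 0) n
        z zero    = refl
        z (suc n) = refl

 Ord-sub : ∀ {M} d k {f} → Ord M k f → Ord M (k N.* suc d) (sub d f)
 Ord-sub d k {f} o n n<kd with W-view d 0 n
 ... | inj₁ (j , refl) = Mod-tr (≡⇒Mod (sub-at d f j)) (o j (NP.*-cancelʳ-< (suc d) j k n<kd))
 ... | inj₂ h = ≡⇒Mod (h f)

 *-cancel-0 : ∀ c {a} → c ≢ + 0 → c * a ≡ + 0 → a ≡ + 0
 *-cancel-0 c nz p with ZP.i*j≡0⇒i≡0∨j≡0 c p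
 ... | inj₁ q = ⊥-elim (nz q)
 ... | inj₂ q = q

 const-cancel : ∀ c {f g} → c ≢ + 0 → const c · f ≋ const c · g → f ≋ g
 const-cancel c {f} {g} nz p = ≡⇒≋ λ n → ZP.i-j≡0⇒i≡j (f n) (g n) (*-cancel-0 c nz
  (trans (ZP.*-distribˡ-+ c (f n) (- g n)) (trans (cong (_+_ (c * f n)) (sym (ZP.neg-distribʳ-* c (g n))))
   (ZP.i≡j⇒i-j≡0 (trans (sym (const-·-≡ c f n)) (trans (SMod-0⇒≡ p n) (const-·-≡ c g n)))))))

 open E

 ⊝-0⇒≋ : ∀ {f g} → f ⊝ g ≋ const (+ 0) → f ≋ g
 ⊝-0⇒≋ {f} {g} p = begin
  f             ≈⟨ solve 2 (λ f g → f := f :- g :+ g) rfl f g ⟩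
  f ⊝ g ⊕ g     ≈⟨ +c p rfl ⟩
  const (+ 0) ⊕ g ≈⟨ +-identityˡ g ⟩
  g ∎
  where open ≈-Reasoning

 -- The equation gives (c - 1) δ 0 = 0, and for n > 0 it expresses δ n by the earlier coefficient δ
 -- (n/2), or by 0 when n is odd.
 sub-≋4-⇒0 : ∀ {δ} c → c ≢ + 1 → δ ≋ const c · sub 1 δ → δ ≋ const (+ 0)
 sub-≋4-⇒0 {δ} c c≢1 p = all-Ord⇒0 go
  where
  go : ∀ n → Ord (+ 0) n δ
  go zero    = Ord-0
  go (suc n) = Ord-suc n (go n) (≡⇒Mod (here n (W-view 1 0 n) refl))
   where
   rec : ∀ n → δ n ≡ c * sub 1 δ n
   rec n = trans (SMod-0⇒≡ p n) (const-·-≡ c (sub 1 δ) n)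
   here : ∀ n' → (∃ λ k → n' ≡ 0 N.+ k N.* 2) ⊎ (∀ f → sub 1 f n' ≡ + 0) → n' ≡ n → δ n' ≡ + 0
   here zero    _ _ = *-cancel-0 (c - + 1) (λ q → c≢1 (ZP.i-j≡0⇒i≡j c (+ 1) q))
    (trans (h c (δ 0)) (ZP.i≡j⇒i-j≡0 (sym (rec 0))))
    where h : ∀ c a → (c - + 1) * a ≡ c * a - a
          h = ring
   here (suc n') (inj₁ (suc k , q)) e = trans (rec (suc n')) (trans (cong (_*_ c)
    (trans (cong (sub 1 δ) q) (trans (sub-at 1 δ (suc k)) (Mod-0⇒≡ (go n (suc k) (lt q e)))))) (ZP.*-zeroʳ c))
    where lt : suc n' ≡ suc k N.* 2 → suc n' ≡ n → suc k N.< n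
          lt q refl = subst (suc k N.<_) (sym q) (NP.m<m*n (suc k) 2 (s≤s (s≤s z≤n)))
   here (suc n') (inj₂ h) e = trans (rec (suc n')) (trans (cong (_*_ c) (h δ)) (ZP.*-zeroʳ c))

 X' Y' X2' Y2' : Ser
 X' = D X
 Y' = D Y
 X2' = sub 1 X'
 Y2' = sub 1 Y'

 private
  2≢0 : + 2 ≢ + 0
  2≢0 ()

 XX' : X · X' ≋ const (+ 2) · (X2 · X2' ⊕ Y2 · Y2')
 XX' = const-cancel (+ 2) 2≢0 (begin
  const (+ 2) · (X · X')
   ≈⟨ solve 2 (λ x x' → con (+ 2) :* (x :* x') := x' :* x :+ x :* x') rfl X X' ⟩
  X' · X ⊕ X · X' ≈⟨ sm (D-· X X) ⟩
  D (X · X) ≈⟨ D-cong X-duplication ⟩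
  D (X2 · X2 ⊕ Y2 · Y2) ≈⟨ D-⊕ _ _ ⟩
  D (X2 · X2) ⊕ D (Y2 · Y2) ≈⟨ +c (D-· X2 X2) (D-· Y2 Y2) ⟩
  (D X2 · X2 ⊕ X2 · D X2) ⊕ (D Y2 · Y2 ⊕ Y2 · D Y2)
   ≈⟨ +c (+c (*c (D-sub 1 X) rfl) (*c rfl (D-sub 1 X)))
        (+c (*c (D-sub 1 Y) rfl) (*c rfl (D-sub 1 Y))) ⟩
  (const (+ 2) · X2' · X2 ⊕ X2 · (const (+ 2) · X2')) ⊕ (const (+ 2) · Y2' · Y2 ⊕ Y2 · (const (+ 2) · Y2'))
   ≈⟨ solve 4 (λ x x' y y' → (con (+ 2) :* x' :* x :+ x :* (con (+ 2) :* x')) :+ (con (+ 2) :* y' :* y :+ y :* (con (+ 2) :* y'))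
     := con (+ 2) :* (con (+ 2) :* (x :* x' :+ y :* y'))) rfl X2 X2' Y2 Y2' ⟩
  const (+ 2) · (const (+ 2) · (X2 · X2' ⊕ Y2 · Y2')) ∎)
  where open ≈-Reasoning

 YY' : Y · Y' ≋ const (+ 2) · (X2' · Y2 ⊕ X2 · Y2')
 YY' = const-cancel (+ 2) 2≢0 (begin
  const (+ 2) · (Y · Y')
   ≈⟨ solve 2 (λ x x' → con (+ 2) :* (x :* x') := x' :* x :+ x :* x') rfl Y Y' ⟩
  Y' · Y ⊕ Y · Y' ≈⟨ sm (D-· Y Y) ⟩
  D (Y · Y) ≈⟨ D-cong Y-duplication ⟩
  D (const (+ 2) · (X2 · Y2)) ≈⟨ D-const-· (+ 2) _ ⟩
  const (+ 2) · D (X2 · Y2) ≈⟨ *c rfl (D-· X2 Y2) ⟩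
  const (+ 2) · (D X2 · Y2 ⊕ X2 · D Y2)
   ≈⟨ *c rfl (+c (*c (D-sub 1 X) rfl) (*c rfl (D-sub 1 Y))) ⟩
  const (+ 2) · (const (+ 2) · X2' · Y2 ⊕ X2 · (const (+ 2) · Y2'))
   ≈⟨ solve 4 (λ x x' y y' → con (+ 2) :* (con (+ 2) :* x' :* y :+ x :* (con (+ 2) :* y'))
     := con (+ 2) :* (con (+ 2) :* (x' :* y :+ x :* y'))) rfl X2 X2' Y2 Y2' ⟩
  const (+ 2) · (const (+ 2) · (X2' · Y2 ⊕ X2 · Y2')) ∎)
  where open ≈-Reasoning

 sub-⊝ : ∀ d f g → sub d (f ⊝ g) ≋ sub d f ⊝ sub d g
 sub-⊝ d f g = tr (sub-⊕ d f (⊖ g)) (+c rfl (sub-⊖ d g))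

 hom6 : Ser → Ser → Ser
 hom6 x y = x · y · (x ↑ 4 ⊝ y ↑ 4)

 sub-hom6 : sub 1 (hom6 X Y) ≋ hom6 X2 Y2
 sub-hom6 = tr (sub-· 1 _ _) (*c (sub-· 1 X Y)
  (tr (sub-⊝ 1 _ _) (+c (sub-↑ 1 X 4) (-c (sub-↑ 1 Y 4)))))

 -- The Wronskian of X and Y.  Both sides satisfy the same functional equation
 -- relating q and q², which determines a series from its first coefficients.
 wronskian : X · Y' ⊝ Y · X' ≋ const (+ 6) · hom6 X Y
 wronskian = ⊝-0⇒≋ (all-Ord⇒0 all-ord)
  where
  open ≈-Reasoning
  δ z2 : Ser
  δ = X · Y' ⊝ Y · X' ⊝ const (+ 6) · hom6 X Y
  z2 = const (+ 2) · (X2 · X2 ⊝ Y2 · Y2)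
  F : Ser → Ser → Ser → Ser → Ser
  F xx yy xx' yy' = xx · yy' ⊝ yy · xx' ⊝ const (+ 6) · (xx · yy · (xx · xx ⊝ yy · yy))
  F-cong : ∀ {a b c d a' b' c' d'} → a ≋ a' → b ≋ b' → c ≋ c' → d ≋ d' → F a b c d ≋ F a' b' c' d'
  F-cong a b c d = +c (+c (*c a d) (-c (*c b c)))
   (-c (*c rfl (*c (*c a b) (+c (*c a a) (-c (*c b b))))))
  sub-δ : sub 1 δ ≋ X2 · Y2' ⊝ Y2 · X2' ⊝ const (+ 6) · hom6 X2 Y2
  sub-δ = tr (sub-⊝ 1 _ _) (+c (tr (sub-⊝ 1 _ _) (+c (sub-· 1 X Y') (-c (sub-· 1 Y X'))))
   (-c (tr (sub-· 1 _ _) (*c (sub-const 1 (+ 6)) sub-hom6))))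
  -- After multiplication by X Y only X², Y², X X' and Y Y' occur, and these are known in terms of
  -- the series at q².
  functional : X · Y · δ ≋ z2 · sub 1 δ
  functional = begin
   X · Y · δ
    ≈⟨ solve 4 (λ x y x' y' → x :* y :* (x :* y' :- y :* x' :- con (+ 6) :* (x :* y :* (x :^ 4 :- y :^ 4)))
      := x :* x :* (y :* y') :- y :* y :* (x :* x') :- con (+ 6) :* (x :* x :* (y :* y) :*
         (x :* x :* (x :* x) :- y :* y :* (y :* y)))) rfl X Y X' Y' ⟩
   F (X · X) (Y · Y) (X · X') (Y · Y')
    ≈⟨ F-cong X-duplication Y-duplication XX' YY' ⟩
   F (X2 · X2 ⊕ Y2 · Y2) (const (+ 2) · (X2 · Y2)) (const (+ 2) · (X2 · X2' ⊕ Y2 · Y2')) (const (+ 2) · (X2' · Y2 ⊕ X2 · Y2'))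
    ≈⟨ solve 4 (λ x y x' y' →
      let xx = x :* x :+ y :* y; yy = con (+ 2) :* (x :* y)
          xx' = con (+ 2) :* (x :* x' :+ y :* y'); yy' = con (+ 2) :* (x' :* y :+ x :* y') in
      xx :* yy' :- yy :* xx' :- con (+ 6) :* (xx :* yy :* (xx :* xx :- yy :* yy))
      := con (+ 2) :* (x :* x :- y :* y) :* (x :* y' :- y :* x' :- con (+ 6) :* (x :* y :* (x :^ 4 :- y :^ 4))))
      rfl X2 Y2 X2' Y2' ⟩
   z2 · (X2 · Y2' ⊝ Y2 · X2' ⊝ const (+ 6) · hom6 X2 Y2) ≈⟨ *c rfl (sm sub-δ) ⟩
   z2 · sub 1 δ ∎
  XY-6 : (X · Y) 6 ≡ + 2
  XY-6 = trans (Mod-0⇒≡ (leading-· 0 6 {X} {Y} Ord-0 Ord-Y)) (cong₂ _*_ X-0 Y-6)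
  z-0 : (X ↑ 4 ⊝ Y ↑ 4) 0 ≡ + 1
  z-0 = trans (⊕-at _ _ 0) (cong₂ _+_ (trans (↑-at-0 X 4) (cong (Z._^ 4) X-0))
   (trans (⊖-at _ 0) (cong -_ (trans (↑-at-0 Y 4) (cong (Z._^ 4) (Mod-0⇒≡ (Ord-Y 0 (s≤s z≤n))))))))
  hom-6 : (hom6 X Y) 6 ≡ + 2
  hom-6 = trans (Mod-0⇒≡ (leading-· 6 0 (Ord-·ˡ 6 Ord-Y) Ord-0)) (cong₂ _*_ XY-6 z-0)
  δ-6 : δ 6 ≡ + 0
  δ-6 = trans (⊕-at _ _ 6) (cong₂ _+_ (trans (⊕-at _ _ 6) (cong₂ _+_
    (trans (Mod-0⇒≡ (leading-· 0 6 {X} {Y'} Ord-0 (Ord-D 6 Ord-Y))) (cong₂ (λ a b → a * (+ 6 * b)) X-0 Y-6))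
    (trans (⊖-at _ 6) (cong -_ (trans (Mod-0⇒≡ (leading-· 6 0 {Y} {X'} Ord-Y Ord-0)) (cong₂ (λ a b → a * (+ 0 * b)) Y-6 X-0))))))
   (trans (⊖-at _ 6) (cong -_ (trans (const-·-≡ (+ 6) (hom6 X Y) 6) (cong (_*_ (+ 6)) hom-6)))))
  ord-6 : Ord (+ 0) 6 δ
  ord-6 = Ord-⊕ 6 (Ord-⊕ 6 (Ord-·ˡ 6 {X} (Ord-D 6 Ord-Y)) (Ord-⊖ 6 (Ord-· 6 0 {Y} {X'} Ord-Y Ord-0)))
   (Ord-⊖ 6 (Ord-·ˡ 6 (Ord-· 6 0 (Ord-·ˡ 6 Ord-Y) Ord-0)))
  -- With N = 7 + n, the lowest coefficient of X Y δ sits at 6 + N and is 2 δ N, while the right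
  -- side has order at least 2N > 6 + N. This works from N = 7 on, so the coefficients up to 6 are
  -- treated directly.
  step : ∀ n → Ord (+ 0) (7 N.+ n) δ → δ (7 N.+ n) ≡ + 0
  step n o = *-cancel-0 (+ 2) 2≢0 (trans (cong (_* δ (7 N.+ n)) (sym XY-6))
   (trans (sym (Mod-0⇒≡ (leading-· 6 (7 N.+ n) {X · Y} (Ord-·ˡ 6 Ord-Y) o)))
   (trans (SMod-0⇒≡ functional (6 N.+ (7 N.+ n)))
    (Mod-0⇒≡ (Ord-·ˡ ((7 N.+ n) N.* 2) {z2} (Ord-sub 1 (7 N.+ n) o) (6 N.+ (7 N.+ n)) lt)))))
   where lt : 6 N.+ (7 N.+ n) N.< (7 N.+ n) N.* 2
         lt = subst (6 N.+ (7 N.+ n) N.<_) (trans (cong (7 N.+ n N.+_) (sym (NP.+-identityʳ (7 N.+ n)))) (NP.*-comm 2 (7 N.+ n)))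
             (NP.+-monoˡ-≤ (7 N.+ n) (NP.m≤m+n 7 n))
  ord-7 : ∀ n → Ord (+ 0) (7 N.+ n) δ
  ord-7 zero    = Ord-suc 6 ord-6 (≡⇒Mod δ-6)
  ord-7 (suc n) = Ord-suc (7 N.+ n) (ord-7 n) (≡⇒Mod (step n (ord-7 n)))
  all-ord : ∀ n → Ord (+ 0) n δ
  all-ord n = Ord-weaken (NP.m≤n+m n 7) (ord-7 n)

 opaque

  -- E2(q^24). It is defined by solving the differential equation of X; the one of Y then follows
  -- from the Wronskian.
  e : Ser
  e = (X' ⊕ X ↑ 5 ⊝ const (+ 5) · (X · Y ↑ 4)) · inv X

  D-X : X' ≋ e · X ⊝ X ↑ 5 ⊕ const (+ 5) · (X · Y ↑ 4)
  D-X = sm (begin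
   e · X ⊝ X ↑ 5 ⊕ const (+ 5) · (X · Y ↑ 4)
    ≈⟨ solve 5 (λ x' x5 t i x → (x' :+ x5 :- t) :* i :* x :- x5 :+ t := (x' :+ x5 :- t) :* (x :* i) :- x5 :+ t) rfl
      X' (X ↑ 5) (const (+ 5) · (X · Y ↑ 4)) (inv X) X ⟩
   (X' ⊕ X ↑ 5 ⊝ const (+ 5) · (X · Y ↑ 4)) · (X · inv X) ⊝ X ↑ 5 ⊕ const (+ 5) · (X · Y ↑ 4)
    ≈⟨ +c (+c (*c rfl (inv-· X X-0)) rfl) rfl ⟩
   (X' ⊕ X ↑ 5 ⊝ const (+ 5) · (X · Y ↑ 4)) · const (+ 1) ⊝ X ↑ 5 ⊕ const (+ 5) · (X · Y ↑ 4)
    ≈⟨ solve 3 (λ x' x5 t → (x' :+ x5 :- t) :* con (+ 1) :- x5 :+ t := x') rfl X' (X ↑ 5) (const (+ 5) · (X · Y ↑ 4)) ⟩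
   X' ∎)
   where open ≈-Reasoning

 D-Y : Y' ≋ e · Y ⊕ const (+ 5) · (X ↑ 4 · Y) ⊝ Y ↑ 5
 D-Y = unit1-cancel X X-0 (begin
  X · Y' ≈⟨ solve 2 (λ a b → a := a :- b :+ b) rfl (X · Y') (Y · X') ⟩
  X · Y' ⊝ Y · X' ⊕ Y · X' ≈⟨ +c wronskian (*c rfl D-X) ⟩
  const (+ 6) · hom6 X Y ⊕ Y · (e · X ⊝ X ↑ 5 ⊕ const (+ 5) · (X · Y ↑ 4))
   ≈⟨ solve 3 (λ x y e → con (+ 6) :* (x :* y :* (x :^ 4 :- y :^ 4)) :+ y :* (e :* x :- x :^ 5 :+ con (+ 5) :* (x :* y :^ 4))
     := x :* (e :* y :+ con (+ 5) :* (x :^ 4 :* y) :- y :^ 5)) rfl X Y e ⟩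
  X · (e · Y ⊕ const (+ 5) · (X ↑ 4 · Y) ⊝ Y ↑ 5) ∎)
  where open ≈-Reasoning

 e2' : Ser
 e2' = sub 1 e

 private
  sub-X' : X2' ≋ e2' · X2 ⊝ X2 ↑ 5 ⊕ const (+ 5) · (X2 · Y2 ↑ 4)
  sub-X' = tr (sub-cong 1 D-X) (tr (sub-⊕ 1 _ _) (+c (tr (sub-⊝ 1 _ _)
   (+c (sub-· 1 e X) (-c (sub-↑ 1 X 5))))
   (tr (sub-· 1 _ _) (*c (sub-const 1 (+ 5)) (tr (sub-· 1 _ _) (*c rfl (sub-↑ 1 Y 4)))))))

  sub-Y' : Y2' ≋ e2' · Y2 ⊕ const (+ 5) · (X2 ↑ 4 · Y2) ⊝ Y2 ↑ 5
  sub-Y' = tr (sub-cong 1 D-Y) (tr (sub-⊝ 1 _ _) (+c (tr (sub-⊕ 1 _ _) (+c (sub-· 1 e Y)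
   (tr (sub-· 1 _ _) (*c (sub-const 1 (+ 5)) (tr (sub-· 1 _ _) (*c (sub-↑ 1 X 4) rfl))))))
   (-c (sub-↑ 1 Y 5))))

 -- Multiplied by X², the left side becomes X X' plus a polynomial in X² and Y², and all of these
 -- are known at q².
 e-duplication : e ≋ const (+ 2) · e2' ⊝ (X2 ↑ 4 ⊕ const (+ 6) · (X2 ↑ 2 · Y2 ↑ 2) ⊕ Y2 ↑ 4)
 e-duplication = unit1-cancel (X · X) (trans (·-at-0 X X) (cong₂ _*_ X-0 X-0)) (begin
  X · X · e
   ≈⟨ solve 3 (λ x y e → x :* x :* e := x :* (e :* x :- x :^ 5 :+ con (+ 5) :* (x :* y :^ 4)) :+
     (x :* x) :* ((x :* x) :* (x :* x) :- con (+ 5) :* (y :* y :* (y :* y)))) rfl X Y e ⟩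
  X · (e · X ⊝ X ↑ 5 ⊕ const (+ 5) · (X · Y ↑ 4)) ⊕ G (X · X) (Y · Y)
   ≈⟨ +c (*c rfl (sm D-X)) (G-cong X-duplication Y-duplication) ⟩
  X · X' ⊕ G (X2 · X2 ⊕ Y2 · Y2) (const (+ 2) · (X2 · Y2))
   ≈⟨ +c (tr XX' (*c rfl (+c (*c rfl sub-X') (*c rfl sub-Y')))) rfl ⟩
  const (+ 2) · (X2 · (e2' · X2 ⊝ X2 ↑ 5 ⊕ const (+ 5) · (X2 · Y2 ↑ 4)) ⊕
         Y2 · (e2' · Y2 ⊕ const (+ 5) · (X2 ↑ 4 · Y2) ⊝ Y2 ↑ 5)) ⊕
   G (X2 · X2 ⊕ Y2 · Y2) (const (+ 2) · (X2 · Y2))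
   ≈⟨ solve 3 (λ x y e → let s = x :* x :+ y :* y; r = con (+ 2) :* (x :* y) in
     con (+ 2) :* (x :* (e :* x :- x :^ 5 :+ con (+ 5) :* (x :* y :^ 4)) :+
            y :* (e :* y :+ con (+ 5) :* (x :^ 4 :* y) :- y :^ 5)) :+ s :* (s :* s :- con (+ 5) :* (r :* r))
     := s :* (con (+ 2) :* e :- (x :^ 4 :+ con (+ 6) :* (x :^ 2 :* y :^ 2) :+ y :^ 4))) rfl X2 Y2 e2' ⟩
  (X2 · X2 ⊕ Y2 · Y2) · (const (+ 2) · e2' ⊝ (X2 ↑ 4 ⊕ const (+ 6) · (X2 ↑ 2 · Y2 ↑ 2) ⊕ Y2 ↑ 4))
   ≈⟨ *c (sm X-duplication) rfl ⟩
  X · X · (const (+ 2) · e2' ⊝ (X2 ↑ 4 ⊕ const (+ 6) · (X2 ↑ 2 · Y2 ↑ 2) ⊕ Y2 ↑ 4)) ∎)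
  where
  open ≈-Reasoning
  G : Ser → Ser → Ser
  G s r = s · (s · s ⊝ const (+ 5) · (r · r))
  G-cong : ∀ {a b a' b'} → a ≋ a' → b ≋ b' → G a b ≋ G a' b'
  G-cong a b = *c a (+c (*c a a) (-c (*c rfl (*c b b))))

open Wronskian

-- Eisenstein series and Ramanujan's differential equations

module Eisenstein where

 open Z using (_+_; _*_; -_; _-_)

 open E

 opaque

  -- With z = θ₃² and x = θ₂⁴/θ₃⁴ these are Ramanujan's E4 = z⁴(1 + 14x + x²) and E6 = z⁶(1 + x)(1 -
  -- 34x + x²), in the variable q^24.
  E4 E6 Δ' : Ser
  E4 = (X ↑ 4) ↑ 2 ⊕ const (+ 14) · (X ↑ 4 · Y ↑ 4) ⊕ (Y ↑ 4) ↑ 2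
  E6 = (X ↑ 4) ↑ 3 ⊝ const (+ 33) · ((X ↑ 4) ↑ 2 · Y ↑ 4) ⊝ const (+ 33) · (X ↑ 4 · (Y ↑ 4) ↑ 2) ⊕ (Y ↑ 4) ↑ 3
  Δ' = E4 ↑ 3 ⊝ E6 ↑ 2

  E4-def : E4 ≋ (X ↑ 4) ↑ 2 ⊕ const (+ 14) · (X ↑ 4 · Y ↑ 4) ⊕ (Y ↑ 4) ↑ 2
  E4-def = rfl

  E6-def : E6 ≋ (X ↑ 4) ↑ 3 ⊝ const (+ 33) · ((X ↑ 4) ↑ 2 · Y ↑ 4) ⊝ const (+ 33) · (X ↑ 4 · (Y ↑ 4) ↑ 2) ⊕ (Y ↑ 4) ↑ 3
  E6-def = rfl

  Δ'-def : Δ' ≋ E4 ↑ 3 ⊝ E6 ↑ 2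
  Δ'-def = rfl

 D-⊝ : ∀ f g → D (f ⊝ g) ≋ D f ⊝ D g
 D-⊝ f g = tr (D-⊕ f (⊖ g)) (+c rfl (D-⊖ g))

 private
  P2 : Ser → Ser → Ser
  P2 x y = x ↑ 4 ⊕ const (+ 6) · (x ↑ 2 · y ↑ 2) ⊕ y ↑ 4

  D-P2 : ∀ x y → D (P2 x y) ≋ const (+ 4) · x ↑ 3 · D x ⊕ const (+ 6) · (const (+ 2) · x ↑ 1 · D x · y ↑ 2 ⊕
                x ↑ 2 · (const (+ 2) · y ↑ 1 · D y)) ⊕ const (+ 4) · y ↑ 3 · D y
  D-P2 x y = tr (D-⊕ _ _) (+c (tr (D-⊕ _ _) (+c (D-↑ x 3) (tr (D-const-· (+ 6) _)
   (*c rfl (tr (D-· _ _) (+c (*c (D-↑ x 1) rfl) (*c rfl (D-↑ y 1)))))))) (D-↑ y 3))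

  sub-P2 : sub 1 (P2 X Y) ≋ P2 X2 Y2
  sub-P2 = tr (sub-⊕ 1 _ _) (+c (tr (sub-⊕ 1 _ _) (+c (sub-↑ 1 X 4) (tr (sub-· 1 _ _)
   (*c (sub-const 1 (+ 6)) (tr (sub-· 1 _ _) (*c (sub-↑ 1 X 2) (sub-↑ 1 Y 2))))))) (sub-↑ 1 Y 4))

  quot : Ser → Ser → Ser → Ser
  quot x y e = const (+ 4) · x ↑ 3 · x' ⊕ const (+ 6) · (const (+ 2) · x ↑ 1 · x' · y ↑ 2 ⊕
        x ↑ 2 · (const (+ 2) · y ↑ 1 · y')) ⊕ const (+ 4) · y ↑ 3 · y'
   where x' = e · x ⊝ x ↑ 5 ⊕ const (+ 5) · (x · y ↑ 4)
         y' = e · y ⊕ const (+ 5) · (x ↑ 4 · y) ⊝ y ↑ 5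

  D-P2-XY : D (P2 X Y) ≋ quot X Y e
  D-P2-XY = tr (D-P2 X Y) (+c (+c (*c rfl D-X) (*c rfl (+c
   (*c (*c rfl D-X) rfl) (*c rfl (*c rfl D-Y))))) (*c rfl D-Y))

  sub-const-· : ∀ c f → sub 1 (const c · f) ≋ const c · sub 1 f
  sub-const-· c f = tr (sub-· 1 _ _) (*c (sub-const 1 c) rfl)

  sub-quot : sub 1 (quot X Y e) ≋ quot X2 Y2 e2'
  sub-quot = tr (sub-⊕ 1 _ _) (+c (tr (sub-⊕ 1 _ _) (+c
    (tr (sub-· 1 _ _) (*c (tr (sub-const-· _ _) (*c rfl (sub-↑ 1 X 3))) sx))
    (tr (sub-const-· _ _) (*c rfl (tr (sub-⊕ 1 _ _) (+c
     (tr (sub-· 1 _ _) (*c (tr (sub-· 1 _ _) (*c (tr (sub-const-· _ _) (*c rfl (sub-↑ 1 X 1))) sx)) (sub-↑ 1 Y 2)))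
     (tr (sub-· 1 _ _) (*c (sub-↑ 1 X 2) (tr (sub-· 1 _ _) (*c (tr (sub-const-· _ _) (*c rfl (sub-↑ 1 Y 1))) sy))))))))))
    (tr (sub-· 1 _ _) (*c (tr (sub-const-· _ _) (*c rfl (sub-↑ 1 Y 3))) sy)))
   where
   sx = tr (sub-⊕ 1 _ _) (+c (tr (sub-⊝ 1 _ _) (+c (sub-· 1 e X) (-c (sub-↑ 1 X 5))))
      (tr (sub-const-· _ _) (*c rfl (tr (sub-· 1 _ _) (*c rfl (sub-↑ 1 Y 4))))))
   sy = tr (sub-⊝ 1 _ _) (+c (tr (sub-⊕ 1 _ _) (+c (sub-· 1 e Y)
      (tr (sub-const-· _ _) (*c rfl (tr (sub-· 1 _ _) (*c (sub-↑ 1 X 4) rfl))))))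
      (-c (sub-↑ 1 Y 5)))

  E4-of : Ser → Ser → Ser
  E4-of x y = (x ↑ 4) ↑ 2 ⊕ const (+ 14) · (x ↑ 4 · y ↑ 4) ⊕ (y ↑ 4) ↑ 2

  opaque
   unfolding E4 E6 Δ'

   sub-E4 : sub 1 E4 ≋ E4-of X2 Y2
   sub-E4 = tr (sub-⊕ 1 _ _) (+c (tr (sub-⊕ 1 _ _) (+c (tr (sub-↑ 1 _ 2) (↑-cong 2 (sub-↑ 1 X 4)))
    (tr (sub-const-· _ _) (*c rfl (tr (sub-· 1 _ _) (*c (sub-↑ 1 X 4) (sub-↑ 1 Y 4)))))))
    (tr (sub-↑ 1 _ 2) (↑-cong 2 (sub-↑ 1 Y 4))))

   E4-dup : E4 ≋ (X2 · X2 ⊕ Y2 · Y2) ↑ 4 ⊕ const (+ 14) · ((X2 · X2 ⊕ Y2 · Y2) ↑ 2 · (const (+ 2) · (X2 · Y2)) ↑ 2) ⊕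
          (const (+ 2) · (X2 · Y2)) ↑ 4
   E4-dup = tr (solve 2 (λ x y → (x :^ 4) :^ 2 :+ con (+ 14) :* (x :^ 4 :* y :^ 4) :+ (y :^ 4) :^ 2
     := (x :* x) :^ 4 :+ con (+ 14) :* ((x :* x) :^ 2 :* (y :* y) :^ 2) :+ (y :* y) :^ 4) rfl X Y)
    (+c (+c (↑-cong 4 X-duplication) (*c rfl (*c (↑-cong 2 X-duplication) (↑-cong 2 Y-duplication))))
        (↑-cong 4 Y-duplication))

 -- Again both sides satisfy the same functional equation relating q and q².
 opaque
  unfolding E4 E6 Δ'

  D-e : D e ≋ const (+ 2) · e ↑ 2 ⊝ const (+ 2) · E4
  D-e = ⊝-0⇒≋ (sub-≋4-⇒0 (+ 4) (λ ()) (begin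
   δ ≈⟨ +c (D-cong e-duplication) (-c (+c (*c rfl (↑-cong 2 e-duplication)) (-c (*c rfl E4-dup)))) ⟩
   D (const (+ 2) · e2' ⊝ P2 X2 Y2) ⊝ (const (+ 2) · (const (+ 2) · e2' ⊝ P2 X2 Y2) ↑ 2 ⊝ const (+ 2) · E4d)
    ≈⟨ +c D-side rfl ⟩
   const (+ 2) · (const (+ 2) · sub 1 (D e)) ⊝ const (+ 2) · quot X2 Y2 e2' ⊝
    (const (+ 2) · (const (+ 2) · e2' ⊝ P2 X2 Y2) ↑ 2 ⊝ const (+ 2) · E4d)
    ≈⟨ solve 4 (λ x y e d →
      let x' = e :* x :- x :^ 5 :+ con (+ 5) :* (x :* y :^ 4); y' = e :* y :+ con (+ 5) :* (x :^ 4 :* y) :- y :^ 5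
          P = x :^ 4 :+ con (+ 6) :* (x :^ 2 :* y :^ 2) :+ y :^ 4
          s = x :* x :+ y :* y; r = con (+ 2) :* (x :* y) in
      con (+ 2) :* (con (+ 2) :* d) :- con (+ 2) :* (con (+ 4) :* x :^ 3 :* x' :+ con (+ 6) :* (con (+ 2) :* x :^ 1 :* x' :* y :^ 2 :+
         x :^ 2 :* (con (+ 2) :* y :^ 1 :* y')) :+ con (+ 4) :* y :^ 3 :* y') :-
       (con (+ 2) :* (con (+ 2) :* e :- P) :^ 2 :- con (+ 2) :* (s :^ 4 :+ con (+ 14) :* (s :^ 2 :* r :^ 2) :+ r :^ 4))
      := con (+ 4) :* (d :- (con (+ 2) :* e :^ 2 :- con (+ 2) :* ((x :^ 4) :^ 2 :+ con (+ 14) :* (x :^ 4 :* y :^ 4) :+ (y :^ 4) :^ 2))))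
      rfl X2 Y2 e2' (sub 1 (D e)) ⟩
   const (+ 4) · (sub 1 (D e) ⊝ (const (+ 2) · e2' ↑ 2 ⊝ const (+ 2) · E4-of X2 Y2))
    ≈⟨ *c rfl (sm sub-δ) ⟩
   const (+ 4) · sub 1 δ ∎))
   where
   open ≈-Reasoning
   δ E4d : Ser
   δ = D e ⊝ (const (+ 2) · e ↑ 2 ⊝ const (+ 2) · E4)
   E4d = (X2 · X2 ⊕ Y2 · Y2) ↑ 4 ⊕ const (+ 14) · ((X2 · X2 ⊕ Y2 · Y2) ↑ 2 · (const (+ 2) · (X2 · Y2)) ↑ 2) ⊕
          (const (+ 2) · (X2 · Y2)) ↑ 4
   sub-δ : sub 1 δ ≋ sub 1 (D e) ⊝ (const (+ 2) · e2' ↑ 2 ⊝ const (+ 2) · E4-of X2 Y2)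
   sub-δ = tr (sub-⊝ 1 _ _) (+c rfl (-c (tr (sub-⊝ 1 _ _) (+c
    (tr (sub-const-· _ _) (*c rfl (sub-↑ 1 e 2))) (-c (tr (sub-const-· _ _) (*c rfl sub-E4)))))))
   D-side : D (const (+ 2) · e2' ⊝ P2 X2 Y2) ≋ const (+ 2) · (const (+ 2) · sub 1 (D e)) ⊝ const (+ 2) · quot X2 Y2 e2'
   D-side = tr (D-⊝ _ _) (+c (tr (D-const-· (+ 2) e2') (*c rfl (D-sub 1 e)))
    (-c (tr (D-cong (sm sub-P2)) (tr (D-sub 1 (P2 X Y)) (*c rfl
     (tr (sub-cong 1 D-P2-XY) sub-quot))))))

 private
  p s : Ser
  p = X ↑ 4
  s = Y ↑ 4

  D-p : D p ≋ const (+ 4) · p · (e ⊝ p ⊕ const (+ 5) · s)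
  D-p = tr (D-↑ X 3) (tr (*c rfl D-X)
   (solve 3 (λ x y e → con (+ 4) :* x :^ 3 :* (e :* x :- x :^ 5 :+ con (+ 5) :* (x :* y :^ 4))
    := con (+ 4) :* x :^ 4 :* (e :- x :^ 4 :+ con (+ 5) :* y :^ 4)) rfl X Y e))

  D-s : D s ≋ const (+ 4) · s · (e ⊕ const (+ 5) · p ⊝ s)
  D-s = tr (D-↑ Y 3) (tr (*c rfl D-Y)
   (solve 3 (λ x y e → con (+ 4) :* y :^ 3 :* (e :* y :+ con (+ 5) :* (x :^ 4 :* y) :- y :^ 5)
    := con (+ 4) :* y :^ 4 :* (e :+ con (+ 5) :* x :^ 4 :- y :^ 4)) rfl X Y e))

 opaque
  unfolding E4 E6 Δ'

  D-E4 : D E4 ≋ const (+ 8) · (e · E4) ⊝ const (+ 8) · E6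
  D-E4 = begin
   D E4 ≈⟨ tr (D-⊕ _ _) (+c (tr (D-⊕ _ _) (+c (tr (D-↑ p 1) (*c rfl D-p))
       (tr (D-const-· (+ 14) _) (*c rfl (tr (D-· p s) (+c (*c D-p rfl) (*c rfl D-s)))))))
       (tr (D-↑ s 1) (*c rfl D-s))) ⟩
   const (+ 2) · p ↑ 1 · p' ⊕ const (+ 14) · (p' · s ⊕ p · s') ⊕ const (+ 2) · s ↑ 1 · s'
    ≈⟨ solve 3 (λ p s e → let p' = con (+ 4) :* p :* (e :- p :+ con (+ 5) :* s); s' = con (+ 4) :* s :* (e :+ con (+ 5) :* p :- s) in
      con (+ 2) :* p :^ 1 :* p' :+ con (+ 14) :* (p' :* s :+ p :* s') :+ con (+ 2) :* s :^ 1 :* s'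
      := con (+ 8) :* (e :* (p :^ 2 :+ con (+ 14) :* (p :* s) :+ s :^ 2)) :-
        con (+ 8) :* (p :^ 3 :- con (+ 33) :* (p :^ 2 :* s) :- con (+ 33) :* (p :* s :^ 2) :+ s :^ 3)) rfl p s e ⟩
   const (+ 8) · (e · E4) ⊝ const (+ 8) · E6 ∎
   where
   open ≈-Reasoning
   p' s' : Ser
   p' = const (+ 4) · p · (e ⊝ p ⊕ const (+ 5) · s)
   s' = const (+ 4) · s · (e ⊕ const (+ 5) · p ⊝ s)

  D-E6 : D E6 ≋ const (+ 12) · (e · E6) ⊝ const (+ 12) · E4 ↑ 2
  D-E6 = begin
   D E6 ≈⟨ tr (D-⊕ _ _) (+c (tr (D-⊝ _ _) (+c (tr (D-⊝ _ _) (+c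
        (tr (D-↑ p 2) (*c rfl D-p))
        (-c (tr (D-const-· (+ 33) _) (*c rfl (tr (D-· _ s)
         (+c (*c (tr (D-↑ p 1) (*c rfl D-p)) rfl) (*c rfl D-s))))))))
        (-c (tr (D-const-· (+ 33) _) (*c rfl (tr (D-· p _)
         (+c (*c D-p rfl) (*c rfl (tr (D-↑ s 1) (*c rfl D-s))))))))))
        (tr (D-↑ s 2) (*c rfl D-s))) ⟩
   const (+ 3) · p ↑ 2 · p' ⊝ const (+ 33) · (const (+ 2) · p ↑ 1 · p' · s ⊕ p ↑ 2 · s') ⊝
    const (+ 33) · (p' · s ↑ 2 ⊕ p · (const (+ 2) · s ↑ 1 · s')) ⊕ const (+ 3) · s ↑ 2 · s'
    ≈⟨ solve 3 (λ p s e → let p' = con (+ 4) :* p :* (e :- p :+ con (+ 5) :* s); s' = con (+ 4) :* s :* (e :+ con (+ 5) :* p :- s) in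
      con (+ 3) :* p :^ 2 :* p' :- con (+ 33) :* (con (+ 2) :* p :^ 1 :* p' :* s :+ p :^ 2 :* s') :-
       con (+ 33) :* (p' :* s :^ 2 :+ p :* (con (+ 2) :* s :^ 1 :* s')) :+ con (+ 3) :* s :^ 2 :* s'
      := con (+ 12) :* (e :* (p :^ 3 :- con (+ 33) :* (p :^ 2 :* s) :- con (+ 33) :* (p :* s :^ 2) :+ s :^ 3)) :-
        con (+ 12) :* (p :^ 2 :+ con (+ 14) :* (p :* s) :+ s :^ 2) :^ 2) rfl p s e ⟩
   const (+ 12) · (e · E6) ⊝ const (+ 12) · E4 ↑ 2 ∎
   where
   open ≈-Reasoning
   p' s' : Ser
   p' = const (+ 4) · p · (e ⊝ p ⊕ const (+ 5) · s)
   s' = const (+ 4) · s · (e ⊕ const (+ 5) · p ⊝ s)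

  -- The E4 and E6 parts cancel and leave the linear equation of first order that η^24 also
  -- satisfies; `D-unique` will identify the two up to a constant.
  D-Δ' : D Δ' ≋ const (+ 24) · (e · Δ')
  D-Δ' = begin
   D Δ' ≈⟨ tr (D-⊝ _ _) (+c (tr (D-↑ E4 2) (*c rfl D-E4)) (-c (tr (D-↑ E6 1) (*c rfl D-E6)))) ⟩
   const (+ 3) · E4 ↑ 2 · (const (+ 8) · (e · E4) ⊝ const (+ 8) · E6) ⊝
    const (+ 2) · E6 ↑ 1 · (const (+ 12) · (e · E6) ⊝ const (+ 12) · E4 ↑ 2)
    ≈⟨ solve 3 (λ a b e → con (+ 3) :* a :^ 2 :* (con (+ 8) :* (e :* a) :- con (+ 8) :* b) :-
       con (+ 2) :* b :^ 1 :* (con (+ 12) :* (e :* b) :- con (+ 12) :* a :^ 2)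
      := con (+ 24) :* (e :* (a :^ 3 :- b :^ 2))) rfl E4 E6 e ⟩
   const (+ 24) · (e · Δ') ∎
   where open ≈-Reasoning

  -- The factor Y⁴ shows that Δ' starts at q^24, with coefficient 108 · 2⁴ = 1728.
  Δ'-product : Δ' ≋ const (+ 108) · (Y ↑ 4 · (X ↑ 4 · (X ↑ 4 ⊝ Y ↑ 4) ↑ 4))
  Δ'-product = solve 2 (λ p s → (p :^ 2 :+ con (+ 14) :* (p :* s) :+ s :^ 2) :^ 3 :-
    (p :^ 3 :- con (+ 33) :* (p :^ 2 :* s) :- con (+ 33) :* (p :* s :^ 2) :+ s :^ 3) :^ 2
    := con (+ 108) :* (s :* (p :* (p :- s) :^ 4))) rfl p s

 opaque
  unfolding X Y

  X-Y-0 : (X ↑ 4 ⊝ Y ↑ 4) 0 ≡ + 1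
  X-Y-0 = trans (⊕-at _ _ 0) (cong₂ _+_ (↑-at-0 X 4) (trans (⊖-at _ 0) (cong -_ (↑-at-0 Y 4))))

 Ord-Δ' : Ord (+ 0) 24 Δ'
 Ord-Δ' = Ord-cong 24 (sm Δ'-product) (Ord-·ˡ 24 (Ord-· 24 0 (Ord-↑ 6 4 Ord-Y) Ord-0))

 opaque
  unfolding X Y

  Δ'-24 : Δ' 24 ≡ + 1728
  Δ'-24 = trans (SMod-0⇒≡ Δ'-product 24) (trans (const-·-≡ (+ 108) _ 24) (cong (_*_ (+ 108))
   (trans (Mod-0⇒≡ (leading-· 24 0 (Ord-↑ 6 4 Ord-Y) Ord-0)) (cong₂ _*_ Y⁴ (trans (·-at-0 (X ↑ 4) _)
    (cong₂ _*_ (↑-at-0 X 4) (trans (↑-at-0 _ 4) (cong (λ z → z * (z * (z * (z * + 1)))) X-Y-0))))))))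
   where
   Y⁴ : (Y ↑ 4) 24 ≡ + 16
   Y⁴ = trans (Mod-0⇒≡ (leading-· 6 18 {Y} Ord-Y (Ord-↑ 6 3 Ord-Y))) (cong (_*_ (+ 2))
     (trans (Mod-0⇒≡ (leading-· 6 12 {Y} Ord-Y (Ord-↑ 6 2 Ord-Y))) (cong (_*_ (+ 2))
     (trans (Mod-0⇒≡ (leading-· 6 6 {Y} Ord-Y (Ord-↑ 6 1 Ord-Y))) (cong (_*_ (+ 2))
     (trans (Mod-0⇒≡ (leading-· 6 0 {Y} Ord-Y (Ord-↑ 6 0 Ord-Y))) refl))))))

 opaque
  unfolding E4 E6 Δ' X Y

  E4-0 : E4 0 ≡ + 1
  E4-0 = trans (⊕-at _ _ 0) (cong₂ _+_ (trans (⊕-at _ _ 0) (cong₂ _+_ (h X)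
    (trans (const-·-≡ (+ 14) _ 0) (cong (_*_ (+ 14)) (trans (·-at-0 _ _) (cong₂ _*_ (↑-at-0 X 4) (↑-at-0 Y 4))))))) (h Y))
   where h : ∀ f → ((f ↑ 4) ↑ 2) 0 ≡ (f 0 Z.^ 4) Z.^ 2
         h f = trans (↑-at-0 _ 2) (cong (Z._^ 2) (↑-at-0 f 4))

  E6-0 : E6 0 ≡ + 1
  E6-0 = trans (⊕-at _ _ 0) (cong₂ _+_ (trans (⊕-at _ _ 0) (cong₂ _+_ (trans (⊕-at _ _ 0) (cong₂ _+_ (h X 3)
    (trans (⊖-at _ 0) (cong -_ (trans (const-·-≡ (+ 33) _ 0) (cong (_*_ (+ 33)) (trans (·-at-0 _ _) (cong₂ _*_ (h X 2) (↑-at-0 Y 4)))))))))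
    (trans (⊖-at _ 0) (cong -_ (trans (const-·-≡ (+ 33) _ 0) (cong (_*_ (+ 33)) (trans (·-at-0 _ _) (cong₂ _*_ (↑-at-0 X 4) (h Y 2))))))))) (h Y 3))
   where h : ∀ f n → ((f ↑ 4) ↑ n) 0 ≡ (f 0 Z.^ 4) Z.^ n
         h f n = trans (↑-at-0 _ n) (cong (Z._^ n) (↑-at-0 f 4))

open Eisenstein

-- Euler's pentagonal number theorem and η as a theta series

module Pentagonal where

 open Z using (_+_; _*_; -_; _-_)

 open E

 Agree : ℕ → Ser → Ser → Set
 Agree N f g = ∀ i → i N.≤ N → f i ≡ g i

 Agree-· : ∀ {N f f' g g'} → Agree N f f' → Agree N g g' → Agree N (f · g) (f' · g')
 Agree-· p q i i≤N = ·-cong-≡ i (λ j j≤i → p j (NP.≤-trans j≤i i≤N)) (λ j j≤i → q j (NP.≤-trans j≤i i≤N))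

 Agree-sub : ∀ {N f f'} d → Agree N f f' → Agree N (sub d f) (sub d f')
 Agree-sub {N} {f} {f'} d p i i≤N with W-view d 0 i
 ... | inj₁ (k , refl) = trans (sub-at d f k) (trans (p k (NP.≤-trans (NP.m≤m*n k (suc d)) i≤N)) (sym (sub-at d f' k)))
 ... | inj₂ h = trans (h f) (sym (h f'))

 ≋⇒Agree : ∀ {N f g} → f ≋ g → Agree N f g
 ≋⇒Agree p i _ = SMod-0⇒≡ p i

 Agree-trans : ∀ {N f g h} → Agree N f g → Agree N g h → Agree N f h
 Agree-trans p q i i≤N = trans (p i i≤N) (q i i≤N)

 Agree-sym : ∀ {N f g} → Agree N f g → Agree N g f
 Agree-sym p i i≤N = sym (p i i≤N)

 Agree-mono : ∀ {M N f g} → M N.≤ N → Agree N f g → Agree M f g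
 Agree-mono M≤N p i i≤M = p i (NP.≤-trans i≤M M≤N)

 agree-by-Ord : ∀ {N f g h} k → N N.< k → f ≋ g ⊕ q^ k · h → Agree N f g
 agree-by-Ord {N} {f} {g} {h} k N<k p i i≤N = trans (SMod-0⇒≡ p i) (trans (⊕-at g _ i)
  (trans (cong (_+_ (g i)) (Mod-0⇒≡ (Ord-⇐ k {q^ k · h} rfl i (NP.≤-<-trans i≤N N<k)))) (ZP.+-identityʳ (g i))))

 eul : ℕ → Ser
 eul zero    = const (+ 1)
 eul (suc n) = eul n · (const (+ 1) ⊝ q^ (suc n))

 Eul : Ser
 Eul n = eul n n

 eul-step : ∀ n → Agree n (eul (suc n)) (eul n)
 eul-step n = agree-by-Ord (suc n) NP.≤-refl
  (solve 2 (λ a q → a :* (con (+ 1) :- q) := a :+ q :* (:- a)) rfl (eul n) (q^ (suc n)))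

 eul-agree : ∀ n k → Agree n (eul (k N.+ n)) (eul n)
 eul-agree n zero    = λ _ _ → refl
 eul-agree n (suc k) = Agree-trans (Agree-mono (NP.m≤n+m n k) (eul-step (k N.+ n))) (eul-agree n k)

 Eul-agree : ∀ n → Agree n Eul (eul n)
 Eul-agree n i i≤n = sym (trans (cong (λ k → eul k i) (sym (NP.m∸n+n≡m i≤n))) (eul-agree i (n N.∸ i) i NP.≤-refl))

 -- Shanks' finite form of the pentagonal number theorem.

 module Pentagonal where

  -- L n y is (-y)^n q^(n(n+1)/2), and G n y is the sum over s ≤ n of L s y times the Euler factors
  -- 1 - q^i with s < i ≤ n. Shanks' sum is the case y = q^n.
  L G : ℕ → Ser → Ser
  L zero    y = const (+ 1)
  L (suc n) y = ⊖ (y · q^ (suc n) · L n y)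
  G zero    y = const (+ 1)
  G (suc n) y = (const (+ 1) ⊝ q^ (suc n)) · G n y ⊕ L (suc n) y

  q : Ser
  q = q^ 1

  L-shift : ∀ n y → L n (q · y) ≋ q^ n · L n y
  L-shift zero    y = sm (*-identityˡ _)
  L-shift (suc n) y = begin
   ⊖ (q · y · q^ (suc n) · L n (q · y)) ≈⟨ -c (*c rfl (L-shift n y)) ⟩
   ⊖ (q · y · q^ (suc n) · (q^ n · L n y))
    ≈⟨ solve 5 (λ q y s t l → :- (q :* y :* s :* (t :* l)) := q :* t :* (:- (y :* s :* l))) rfl q y (q^ (suc n)) (q^ n) (L n y) ⟩
   q · q^ n · L (suc n) y ≈⟨ *c (q^-+ 1 n) rfl ⟩
   q^ (suc n) · L (suc n) y ∎
   where open ≈-Reasoning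

  L-suc : ∀ n y → L (suc n) y ≋ ⊖ (y · q · L n (q · y))
  L-suc n y = -c (begin
   y · q^ (suc n) · L n y ≈⟨ *c (*c rfl (sm (q^-+ 1 n))) rfl ⟩
   y · (q · q^ n) · L n y ≈⟨ solve 4 (λ y q s l → y :* (q :* s) :* l := y :* q :* (s :* l)) rfl y q (q^ n) (L n y) ⟩
   y · q · (q^ n · L n y) ≈⟨ *c rfl (sm (L-shift n y)) ⟩
   y · q · L n (q · y) ∎)
   where open ≈-Reasoning

  -- At y = q^n the factor 1 - y q is the next Euler factor 1 - q^(n+1), so this leads from S n to S
  -- (n + 1).
  G-shift : ∀ n y → (const (+ 1) ⊝ y · q) · G n (q · y) ≋ G n y ⊝ y · q · L n (q · y)
  G-shift zero    y = solve 2 (λ y q → (con (+ 1) :- y :* q) :* con (+ 1) := con (+ 1) :- y :* q :* con (+ 1)) rfl y q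
  G-shift (suc n) y = begin
   (const (+ 1) ⊝ y · q) · (a · G n (q · y) ⊕ L (suc n) (q · y))
    ≈⟨ solve 5 (λ y q a g l → (con (+ 1) :- y :* q) :* (a :* g :+ l) := a :* ((con (+ 1) :- y :* q) :* g) :+ (con (+ 1) :- y :* q) :* l)
      rfl y q a (G n (q · y)) (L (suc n) (q · y)) ⟩
   a · ((const (+ 1) ⊝ y · q) · G n (q · y)) ⊕ (const (+ 1) ⊝ y · q) · L (suc n) (q · y)
    ≈⟨ +c (*c rfl (G-shift n y)) rfl ⟩
   a · (G n y ⊝ y · q · L n (q · y)) ⊕ (const (+ 1) ⊝ y · q) · L (suc n) (q · y)
    ≈⟨ solve 5 (λ y q s g l → let l' = :- (q :* y :* s :* l); a = con (+ 1) :- s in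
      a :* (g :- y :* q :* l) :+ (con (+ 1) :- y :* q) :* l' := a :* g :+ (:- (y :* q :* l)) :- y :* q :* l')
      rfl y q (q^ (suc n)) (G n y) (L n (q · y)) ⟩
   a · G n y ⊕ (⊖ (y · q · L n (q · y))) ⊝ y · q · L (suc n) (q · y)
    ≈⟨ +c (+c rfl (sm (L-suc n y))) rfl ⟩
   G (suc n) y ⊝ y · q · L (suc n) (q · y) ∎
   where open ≈-Reasoning
         a : Ser
         a = const (+ 1) ⊝ q^ (suc n)

  S : ℕ → Ser
  S n = G n (q^ n)

  G-cong : ∀ n {y z} → y ≋ z → G n y ≋ G n z
  L-cong : ∀ n {y z} → y ≋ z → L n y ≋ L n z
  L-cong zero    p = rfl
  L-cong (suc n) p = -c (*c (*c p rfl) (L-cong n p))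
  G-cong zero    p = rfl
  G-cong (suc n) p = +c (*c rfl (G-cong n p)) (L-cong (suc n) p)

  S-suc : ∀ n → S (suc n) ≋ S n ⊝ q^ (suc n) · (const (+ 1) ⊕ q^ (suc n)) · L n (q^ (suc n))
  S-suc n = begin
   (const (+ 1) ⊝ q^ (suc n)) · G n (q^ (suc n)) ⊝ q^ (suc n) · q^ (suc n) · l
    ≈⟨ +c (*c (+c rfl (-c qn)) (G-cong n qn')) rfl ⟩
   (const (+ 1) ⊝ q^ n · q) · G n (q · q^ n) ⊝ q^ (suc n) · q^ (suc n) · l
    ≈⟨ +c (G-shift n (q^ n)) rfl ⟩
   S n ⊝ q^ n · q · L n (q · q^ n) ⊝ q^ (suc n) · q^ (suc n) · l
    ≈⟨ +c (+c rfl (-c (*c (sm qn) (L-cong n (sm qn'))))) rfl ⟩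
   S n ⊝ q^ (suc n) · l ⊝ q^ (suc n) · q^ (suc n) · l
    ≈⟨ solve 3 (λ s q l → s :- q :* l :- q :* q :* l := s :- q :* (con (+ 1) :+ q) :* l) rfl (S n) (q^ (suc n)) l ⟩
   S n ⊝ q^ (suc n) · (const (+ 1) ⊕ q^ (suc n)) · l ∎
   where
   open ≈-Reasoning
   l : Ser
   l = L n (q^ (suc n))
   qn' : q^ (suc n) ≋ q · q^ n
   qn' = sm (q^-+ 1 n)
   qn : q^ (suc n) ≋ q^ n · q
   qn = tr qn' (*-comm _ _)

  T : ℕ → ℕ
  T zero    = 0
  T (suc n) = suc n N.+ T n

  sgn : ℕ → ℤ
  sgn zero    = + 1
  sgn (suc n) = - sgn n

  L-q^ : ∀ n k → L n (q^ k) ≋ const (sgn n) · q^ (n N.* k N.+ T n)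
  L-q^ zero    k = sm (*-identityˡ _)
  L-q^ (suc n) k = begin
   ⊖ (q^ k · q^ (suc n) · L n (q^ k)) ≈⟨ -c (*c (q^-+ k (suc n)) (L-q^ n k)) ⟩
   ⊖ (q^ (k N.+ suc n) · (const (sgn n) · q^ (n N.* k N.+ T n)))
    ≈⟨ solve 3 (λ a b c → :- (a :* (b :* c)) := (:- b) :* (a :* c)) rfl (q^ (k N.+ suc n)) (const (sgn n)) (q^ (n N.* k N.+ T n)) ⟩
   (⊖ const (sgn n)) · (q^ (k N.+ suc n) · q^ (n N.* k N.+ T n))
    ≈⟨ *c (sm (const-neg (sgn n))) (tr (q^-+ (k N.+ suc n) (n N.* k N.+ T n)) (≡⇒≋ λ i → cong (λ m → q^ m i) (ar k n (T n)))) ⟩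
   const (sgn (suc n)) · q^ (suc n N.* k N.+ T (suc n)) ∎
   where open ≈-Reasoning
         ar : ∀ k n t → k N.+ suc n N.+ (n N.* k N.+ t) ≡ suc n N.* k N.+ (suc n N.+ t)
         ar = ringN

  -- All summands of G with s > 0 carry a factor y q; at y = q^n they do not touch the coefficients
  -- up to q^n.
  G-eul : ∀ n y → ∃ λ h → G n y ≋ eul n ⊕ y · q · h
  G-eul zero    y = const (+ 0) , solve 1 (λ a → con (+ 1) := con (+ 1) :+ a :* con (+ 0)) rfl (y · q)
  G-eul (suc n) y with G-eul n y
  ... | h , p = (const (+ 1) ⊝ q^ (suc n)) · h ⊝ q^ n · L n y , (begin
   (const (+ 1) ⊝ q^ (suc n)) · G n y ⊝ y · q^ (suc n) · L n y
    ≈⟨ +c (*c rfl p) (-c (*c (*c rfl (sm (q^-+ 1 n))) rfl)) ⟩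
   (const (+ 1) ⊝ q^ (suc n)) · (eul n ⊕ y · q · h) ⊝ y · (q · q^ n) · L n y
    ≈⟨ solve 7 (λ s eu y q h t l → (con (+ 1) :- s) :* (eu :+ y :* q :* h) :- y :* (q :* t) :* l :=
      eu :* (con (+ 1) :- s) :+ y :* q :* ((con (+ 1) :- s) :* h :- t :* l)) rfl (q^ (suc n)) (eul n) y q h (q^ n) (L n y) ⟩
   eul n · (const (+ 1) ⊝ q^ (suc n)) ⊕ y · q · ((const (+ 1) ⊝ q^ (suc n)) · h ⊝ q^ n · L n y) ∎)
   where open ≈-Reasoning

  S-agree : ∀ n → Agree n Eul (S n)
  S-agree n with G-eul n (q^ n)
  ... | h , p = Agree-trans (Eul-agree n) (Agree-sym (agree-by-Ord {h = h} (suc n) NP.≤-refl (tr p (+c rfl (*c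
    (tr (*-comm _ _) (q^-+ 1 n)) rfl)))))

 open Pentagonal using (T; sgn) public

 -- The Dirichlet character (12/·).

 χt : ℕ → ℤ
 χt 1  = + 1
 χt 5  = - + 1
 χt 7  = - + 1
 χt 11 = + 1
 χt _  = + 0

 χ : ℤ → ℤ
 χ x = χt (Z.∣ x ∣ NM.% 12)

 private
  χ-+12 : ∀ n → χ (+ (12 N.+ n)) ≡ χ (+ n)
  χ-+12 n = cong χt (trans (cong (NM._% 12) (NP.+-comm 12 n)) (NM.[m+n]%n≡m%n n 12))

  χ-6n+ : ∀ r n → χ (+ (6 N.* suc (suc n) N.+ r)) ≡ χ (+ (6 N.* n N.+ r))
  χ-6n+ r n = trans (cong (χ ∘ +_) (h n r)) (χ-+12 (6 N.* n N.+ r))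
   where h : ∀ n r → 6 N.* (2 N.+ n) N.+ r ≡ 12 N.+ (6 N.* n N.+ r)
         h = ringN

  χ-6n : ∀ r (c : ℕ → ℤ) → (∀ n → c (suc (suc n)) ≡ c n) → χ (+ r) ≡ c 0 → χ (+ (6 N.+ r)) ≡ c 1 →
     ∀ n → χ (+ (6 N.* n N.+ r)) ≡ c n
  χ-6n r c p z o zero          = z
  χ-6n r c p z o (suc zero)    = o
  χ-6n r c p z o (suc (suc n)) = trans (χ-6n+ r n) (trans (χ-6n r c p z o n) (sym (p n)))

  sgn-2 : ∀ n → sgn (suc (suc n)) ≡ sgn n
  sgn-2 n = ZP.neg-involutive (sgn n)

 -- Half of the theta series of an even weight vanishing at 0, cut off at k; `th-U` restores the
 -- factor 2 for ±x.
 U : (ℤ → ℤ) → ℕ → ℕ → Ser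
 U w a zero    = const (+ 0)
 U w a (suc k) = U w a k ⊕ const (w (+ suc k)) · q^ (a N.* (suc k N.* suc k))

 opaque
  unfolding _⊕_ _·_

  th-U : ∀ a w → (∀ n → w -[1+ n ] ≡ w (+ suc n)) → w (+ 0) ≡ + 0 → 1 N.≤ a → ∀ {N K} → N N.≤ K →
     th a w N ≡ + 2 * U w a K N
  th-U a w even w0 1≤a {N} {K} N≤K = trans (θ-box 1 (e1-proper 1≤a) (w ∘ Vec.head) K N N≤K)
    (trans (sumL-vecs (rangeℤ K) 0 _) (trans (sumL-cong (rangeℤ K) λ x → ZP.+-identityʳ _) (go K)))
   where
   term : ℤ → ℤ
   term x = [ a N.* sq x N.≟ N ] * w x
   mono : ∀ k → (const (w (+ suc k)) · q^ (a N.* (suc k N.* suc k))) N ≡ term (+ suc k)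
   mono k = trans (const-·-≡ _ (q^ m) N) (h (m N.≟ N))
    where m : ℕ
          m = a N.* (suc k N.* suc k)
          h : (d : Dec (m ≡ N)) → w (+ suc k) * q^ m N ≡ [ d ] * w (+ suc k)
          h (yes refl) = trans (cong (_*_ (w (+ suc k))) (q^-≡ m)) (ZP.*-comm (w (+ suc k)) (+ 1))
          h (no p)     = trans (cong (_*_ (w (+ suc k))) (q^-≢ m N p)) (ZP.*-zeroʳ (w (+ suc k)))
   go : ∀ K → sumL (rangeℤ K) term ≡ + 2 * U w a K N
   go zero = trans (ZP.+-identityʳ _) (trans (cong (_*_ [ a N.* 0 N.≟ N ]) w0) (trans (ZP.*-zeroʳ [ a N.* 0 N.≟ N ]) (z N)))
    where z : ∀ N → + 0 ≡ + 2 * const (+ 0) N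
          z zero    = refl
          z (suc N) = refl
   go (suc K) = trans (cong₂ (λ x y → term (+ suc K) + (x + y)) (cong (_*_ [ a N.* (suc K N.* suc K) N.≟ N ]) (even K)) (go K))
    (trans (h (term (+ suc K)) (U w a K N)) (cong (λ z → + 2 * (U w a K N + z)) (sym (mono K))))
    where h : ∀ t u → t + (t + + 2 * u) ≡ + 2 * (u + t)
          h = ring

 open Pentagonal using (S; S-suc; S-agree; L; L-q^)

 q^≡ : ∀ {i j} → i ≡ j → q^ i ≋ q^ j
 q^≡ refl = rfl

 private
  24T : ∀ n → 24 N.* T n ≡ 12 N.* (n N.* suc n)
  24T zero    = refl
  24T (suc n) = trans (NP.*-distribˡ-+ 24 (suc n) (T n)) (trans (cong (24 N.* suc n N.+_) (24T n)) (h n))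
   where h : ∀ n → 24 N.* suc n N.+ 12 N.* (n N.* suc n) ≡ 12 N.* (suc n N.* suc (suc n))
         h = ringN

  -- Completing the square: 24 times the pentagonal number (n+1)(3n+2)/2, plus 1, is (6n+5)².
  pent-exp1 : ∀ n → 1 N.+ (suc n N.+ (n N.* suc n N.+ T n)) N.* 24 ≡ 1 N.* ((6 N.* n N.+ 5) N.* (6 N.* n N.+ 5))
  pent-exp1 n = trans (h n (T n)) (trans (cong (1 N.+ (suc n N.+ n N.* suc n) N.* 24 N.+_) (24T n)) (h' n))
   where h : ∀ n t → 1 N.+ (suc n N.+ (n N.* suc n N.+ t)) N.* 24 ≡ 1 N.+ (suc n N.+ n N.* suc n) N.* 24 N.+ 24 N.* t
         h = ringN
         h' : ∀ n → 1 N.+ (suc n N.+ n N.* suc n) N.* 24 N.+ 12 N.* (n N.* suc n) ≡ 1 N.* ((6 N.* n N.+ 5) N.* (6 N.* n N.+ 5))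
         h' = ringN

  pent-exp2 : ∀ n → 1 N.+ (suc n N.+ (suc n N.+ (n N.* suc n N.+ T n))) N.* 24 ≡ 1 N.* ((6 N.* n N.+ 7) N.* (6 N.* n N.+ 7))
  pent-exp2 n = trans (h n (T n)) (trans (cong (1 N.+ (suc n N.+ (suc n N.+ n N.* suc n)) N.* 24 N.+_) (24T n)) (h' n))
   where h : ∀ n t → 1 N.+ (suc n N.+ (suc n N.+ (n N.* suc n N.+ t))) N.* 24 ≡ 1 N.+ (suc n N.+ (suc n N.+ n N.* suc n)) N.* 24 N.+ 24 N.* t
         h = ringN
         h' : ∀ n → 1 N.+ (suc n N.+ (suc n N.+ n N.* suc n)) N.* 24 N.+ 12 N.* (n N.* suc n) ≡ 1 N.* ((6 N.* n N.+ 7) N.* (6 N.* n N.+ 7))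
         h' = ringN

  U-term : ∀ w a k {c m} → w (+ suc k) ≡ c → a N.* (suc k N.* suc k) ≡ m →
      U w a (suc k) ≋ U w a k ⊕ const c · q^ m
  U-term w a k refl refl = rfl

  U-skip : ∀ w a k → w (+ suc k) ≡ + 0 → U w a (suc k) ≋ U w a k
  U-skip w a k p = tr (U-term w a k p refl) (solve 2 (λ u m → u :+ con (+ 0) :* m := u) rfl (U w a k) (q^ (a N.* (suc k N.* suc k))))

  U-pent : ∀ n → q^ 1 · sub 23 (S n) ≋ U χ 1 (6 N.* n N.+ 1)
  U-pent zero = begin
   q^ 1 · sub 23 (const (+ 1)) ≈⟨ *c rfl (sub-const 23 (+ 1)) ⟩
   q^ 1 · const (+ 1) ≈⟨ solve 1 (λ q → q :* con (+ 1) := con (+ 0) :+ con (+ 1) :* q) rfl (q^ 1) ⟩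
   U χ 1 1 ∎
   where open ≈-Reasoning
  U-pent (suc n) = begin
   q^ 1 · sub 23 (S (suc n))
    ≈⟨ *c rfl (sub-cong 23 (tr (S-suc n) (+c rfl (-c (tr (*c rfl (L-q^ n (suc n)))
      (tr (solve 3 (λ s c m → s :* (con (+ 1) :+ s) :* (c :* m) := c :* (s :* m :+ s :* (s :* m))) rfl (q^ (suc n)) (const (sgn n)) (q^ t))
       (*c rfl (+c (q^-+ (suc n) t) (tr (*c rfl (q^-+ (suc n) t)) (q^-+ (suc n) (suc n N.+ t))))))))))) ⟩
   q^ 1 · sub 23 (S n ⊝ const (sgn n) · (q^ (suc n N.+ t) ⊕ q^ (suc n N.+ (suc n N.+ t))))
    ≈⟨ *c rfl (tr (sub-⊝ 23 _ _) (+c rfl (-c (tr (sub-· 23 _ _) (*c (sub-const 23 (sgn n))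
      (tr (sub-⊕ 23 _ _) (+c (sub-q^ 23 (suc n N.+ t)) (sub-q^ 23 (suc n N.+ (suc n N.+ t)))))))))) ⟩
   q^ 1 · (sub 23 (S n) ⊝ const (sgn n) · (q^ ((suc n N.+ t) N.* 24) ⊕ q^ ((suc n N.+ (suc n N.+ t)) N.* 24)))
    ≈⟨ solve 5 (λ q s c a b → q :* (s :- c :* (a :+ b)) := q :* s :+ (:- c) :* (q :* a) :+ (:- c) :* (q :* b)) rfl
      (q^ 1) (sub 23 (S n)) (const (sgn n)) (q^ ((suc n N.+ t) N.* 24)) (q^ ((suc n N.+ (suc n N.+ t)) N.* 24)) ⟩
   q^ 1 · sub 23 (S n) ⊕ (⊖ const (sgn n)) · (q^ 1 · q^ ((suc n N.+ t) N.* 24)) ⊕ (⊖ const (sgn n)) · (q^ 1 · q^ ((suc n N.+ (suc n N.+ t)) N.* 24))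
    ≈⟨ +c (+c (U-pent n) (*c (sm (const-neg (sgn n))) (tr (q^-+ 1 _) (q^≡ (pent-exp1 n)))))
      (*c (sm (const-neg (sgn n))) (tr (q^-+ 1 _) (q^≡ (pent-exp2 n)))) ⟩
   U χ 1 (6 N.* n N.+ 1) ⊕ const (sgn (suc n)) · q^ (1 N.* ((6 N.* n N.+ 5) N.* (6 N.* n N.+ 5))) ⊕
    const (sgn (suc n)) · q^ (1 N.* ((6 N.* n N.+ 7) N.* (6 N.* n N.+ 7)))
    ≈⟨ sm step ⟩
   U χ 1 (6 N.* suc n N.+ 1) ∎
   where
   open ≈-Reasoning
   t = n N.* suc n N.+ T n
   zr : ∀ r → χ (+ r) ≡ + 0 → χ (+ (6 N.+ r)) ≡ + 0 → ∀ n → χ (+ (6 N.* n N.+ r)) ≡ + 0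
   zr r p p' = χ-6n r (λ _ → + 0) (λ _ → refl) p p'
   k : ℕ → ℕ
   k r = 6 N.* n N.+ r
   s+ : ∀ r → suc (k r) ≡ k (suc r)
   s+ r = sym (NP.+-suc (6 N.* n) r)
   skip : ∀ r → χ (+ (suc r)) ≡ + 0 → χ (+ (6 N.+ suc r)) ≡ + 0 → U χ 1 (k (suc r)) ≋ U χ 1 (k r)
   skip r p p' = tr (≡⇒≋ λ i → cong (λ m → U χ 1 m i) (sym (s+ r))) (U-skip χ 1 (k r) (trans (cong (χ ∘ +_) (s+ r)) (zr (suc r) p p' n)))
   take : ∀ r → (∀ n → χ (+ (6 N.* n N.+ suc r)) ≡ sgn (suc n)) →
      U χ 1 (k (suc r)) ≋ U χ 1 (k r) ⊕ const (sgn (suc n)) · q^ (1 N.* (k (suc r) N.* k (suc r)))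
   take r p = tr (≡⇒≋ λ i → cong (λ m → U χ 1 m i) (sym (s+ r)))
    (U-term χ 1 (k r) (trans (cong (χ ∘ +_) (s+ r)) (p n)) (cong (λ m → 1 N.* (m N.* m)) (s+ r)))
   χ5 : ∀ n → χ (+ (6 N.* n N.+ 5)) ≡ sgn (suc n)
   χ5 = χ-6n 5 (sgn ∘ suc) (λ n → sgn-2 (suc n)) refl refl
   χ7 : ∀ n → χ (+ (6 N.* n N.+ 7)) ≡ sgn (suc n)
   χ7 = χ-6n 7 (sgn ∘ suc) (λ n → sgn-2 (suc n)) refl refl
   step : U χ 1 (6 N.* suc n N.+ 1) ≋ U χ 1 (6 N.* n N.+ 1) ⊕ const (sgn (suc n)) · q^ (1 N.* (k 5 N.* k 5)) ⊕
       const (sgn (suc n)) · q^ (1 N.* (k 7 N.* k 7))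
   step = begin
    U χ 1 (6 N.* suc n N.+ 1) ≈⟨ ≡⇒≋ (λ i → cong (λ m → U χ 1 m i) (ar n)) ⟩
    U χ 1 (k 7) ≈⟨ take 6 χ7 ⟩
    U χ 1 (k 6) ⊕ last ≈⟨ +c (tr (skip 5 refl refl) (take 4 χ5)) rfl ⟩
    U χ 1 (k 4) ⊕ const (sgn (suc n)) · q^ (1 N.* (k 5 N.* k 5)) ⊕ last
     ≈⟨ +c (+c (tr (skip 3 refl refl) (tr (skip 2 refl refl) (skip 1 refl refl))) rfl) rfl ⟩
    U χ 1 (k 1) ⊕ const (sgn (suc n)) · q^ (1 N.* (k 5 N.* k 5)) ⊕ last ∎
    where last : Ser
          last = const (sgn (suc n)) · q^ (1 N.* (k 7 N.* k 7))
          ar : ∀ n → 6 N.* suc n N.+ 1 ≡ 6 N.* n N.+ 7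
          ar = ringN

 opaque

  η : Ser
  η = q^ 1 · sub 23 Eul

  η-def : η ≋ q^ 1 · sub 23 Eul
  η-def = rfl

 -- χ is even and vanishes at 0, so x and -x give the same term: hence the 2. For the coefficient at
 -- N the finite identity for S N suffices.
 θη≋2η : th 1 χ ≋ const (+ 2) · η
 θη≋2η = ≡⇒≋ λ N → begin
  th 1 χ N ≡⟨ th-U 1 χ (λ _ → refl) refl (s≤s z≤n) (NP.≤-trans (NP.m≤n*m N 6) (NP.m≤m+n (6 N.* N) 1)) ⟩
  + 2 * U χ 1 (6 N.* N N.+ 1) N ≡⟨ cong (_*_ (+ 2)) (sym (SMod-0⇒≡ (U-pent N) N)) ⟩
  + 2 * (q^ 1 · sub 23 (S N)) N
   ≡⟨ cong (_*_ (+ 2)) (Agree-· {f = q^ 1} (λ _ _ → refl) (Agree-sub 23 (Agree-sym (S-agree N))) N NP.≤-refl) ⟩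
  + 2 * (q^ 1 · sub 23 Eul) N ≡⟨ cong (_*_ (+ 2)) (sym (SMod-0⇒≡ η-def N)) ⟩
  + 2 * η N ≡⟨ sym (const-·-≡ (+ 2) η N) ⟩
  (const (+ 2) · η) N ∎
  where open ≡-Reasoning

open Pentagonal

-- Gauss' identity and Y as an eta quotient

module GaussIdentity where

 open Z using (_+_; _*_; -_; _-_)

 open E

 -- Shanks' finite form of Gauss' identity ψ(q) E(q) = E(q²)².

 module Gauss where

  -- A n and B n are the partial products of 1 - q^(2i) and of 1 - q^(2i-1) over 1 ≤ i ≤ n, and R n
  -- is the sum of q^(k(k+1)/2) over k < 2n.
  A B R : ℕ → Ser
  A zero    = const (+ 1)
  A (suc n) = A n · (const (+ 1) ⊝ q^ (2 N.* suc n))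
  B zero    = const (+ 1)
  B (suc n) = B n · (const (+ 1) ⊝ q^ (2 N.* n N.+ 1))

  -- H n x is the sum of (A n / A s) B s x^s over s < n, and Ĥ adds the term s = n. For n > 0 and x
  -- = q^(2n+1) the sum agrees with A n below q^(2n+1) and also equals B n R n, which yields Gauss'
  -- identity.
  H Ĥ : ℕ → Ser → Ser
  H zero    x = const (+ 0)
  H (suc n) x = (const (+ 1) ⊝ q^ (2 N.* suc n)) · Ĥ n x
  Ĥ n x = H n x ⊕ B n · x ↑ n

  q q² : Ser
  q = q^ 1
  q² = q^ 2

  q²-↑ : ∀ n x → (q² · x) ↑ n ≋ q^ (2 N.* n) · x ↑ n
  q²-↑ zero    x = sm (*-identityˡ _)
  q²-↑ (suc n) x = begin
   q² · x · (q² · x) ↑ n ≈⟨ *c rfl (q²-↑ n x) ⟩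
   q² · x · (q^ (2 N.* n) · x ↑ n) ≈⟨ solve 4 (λ a x b y → a :* x :* (b :* y) := a :* b :* (x :* y)) rfl q² x (q^ (2 N.* n)) (x ↑ n) ⟩
   q² · q^ (2 N.* n) · x ↑ suc n ≈⟨ *c (tr (q^-+ 2 (2 N.* n)) (q^≡ (sym (NP.*-suc 2 n)))) rfl ⟩
   q^ (2 N.* suc n) · x ↑ suc n ∎
   where open ≈-Reasoning

  -- Relates the sums at x and q² x: the passage from x = q^(2n+1) to q^(2n+3) in the induction of
  -- `H≈BR`.
  shift : ∀ n x → Ĥ n (q² · x) ⊕ x · H n x ≋ Ĥ n x ⊕ x · q · H n (q² · x)
  shift zero    x = solve 2 (λ x q → con (+ 0) :+ con (+ 1) :* con (+ 1) :+ x :* con (+ 0) :=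
                con (+ 0) :+ con (+ 1) :* con (+ 1) :+ x :* q :* con (+ 0)) rfl x q
  shift (suc n) x = begin
   a · (h' ⊕ b · (q² · x) ↑ n) ⊕ b · o · (q² · x) ↑ suc n ⊕ x · (a · (h ⊕ b · xn))
    ≈⟨ +c (+c (*c rfl (+c rfl (*c rfl (q²-↑ n x)))) (*c rfl (*c rfl (q²-↑ n x)))) rfl ⟩
   a · (h' ⊕ b · (q2n · xn)) ⊕ b · o · (q² · x · (q2n · xn)) ⊕ x · (a · (h ⊕ b · xn))
    ≈⟨ solve 9 (λ a h' b q2n xn o q² x h → a :* (h' :+ b :* (q2n :* xn)) :+ b :* o :* (q² :* x :* (q2n :* xn)) :+ x :* (a :* (h :+ b :* xn))
      := a :* ((h' :+ b :* (q2n :* xn)) :+ x :* h) :+ b :* o :* (q² :* x :* (q2n :* xn)) :+ x :* (a :* (b :* xn))) rfl a h' b q2n xn o q² x h ⟩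
   a · ((h' ⊕ b · (q2n · xn)) ⊕ x · h) ⊕ b · o · (q² · x · (q2n · xn)) ⊕ x · (a · (b · xn))
    ≈⟨ +c (+c (*c rfl (tr (+c (+c rfl (*c rfl (sm (q²-↑ n x)))) rfl) (shift n x))) rfl) rfl ⟩
   a · (h ⊕ b · xn ⊕ x · q · h') ⊕ b · o · (q² · x · (q2n · xn)) ⊕ x · (a · (b · xn))
    ≈⟨ +c (+c (*c a≈ rfl) (*c (*c rfl o≈) rfl)) (*c rfl (*c a≈ rfl)) ⟩
   a1 · (h ⊕ b · xn ⊕ x · q · h') ⊕ b · o1 · (q² · x · (q2n · xn)) ⊕ x · (a1 · (b · xn))
    ≈⟨ +c (+c rfl (*c rfl (*c (*c q²≈ rfl) rfl))) rfl ⟩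
   a1 · (h ⊕ b · xn ⊕ x · q · h') ⊕ b · o1 · (q · q · x · (q2n · xn)) ⊕ x · (a1 · (b · xn))
    ≈⟨ solve 7 (λ h b xn x q h' t → let a = con (+ 1) :- q :* q :* t; o = con (+ 1) :- t :* q in
      a :* (h :+ b :* xn :+ x :* q :* h') :+ b :* o :* (q :* q :* x :* (t :* xn)) :+ x :* (a :* (b :* xn))
      := a :* (h :+ b :* xn) :+ b :* o :* (x :* xn) :+ x :* q :* (a :* (h' :+ b :* (t :* xn)))) rfl h b xn x q h' q2n ⟩
   a1 · (h ⊕ b · xn) ⊕ b · o1 · (x · xn) ⊕ x · q · (a1 · (h' ⊕ b · (q2n · xn)))
    ≈⟨ +c (+c (*c (sm a≈) rfl) (*c (*c rfl (sm o≈)) rfl)) (*c rfl (*c (sm a≈)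
      (+c rfl (*c rfl (sm (q²-↑ n x)))))) ⟩
   Ĥ (suc n) x ⊕ x · q · H (suc n) (q² · x) ∎
   where
   open ≈-Reasoning
   a h h' b xn q2n o a1 o1 : Ser
   a = const (+ 1) ⊝ q^ (2 N.* suc n)
   h = H n x
   h' = H n (q² · x)
   b = B n
   xn = x ↑ n
   q2n = q^ (2 N.* n)
   o = const (+ 1) ⊝ q^ (2 N.* n N.+ 1)
   a1 = const (+ 1) ⊝ q · q · q2n
   o1 = const (+ 1) ⊝ q2n · q
   q²≈ : q² ≋ q · q
   q²≈ = sm (q^-+ 1 1)
   a≈ : a ≋ a1
   a≈ = +c rfl (-c (tr (q^≡ (NP.*-suc 2 n)) (tr (sm (q^-+ 2 (2 N.* n))) (*c q²≈ rfl))))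
   o≈ : o ≋ o1
   o≈ = +c rfl (-c (sm (q^-+ (2 N.* n) 1)))

  H-cong : ∀ n {x y} → x ≋ y → H n x ≋ H n y
  H-cong zero    p = rfl
  H-cong (suc n) p = *c rfl (+c (H-cong n p) (*c rfl (↑-cong n p)))

  o : ℕ → ℕ
  o n = 2 N.* n N.+ 1

  R zero    = const (+ 0)
  R (suc n) = R n ⊕ q^ (o n) ↑ n · (const (+ 1) ⊕ q^ (o n))

  H≈BR : ∀ n → H n (q^ (o n)) ≋ B n · R n
  H≈BR zero    = sm (zeroʳ _)
  H≈BR (suc n) = begin
   a · Ĥ n (q^ (o (suc n)))
    ≈⟨ *c rfl (+c (H-cong n x') (*c rfl (↑-cong n x'))) ⟩
   a · Ĥ n (q² · x) ≈⟨ *c (+c rfl (-c (tr (q^≡ (ar n)) (sm (q^-+ 1 (o n)))))) rfl ⟩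
   (const (+ 1) ⊝ q · x) · (H n (q² · x) ⊕ b · (q² · x) ↑ n)
    ≈⟨ solve 5 (λ q x h b y → (con (+ 1) :- q :* x) :* (h :+ b :* y) := (h :+ b :* y :+ x :* con (+ 0)) :- x :* q :* h :- q :* x :* (b :* y))
      rfl q x (H n (q² · x)) b ((q² · x) ↑ n) ⟩
   (Ĥ n (q² · x) ⊕ x · const (+ 0)) ⊝ x · q · H n (q² · x) ⊝ q · x · (b · (q² · x) ↑ n)
    ≈⟨ solve 6 (λ a x h k q z → (a :+ x :* con (+ 0)) :- x :* q :* k :- z := (a :+ x :* h) :- x :* h :- x :* q :* k :- z) rfl
      (Ĥ n (q² · x)) x (H n x) (H n (q² · x)) q (q · x · (b · (q² · x) ↑ n)) ⟩
   (Ĥ n (q² · x) ⊕ x · H n x) ⊝ x · H n x ⊝ x · q · H n (q² · x) ⊝ q · x · (b · (q² · x) ↑ n)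
    ≈⟨ +c (+c (+c (shift n x) rfl) rfl) (-c (*c rfl (*c rfl (q²-↑ n x)))) ⟩
   (Ĥ n x ⊕ x · q · H n (q² · x)) ⊝ x · H n x ⊝ x · q · H n (q² · x) ⊝ q · x · (b · (q^ (2 N.* n) · x ↑ n))
    ≈⟨ solve 7 (λ h b y x q k t → (h :+ b :* y :+ x :* q :* k) :- x :* h :- x :* q :* k :- q :* x :* (b :* (t :* y))
      := (con (+ 1) :- x) :* h :+ b :* y :* (con (+ 1) :- x :* (t :* q))) rfl (H n x) b (x ↑ n) x q (H n (q² · x)) (q^ (2 N.* n)) ⟩
   (const (+ 1) ⊝ x) · H n x ⊕ b · x ↑ n · (const (+ 1) ⊝ x · (q^ (2 N.* n) · q))
    ≈⟨ +c (*c rfl (H≈BR n)) (*c rfl (+c rfl (-c (*c rfl (q^-+ (2 N.* n) 1))))) ⟩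
   (const (+ 1) ⊝ x) · (b · R n) ⊕ b · x ↑ n · (const (+ 1) ⊝ x · x)
    ≈⟨ solve 4 (λ x b r y → (con (+ 1) :- x) :* (b :* r) :+ b :* y :* (con (+ 1) :- x :* x)
      := b :* (con (+ 1) :- x) :* (r :+ y :* (con (+ 1) :+ x))) rfl x b (R n) (x ↑ n) ⟩
   B (suc n) · R (suc n) ∎
   where
   open ≈-Reasoning
   a x b : Ser
   a = const (+ 1) ⊝ q^ (2 N.* suc n)
   x = q^ (o n)
   b = B n
   ar : ∀ n → 2 N.* suc n ≡ 1 N.+ (2 N.* n N.+ 1)
   ar = ringN
   x' : q^ (o (suc n)) ≋ q² · x
   x' = tr (q^≡ (cong (N._+ 1) (NP.*-suc 2 n))) (sm (q^-+ 2 (o n)))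

  H-A : ∀ n x → ∃ λ h → H (suc n) x ≋ A (suc n) ⊕ x · h
  H-A zero x = const (+ 0) , solve 2 (λ a x → a :* (con (+ 0) :+ con (+ 1) :* con (+ 1)) := con (+ 1) :* a :+ x :* con (+ 0)) rfl _ x
  H-A (suc n) x with H-A n x
  ... | h , p = _ , tr (*c rfl (+c p rfl))
   (solve 6 (λ c a x h b y → c :* (a :+ x :* h :+ b :* (x :* y)) := a :* c :+ x :* (c :* (h :+ b :* y))) rfl
    (const (+ 1) ⊝ q^ (2 N.* suc (suc n))) (A (suc n)) x h (B (suc n)) (x ↑ n))

  A-agree : ∀ n → Agree n (A (suc n)) (B (suc n) · R (suc n))
  A-agree n with H-A n (q^ (o (suc n)))
  ... | h , p = Agree-trans (Agree-sym (agree-by-Ord {h = h} (o (suc n)) lt p)) (≋⇒Agree (H≈BR (suc n)))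
   where lt : n N.< o (suc n)
         lt = NP.≤-trans (NP.m≤m+n (suc n) (suc n N.+ 0)) (NP.m≤m+n _ 1)

  eul-AB : ∀ n → eul (2 N.* n) ≋ A n · B n
  eul-AB zero    = sm (*-identityˡ _)
  eul-AB (suc n) = begin
   eul (2 N.* suc n) ≈⟨ eul≡ (NP.*-suc 2 n) ⟩
   eul (2 N.* n) · (const (+ 1) ⊝ q^ (suc (2 N.* n))) · (const (+ 1) ⊝ q^ (2 N.+ 2 N.* n))
    ≈⟨ *c (*c (eul-AB n) (+c rfl (-c (q^≡ (NP.+-comm 1 (2 N.* n)))))) (+c rfl (-c (q^≡ (sym (NP.*-suc 2 n))))) ⟩
   A n · B n · (const (+ 1) ⊝ q^ (o n)) · (const (+ 1) ⊝ q^ (2 N.* suc n))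
    ≈⟨ solve 4 (λ a b x y → a :* b :* x :* y := a :* y :* (b :* x)) rfl (A n) (B n) _ _ ⟩
   A (suc n) · B (suc n) ∎
   where open ≈-Reasoning
         eul≡ : ∀ {i j} → i ≡ j → eul i ≋ eul j
         eul≡ refl = rfl

  A-sub : ∀ n → A n ≋ sub 1 (eul n)
  A-sub zero    = sm (sub-const 1 (+ 1))
  A-sub (suc n) = sm (tr (sub-· 1 _ _) (*c (sm (A-sub n)) (tr (sub-⊝ 1 _ _) (+c (sub-const 1 (+ 1))
   (-c (tr (sub-q^ 1 (suc n)) (q^≡ (NP.*-comm (suc n) 2))))))))

  identity : ∀ n → Agree n (Eul · R (suc n)) (sub 1 Eul · sub 1 Eul)
  identity n = Agree-trans (Agree-· {g = R (suc n)} (Agree-mono n≤ (Agree-trans (Eul-agree (2 N.* suc n)) (≋⇒Agree (eul-AB (suc n))))) (λ _ _ → refl))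
   (Agree-trans (≋⇒Agree (solve 3 (λ a b r → a :* b :* r := a :* (b :* r)) rfl (A (suc n)) (B (suc n)) (R (suc n))))
   (Agree-trans (Agree-· {f = A (suc n)} (λ _ _ → refl) (Agree-sym (A-agree n)))
    (Agree-· Aa Aa)))
   where n≤ : n N.≤ 2 N.* suc n
         n≤ = NP.≤-trans (NP.n≤1+n n) (NP.m≤m+n (suc n) _)
         Aa : Agree n (A (suc n)) (sub 1 Eul)
         Aa = Agree-trans (≋⇒Agree (A-sub (suc n))) (Agree-sub 1 (Agree-mono (NP.n≤1+n n) (Agree-sym (Eul-agree (suc n)))))

 private
  open Gauss using (R; o)

  od-odd : ∀ k → od (+ suc (2 N.* k)) ≡ + 1
  od-odd k = cong (λ z → + 1 - z) (trans (cong ev (trans (ZP.+-comm (+ 1) (+ (2 N.* k))) (cong (_+ + 1) (ZP.pos-* 2 k)))) (ev-odd (+ k)))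

  od-even : ∀ k → od (+ (2 N.* k)) ≡ + 0
  od-even k = cong (λ z → + 1 - z) (trans (cong ev (ZP.pos-* 2 k)) (ev-even (+ k)))

  od-neg : ∀ n → od -[1+ n ] ≡ od (+ suc n)
  od-neg n = cong (λ z → + 1 - z) (h (parity (+ suc n)))
   where
   h : Even (+ suc n) ⊎ Odd' (+ suc n) → ev -[1+ n ] ≡ ev (+ suc n)
   h (inj₁ (k , p)) = trans (trans (cong (ev ∘ -_) p) (trans (cong ev (r k)) (ev-even (- k)))) (sym (trans (cong ev p) (ev-even k)))
    where r : ∀ k → - (+ 2 * k) ≡ + 2 * - k
          r = ring
   h (inj₂ (k , p)) = trans (trans (cong (ev ∘ -_) p) (trans (cong ev (r k)) (ev-odd (- k - + 1)))) (sym (trans (cong ev p) (ev-odd k)))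
    where r : ∀ k → - (+ 2 * k + + 1) ≡ + 2 * (- k - + 1) + + 1
          r = ring

  U≡ : ∀ {i j} → i ≡ j → U od 6 i ≋ U od 6 j
  U≡ refl = rfl

  -- 6 + 48 k(k+1)/2 = 6(2k+1)² turns triangular exponents into those of Y. Each step of R covers
  -- two odd numbers, 4n + 1 and 4n + 3.
  R-U : ∀ n → q^ 6 · sub 47 (R n) ≋ U od 6 (4 N.* n)
  R-U zero = tr (*c rfl (sub-const 47 (+ 0))) (zeroʳ _)
  R-U (suc n) = begin
   q^ 6 · sub 47 (R n ⊕ q^ (o n) ↑ n · (const (+ 1) ⊕ q^ (o n)))
    ≈⟨ *c rfl (sub-cong 47 (+c rfl (tr (distribˡ _ _ _) (+c (tr (*-identityʳ _) pw)
      (tr (*c pw rfl) (q^-+ (n N.* o n) (o n))))))) ⟩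
   q^ 6 · sub 47 (R n ⊕ (q^ (n N.* o n) ⊕ q^ (n N.* o n N.+ o n)))
    ≈⟨ *c rfl (tr (sub-⊕ 47 _ _) (+c rfl (tr (sub-⊕ 47 _ _)
      (+c (sub-q^ 47 (n N.* o n)) (sub-q^ 47 (n N.* o n N.+ o n)))))) ⟩
   q^ 6 · (sub 47 (R n) ⊕ (q^ (n N.* o n N.* 48) ⊕ q^ ((n N.* o n N.+ o n) N.* 48)))
    ≈⟨ solve 4 (λ q r a b → q :* (r :+ (a :+ b)) := q :* r :+ con (+ 1) :* (q :* a) :+ con (+ 1) :* (q :* b)) rfl (q^ 6) (sub 47 (R n)) _ _ ⟩
   q^ 6 · sub 47 (R n) ⊕ const (+ 1) · (q^ 6 · q^ (n N.* o n N.* 48)) ⊕ const (+ 1) · (q^ 6 · q^ ((n N.* o n N.+ o n) N.* 48))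
    ≈⟨ +c (+c (R-U n) (*c rfl (tr (q^-+ 6 _) (q^≡ (x1 n))))) (*c rfl (tr (q^-+ 6 _) (q^≡ (x2 n)))) ⟩
   U od 6 (4 N.* n) ⊕ term (4 N.* n) ⊕ term (2 N.+ 4 N.* n)
    ≈⟨ +c (sm (tr (skip (suc (2 N.* n)) (a2 n)) (take (2 N.* n) (a1 n)))) rfl ⟩
   U od 6 (2 N.+ 4 N.* n) ⊕ term (2 N.+ 4 N.* n)
    ≈⟨ sm (tr (skip (suc (suc (2 N.* n))) (a4 n)) (take (suc (2 N.* n)) (a2 n))) ⟩
   U od 6 (4 N.+ 4 N.* n) ≈⟨ U≡ (sym (NP.*-suc 4 n)) ⟩
   U od 6 (4 N.* suc n) ∎
   where
   open ≈-Reasoning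
   term : ℕ → Ser
   term k = const (+ 1) · q^ (6 N.* (suc k N.* suc k))
   pw : q^ (o n) ↑ n ≋ q^ (n N.* o n)
   pw = go n
    where go : ∀ j → q^ (o n) ↑ j ≋ q^ (j N.* o n)
          go zero    = rfl
          go (suc j) = tr (*c rfl (go j)) (q^-+ (o n) (j N.* o n))
   x1 : ∀ n → 6 N.+ n N.* (2 N.* n N.+ 1) N.* 48 ≡ 6 N.* ((1 N.+ 4 N.* n) N.* (1 N.+ 4 N.* n))
   x1 = ringN
   x2 : ∀ n → 6 N.+ (n N.* (2 N.* n N.+ 1) N.+ (2 N.* n N.+ 1)) N.* 48 ≡ 6 N.* ((3 N.+ 4 N.* n) N.* (3 N.+ 4 N.* n))
   x2 = ringN
   a1 : ∀ n → 4 N.* n ≡ 2 N.* (2 N.* n)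
   a1 = ringN
   a2 : ∀ n → 2 N.+ 4 N.* n ≡ 2 N.* (1 N.+ 2 N.* n)
   a2 = ringN
   a4 : ∀ n → 4 N.+ 4 N.* n ≡ 2 N.* (2 N.+ 2 N.* n)
   a4 = ringN
   take : ∀ j {k} → k ≡ 2 N.* j → U od 6 (suc k) ≋ U od 6 k ⊕ term k
   take j refl = +c rfl (*c (≡⇒≋ λ i → cong (λ c → const c i) (od-odd j)) rfl)
   skip : ∀ j {k} → suc k ≡ 2 N.* j → U od 6 (suc k) ≋ U od 6 k
   skip j {k} p = tr (+c rfl (tr (*c (≡⇒≋ λ i → cong (λ c → const c i) (trans (cong (od ∘ +_) p) (od-even j))) rfl)
    (zeroˡ _))) (tr (solve 1 (λ u → u :+ con (+ 0) := u) rfl (U od 6 k)) rfl)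

 η2 η4 : Ser
 η2 = sub 1 η
 η4 = sub 1 η2

 private
  η2≈ : η2 ≋ q^ 2 · sub 47 Eul
  η2≈ = tr (sub-cong 1 η-def) (tr (sub-· 1 _ _) (*c (sub-q^ 1 1) (sub-sub 1 23 47 refl Eul)))

  η4≈ : η4 ≋ q^ 4 · sub 47 (sub 1 Eul)
  η4≈ = tr (sub-cong 1 η2≈) (tr (sub-· 1 _ _) (*c (sub-q^ 1 2)
   (tr (sub-sub 1 47 95 refl Eul) (sm (sub-sub 47 1 95 refl Eul)))))

 -- 2 η(q⁴)² = Y(q) η(q²)
 Y-η : Y · η2 ≋ const (+ 2) · (η4 · η4)
 Y-η = ≡⇒≋ λ N → begin
  (Y · η2) N ≡⟨ Agree-· {g = η2} (Y-agree N) (≋⇒Agree η2≈) N NP.≤-refl ⟩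
  (const (+ 2) · (q^ 6 · sub 47 (R (suc N))) · (q^ 2 · sub 47 Eul)) N
   ≡⟨ SMod-0⇒≡ (tr (solve 5 (λ t a r b u → t :* (a :* r) :* (b :* u) := t :* (a :* b :* (u :* r))) rfl
     (const (+ 2)) (q^ 6) (sub 47 (R (suc N))) (q^ 2) (sub 47 Eul))
     (*c rfl (*c (q^-+ 6 2) (sm (sub-· 47 Eul (R (suc N))))))) N ⟩
  (const (+ 2) · (q^ 8 · sub 47 (Eul · R (suc N)))) N
   ≡⟨ Agree-· {f = const (+ 2)} (λ _ _ → refl) (Agree-· {f = q^ 8} (λ _ _ → refl) (Agree-sub 47 (Gauss.identity N))) N NP.≤-refl ⟩
  (const (+ 2) · (q^ 8 · sub 47 (sub 1 Eul · sub 1 Eul))) N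
   ≡⟨ SMod-0⇒≡ (*c rfl (tr (*c (sm (q^-+ 4 4)) (sub-· 47 _ _))
     (tr (solve 2 (λ a b → a :* a :* (b :* b) := a :* b :* (a :* b)) rfl (q^ 4) (sub 47 (sub 1 Eul)))
      (*c (sm η4≈) (sm η4≈))))) N ⟩
  (const (+ 2) · (η4 · η4)) N ∎
  where
  open ≡-Reasoning
  Y-agree : ∀ N → Agree N Y (const (+ 2) · (q^ 6 · sub 47 (R (suc N))))
  Y-agree N i i≤N = trans (Y-th i) (trans (th-U 6 od od-neg refl (s≤s z≤n) (NP.≤-trans i≤N (NP.≤-trans (NP.n≤1+n N) (NP.m≤n*m (suc N) 4))))
   (trans (cong (_*_ (+ 2)) (sym (SMod-0⇒≡ (R-U (suc N)) i))) (sym (const-·-≡ (+ 2) _ i))))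

open GaussIdentity using (η2; η4; Y-η)

-- The logarithmic derivative of η, and the discriminant as η^24

module EtaDerivative where

 open Z using (_+_; _*_; -_; _-_)

 open E

 leading-↑ : ∀ k n {f} → Ord (+ 0) k f → (f ↑ n) (n N.* k) ≡ f k Z.^ n
 leading-↑ k zero    o = refl
 leading-↑ k (suc n) {f} o = trans (Mod-0⇒≡ (leading-· k (n N.* k) o (Ord-↑ k n o))) (cong (_*_ (f k)) (leading-↑ k n o))

 Êul : Ser
 Êul = sub 23 Eul

 Êul-0 : Êul 0 ≡ + 1
 Êul-0 = refl

 Ord-η : Ord (+ 0) 1 η
 Ord-η = Ord-⇐ 1 η-def

 η-1 : η 1 ≡ + 1
 η-1 = trans (SMod-0⇒≡ η-def 1) (trans (SMod-0⇒≡ (q^-· {+ 0} 1 Êul) 1) refl)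

 -- The logarithmic derivative of η.
 private
  ε : Ser
  ε = const (+ 1) ⊕ D Êul · inv Êul

  D-η' : D η ≋ ε · η
  D-η' = begin
   D η ≈⟨ tr (D-cong η-def) (D-· (q^ 1) Êul) ⟩
   D (q^ 1) · Êul ⊕ q^ 1 · D Êul ≈⟨ +c (*c (D-q^ 1) rfl) (*c rfl (sm (*-identityʳ (D Êul)))) ⟩
   const (+ 1) · q^ 1 · Êul ⊕ q^ 1 · (D Êul · const (+ 1))
    ≈⟨ +c rfl (*c rfl (*c rfl (sm (inv-· Êul Êul-0)))) ⟩
   const (+ 1) · q^ 1 · Êul ⊕ q^ 1 · (D Êul · (Êul · inv Êul))
    ≈⟨ solve 4 (λ q e d i → con (+ 1) :* q :* e :+ q :* (d :* (e :* i)) := (con (+ 1) :+ d :* i) :* (q :* e)) rfl (q^ 1) Êul (D Êul) (inv Êul) ⟩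
   ε · (q^ 1 · Êul) ≈⟨ *c rfl (sm η-def) ⟩
   ε · η ∎
   where open ≈-Reasoning

  ε2 ε4 e4 X4 Y4 : Ser
  ε2 = sub 1 ε
  ε4 = sub 1 ε2
  e4 = sub 1 e2'
  X4 = sub 1 X2
  Y4 = sub 1 Y2

  D-η2 : D η2 ≋ const (+ 2) · (ε2 · η2)
  D-η2 = tr (D-sub 1 η) (*c rfl (tr (sub-cong 1 D-η') (sub-· 1 ε η)))

  D-η4 : D η4 ≋ const (+ 4) · (ε4 · η4)
  D-η4 = tr (D-sub 1 η2) (tr (*c rfl (tr (sub-cong 1 D-η2) (tr (sub-· 1 _ _)
   (*c (sub-const 1 (+ 2)) (sub-· 1 ε2 η2)))))
   (solve 1 (λ a → con (+ 2) :* (con (+ 2) :* a) := con (+ 4) :* a) rfl (ε4 · η4)))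

  logY : Ser
  logY = e ⊕ const (+ 5) · X ↑ 4 ⊝ Y ↑ 4

  D-Y-η : logY · (η4 · η4) ≋ (const (+ 8) · ε4 ⊝ const (+ 2) · ε2) · (η4 · η4)
  D-Y-η = const-cancel (+ 2) (λ ()) (begin
   const (+ 2) · (logY · (η4 · η4)) ≈⟨ solve 2 (λ l x → con (+ 2) :* (l :* x) := l :* (con (+ 2) :* x)) rfl logY (η4 · η4) ⟩
   logY · (const (+ 2) · (η4 · η4)) ≈⟨ *c rfl (sm Y-η) ⟩
   logY · (Y · η2)
    ≈⟨ solve 5 (λ e x y h d → (e :+ con (+ 5) :* x :- y :^ 4) :* (y :* h) := ((e :* y :+ con (+ 5) :* (x :* y) :- y :^ 5) :* h :+ y :* d) :- y :* d)
      rfl e (X ↑ 4) Y η2 (const (+ 2) · (ε2 · η2)) ⟩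
   ((e · Y ⊕ const (+ 5) · (X ↑ 4 · Y) ⊝ Y ↑ 5) · η2 ⊕ Y · (const (+ 2) · (ε2 · η2))) ⊝ Y · (const (+ 2) · (ε2 · η2))
    ≈⟨ +c (+c (*c (sm D-Y) rfl) (*c rfl (sm D-η2))) rfl ⟩
   (Y' · η2 ⊕ Y · D η2) ⊝ Y · (const (+ 2) · (ε2 · η2))
    ≈⟨ +c (sm (D-· Y η2)) (-c (solve 3 (λ y a h → y :* (con (+ 2) :* (a :* h)) := con (+ 2) :* a :* (y :* h)) rfl Y ε2 η2)) ⟩
   D (Y · η2) ⊝ const (+ 2) · ε2 · (Y · η2)
    ≈⟨ +c (tr (D-cong Y-η) (tr (D-const-· (+ 2) _) (*c rfl (tr (D-· η4 η4)
      (+c (*c D-η4 rfl) (*c rfl D-η4)))))) (-c (*c rfl Y-η)) ⟩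
   const (+ 2) · (const (+ 4) · (ε4 · η4) · η4 ⊕ η4 · (const (+ 4) · (ε4 · η4))) ⊝ const (+ 2) · ε2 · (const (+ 2) · (η4 · η4))
    ≈⟨ solve 3 (λ a b h → con (+ 2) :* (con (+ 4) :* (a :* h) :* h :+ h :* (con (+ 4) :* (a :* h))) :- con (+ 2) :* b :* (con (+ 2) :* (h :* h))
      := con (+ 2) :* ((con (+ 8) :* a :- con (+ 2) :* b) :* (h :* h))) rfl ε4 ε2 η4 ⟩
   const (+ 2) · ((const (+ 8) · ε4 ⊝ const (+ 2) · ε2) · (η4 · η4)) ∎)
   where open ≈-Reasoning

  Êul4 : Ser
  Êul4 = sub 1 (sub 1 Êul)

  η4≈ : η4 ≋ q^ 4 · Êul4
  η4≈ = tr (sub-cong 1 (tr (sub-cong 1 η-def) (tr (sub-· 1 _ _) (*c (sub-q^ 1 1) rfl))))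
   (tr (sub-· 1 _ _) (*c (sub-q^ 1 2) rfl))

  η4²-cancel : ∀ {f g} → f · (η4 · η4) ≋ g · (η4 · η4) → f ≋ g
  η4²-cancel {f} {g} p = unit1-cancel (Êul4 · Êul4) (trans (·-at-0 Êul4 Êul4) refl) (q^-cancel 8 (begin
   q^ 8 · (Êul4 · Êul4 · f) ≈⟨ h f ⟩
   f · (η4 · η4) ≈⟨ p ⟩
   g · (η4 · η4) ≈⟨ sm (h g) ⟩
   q^ 8 · (Êul4 · Êul4 · g) ∎))
   where
   open ≈-Reasoning
   h : ∀ f → q^ 8 · (Êul4 · Êul4 · f) ≋ f · (η4 · η4)
   h f = tr (*c (sm (q^-+ 4 4)) rfl) (tr (solve 3 (λ q u f → q :* q :* (u :* u :* f) := f :* ((q :* u) :* (q :* u))) rfl (q^ 4) Êul4 f)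
    (*c rfl (*c (sm η4≈) (sm η4≈))))

  -- Duplication, used twice, expresses the logarithmic derivative of Y by e at q² and q⁴ alone, in
  -- the shape that `D-Y-η` gives for ε.
  logY-e : logY ≋ const (+ 8) · e4 ⊝ const (+ 2) · e2'
  logY-e = begin
   e ⊕ const (+ 5) · X ↑ 4 ⊝ Y ↑ 4
    ≈⟨ tr (+c (+c e-duplication (*c rfl (pow4 X))) (-c (pow4 Y)))
      (+c (+c rfl (*c rfl (*c X-duplication X-duplication))) (-c (*c Y-duplication Y-duplication))) ⟩
   const (+ 2) · e2' ⊝ (X2 ↑ 4 ⊕ const (+ 6) · (X2 ↑ 2 · Y2 ↑ 2) ⊕ Y2 ↑ 4) ⊕
    const (+ 5) · ((X2 · X2 ⊕ Y2 · Y2) · (X2 · X2 ⊕ Y2 · Y2)) ⊝ const (+ 2) · (X2 · Y2) · (const (+ 2) · (X2 · Y2))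
    ≈⟨ solve 3 (λ x y e → con (+ 2) :* e :- (x :^ 4 :+ con (+ 6) :* (x :^ 2 :* y :^ 2) :+ y :^ 4) :+
      con (+ 5) :* ((x :* x :+ y :* y) :* (x :* x :+ y :* y)) :- con (+ 2) :* (x :* y) :* (con (+ 2) :* (x :* y))
     := con (+ 2) :* e :+ con (+ 4) :* (x :* x :* (x :* x) :+ y :* y :* (y :* y))) rfl X2 Y2 e2' ⟩
   const (+ 2) · e2' ⊕ const (+ 4) · (X2 · X2 · (X2 · X2) ⊕ Y2 · Y2 · (Y2 · Y2))
    ≈⟨ +c rfl (*c rfl (+c (*c X2d X2d) (*c Y2d Y2d))) ⟩
   const (+ 2) · e2' ⊕ const (+ 4) · ((X4 · X4 ⊕ Y4 · Y4) · (X4 · X4 ⊕ Y4 · Y4) ⊕ const (+ 2) · (X4 · Y4) · (const (+ 2) · (X4 · Y4)))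
    ≈⟨ solve 3 (λ x y f → con (+ 2) :* f :+ con (+ 4) :* ((x :* x :+ y :* y) :* (x :* x :+ y :* y) :+ con (+ 2) :* (x :* y) :* (con (+ 2) :* (x :* y)))
     := con (+ 4) :* (f :+ (x :^ 4 :+ con (+ 6) :* (x :^ 2 :* y :^ 2) :+ y :^ 4)) :- con (+ 2) :* f) rfl X4 Y4 e2' ⟩
   const (+ 4) · (e2' ⊕ P4) ⊝ const (+ 2) · e2'
    ≈⟨ +c (*c rfl (+c e2d rfl)) rfl ⟩
   const (+ 4) · (const (+ 2) · e4 ⊝ P4 ⊕ P4) ⊝ const (+ 2) · e2'
    ≈⟨ solve 3 (λ a p f → con (+ 4) :* (con (+ 2) :* a :- p :+ p) :- con (+ 2) :* f := con (+ 8) :* a :- con (+ 2) :* f) rfl e4 P4 e2' ⟩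
   const (+ 8) · e4 ⊝ const (+ 2) · e2' ∎
   where
   open ≈-Reasoning
   P4 : Ser
   P4 = X4 ↑ 4 ⊕ const (+ 6) · (X4 ↑ 2 · Y4 ↑ 2) ⊕ Y4 ↑ 4
   pow4 : ∀ f → f ↑ 4 ≋ f · f · (f · f)
   pow4 = solve 1 (λ f → f :^ 4 := f :* f :* (f :* f)) rfl
   X2d : X2 · X2 ≋ X4 · X4 ⊕ Y4 · Y4
   X2d = tr (sm (sub-· 1 X X)) (tr (sub-cong 1 X-duplication) (tr (sub-⊕ 1 _ _) (+c (sub-· 1 _ _) (sub-· 1 _ _))))
   Y2d : Y2 · Y2 ≋ const (+ 2) · (X4 · Y4)
   Y2d = tr (sm (sub-· 1 Y Y)) (tr (sub-cong 1 Y-duplication) (tr (sub-· 1 _ _) (*c (sub-const 1 (+ 2)) (sub-· 1 _ _))))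
   e2d : e2' ≋ const (+ 2) · e4 ⊝ P4
   e2d = tr (sub-cong 1 e-duplication) (tr (sub-⊝ 1 _ _) (+c (tr (sub-· 1 _ _) (*c (sub-const 1 (+ 2)) rfl))
    (-c (tr (sub-⊕ 1 _ _) (+c (tr (sub-⊕ 1 _ _) (+c (sub-↑ 1 X2 4) (tr (sub-· 1 _ _) (*c (sub-const 1 (+ 6))
     (tr (sub-· 1 _ _) (*c (sub-↑ 1 X2 2) (sub-↑ 1 Y2 2))))))) (sub-↑ 1 Y2 4))))))

  sub-inj : ∀ {f g} → sub 1 f ≋ sub 1 g → f ≋ g
  sub-inj {f} {g} p = ≡⇒≋ λ n → trans (sym (sub-at 1 f n)) (trans (SMod-0⇒≡ p (n N.* 2)) (sub-at 1 g n))

 -- For f = ε and for f = e, the series 8 f(q⁴) - 2 f(q²) is the logarithmic derivative of Y. So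
 -- f(q²) = 4 f(q⁴) holds for the difference, which is zero by `sub-≋4-⇒0`.
 ε≋e : ε ≋ e
 ε≋e = ⊝-0⇒≋ (sub-≋4-⇒0 (+ 4) (λ ()) (sub-inj (const-cancel (+ 2) (λ ()) (begin
  const (+ 2) · sub 1 (ε ⊝ e) ≈⟨ *c rfl (sub-⊝ 1 ε e) ⟩
  const (+ 2) · (ε2 ⊝ e2')
   ≈⟨ solve 4 (λ a b c d → con (+ 2) :* (a :- b) := (con (+ 8) :* c :- con (+ 2) :* b) :- (con (+ 8) :* c :- con (+ 2) :* a)) rfl ε2 e2' ε4 e4 ⟩
  (const (+ 8) · ε4 ⊝ const (+ 2) · e2') ⊝ (const (+ 8) · ε4 ⊝ const (+ 2) · ε2)
   ≈⟨ +c rfl (-c (tr (sm (η4²-cancel D-Y-η)) logY-e)) ⟩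
  (const (+ 8) · ε4 ⊝ const (+ 2) · e2') ⊝ (const (+ 8) · e4 ⊝ const (+ 2) · e2')
   ≈⟨ solve 3 (λ a b c → (con (+ 8) :* a :- con (+ 2) :* c) :- (con (+ 8) :* b :- con (+ 2) :* c) := con (+ 2) :* (con (+ 4) :* (a :- b))) rfl ε4 e4 e2' ⟩
  const (+ 2) · (const (+ 4) · (ε4 ⊝ e4))
   ≈⟨ *c rfl (*c rfl (sm (tr (sub-cong 1 (sub-⊝ 1 ε e)) (sub-⊝ 1 ε2 e2')))) ⟩
  const (+ 2) · (const (+ 4) · sub 1 (sub 1 (ε ⊝ e)))
   ≈⟨ *c rfl (tr (*c (sm (sub-const 1 (+ 4))) rfl) (sm (sub-· 1 _ _))) ⟩
  const (+ 2) · sub 1 (const (+ 4) · sub 1 (ε ⊝ e)) ∎))))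
  where open ≈-Reasoning

 D-η : D η ≋ e · η
 D-η = tr D-η' (*c ε≋e rfl)

 D-Êul : D Êul ≋ (e ⊝ const (+ 1)) · Êul
 D-Êul = begin
  D Êul ≈⟨ sm (*-identityʳ _) ⟩
  D Êul · const (+ 1) ≈⟨ *c rfl (sm (inv-· Êul Êul-0)) ⟩
  D Êul · (Êul · inv Êul) ≈⟨ solve 3 (λ d u i → d :* (u :* i) := (con (+ 1) :+ d :* i :- con (+ 1)) :* u) rfl (D Êul) Êul (inv Êul) ⟩
  (ε ⊝ const (+ 1)) · Êul ≈⟨ *c (+c ε≋e rfl) rfl ⟩
  (e ⊝ const (+ 1)) · Êul ∎
  where open ≈-Reasoning

 -- The lowest coefficient of a solution u of D u = c u, sitting at n, satisfies n u_n = c_0 u_n,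
 -- and g shows c_0 = k. Hence f - f_k g, which has order above k, is zero.
 D-unique : ∀ k c {f g} → D f ≋ c · f → D g ≋ c · g → Ord (+ 0) k f → Ord (+ 0) k g → g k ≡ + 1 → f ≋ const (f k) · g
 D-unique k c {f} {g} Df Dg of og gk = ⊝-0⇒≋ (all-Ord⇒0 all)
  where
  open ≈-Reasoning
  h : Ser
  h = f ⊝ const (f k) · g
  Dh : D h ≋ c · h
  Dh = begin
   D h ≈⟨ D-⊝ f _ ⟩
   D f ⊝ D (const (f k) · g) ≈⟨ +c Df (-c (tr (D-const-· (f k) g) (*c rfl Dg))) ⟩
   c · f ⊝ const (f k) · (c · g) ≈⟨ solve 4 (λ c f a g → c :* f :- a :* (c :* g) := c :* (f :- a :* g)) rfl c f (const (f k)) g ⟩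
   c · h ∎
  lead : ∀ n {u} → D u ≋ c · u → Ord (+ 0) n u → + n * u n ≡ c 0 * u n
  lead n Du o = trans (SMod-0⇒≡ Du n) (Mod-0⇒≡ (leading-· 0 n {c} Ord-0 o))
  c0 : c 0 ≡ + k
  c0 = sym (trans (sym (ZP.*-identityʳ (+ k))) (trans (cong (_*_ (+ k)) (sym gk)) (trans (lead k Dg og) (trans (cong (_*_ (c 0)) gk) (ZP.*-identityʳ (c 0))))))
  h-k : h k ≡ + 0
  h-k = trans (⊕-at f _ k) (trans (cong (_+_ (f k)) (trans (⊖-at _ k) (cong -_ (trans (const-·-≡ (f k) g k) (trans (cong (_*_ (f k)) gk) (ZP.*-identityʳ (f k)))))))
   (ZP.+-inverseʳ (f k)))
  base : Ord (+ 0) k h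
  base = Ord-⊕ k of (Ord-⊖ k (Ord-·ˡ k og))
  all' : ∀ j → Ord (+ 0) (suc k N.+ j) h
  all' zero    = subst (λ n → Ord (+ 0) n h) (sym (NP.+-identityʳ (suc k))) (Ord-suc k base (≡⇒Mod h-k))
  all' (suc j) = subst (λ n → Ord (+ 0) n h) (sym (NP.+-suc (suc k) j)) (Ord-suc n (all' j) (≡⇒Mod (*-cancel-0 (+ n - + k) nz
    (trans (r (+ n) (+ k) (h n)) (ZP.i≡j⇒i-j≡0 (trans (lead n Dh (all' j)) (cong (_* h n) c0)))))))
   where n : ℕ
         n = suc k N.+ j
         r : ∀ a b x → (a - b) * x ≡ a * x - b * x
         r = ring
         nz : + n - + k ≢ + 0
         nz p = NP.<-irrefl (sym (ZP.+-injective (ZP.i-j≡0⇒i≡j (+ n) (+ k) p))) (s≤s (NP.m≤m+n k j))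
  all : ∀ n → Ord (+ 0) n h
  all n = Ord-weaken (NP.≤-trans (NP.m≤n+m n k) (NP.n≤1+n _)) (all' n)

 D-η↑ : ∀ n → D (η ↑ n) ≋ const (+ n) · e · η ↑ n
 D-η↑ zero    = tr (D-const (+ 1)) (solve 1 (λ e → con (+ 0) := con (+ 0) :* e :* con (+ 1)) rfl e)
 D-η↑ (suc n) = tr (D-↑ η n) (tr (*c rfl D-η)
  (solve 4 (λ c p e h → c :* p :* (e :* h) := c :* e :* (h :* p)) rfl (const (+ suc n)) (η ↑ n) e η))

 Δ'≋η²⁴ : Δ' ≋ const (+ 1728) · η ↑ 24
 Δ'≋η²⁴ = tr (D-unique 24 (const (+ 24) · e) {Δ'} {η ↑ 24} (tr D-Δ' (sm (*-assoc _ _ _))) (D-η↑ 24) Ord-Δ'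
   (Ord-↑ 1 24 Ord-η) (trans (leading-↑ 1 24 Ord-η) (trans (cong (Z._^ 24) η-1) refl)))
  (*c (≡⇒≋ λ i → cong (λ c → const c i) Δ'-24) rfl)

open EtaDerivative

-- Generating functions of partitions and multipartitions

module Partitions where

 open Z using (_+_; _*_; -_; _-_)

 open E

 sumTo-shift : ∀ n (f : ℕ → ℕ) → sumTo (suc n) f ≡ f 0 N.+ sumTo n (f ∘ suc)
 sumTo-shift zero    f = refl
 sumTo-shift (suc n) f = trans (cong (N._+ f (suc (suc n))) (sumTo-shift n f)) (NP.+-assoc (f 0) _ _)

 PL : ℕ → Ser
 PL k n = + partsLe n k

 private
  -- The summand is local to the definition of `partsLe`; it is named through an existential whose
  -- witness unification finds.
  summands : ∀ n k → ∃ λ f → partsLe (suc n) (suc k) ≡ sumTo (suc n) f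
  summands n k = _ , refl

  summand : ∀ n k j → + proj₁ (summands n k) j ≡ sh (j N.* suc k) (PL k) (suc n)
  summand n k j with j N.* suc k N.≤? suc n
  ... | yes p = sym (trans (cong (sh (j N.* suc k) (PL k)) (sym (NP.m+[n∸m]≡n p))) (sh-at (j N.* suc k) (PL k) _))
  ... | no ¬p = sym (sh-below (j N.* suc k) (PL k) (suc n) (NP.≰⇒> ¬p))

  opaque
   unfolding _⊕_

   geom-sumTo : ∀ k N n (f : ℕ → ℕ) → (∀ j → + f j ≡ sh (j N.* suc k) (PL k) N) →
         + sumTo n f ≡ (geom (q^ (suc k)) n · PL k) N
   geom-sumTo k N n f p = trans (go n) (SMod-0⇒≡ (*c (geom-Σ n) rfl) N)
    where
    Σq : ℕ → Ser
    Σq zero    = q^ 0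
    Σq (suc n) = Σq n ⊕ q^ (suc n N.* suc k)
    u-Σq : ∀ n → q^ 0 ⊕ q^ (suc k) · Σq n ≋ Σq (suc n)
    u-Σq zero    = E.+c (E.rfl {q^ 0}) (q^-+ (suc k) 0)
    u-Σq (suc n) = tr (solve 4 (λ o q s t → o :+ q :* (s :+ t) := (o :+ q :* s) :+ q :* t) rfl (q^ 0) (q^ (suc k)) (Σq n) (q^ (suc n N.* suc k)))
     (E.+c {x = q^ 0 ⊕ q^ (suc k) · Σq n} {u = q^ (suc k) · q^ (suc n N.* suc k)} (u-Σq n) (q^-+ (suc k) (suc n N.* suc k)))
    geom-Σ : ∀ n → Σq n ≋ geom (q^ (suc k)) n
    geom-Σ zero    = rfl
    geom-Σ (suc n) = tr (sm (u-Σq n)) (E.+c (E.rfl {q^ 0}) (*c rfl (geom-Σ n)))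
    go : ∀ n → + sumTo n f ≡ (Σq n · PL k) N
    go zero    = trans (p 0) (sym (SMod-0⇒≡ (q^-· {+ 0} 0 (PL k)) N))
    go (suc n) = trans (cong₂ _+_ (go n) (trans (p (suc n)) (sym (SMod-0⇒≡ (q^-· {+ 0} (suc n N.* suc k) (PL k)) N))))
     (sym (SMod-0⇒≡ (distribʳ (PL k) (Σq n) (q^ (suc n N.* suc k))) N))

  geom-tail : ∀ k N j → (geom (q^ (suc k)) (j N.+ N) · PL k) N ≡ (geom (q^ (suc k)) N · PL k) N
  geom-tail k N zero    = refl
  geom-tail k N (suc j) = trans (·-cong-≡ {geom (q^ (suc k)) (suc (j N.+ N))} {geom (q^ (suc k)) (j N.+ N)} N
   (λ i i≤N → sym (agree-by-Ord {f = geom u (j N.+ N)} {g = geom u (suc (j N.+ N))} {h = const (- + 1)} (suc (j N.+ N) N.* suc k) (lt i i≤N) (step (j N.+ N)) i NP.≤-refl))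
   (λ _ _ → refl)) (geom-tail k N j)
   where
   u : Ser
   u = q^ (suc k)
   lt : ∀ i → i N.≤ N → i N.< suc (j N.+ N) N.* suc k
   lt i i≤N = NP.<-≤-trans (s≤s (NP.≤-trans i≤N (NP.m≤n+m N j))) (NP.m≤m*n (suc (j N.+ N)) (suc k))
   step : ∀ n → geom u n ≋ geom u (suc n) ⊕ q^ (suc n N.* suc k) · const (- + 1)
   step zero    = tr (solve 1 (λ q → con (+ 1) := con (+ 1) :+ q :* con (+ 1) :+ q :* con (- + 1)) rfl u)
    (+c rfl (*c (q^≡ (sym (NP.+-identityʳ (suc k)))) rfl))
   step (suc n) = tr (+c rfl (*c rfl (step n))) (tr
    (solve 3 (λ q g t → con (+ 1) :+ q :* (g :+ t :* con (- + 1)) := con (+ 1) :+ q :* g :+ q :* t :* con (- + 1)) rfl u (geom u (suc n)) (q^ (suc n N.* suc k)))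
    (+c rfl (*c (q^-+ (suc k) (suc n N.* suc k)) rfl)))

 PL-geom : ∀ k N → PL (suc k) N ≡ (geom (q^ (suc k)) N · PL k) N
 PL-geom k zero    = trans (sym (ZP.*-identityˡ (PL k 0))) (sym (·-at-0 (const (+ 1)) (PL k)))
 PL-geom k (suc n) = geom-sumTo k (suc n) (suc n) (proj₁ (summands n k)) (summand n k)

 -- The sum over the multiplicity of the part k + 1 is a geometric series; cutting it off at N is
 -- invisible in the coefficients up to N.
 PL-suc : ∀ k → (const (+ 1) ⊝ q^ (suc k)) · PL (suc k) ≋ PL k
 PL-suc k = ≡⇒≋ λ N → begin
  ((const (+ 1) ⊝ u) · PL (suc k)) N
   ≡⟨ ·-cong-≡ {const (+ 1) ⊝ u} N (λ _ _ → refl) (λ i i≤N → trans (PL-geom k i)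
     (sym (trans (cong (λ m → (geom u m · PL k) i) (sym (NP.m∸n+n≡m i≤N))) (geom-tail k i (N N.∸ i))))) ⟩
  ((const (+ 1) ⊝ u) · (geom u N · PL k)) N
   ≡⟨ SMod-0⇒≡ (tr (sm (*-assoc _ _ _)) (tr (*c (geom-telescope u N) rfl)
     (tr (solve 2 (λ p t → (con (+ 1) :- t) :* p := p :+ t :* (:- p)) rfl (PL k) (u ↑ suc N)) (+c rfl (*c (pw (suc N)) rfl))))) N ⟩
  (PL k ⊕ q^ (suc N N.* suc k) · (⊖ PL k)) N
   ≡⟨ agree-by-Ord {h = ⊖ PL k} (suc N N.* suc k) (NP.<-≤-trans NP.≤-refl (NP.m≤m*n (suc N) (suc k))) rfl N NP.≤-refl ⟩
  PL k N ∎
  where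
  open ≡-Reasoning
  u : Ser
  u = q^ (suc k)
  pw : ∀ n → u ↑ n ≋ q^ (n N.* suc k)
  pw zero    = rfl
  pw (suc n) = tr (*c rfl (pw n)) (q^-+ (suc k) (n N.* suc k))

 PL-eul : ∀ k → PL k · eul k ≋ const (+ 1)
 PL-eul zero    = tr (*-identityʳ _) (≡⇒≋ λ { zero → refl ; (suc n) → refl })
 PL-eul (suc k) = tr (solve 3 (λ p e a → p :* (e :* a) := a :* p :* e) rfl (PL (suc k)) (eul k) (const (+ 1) ⊝ q^ (suc k)))
  (tr (*c (PL-suc k) rfl) (PL-eul k))

 P : Ser
 P n = + partitions n

 PL-agree : ∀ n j → Agree n (PL (j N.+ n)) (PL n)
 PL-agree n zero    = λ _ _ → refl
 PL-agree n (suc j) = Agree-trans (agree-by-Ord {h = PL (suc (j N.+ n))} (suc (j N.+ n)) (s≤s (NP.m≤n+m n j))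
  (tr (solve 2 (λ p q → p := (con (+ 1) :- q) :* p :+ q :* p) rfl (PL (suc (j N.+ n))) (q^ (suc (j N.+ n))))
   (+c (PL-suc (j N.+ n)) rfl))) (PL-agree n j)

 P-Eul : P · Eul ≋ const (+ 1)
 P-Eul = ≡⇒≋ λ N → trans (Agree-· {f = P} {f' = PL N} (P-agree N) (Eul-agree N) N NP.≤-refl) (SMod-0⇒≡ (PL-eul N) N)
  where P-agree : ∀ N → Agree N P (PL N)
        P-agree N i i≤N = sym (trans (cong (λ k → PL k i) (sym (NP.m∸n+n≡m i≤N))) (PL-agree i (N N.∸ i) i NP.≤-refl))

 opaque
  unfolding _·_

  ·-sumTo : ∀ (f g : ℕ → ℕ) n → ((λ i → + f i) · (λ i → + g i)) n ≡ + sumTo n (λ a → f a N.* g (n N.∸ a))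
  ·-sumTo f g zero    = sym (ZP.pos-* (f 0) (g 0))
  ·-sumTo f g (suc n) = trans (cong₂ _+_ (sym (ZP.pos-* (f 0) (g (suc n)))) (·-sumTo (f ∘ suc) g n))
   (cong +_ (sym (sumTo-shift n (λ a → f a N.* g (suc n N.∸ a)))))

 multipartitions-gf : ∀ r → (λ n → + multipartitions r n) ≋ P ↑ r
 multipartitions-gf zero    = ≡⇒≋ λ { zero → refl ; (suc n) → refl }
 multipartitions-gf (suc r) = tr (≡⇒≋ λ n → sym (·-sumTo partitions (multipartitions r) n)) (*c rfl (multipartitions-gf r))

 -- q^r η^(-r)
 π̂ : ℕ → Ser
 π̂ r n = + pr24 r n

 π̂-gf : ∀ r → π̂ r ≋ sub 23 P ↑ r
 π̂-gf r = tr (sm (≡⇒≋ (sub-≡ 23 (λ n → + multipartitions r n) (π̂ r) on off)))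
   (tr (sub-cong 23 (multipartitions-gf r)) (sub-↑ 23 P r))
  where
  on : ∀ k → + multipartitions r k ≡ π̂ r (k N.* 24)
  on k with 24 ND.∣? k N.* 24
  ... | yes _ = cong (+_ ∘ multipartitions r) (sym (NM.m*n/n≡m k 24))
  ... | no ¬p = ⊥-elim (¬p (ND.divides k refl))
  off : ∀ n → ¬ (∃ λ k → n ≡ k N.* 24) → + 0 ≡ π̂ r n
  off n p with 24 ND.∣? n
  ... | yes (ND.divides k q) = ⊥-elim (p (k , q))
  ... | no _ = refl

 π̂-Êul : ∀ r → π̂ r · sub 23 Eul ↑ r ≋ const (+ 1)
 π̂-Êul r = tr (*c (π̂-gf r) rfl) (tr (sm (·-↑ (sub 23 P) (sub 23 Eul) r))
  (tr (↑-cong r (tr (sm (sub-· 23 P Eul)) (tr (sub-cong 23 P-Eul) (sub-const 23 (+ 1))))) (1-↑ r)))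

open Partitions using (π̂; π̂-Êul)

-- Congruences of series and binomial coefficients

module Binomials where

 open Z using (_+_; _*_; -_; _-_)

 open E using (_≈_)

 Mod⇒∣ : ∀ {m a} → Mod (+ m) a (+ 0) → m ND.∣ Z.∣ a ∣
 Mod⇒∣ {m} (mod k refl) = ND.divides Z.∣ k ∣ (trans (cong Z.∣_∣ (ZP.+-identityˡ (k * + m))) (ZP.abs-* k (+ m)))

 ∣⇒Mod : ∀ {m a} → m ND.∣ Z.∣ a ∣ → Mod (+ m) a (+ 0)
 ∣⇒Mod {m} {+ _} (ND.divides k refl) = mod (+ k) (trans (ZP.pos-* k m) (sym (ZP.+-identityˡ _)))
 ∣⇒Mod {m} { -[1+ n ]} (ND.divides k p) = mod (- + k) (trans (cong (-_ ∘ +_) p)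
  (trans (cong -_ (ZP.pos-* k m)) (trans (ZP.neg-distribˡ-* (+ k) (+ m)) (sym (ZP.+-identityˡ _)))))

 Mod-diff : ∀ {M a b} → Mod M (a - b) (+ 0) → Mod M a b
 Mod-diff {M} {a} {b} (mod k p) = mod k (trans (h a b) (trans (cong (_+_ b) p) (h' b (k * M))))
  where h : ∀ a b → a ≡ b + (a - b)
        h = ring
        h' : ∀ b c → b + (+ 0 + c) ≡ b + c
        h' = ring

 module _ {M : ℤ} where
  open SR M hiding (_≈_)

  SMod-diff : ∀ {f g} → SMod M (f ⊝ g) (const (+ 0)) → SMod M f g
  SMod-diff {f} {g} p = tr (solve 2 (λ f g → f := f :- g :+ g) rfl f g) (tr (+c p rfl) (+-identityˡ g))

  SMod-⊝ : ∀ {f g} → SMod M f g → SMod M (f ⊝ g) (const (+ 0))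
  SMod-⊝ {f} {g} p = tr (+c p rfl) (solve 1 (λ g → g :- g := con (+ 0)) rfl g)

  SMod-0⇒multiple : ∀ {f} → SMod M f (const (+ 0)) → ∃ λ g → f ≋ const M · g
  SMod-0⇒multiple {f} p = (λ n → Mod.quo (at p n)) , ≡⇒≋ λ n →
   trans (Mod.eq (at p n)) (trans (cong (_+ Mod.quo (at p n) * M) (z n))
    (trans (ZP.+-identityˡ _) (trans (ZP.*-comm _ M) (sym (const-·-≡ M _ n)))))
   where z : ∀ n → const (+ 0) n ≡ + 0
         z zero    = refl
         z (suc n) = refl

  multiple⇒SMod-0 : ∀ f → SMod M (const M · f) (const (+ 0))
  multiple⇒SMod-0 f = tr (*c (Mod⇒const (mod (+ 1) (sym (trans (ZP.+-identityˡ _) (ZP.*-identityˡ M))))) rfl) (zeroˡ f)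

 SMod-weaken : ∀ {M f g} N → SMod (N * M) f g → SMod M f g
 SMod-weaken N p = smod λ n → Mod-weaken N (at p n)

 SMod-0-* : ∀ {M N f g} → SMod M f (const (+ 0)) → SMod N g (const (+ 0)) → SMod (M * N) (f · g) (const (+ 0))
 SMod-0-* {M} {N} {f} {g} p q with SMod-0⇒multiple p | SMod-0⇒multiple q
 ... | f' , pf | g' , qg = tr (exact (E.tr (E.*c pf qg) (E.tr
     (E.solve 4 (λ a b c d → a E.:* b E.:* (c E.:* d) E.:= a E.:* c E.:* (b E.:* d)) E.rfl (const M) f' (const N) g')
     (E.*c (E.sm (const-* M N)) E.rfl)))) (multiple⇒SMod-0 (f' · g'))
  where open SR (M * N) hiding (_≈_)

 SMod-cancel-const : ∀ {M N f g} → N ≢ + 0 → SMod (N * M) (const N · f) (const N · g) → SMod M f g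
 SMod-cancel-const {M} {N} {f} {g} nz p = smod λ n → mod (Mod.quo (at p n)) (ZP.i-j≡0⇒i≡j _ _ (*-cancel-0 N nz
  (trans (h N (f n) (g n) (Mod.quo (at p n)) M) (ZP.i≡j⇒i-j≡0 (trans (sym (const-·-≡ N f n)) (trans (Mod.eq (at p n))
   (cong (_+ Mod.quo (at p n) * (N * M)) (const-·-≡ N g n))))))))
  where h : ∀ N a b k M → N * (a - (b + k * M)) ≡ N * a - (N * b + k * (N * M))
        h = ring

 Mod-unscale : ∀ {M a b} N → N ≢ + 0 → Mod (N * M) (N * a) (N * b) → Mod M a b
 Mod-unscale {M} {a} {b} N nz (mod k p) = mod k (ZP.i-j≡0⇒i≡j _ _ (*-cancel-0 N nz (trans (h N a b k M) (ZP.i≡j⇒i-j≡0 p))))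
  where h : ∀ N a b k M → N * (a - (b + k * M)) ≡ N * a - (N * b + k * (N * M))
        h = ring

 -- Binomial coefficients, indexed symmetrically: bin i j = (i+j)! / (i! j!).

 bin : ℕ → ℕ → ℕ
 bin zero    j       = 1
 bin (suc i) zero    = 1
 bin (suc i) (suc j) = bin i (suc j) N.+ bin (suc i) j

 bin-absorb : ∀ i j → suc i N.* bin (suc i) j ≡ (suc i N.+ j) N.* bin i j
 private
  -- The two absorption rules feed each other from one diagonal i + j = n to the next, so they are
  -- proved together.
  bin-absorb-both : ∀ n i j → i N.+ j ≡ n → suc i N.* bin (suc i) j ≡ (suc i N.+ j) N.* bin i j ×
                       suc j N.* bin i (suc j) ≡ (i N.+ suc j) N.* bin i j
  bin-absorb-both n zero zero p = refl , refl
  bin-absorb-both n zero (suc j) p = fst , refl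
   where
   fst : 1 N.* bin 1 (suc j) ≡ (2 N.+ j) N.* 1
   fst = trans (NP.*-identityˡ (suc (bin 1 j))) (trans (cong suc (h j)) (sym (NP.*-identityʳ (2 N.+ j))))
    where h : ∀ j → bin 1 j ≡ suc j
          h zero    = refl
          h (suc j) = cong suc (h j)
  bin-absorb-both (suc n) (suc i) zero p = a , b
   where
   h : ∀ i → bin i 1 ≡ suc i
   h zero    = refl
   h (suc i) = trans (cong (N._+ 1) (h i)) (NP.+-comm (suc i) 1)
   a : suc (suc i) N.* 1 ≡ (suc (suc i) N.+ 0) N.* 1
   a = cong (N._* 1) (sym (NP.+-identityʳ (suc (suc i))))
   b : 1 N.* bin (suc i) 1 ≡ (suc i N.+ 1) N.* 1
   b = trans (NP.*-identityˡ _) (trans (h (suc i)) (trans (NP.+-comm 1 (suc i)) (sym (NP.*-identityʳ _))))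
  bin-absorb-both (suc zero) (suc i) (suc j) p with trans (sym (NP.+-suc i j)) (NP.suc-injective p)
  ... | ()
  bin-absorb-both (suc (suc n)) (suc i) (suc j) p = fst , snd
   where
   p1 : i N.+ suc j ≡ suc n
   p1 = NP.suc-injective p
   p2 : suc i N.+ j ≡ suc n
   p2 = trans (sym (NP.+-suc i j)) p1
   ih1 = proj₁ (bin-absorb-both (suc n) i (suc j) p1)
   ih1' = proj₂ (bin-absorb-both (suc n) i (suc j) p1)
   ih2 = proj₁ (bin-absorb-both (suc n) (suc i) j p2)
   ih2' = proj₂ (bin-absorb-both (suc n) (suc i) j p2)
   open ≡-Reasoning
   fst : suc (suc i) N.* (bin (suc i) (suc j) N.+ bin (suc (suc i)) j) ≡ (suc (suc i) N.+ suc j) N.* bin (suc i) (suc j)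
   fst = begin
    suc (suc i) N.* (bin (suc i) (suc j) N.+ bin (suc (suc i)) j)
     ≡⟨ NP.*-distribˡ-+ (suc (suc i)) (bin (suc i) (suc j)) _ ⟩
    suc (suc i) N.* bin (suc i) (suc j) N.+ suc (suc i) N.* bin (suc (suc i)) j
     ≡⟨ cong (suc (suc i) N.* bin (suc i) (suc j) N.+_) (trans ih2 (trans (cong (N._* bin (suc i) j) (sym (NP.+-suc (suc i) j))) (sym ih2'))) ⟩
    suc (suc i) N.* bin (suc i) (suc j) N.+ suc j N.* bin (suc i) (suc j)
     ≡⟨ sym (NP.*-distribʳ-+ (bin (suc i) (suc j)) (suc (suc i)) (suc j)) ⟩
    (suc (suc i) N.+ suc j) N.* bin (suc i) (suc j) ∎
   snd : suc (suc j) N.* (bin i (suc (suc j)) N.+ bin (suc i) (suc j)) ≡ (suc i N.+ suc (suc j)) N.* bin (suc i) (suc j)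
   snd = begin
    suc (suc j) N.* (bin i (suc (suc j)) N.+ bin (suc i) (suc j))
     ≡⟨ NP.*-distribˡ-+ (suc (suc j)) (bin i (suc (suc j))) _ ⟩
    suc (suc j) N.* bin i (suc (suc j)) N.+ suc (suc j) N.* bin (suc i) (suc j)
     ≡⟨ cong (N._+ suc (suc j) N.* bin (suc i) (suc j)) (trans ih1' (trans (cong (N._* bin i (suc j)) (NP.+-suc i (suc j))) (sym ih1))) ⟩
    suc i N.* bin (suc i) (suc j) N.+ suc (suc j) N.* bin (suc i) (suc j)
     ≡⟨ sym (NP.*-distribʳ-+ (bin (suc i) (suc j)) (suc i) (suc (suc j))) ⟩
    (suc i N.+ suc (suc j)) N.* bin (suc i) (suc j) ∎

 bin-absorb i j = proj₁ (bin-absorb-both _ i j refl)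

 bin-balance : ∀ i j → suc i N.* bin (suc i) j ≡ suc j N.* bin i (suc j)
 bin-balance i j = trans (bin-absorb i j) (trans (cong (N._* bin i j) (sym (NP.+-suc i j))) (sym (proj₂ (bin-absorb-both _ i j refl))))

 -- Sums over i + j = n.

 hs : ℕ → (ℕ → ℕ → Ser) → Ser
 hs zero    F = F 0 0
 hs (suc n) F = F 0 (suc n) ⊕ hs n (λ i j → F (suc i) j)

 module _ {M : ℤ} where
  open SR M hiding (_≈_)

  hs-cong : ∀ n {F G} → (∀ i j → SMod M (F i j) (G i j)) → SMod M (hs n F) (hs n G)
  hs-cong zero    p = p 0 0
  hs-cong (suc n) p = +c (p 0 (suc n)) (hs-cong n λ i j → p (suc i) j)

  hs-⊕ : ∀ n F G → SMod M (hs n (λ i j → F i j ⊕ G i j)) (hs n F ⊕ hs n G)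
  hs-⊕ zero    F G = rfl
  hs-⊕ (suc n) F G = tr (+c rfl (hs-⊕ n (λ i j → F (suc i) j) λ i j → G (suc i) j))
   (solve 4 (λ a b c d → a :+ b :+ (c :+ d) := a :+ c :+ (b :+ d)) rfl (F 0 (suc n)) (G 0 (suc n)) _ _)

  hs-· : ∀ n f F → SMod M (hs n (λ i j → f · F i j)) (f · hs n F)
  hs-· zero    f F = rfl
  hs-· (suc n) f F = tr (+c rfl (hs-· n f (λ i j → F (suc i) j))) (sm (distribˡ f _ _))

  hs-ends : ∀ n F → (∀ i j → i N.+ j ≡ n → SMod M (F (suc i) (suc j)) (const (+ 0))) →
       SMod M (hs (suc (suc n)) F) (F 0 (suc (suc n)) ⊕ F (suc (suc n)) 0)
  hs-ends n F p = +c rfl (last n (λ i j → F (suc i) j) p)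
   where last : ∀ n G → (∀ i j → i N.+ j ≡ n → SMod M (G i (suc j)) (const (+ 0))) → SMod M (hs (suc n) G) (G (suc n) 0)
         last zero    G p = tr (+c (p 0 0 refl) rfl) (+-identityˡ _)
         last (suc n) G p = tr (+c (p 0 (suc n) refl) (last n (λ i j → G (suc i) j) λ i j q → p (suc i) j (cong suc q))) (+-identityˡ _)

 -- Pascal's rule for hs: multiplication by a weight shifting i or j.
 shiftij : (ℕ → ℕ → Ser) → (ℕ → ℕ → Ser) → ℕ → ℕ → Ser
 shiftij A B zero    zero    = const (+ 0)
 shiftij A B zero    (suc j) = B 0 j
 shiftij A B (suc i) zero    = A i 0
 shiftij A B (suc i) (suc j) = A i (suc j) ⊕ B (suc i) j

 hs-shift : ∀ {M} n A B → SMod M (hs n A ⊕ hs n B) (hs (suc n) (shiftij A B))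
 hs-shift {M} zero    A B = SR.solve M 2 (λ a b → SR._:=_ M (SR._:+_ M a b) (SR._:+_ M b a)) (SR.rfl M) (A 0 0) (B 0 0)
 hs-shift {M} (suc n) A B = tr (solve 4 (λ a x b y → (a :+ x) :+ (b :+ y) := b :+ (a :+ (x :+ y))) rfl (A 0 (suc n)) _ (B 0 (suc n)) _)
   (+c rfl (tr (+c rfl (hs-shift n (λ i j → A (suc i) j) (λ i j → B (suc i) j)))
    (tr (solve 3 (λ a b x → a :+ (b :+ x) := (a :+ b) :+ x) rfl (A 0 (suc n)) (B 1 n) _)
     (+c rfl (hs-cong n same)))))
  where
  open SR M hiding (_≈_)
  same : ∀ i j → SMod M (shiftij (λ i j → A (suc i) j) (λ i j → B (suc i) j) (suc i) j) (shiftij A B (suc (suc i)) j)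
  same i zero    = rfl
  same i (suc j) = rfl

 binomial-theorem : ∀ {M} a b n → SMod M ((a ⊕ b) ↑ n) (hs n λ i j → const (+ bin i j) · (a ↑ i · b ↑ j))
 binomial-theorem {M} a b zero = solve 0 (con (+ 1) := con (+ 1) :* (con (+ 1) :* con (+ 1))) rfl
  where open SR M hiding (_≈_)
 binomial-theorem {M} a b (suc n) = begin
  (a ⊕ b) · (a ⊕ b) ↑ n ≈⟨ *c rfl (binomial-theorem a b n) ⟩
  (a ⊕ b) · hs n F ≈⟨ distribʳ _ a b ⟩
  a · hs n F ⊕ b · hs n F ≈⟨ +c (sm (hs-· n a F)) (sm (hs-· n b F)) ⟩
  hs n (λ i j → a · F i j) ⊕ hs n (λ i j → b · F i j) ≈⟨ hs-shift n _ _ ⟩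
  hs (suc n) (shiftij (λ i j → a · F i j) (λ i j → b · F i j)) ≈⟨ +c top (hs-cong n pascal) ⟩
  hs (suc n) F ∎
  where
  open SR M hiding (_≈_)
  open ≈-Reasoning
  F : ℕ → ℕ → Ser
  F i j = const (+ bin i j) · (a ↑ i · b ↑ j)
  top : SMod M (b · F 0 n) (F 0 (suc n))
  top = solve 2 (λ b y → b :* (con (+ 1) :* (con (+ 1) :* y)) := con (+ 1) :* (con (+ 1) :* (b :* y))) rfl b (b ↑ n)
  bin0 : ∀ i → bin i 0 ≡ 1
  bin0 zero    = refl
  bin0 (suc i) = refl
  pascal : ∀ i j → SMod M (shiftij (λ i j → a · F i j) (λ i j → b · F i j) (suc i) j) (F (suc i) j)
  pascal i zero rewrite bin0 i = solve 2 (λ a x → a :* (con (+ 1) :* (x :* con (+ 1))) := con (+ 1) :* (a :* x :* con (+ 1))) rfl a (a ↑ i)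
  pascal i (suc j) = tr (solve 6 (λ a b x y c d → a :* (c :* (x :* (b :* y))) :+ b :* (d :* (a :* x :* y)) := (c :+ d) :* (a :* x :* (b :* y))) rfl
    a b (a ↑ i) (b ↑ j) (const (+ bin i (suc j))) (const (+ bin (suc i) j)))
   (*c (sm (const-+ (+ bin i (suc j)) (+ bin (suc i) j))) rfl)

open Binomials

-- Frobenius and Euler's theorem modulo prime powers

module PrimePower where

 open Z using (_+_; _*_; -_; _-_)

 euclid : ∀ {p} → Prime p → ∀ {a b} → Mod (+ p) (a * b) (+ 0) → Mod (+ p) a (+ 0) ⊎ Mod (+ p) b (+ 0)
 euclid {p} pr {a} {b} h with Prime.euclidsLemma Z.∣ a ∣ Z.∣ b ∣ pr (subst (p ND.∣_) (ZP.abs-* a b) (Mod⇒∣ h))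
 ... | inj₁ q = inj₁ (∣⇒Mod q)
 ... | inj₂ q = inj₂ (∣⇒Mod q)

 sub-unfold : ∀ {M} d f → SMod M (sub d f) (const (f 0) ⊕ q^ (suc d) · sub d (tl f))
 sub-unfold {M} d f = ≡⇒SMod λ n → trans (h n) (sym (trans (⊕-at _ _ n) (cong (_+_ (const (f 0) n)) (SMod-0⇒≡ (q^-· (suc d) (sub d (tl f))) n))))
  where
  W-sh : ∀ j g n → W d j g n ≡ sh j (sub d g) n
  W-sh zero    g n       = refl
  W-sh (suc j) g zero    = refl
  W-sh (suc j) g (suc n) = W-sh j g n
  h : ∀ n → sub d f n ≡ const (f 0) n + sh (suc d) (sub d (tl f)) n
  h zero    = sym (ZP.+-identityʳ (f 0))
  h (suc n) = trans (W-sh d (tl f) n) (sym (ZP.+-identityˡ _))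

 unfold-0 : ∀ {M} f → SMod M f (const (f 0) ⊕ q^ 1 · tl f)
 unfold-0 f = ≡⇒SMod λ n → sym (trans (⊕-at _ _ n) (trans (cong (_+_ (const (f 0) n)) (SMod-0⇒≡ (q^-· 1 (tl f)) n)) (h n)))
  where h : ∀ n → const (f 0) n + sh 1 (tl f) n ≡ f n
        h zero    = ZP.+-identityʳ (f 0)
        h (suc n) = ZP.+-identityˡ (f (suc n))

 q^-↑ : ∀ {M} k n → SMod M (q^ k ↑ n) (q^ (n N.* k))
 q^-↑ {M} k zero    = SR.rfl M
 q^-↑ {M} k (suc n) = tr (*c rfl (q^-↑ k n)) (q^-+ k (n N.* k))
  where open SR M

 module PrimePowers (d : ℕ) (pr : Prime (suc d)) where

  m : ℕ
  m = suc d

  pw : ℕ → ℤ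
  pw L = (+ m) Z.^ L

  private
   M1 : ℤ
   M1 = + m

  d≥1 : 1 N.≤ d
  d≥1 = NP.≤-pred (N.nonTrivial⇒n>1 m {{Prime.prime⇒nonTrivial pr}})

  bin-0 : ∀ i j → suc i N.+ suc j ≡ m → Mod M1 (+ bin (suc i) (suc j)) (+ 0)
  bin-0 i j e = get (euclid pr {+ suc i} {+ bin (suc i) (suc j)}
    (∣⇒Mod {a = + suc i * + bin (suc i) (suc j)} (subst (m ND.∣_) (sym (ZP.abs-* (+ suc i) (+ bin (suc i) (suc j))))
     (ND.divides (bin i (suc j)) (trans (bin-absorb i (suc j)) (trans (cong (N._* bin i (suc j)) e) (NP.*-comm m _)))))))
   where
   get : Mod M1 (+ suc i) (+ 0) ⊎ _ → Mod M1 (+ bin (suc i) (suc j)) (+ 0)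
   get (inj₂ q) = q
   get (inj₁ q) = ⊥-elim (NP.<⇒≱ (subst (suc i N.<_) e (NP.m<m+n (suc i) (s≤s z≤n))) (ND.∣⇒≤ (Mod⇒∣ {a = + suc i} q)))

  freshman : ∀ a b → SMod M1 ((a ⊕ b) ↑ m) (a ↑ m ⊕ b ↑ m)
  freshman a b = go d refl d≥1
   where
   open SR M1
   go : ∀ k → k ≡ d → 1 N.≤ k → (a ⊕ b) ↑ suc k ≈ a ↑ suc k ⊕ b ↑ suc k
   go (suc k) e _ = tr (binomial-theorem a b (suc (suc k))) (tr
    (hs-ends k (λ i j → const (+ bin i j) · (a ↑ i · b ↑ j)) (λ i j q → tr (*c (Mod⇒const (bin-0 i j
     (trans (cong suc (trans (NP.+-suc i j) (cong suc q))) (cong suc e)))) rfl) (zeroˡ _)))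
    (solve 2 (λ x y → con (+ 1) :* (con (+ 1) :* y) :+ con (+ 1) :* (x :* con (+ 1)) := x :+ y) rfl (a ↑ suc (suc k)) (b ↑ suc (suc k))))

  fermat-const : ∀ a → SMod M1 (const a ↑ m) (const a)
  fermat-const (+ n) = go n
   where
   open SR M1
   go : ∀ n → const (+ n) ↑ m ≈ const (+ n)
   go zero    = zeroˡ _
   go (suc n) = tr (↑-cong m (const-+ (+ 1) (+ n))) (tr (freshman (const (+ 1)) (const (+ n)))
    (tr (+c (1-↑ m) (go n)) (sm (const-+ (+ 1) (+ n)))))
  fermat-const -[1+ n ] = tr (solve 2 (λ a b → a := (a :+ b) :- b) rfl (const -[1+ n ] ↑ m) (const (+ suc n) ↑ m))
    (tr (+c (sm (freshman (const -[1+ n ]) (const (+ suc n)))) (-c (fermat-const (+ suc n))))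
    (tr (+c (tr (↑-cong m zer) (zeroˡ _)) rfl)
    (tr (+-identityˡ _) (sm (const-neg (+ suc n))))))
   where
   open SR M1
   zer : const -[1+ n ] ⊕ const (+ suc n) ≈ const (+ 0)
   zer = tr (sm (const-+ -[1+ n ] (+ suc n))) (Mod⇒const (≡⇒Mod (ZP.+-inverseˡ (+ suc n))))

  -- Peel off the constant term: (f 0 + q tl f)^m ≡ f 0 + q^m (tl f)^m by the binomial theorem and
  -- Fermat; then induct on the coefficient.
  frobenius : ∀ f → SMod M1 (f ↑ m) (sub d f)
  frobenius f = smod λ n → go (suc n) f n NP.≤-refl
   where
   open SR M1
   step : ∀ f → f ↑ m ≈ const (f 0) ⊕ q^ m · tl f ↑ m
   step f = tr (↑-cong m (unfold-0 f)) (tr (freshman (const (f 0)) (q^ 1 · tl f))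
    (+c (fermat-const (f 0)) (tr (·-↑ (q^ 1) (tl f) m) (*c (tr (q^-↑ 1 m) (≡⇒SMod λ i → cong (λ k → q^ k i) (NP.*-identityʳ m))) rfl))))
   at-step : ∀ A c n → (∀ k → m N.+ k ≡ n → Mod M1 (A k) (c k)) → Mod M1 ((q^ m · A) n) ((q^ m · c) n)
   at-step A c n h = Mod-tr (at (q^-· m A) n) (Mod-tr (cases (m N.≤? n)) (Mod-sym (at (q^-· m c) n)))
    where
    cases : Dec (m N.≤ n) → Mod M1 (sh m A n) (sh m c n)
    cases (yes p) = subst (λ z → Mod M1 (sh m A z) (sh m c z)) (NP.m+[n∸m]≡n p)
     (Mod-tr (≡⇒Mod (sh-at m A (n N.∸ m))) (Mod-tr (h (n N.∸ m) (NP.m+[n∸m]≡n p)) (≡⇒Mod (sym (sh-at m c (n N.∸ m))))))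
    cases (no ¬p) = ≡⇒Mod (trans (sh-below m A n (NP.≰⇒> ¬p)) (sym (sh-below m c n (NP.≰⇒> ¬p))))
   go : ∀ N f n → n N.< N → Mod M1 ((f ↑ m) n) (sub d f n)
   go (suc N) f n n<N = Mod-tr (at (step f) n) (Mod-tr (≡⇒Mod (⊕-at _ _ n)) (Mod-tr
    (Mod-+ {a = const (f 0) n} Mod-refl (at-step (tl f ↑ m) (sub d (tl f)) n λ k e → go N (tl f) k
     (NP.<-≤-trans (subst (k N.<_) e (NP.m<n+m k (s≤s z≤n))) (NP.≤-pred n<N))))
    (Mod-tr (≡⇒Mod (sym (⊕-at _ _ n))) (Mod-sym (at (sub-unfold d f) n)))))

  geomSum : ℕ → Ser → Ser → Ser
  geomSum zero    f g = const (+ 0)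
  geomSum (suc n) f g = f ↑ n ⊕ g · geomSum n f g

  ↑-difference : ∀ n f g → f ↑ n ⊝ g ↑ n ≋ (f ⊝ g) · geomSum n f g
  ↑-difference zero    f g = E.solve 1 (λ x → E.con (+ 1) E.:- E.con (+ 1) E.:= x E.:* E.con (+ 0)) E.rfl (f ⊝ g)
  ↑-difference (suc n) f g = begin
   f · f ↑ n ⊝ g · g ↑ n ≈⟨ solve 4 (λ f g a b → f :* a :- g :* b := (f :- g) :* a :+ g :* (a :- b)) rfl f g (f ↑ n) (g ↑ n) ⟩
   (f ⊝ g) · f ↑ n ⊕ g · (f ↑ n ⊝ g ↑ n) ≈⟨ +c rfl (*c rfl (↑-difference n f g)) ⟩
   (f ⊝ g) · f ↑ n ⊕ g · ((f ⊝ g) · geomSum n f g) ≈⟨ solve 4 (λ d a g s → d :* a :+ g :* (d :* s) := d :* (a :+ g :* s)) rfl (f ⊝ g) (f ↑ n) g (geomSum n f g) ⟩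
   (f ⊝ g) · geomSum (suc n) f g ∎
   where open E
         open ≈-Reasoning

  geomSum-≡ : ∀ n {f g} → SMod M1 f g → SMod M1 (geomSum (suc n) f g) (const (+ suc n) · g ↑ n)
  geomSum-≡ zero    {f} {g} p = solve 1 (λ g → con (+ 1) :+ g :* con (+ 0) := con (+ 1) :* con (+ 1)) rfl g
   where open SR M1
  geomSum-≡ (suc n) {f} {g} p = tr (+c (↑-cong (suc n) p) (*c rfl (geomSum-≡ n p)))
    (tr (solve 3 (λ g a c → g :* a :+ g :* (c :* a) := (con (+ 1) :+ c) :* (g :* a)) rfl g (g ↑ n) (const (+ suc n)))
     (*c (sm (const-+ (+ 1) (+ suc n))) rfl))
   where open SR M1

  pw-weaken : ∀ {L f g} → SMod (pw (suc L)) f g → SMod (pw L) f g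
  pw-weaken p = SMod-weaken (+ m) p

  pw-≤ : ∀ {K L} → K N.≤ L → ∀ {f g} → SMod (pw L) f g → SMod (pw K) f g
  pw-≤ {K} {L} K≤L {f} {g} p = go (NP.≤⇒≤′ K≤L) p
   where go : ∀ {L} → K N.≤′ L → SMod (pw L) f g → SMod (pw K) f g
         go N.≤′-refl p = p
         go {suc L} (N.≤′-step q) p = go q (pw-weaken {L} p)

  pw-1 : pw 1 ≡ M1
  pw-1 = ZP.*-identityʳ (+ m)

  pw⇒M1 : ∀ {L f g} → SMod (pw (suc L)) f g → SMod M1 f g
  pw⇒M1 {L} {f} {g} p = subst (λ z → SMod z f g) pw-1 (pw-≤ {1} {suc L} (s≤s z≤n) p)

  M1⇒pw : ∀ {f g} → SMod M1 f g → SMod (pw 1) f g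
  M1⇒pw {f} {g} p = subst (λ z → SMod z f g) (sym pw-1) p

  -- f^m - g^m is f - g times the sum of f^i g^(m-1-i), and for f ≡ g modulo m that sum is m g^(m-1)
  -- ≡ 0: one more factor m is gained.
  lift-step : ∀ L {f g} → SMod (pw (suc L)) f g → SMod (pw (suc (suc L))) (f ↑ m) (g ↑ m)
  lift-step L {f} {g} p = SMod-diff (SR.tr _ (exact (↑-difference m f g))
   (subst (λ z → SMod z ((f ⊝ g) · geomSum m f g) (const (+ 0))) (ZP.*-comm (pw (suc L)) (+ m)) (SMod-0-* (SMod-⊝ p) zer)))
   where
   open SR M1
   zer : geomSum m f g ≈ const (+ 0)
   zer = tr (geomSum-≡ d (pw⇒M1 {L} p)) (tr (*c (Mod⇒const (mod (+ 1) (sym (trans (ZP.+-identityˡ _) (ZP.*-identityˡ (+ m)))))) rfl) (zeroˡ _))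

  ↑-lift : ∀ L {f g} → SMod M1 f g → SMod (pw (suc L)) (f ↑ (m N.^ L)) (g ↑ (m N.^ L))
  ↑-lift zero    p = ↑-cong 1 (M1⇒pw p)
  ↑-lift (suc L) {f} {g} p = tr (↑-* f m (m N.^ L)) (tr (lift-step L (↑-lift L p)) (sm (↑-* g m (m N.^ L))))
   where open SR (pw (suc (suc L)))

  Mod-const : ∀ {M a b} → SMod M (const a) (const b) → Mod M a b
  Mod-const p = at p 0

  fermat : ∀ a → Mod M1 (a Z.^ m) a
  fermat a = Mod-const (SR.tr M1 (SR.sm M1 (const-↑ a m)) (fermat-const a))

  fermat' : ∀ a → ¬ Mod M1 a (+ 0) → Mod M1 (a Z.^ d) (+ 1)
  fermat' a na with euclid pr {a} {a Z.^ d - + 1} (Mod-tr (≡⇒Mod (h a (a Z.^ d))) (Mod-- (fermat a)))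
   where h : ∀ a b → a * (b - + 1) ≡ a * b - a
         h = ring
  ... | inj₁ q = ⊥-elim (na q)
  ... | inj₂ q = Mod-diff q

  -- `↑-lift` applied to Fermat's a^(m-1) ≡ 1.
  euler : ∀ L a → ¬ Mod M1 a (+ 0) → Mod (pw (suc L)) (a Z.^ (m N.^ L N.* d)) (+ 1)
  euler L a na = Mod-const (tr (sm (const-↑ a (m N.^ L N.* d))) (tr (↑-* (const a) (m N.^ L) d)
   (tr (↑-lift L (SR.tr M1 (const-↑ a d) (Mod⇒const (fermat' a na)))) (1-↑ (m N.^ L)))))
   where open SR (pw (suc L))

  unit : ∀ L a → ¬ Mod M1 a (+ 0) → ∃ λ u → Mod (pw L) (a * u) (+ 1)
  -- As a^φ ≡ 1 with φ = m^L (m - 1) ≥ 1, the inverse is a^(φ-1).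
  unit L a na = a Z.^ N.pred (m N.^ L N.* d) , Mod-weaken (+ m) (subst (λ z → Mod (pw (suc L)) z (+ 1)) (sym (pow-pred (m N.^ L N.* d) pos)) (euler L a na))
   where
   pos : 1 N.≤ m N.^ L N.* d
   pos = NP.*-mono-≤ (NP.^-monoʳ-≤ m {{_}} (z≤n {L})) d≥1
   pow-pred : ∀ n → 1 N.≤ n → a * a Z.^ N.pred n ≡ a Z.^ n
   pow-pred (suc n) _ = refl

  module _ (L : ℕ) {a : ℤ} (na : ¬ Mod M1 a (+ 0)) where

   unit-cancel-Mod : ∀ {b c} → Mod (pw L) (a * b) (a * c) → Mod (pw L) b c
   unit-cancel-Mod {b} {c} p with unit L a na
   ... | u , q = Mod-tr (Mod-sym (one b)) (Mod-tr (≡⇒Mod (h b)) (Mod-tr (Mod-* {a = u} {u} Mod-refl p)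
          (Mod-tr (≡⇒Mod (sym (h c))) (one c))))
    where
    h : ∀ b → a * u * b ≡ u * (a * b)
    h b = r a u b
     where r : ∀ a u b → a * u * b ≡ u * (a * b)
           r = ring
    one : ∀ b → Mod (pw L) (a * u * b) b
    one b = Mod-tr (Mod-* q (Mod-refl {a = b})) (≡⇒Mod (ZP.*-identityˡ b))

   unit-cancel-const : ∀ {f g} → SMod (pw L) (const a · f) (const a · g) → SMod (pw L) f g
   unit-cancel-const {f} {g} p = smod λ n → unit-cancel-Mod
    (Mod-tr (≡⇒Mod (sym (const-·-≡ a f n))) (Mod-tr (at p n) (≡⇒Mod (const-·-≡ a g n))))

  na-↑ : ∀ {a} n → ¬ Mod M1 a (+ 0) → ¬ Mod M1 (a Z.^ n) (+ 0)
  na-↑ zero    na p = NP.<⇒≱ (s≤s d≥1) (ND.∣⇒≤ (Mod⇒∣ {a = + 1} p))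
  na-↑ {a} (suc n) na p with euclid pr {a} p
  ... | inj₁ q = na q
  ... | inj₂ q = na-↑ n na q

  na-* : ∀ {a b} → ¬ Mod M1 a (+ 0) → ¬ Mod M1 b (+ 0) → ¬ Mod M1 (a * b) (+ 0)
  na-* {a} na nb p with euclid pr {a} p
  ... | inj₁ q = na q
  ... | inj₂ q = nb q

open PrimePower

-- Integral modular forms of level one

module Isobaric where

 open Z using (_+_; _*_; -_; _-_)

 open E

 -- Isobaric polynomials in E4 and E6; the index is half the weight.

 data Iso : ℕ → Ser → Set where
  iso-const : ∀ c → Iso 0 (const c)
  iso-0     : ∀ {v} → Iso v (const (+ 0))
  iso-⊕     : ∀ {v f g} → Iso v f → Iso v g → Iso v (f ⊕ g)
  iso-E4    : ∀ {v f} → Iso v f → Iso (2 N.+ v) (E4 · f)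
  iso-E6    : ∀ {v f} → Iso v f → Iso (3 N.+ v) (E6 · f)
  iso-≋     : ∀ {v f g} → f ≋ g → Iso v f → Iso v g

 iso-scale : ∀ c {v f} → Iso v f → Iso v (const c · f)
 iso-scale c (iso-const c') = iso-≋ (const-* c c') (iso-const (c * c'))
 iso-scale c iso-0          = iso-≋ (sm (zeroʳ _)) iso-0
 iso-scale c (iso-⊕ p p')   = iso-≋ (sm (distribˡ _ _ _)) (iso-⊕ (iso-scale c p) (iso-scale c p'))
 iso-scale c (iso-E4 {f = f} p) = iso-≋ (solve 3 (λ a b c → a :* (b :* c) := b :* (a :* c)) rfl E4 (const c) f) (iso-E4 (iso-scale c p))
 iso-scale c (iso-E6 {f = f} p) = iso-≋ (solve 3 (λ a b c → a :* (b :* c) := b :* (a :* c)) rfl E6 (const c) f) (iso-E6 (iso-scale c p))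
 iso-scale c (iso-≋ q p)    = iso-≋ (*c rfl q) (iso-scale c p)

 iso-· : ∀ {v w f g} → Iso v f → Iso w g → Iso (v N.+ w) (f · g)
 iso-· (iso-const c) q = iso-scale c q
 iso-· iso-0         q = iso-≋ (sm (zeroˡ _)) iso-0
 iso-· (iso-⊕ p p')  q = iso-≋ (sm (distribʳ _ _ _)) (iso-⊕ (iso-· p q) (iso-· p' q))
 iso-· (iso-E4 p)    q = iso-≋ (sm (*-assoc _ _ _)) (iso-E4 (iso-· p q))
 iso-· (iso-E6 p)    q = iso-≋ (sm (*-assoc _ _ _)) (iso-E6 (iso-· p q))
 iso-· (iso-≋ r p)   q = iso-≋ (*c r rfl) (iso-· p q)

 iso-⊖ : ∀ {v f} → Iso v f → Iso v (⊖ f)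
 iso-⊖ {f = f} p = iso-≋ (solve 1 (λ f → con (- + 1) :* f := :- f) rfl f) (iso-scale (- + 1) p)

 iso-⊝ : ∀ {v f g} → Iso v f → Iso v g → Iso v (f ⊝ g)
 iso-⊝ p q = iso-⊕ p (iso-⊖ q)

 iso-≡ : ∀ {v w f} → v ≡ w → Iso v f → Iso w f
 iso-≡ refl p = p

 iso-↑ : ∀ n {v f} → Iso v f → Iso (n N.* v) (f ↑ n)
 iso-↑ zero    p = iso-const (+ 1)
 iso-↑ (suc n) p = iso-· p (iso-↑ n p)

 iso-E4' : Iso 2 E4
 iso-E4' = iso-≋ (*-identityʳ E4) (iso-E4 (iso-const (+ 1)))

 iso-E6' : Iso 3 E6
 iso-E6' = iso-≋ (*-identityʳ E6) (iso-E6 (iso-const (+ 1)))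

 iso-Δ' : Iso 6 Δ'
 iso-Δ' = iso-≋ (sm Δ'-def) (iso-⊝ (iso-↑ 3 iso-E4') (iso-↑ 2 iso-E6'))

 -- The Serre derivative.

 const≡ : ∀ {M a b} → a ≡ b → SMod M (const a) (const b)
 const≡ {M} refl = SR.rfl M

 iso-D : ∀ {v f} → Iso v f → ∃ λ f' → Iso (suc v) f' × D f ≋ f' ⊕ const (+ (4 N.* v)) · (e · f)
 iso-D (iso-const c) = const (+ 0) , iso-0 , tr (D-const c) (solve 1 (λ x → con (+ 0) := con (+ 0) :+ con (+ 0) :* x) rfl (e · const c))
 iso-D {v} iso-0 = const (+ 0) , iso-0 , tr (D-const (+ 0)) (solve 2 (λ c e → con (+ 0) := con (+ 0) :+ c :* (e :* con (+ 0))) rfl (const (+ (4 N.* v))) e)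
 iso-D {v} (iso-⊕ {f = f} {g} p q) with iso-D p | iso-D q
 ... | f' , pf , ef | g' , pg , eg = f' ⊕ g' , iso-⊕ pf pg , tr (D-⊕ f g) (tr (+c ef eg)
  (solve 6 (λ f g c e f' g' → f' :+ c :* (e :* f) :+ (g' :+ c :* (e :* g)) := f' :+ g' :+ c :* (e :* (f :+ g))) rfl f g (const (+ (4 N.* v))) e f' g'))
 -- The 8 e in D E4 raises 4v to 4(v + 2), in step with the half-weight. The factor 4v is twice the
 -- weight rather than a twelfth of it, because D is 24 times the derivation in q^24.
 iso-D (iso-E4 {v} {f} p) with iso-D p
 ... | f' , pf , ef = E4 · f' ⊝ const (+ 8) · (E6 · f) , iso-⊝ (iso-E4 pf) (iso-scale (+ 8) (iso-E6 p)) , (begin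
  D (E4 · f) ≈⟨ tr (D-· E4 f) (+c (*c D-E4 rfl) (*c rfl ef)) ⟩
  (const (+ 8) · (e · E4) ⊝ const (+ 8) · E6) · f ⊕ E4 · (f' ⊕ const (+ (4 N.* v)) · (e · f))
   ≈⟨ solve 6 (λ a b e f f' c → (con (+ 8) :* (e :* a) :- con (+ 8) :* b) :* f :+ a :* (f' :+ c :* (e :* f))
     := (a :* f' :- con (+ 8) :* (b :* f)) :+ (con (+ 8) :+ c) :* (e :* (a :* f))) rfl E4 E6 e f f' (const (+ (4 N.* v))) ⟩
  (E4 · f' ⊝ const (+ 8) · (E6 · f)) ⊕ (const (+ 8) ⊕ const (+ (4 N.* v))) · (e · (E4 · f))
   ≈⟨ +c rfl (*c (tr (sm (const-+ (+ 8) (+ (4 N.* v)))) (const≡ (cong +_ (sym (NP.*-distribˡ-+ 4 2 v))))) rfl) ⟩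
  (E4 · f' ⊝ const (+ 8) · (E6 · f)) ⊕ const (+ (4 N.* (2 N.+ v))) · (e · (E4 · f)) ∎)
  where open ≈-Reasoning
 iso-D (iso-E6 {v} {f} p) with iso-D p
 ... | f' , pf , ef = E6 · f' ⊝ const (+ 12) · (E4 · (E4 · f)) , iso-⊝ (iso-E6 pf) (iso-scale (+ 12) (iso-E4 (iso-E4 p))) , (begin
  D (E6 · f) ≈⟨ tr (D-· E6 f) (+c (*c D-E6 rfl) (*c rfl ef)) ⟩
  (const (+ 12) · (e · E6) ⊝ const (+ 12) · E4 ↑ 2) · f ⊕ E6 · (f' ⊕ const (+ (4 N.* v)) · (e · f))
   ≈⟨ solve 6 (λ a b e f f' c → (con (+ 12) :* (e :* b) :- con (+ 12) :* a :^ 2) :* f :+ b :* (f' :+ c :* (e :* f))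
     := (b :* f' :- con (+ 12) :* (a :* (a :* f))) :+ (con (+ 12) :+ c) :* (e :* (b :* f))) rfl E4 E6 e f f' (const (+ (4 N.* v))) ⟩
  (E6 · f' ⊝ const (+ 12) · (E4 · (E4 · f))) ⊕ (const (+ 12) ⊕ const (+ (4 N.* v))) · (e · (E6 · f))
   ≈⟨ +c rfl (*c (tr (sm (const-+ (+ 12) (+ (4 N.* v)))) (const≡ (cong +_ (sym (NP.*-distribˡ-+ 4 3 v))))) rfl) ⟩
  (E6 · f' ⊝ const (+ 12) · (E4 · (E4 · f))) ⊕ const (+ (4 N.* (3 N.+ v))) · (e · (E6 · f)) ∎)
  where open ≈-Reasoning
 iso-D (iso-≋ q p) with iso-D p
 ... | f' , pf , ef = f' , pf , tr (D-cong (sm q)) (tr ef (+c rfl (*c rfl (*c rfl q))))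

 -- Canonical basis elements E4^a E6^b (b ≤ 1) and splitting off Δ'.

 cb : ℕ → Ser
 cb 0 = const (+ 1)
 -- There is no nonzero form of weight 2.
 cb 1 = const (+ 0)
 cb 2 = E4
 cb 3 = E6
 cb (suc (suc w@(suc (suc v)))) = E4 · cb w

 iso-cb : ∀ v → Iso v (cb v)
 iso-cb 0 = iso-const (+ 1)
 iso-cb 1 = iso-0
 iso-cb 2 = iso-E4'
 iso-cb 3 = iso-E6'
 iso-cb (suc (suc w@(suc (suc v)))) = iso-E4 (iso-cb w)

 cb-0 : ∀ v → v ≢ 1 → (cb v) 0 ≡ + 1
 cb-0 0 _ = refl
 cb-0 1 p = ⊥-elim (p refl)
 cb-0 2 _ = E4-0
 cb-0 3 _ = E6-0
 cb-0 (suc (suc w@(suc (suc v)))) _ = trans (·-at-0 E4 _) (cong₂ _*_ E4-0 (cb-0 w λ ()))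

 data Split (v : ℕ) (f : Ser) : Set where
  small : ∀ c → f ≋ const c · cb v → Split v f
  big   : ∀ c w g → v ≡ 6 N.+ w → Iso w g → f ≋ const c · cb v ⊕ Δ' · g → Split v f

 split-≋ : ∀ {v f g} → f ≋ g → Split v f → Split v g
 split-≋ p (small c q)         = small c (tr (sm p) q)
 split-≋ p (big c w g a b q)   = big c w g a b (tr (sm p) q)

 split-⊕ : ∀ {v f g} → Split v f → Split v g → Split v (f ⊕ g)
 split-⊕ {v} (small c p) (small c' p') = small (c + c') (tr (+c p p')
  (tr (sm (distribʳ _ _ _)) (*c (sm (const-+ c c')) rfl)))
 split-⊕ {v} (small c p) (big c' w g a b p') = big (c + c') w g a b (tr (+c p p')
  (tr (solve 4 (λ c c' x y → c :* x :+ (c' :* x :+ y) := (c :+ c') :* x :+ y) rfl (const c) (const c') (cb v) (Δ' · g))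
   (+c (*c (sm (const-+ c c')) rfl) rfl)))
 split-⊕ {v} (big c' w g a b p') (small c p) = big (c + c') w g a b (tr (+c p' p)
  (tr (solve 4 (λ c c' x y → (c' :* x :+ y) :+ c :* x := (c :+ c') :* x :+ y) rfl (const c) (const c') (cb v) (Δ' · g))
   (+c (*c (sm (const-+ c c')) rfl) rfl)))
 split-⊕ {v} (big c w g refl b p) (big c' w g' refl b' p') = big (c + c') w (g ⊕ g') refl (iso-⊕ b b') (tr (+c p p')
  (tr (solve 6 (λ c c' x d g g' → (c :* x :+ d :* g) :+ (c' :* x :+ d :* g') := (c :+ c') :* x :+ d :* (g :+ g')) rfl (const c) (const c') (cb v) Δ' g g')
   (+c (*c (sm (const-+ c c')) rfl) rfl)))

 split-scale : ∀ {v f} c → Split v f → Split v (const c · f)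
 split-scale {v} c (small c' p) = small (c * c') (tr (*c rfl p) (tr (sm (*-assoc _ _ _)) (*c (sm (const-* c c')) rfl)))
 split-scale {v} c (big c' w g a b p) = big (c * c') w (const c · g) a (iso-scale c b) (tr (*c rfl p)
  (tr (solve 5 (λ c c' x d g → c :* (c' :* x :+ d :* g) := c :* c' :* x :+ d :* (c :* g)) rfl (const c) (const c') (cb v) Δ' g)
   (+c (*c (sm (const-* c c')) rfl) rfl)))

 split-Δ' : ∀ {w g} → Iso w g → Split (6 N.+ w) (Δ' · g)
 split-Δ' {w} {g} p = big (+ 0) w g refl p (solve 2 (λ x y → y := con (+ 0) :* x :+ y) rfl (cb (6 N.+ w)) (Δ' · g))

 split-E4cb : ∀ v → Split (2 N.+ v) (E4 · cb v)
 split-E4cb 0 = small (+ 1) (*-comm _ _)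
 split-E4cb 1 = small (+ 0) (solve 2 (λ a b → a :* con (+ 0) := con (+ 0) :* b) rfl E4 E6)
 split-E4cb (suc (suc v)) = small (+ 1) (sm (*-identityˡ _))

 split-E4 : ∀ {v f} → Split v f → Split (2 N.+ v) (E4 · f)
 split-E4 {v} (small c p) = split-≋ (tr (solve 3 (λ a b c → c :* (a :* b) := a :* (c :* b)) rfl E4 (cb v) (const c)) (*c rfl (sm p)))
  (split-scale c (split-E4cb v))
 split-E4 {v} (big c w g refl b p) = split-≋ (tr (solve 5 (λ a x c d g → c :* (a :* x) :+ d :* (a :* g) := a :* (c :* x :+ d :* g)) rfl E4 (cb v) (const c) Δ' g)
   (*c rfl (sm p)))
  (split-⊕ (split-scale c (split-E4cb v)) (split-Δ' (iso-E4 b)))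

 split-E6cb : ∀ v → Split (3 N.+ v) (E6 · cb v)
 split-E6cb 0 = small (+ 1) (*-comm _ _)
 split-E6cb 1 = small (+ 0) (solve 2 (λ a b → a :* con (+ 0) := con (+ 0) :* b) rfl E6 (cb 4))
 split-E6cb 2 = small (+ 1) (solve 2 (λ a b → a :* b := con (+ 1) :* (b :* a)) rfl E6 E4)
 -- E6² = E4³ - Δ' is the one reduction; all other cases only reorder factors.
 split-E6cb 3 = big (+ 1) 0 (const (- + 1)) refl (iso-const (- + 1))
  (tr (solve 2 (λ a b → b :* b := con (+ 1) :* (a :* (a :* a)) :+ (a :^ 3 :- b :^ 2) :* con (- + 1)) rfl E4 E6)
   (+c rfl (*c (sm Δ'-def) rfl)))
 split-E6cb (suc (suc w@(suc (suc v)))) = split-≋ (solve 3 (λ a b c → a :* (b :* c) := b :* (a :* c)) rfl E4 E6 (cb w))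
  (split-E4 (split-E6cb w))

 split-E6 : ∀ {v f} → Split v f → Split (3 N.+ v) (E6 · f)
 split-E6 {v} (small c p) = split-≋ (tr (solve 3 (λ a b c → c :* (a :* b) := a :* (c :* b)) rfl E6 (cb v) (const c)) (*c rfl (sm p)))
  (split-scale c (split-E6cb v))
 split-E6 {v} (big c w g refl b p) = split-≋ (tr (solve 5 (λ a x c d g → c :* (a :* x) :+ d :* (a :* g) := a :* (c :* x :+ d :* g)) rfl E6 (cb v) (const c) Δ' g)
   (*c rfl (sm p)))
  (split-⊕ (split-scale c (split-E6cb v)) (split-Δ' (iso-E6 b)))

 split : ∀ {v f} → Iso v f → Split v f
 split (iso-const c) = small c (sm (*-identityʳ _))
 split iso-0         = small (+ 0) (sm (zeroˡ _))
 split (iso-⊕ p q)   = split-⊕ (split p) (split q)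
 split (iso-E4 p)    = split-E4 (split p)
 split (iso-E6 p)    = split-E6 (split p)
 split (iso-≋ q p)   = split-≋ q (split p)

 -- `reg` says that 1728, the leading coefficient of Δ', is no zero divisor modulo M; so Δ' can be
 -- cancelled coefficient by coefficient.
 module Division (M : ℤ) (reg : ∀ {a} → Mod M (+ 1728 * a) (+ 0) → Mod M a (+ 0)) where

  open SR M using () renaming (rfl to ≈M-refl; tr to ≈M-trans; sm to ≈M-sym; *c to *M-cong; +c to +M-cong)

  OrdM-Δ' : Ord M 24 Δ'
  OrdM-Δ' n p = ≡⇒Mod (Mod-0⇒≡ (Ord-Δ' n p))

  Δ'-cancel-Ord : ∀ n {g} → Ord M (24 N.+ n) (Δ' · g) → Ord M n g
  Δ'-cancel-Ord zero    o = Ord-0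
  Δ'-cancel-Ord (suc n) {g} o = Ord-suc n ih (reg (Mod-tr (≡⇒Mod (cong (_* g n) (sym Δ'-24)))
    (Mod-tr (Mod-sym (leading-· 24 n OrdM-Δ' ih)) (o (24 N.+ n) (NP.+-monoʳ-< 24 NP.≤-refl)))))
   where ih : Ord M n g
         ih = Δ'-cancel-Ord n (Ord-weaken (NP.+-monoʳ-≤ 24 (NP.n≤1+n n)) o)

  Δ'-cancel : ∀ {g} → SMod M (Δ' · g) (const (+ 0)) → SMod M g (const (+ 0))
  Δ'-cancel {g} p = all-Ord⇒0 λ n → Δ'-cancel-Ord n λ i _ → Mod-tr (at p i) (≡⇒Mod (z i))
   where z : ∀ i → const (+ 0) i ≡ + 0
         z zero    = refl
         z (suc i) = refl

  private
   Δ'-0 : ∀ g → (Δ' · g) 0 ≡ + 0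
   Δ'-0 g = Mod-0⇒≡ (Ord-· 24 0 {Δ'} {g} Ord-Δ' Ord-0 0 (s≤s z≤n))

   const-coeff : ∀ {v f c r} → v ≢ 1 → f ≋ const c · cb v ⊕ r → r 0 ≡ + 0 → f 0 ≡ c
   const-coeff {v} {f} {c} {r} v≢1 p r0 = trans (SMod-0⇒≡ p 0) (trans (⊕-at _ r 0) (trans (cong₂ _+_ (trans (const-·-≡ c (cb v) 0)
    (trans (cong (_*_ c) (cb-0 v v≢1)) (ZP.*-identityʳ c))) r0) (ZP.+-identityʳ c)))

   +0 : ∀ {f} → f ≋ f ⊕ const (+ 0)
   +0 {f} = solve 1 (λ f → f := f :+ con (+ 0)) rfl f

  -- The constant term of c cb v + Δ' g is c. If it vanishes modulo M, then c drops out and Δ'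
  -- divides; a form whose splitting has no Δ' part is then zero modulo M.
  divide-Δ' : ∀ h {v f} → Iso v f → Ord M (h N.* 24) f →
        (∃ λ w → ∃ λ g → v ≡ h N.* 6 N.+ w × Iso w g × SMod M f (Δ' ↑ h · g)) ⊎ SMod M f (const (+ 0))
  divide-Δ' zero {v} {f} p o = inj₁ (v , f , refl , p , exact (sm (*-identityˡ f)))
  divide-Δ' (suc h) {v} {f} p o = step (split p) (v N.≟ 1)
   where
   Result : Set
   Result = (∃ λ w → ∃ λ g → v ≡ suc h N.* 6 N.+ w × Iso w g × SMod M f (Δ' ↑ suc h · g)) ⊎ SMod M f (const (+ 0))
   c≈0 : ∀ {c r} → v ≢ 1 → f ≋ const c · cb v ⊕ r → r 0 ≡ + 0 → SMod M (const c) (const (+ 0))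
   c≈0 v≢1 q r0 = Mod⇒const (Mod-tr (≡⇒Mod (sym (const-coeff v≢1 q r0))) (o 0 (s≤s z≤n)))
   step : Split v f → Dec (v ≡ 1) → Result
   step (small c q) (yes refl) = inj₂ (exact (tr q (zeroʳ _)))
   step (small c q) (no v≢1) = inj₂ (≈M-trans (exact q) (≈M-trans (*M-cong (c≈0 {r = const (+ 0)} v≢1 (tr q +0) refl) ≈M-refl) (exact (zeroˡ (cb v)))))
   step (big c w g refl b q) (yes ())
   step (big c w g v≡ b q) (no v≢1) = next (divide-Δ' h b (Δ'-cancel-Ord (h N.* 24) λ n n< → Mod-tr (Mod-sym (at f≈ n)) (o n n<)))
    where
    f≈ : SMod M f (Δ' · g)
    f≈ = ≈M-trans (exact q) (≈M-trans (+M-cong (*M-cong (c≈0 v≢1 q (Δ'-0 g)) ≈M-refl) ≈M-refl)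
       (exact (solve 2 (λ x y → con (+ 0) :* x :+ y := y) rfl (cb v) (Δ' · g))))
    next : (∃ λ w' → ∃ λ g' → w ≡ h N.* 6 N.+ w' × Iso w' g' × SMod M g (Δ' ↑ h · g')) ⊎ SMod M g (const (+ 0)) → Result
    next (inj₁ (w' , g' , w≡ , b' , q')) = inj₁ (w' , g' , trans v≡ (cong (6 N.+_) w≡) , b' ,
     ≈M-trans f≈ (≈M-trans (*M-cong ≈M-refl q') (exact (sm (*-assoc _ _ _)))))
    next (inj₂ z) = inj₂ (≈M-trans f≈ (≈M-trans (*M-cong ≈M-refl z) (exact (zeroʳ Δ'))))

  -- Divisibility of a series by M is divisibility inside the module of integral forms: the constant
  -- term c is divisible, so Δ' g is, so g is by cancelling Δ', and g has smaller weight. This is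
  -- what permits dividing congruences of forms by powers of m.
  saturate : ∀ {v f} → Iso v f → SMod M f (const (+ 0)) → ∃ λ g → Iso v g × f ≋ const M · g
  saturate {v} p z = go v NP.≤-refl p z
   where
   quo-eq : ∀ {c} (q : Mod M c (+ 0)) → const c ≋ const M · const (Mod.quo q)
   quo-eq q = tr (const≡ (trans (Mod.eq q) (trans (ZP.+-identityˡ _) (ZP.*-comm (Mod.quo q) M)))) (const-* M (Mod.quo q))
   go : ∀ n {v f} → v N.≤ n → Iso v f → SMod M f (const (+ 0)) → ∃ λ g → Iso v g × f ≋ const M · g
   go n {v} {f} v≤n p z = step n v≤n (split p) (v N.≟ 1)
    where
    c≡0 : ∀ {c r} → v ≢ 1 → f ≋ const c · cb v ⊕ r → r 0 ≡ + 0 → Mod M c (+ 0)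
    c≡0 v≢1 q r0 = Mod-tr (≡⇒Mod (sym (const-coeff v≢1 q r0))) (at z 0)
    step : ∀ n → v N.≤ n → Split v f → Dec (v ≡ 1) → ∃ λ g → Iso v g × f ≋ const M · g
    step n _ (small c q) (yes refl) = const (+ 0) , iso-0 , tr q (tr (zeroʳ _) (sm (zeroʳ _)))
    step n _ (small c q) (no v≢1) = const (Mod.quo c₀) · cb v , iso-scale _ (iso-cb v) , tr q (tr (*c (quo-eq c₀) rfl) (*-assoc _ _ _))
     where c₀ : Mod M c (+ 0)
           c₀ = c≡0 {r = const (+ 0)} v≢1 (tr q +0) refl
    step n _ (big c w g refl b q) (yes ())
    step (suc n) (s≤s w≤n) (big c w g refl b q) (no v≢1) = fin (go n (NP.≤-trans (NP.m≤n+m w 5) w≤n) b (Δ'-cancel g≈))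
     where
     c₀ : Mod M c (+ 0)
     c₀ = c≡0 v≢1 q (Δ'-0 g)
     g≈ : SMod M (Δ' · g) (const (+ 0))
     g≈ = ≈M-trans (exact (solve 2 (λ x y → y := con (+ 0) :* x :+ y) rfl (cb v) (Δ' · g)))
        (≈M-trans (+M-cong (*M-cong (Mod⇒const (Mod-sym c₀)) ≈M-refl) ≈M-refl) (≈M-trans (exact (sm q)) z))
     fin : (∃ λ g' → Iso w g' × g ≋ const M · g') → ∃ λ g → Iso v g × f ≋ const M · g
     fin (g' , b' , q') = const (Mod.quo c₀) · cb v ⊕ Δ' · g' , iso-⊕ (iso-scale _ (iso-cb v)) (iso-· iso-Δ' b') ,
      tr q (tr (+c (*c (quo-eq c₀) rfl) (*c rfl q'))
       (solve 5 (λ m k x d g → m :* k :* x :+ d :* (m :* g) := m :* (k :* x :+ d :* g)) rfl (const M) (const (Mod.quo c₀)) (cb v) Δ' g'))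

open Isobaric

-- Bol's identity for η times a modular form

module BolIdentity where

 open Z using (_+_; _*_; -_; _-_)

 open E

 D^ : ℕ → Ser → Ser
 D^ zero    f = f
 D^ (suc n) f = D (D^ n f)

 -- Rising products x (x+2) ⋯ (x+2i−2).

 ph : ℕ → ℤ → ℤ
 ph zero    x = + 1
 ph (suc i) x = x * ph i (x + + 2)

 ph-last : ∀ i x → ph (suc i) x ≡ ph i x * (x + + 2 * + i)
 ph-last zero    x = h x
  where h : ∀ x → x * + 1 ≡ + 1 * (x + + 0)
        h = ring
 ph-last (suc i) x = trans (cong (_*_ x) (ph-last i (x + + 2))) (h x (ph i (x + + 2)) (+ i))
  where h : ∀ x p i → x * (p * (x + + 2 + + 2 * i)) ≡ x * p * (x + + 2 * (+ 1 + i))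
        h = ring

 -- Bol's operator.  For P of weight 2v put W = 1 + 4v, twice the weight of ηP.  The modular forms
 -- bol 0, bol 1, … satisfy D^n(ηP) = η Σ_{i+j=n} C(n,i) ph i (W+2j) e^i (bol j), and
 -- every term with i ≥ 1 contains the factor W + 2n − 2.

 module Bol {v : ℕ} {P : Ser} (iP : Iso v P) where

  -- 4j(j + k - 1) with k = 2v + 1/2, the weight of ηP. This is 24² times the usual coefficient j(j
  -- + k - 1)/144 of E4 in the recursion for iterated Serre derivatives.
  κ : ℕ → ℤ
  κ j = + 2 * + j * (+ 2 * + j + + 4 * + v - + 1)

  Wt : ℤ
  Wt = + 1 + + 4 * + v

  -- Two consecutive members are carried along because the recursion looks two steps back.
  bols : ∀ j → (∃ λ f → Iso (j N.+ v) f) × (∃ λ f → Iso (suc j N.+ v) f)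
  bols zero    = (P , iP) , (proj₁ (iso-D iP) , proj₁ (proj₂ (iso-D iP)))
  bols (suc j) = proj₂ (bols j) , next (bols j)
   where next : (∃ λ f → Iso (j N.+ v) f) × (∃ λ f → Iso (suc j N.+ v) f) → ∃ λ f → Iso (suc (suc j) N.+ v) f
         next ((a , ia) , (b , ib)) = proj₁ (iso-D ib) ⊝ const (κ (suc j)) · (E4 · a) ,
                        iso-⊝ (proj₁ (proj₂ (iso-D ib))) (iso-scale (κ (suc j)) (iso-E4 ia))

  bol : ℕ → Ser
  bol j = proj₁ (proj₁ (bols j))

  iso-bol : ∀ j → Iso (j N.+ v) (bol j)
  iso-bol j = proj₂ (proj₁ (bols j))

  bolpred : ℕ → Ser
  bolpred zero    = const (+ 0)
  bolpred (suc j) = bol j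

  D-bol : ∀ j → D (bol j) ≋ bol (suc j) ⊕ const (κ j) · (E4 · bolpred j) ⊕ const (+ 4 * (+ j + + v)) · (e · bol j)
  D-bol zero    = tr (proj₂ (proj₂ (iso-D iP))) (+c (solve 3 (λ f k x → f := f :+ k :* (x :* con (+ 0))) rfl _ (const (κ 0)) E4)
   (*c (const≡ (trans (ZP.pos-* 4 v) (cong (_*_ (+ 4)) (sym (ZP.+-identityˡ (+ v)))))) rfl))
  D-bol (suc j) = tr (proj₂ (proj₂ (iso-D (proj₂ (proj₂ (bols j))))))
   (+c (solve 2 (λ f x → f := f :- x :+ x) rfl _ (const (κ (suc j)) · (E4 · bol j)))
    (*c (const≡ (ZP.pos-* 4 (suc j N.+ v))) rfl))

  private
   c : ℕ → ℕ → ℤ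
   c i j = + bin i j * ph i (Wt + + 2 * + j)

   epred : ℕ → Ser
   epred zero    = const (+ 0)
   epred (suc i) = e ↑ i

   D-e↑ : ∀ i → D (e ↑ i) ≋ const (+ 2 * + i) · e ↑ suc i ⊝ const (+ 2 * + i) · (E4 · epred i)
   D-e↑ zero    = tr (D-const (+ 1)) (solve 2 (λ x y → con (+ 0) := con (+ 0) :* x :- con (+ 0) :* (y :* con (+ 0))) rfl (e ↑ 1) E4)
   D-e↑ (suc i) = tr (D-↑ e i) (tr (*c rfl D-e)
    (tr (solve 4 (λ k p e x → k :* p :* (con (+ 2) :* e :^ 2 :- con (+ 2) :* x) := con (+ 2) :* k :* (e :* (e :* p)) :- con (+ 2) :* k :* (x :* p)) rfl (const (+ suc i)) (e ↑ i) e E4)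
     (+c (*c (sm (const-* (+ 2) (+ suc i))) rfl) (-c (*c (sm (const-* (+ 2) (+ suc i))) rfl)))))

   F A B C G : ℕ → ℕ → Ser
   F i j = const (c i j) · (e ↑ i · bol j)
   A i j = const (c i j * (Wt + + 2 * + i + + 4 * + j)) · (e ↑ suc i · bol j)
   B i j = const (c i j) · (e ↑ i · bol (suc j))
   C i j = const (c i j * κ j) · (E4 · (e ↑ i · bolpred j))
   G i j = const (c i j * (+ 2 * + i)) · (E4 · (epred i · bol j))

   D-hs : ∀ n F → D (hs n F) ≋ hs n (λ i j → D (F i j))
   D-hs zero    F = rfl
   D-hs (suc n) F = tr (D-⊕ _ _) (+c rfl (D-hs n λ i j → F (suc i) j))

   term : ∀ i j → e · F i j ⊕ D (F i j) ≋ (A i j ⊕ B i j) ⊕ (C i j ⊝ G i j)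
   term i j = begin
    e · F i j ⊕ D (F i j)
     ≈⟨ +c rfl (tr (D-const-· (c i j) _) (*c rfl (tr (D-· (e ↑ i) (bol j)) (+c (*c (D-e↑ i) rfl) (*c rfl (D-bol j)))))) ⟩
    e · (k · (p · h)) ⊕ k · ((a · (e · p) ⊝ a · (E4 · epred i)) · h ⊕ p · (h⁺ ⊕ const (κ j) · (E4 · h⁻) ⊕ w · (e · h)))
     ≈⟨ solve 11 (λ e k p h a x ep h⁺ κ h⁻ w → e :* (k :* (p :* h)) :+ k :* ((a :* (e :* p) :- a :* (x :* ep)) :* h :+ p :* (h⁺ :+ κ :* (x :* h⁻) :+ w :* (e :* h)))
       := (k :* (con (+ 1) :+ a :+ w) :* (e :* p :* h) :+ k :* (p :* h⁺)) :+ (k :* κ :* (x :* (p :* h⁻)) :- k :* a :* (x :* (ep :* h)))) rfl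
       e k p h a E4 (epred i) h⁺ (const (κ j)) h⁻ w ⟩
    (k · (const (+ 1) ⊕ a ⊕ w) · (e · p · h) ⊕ k · (p · h⁺)) ⊕ (k · const (κ j) · (E4 · (p · h⁻)) ⊝ k · a · (E4 · (epred i · h)))
     ≈⟨ +c (+c (*c (tr (*c rfl (sm (tr (const≡ (r (+ v) (+ i) (+ j))) (tr (const-+ _ _) (+c (const-+ (+ 1) (+ 2 * + i)) rfl)))))
       (sm (const-* (c i j) (Wt + + 2 * + i + + 4 * + j)))) rfl) rfl)
       (+c (*c (sm (const-* _ _)) rfl) (-c (*c (sm (const-* _ _)) rfl))) ⟩
    (A i j ⊕ B i j) ⊕ (C i j ⊝ G i j) ∎
    where
    open ≈-Reasoning
    k p h a h⁺ h⁻ w : Ser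
    k = const (c i j)
    p = e ↑ i
    h = bol j
    a = const (+ 2 * + i)
    h⁺ = bol (suc j)
    h⁻ = bolpred j
    w = const (+ 4 * (+ j + + v))
    r : ∀ v i j → + 1 + + 4 * v + + 2 * i + + 4 * j ≡ + 1 + + 2 * i + + 4 * (j + v)
    r = ring

   bin0 : ∀ i → bin i 0 ≡ 1
   bin0 zero    = refl
   bin0 (suc i) = refl

   balanceℤ : ∀ i j → (+ 1 + + i) * + bin (suc i) j ≡ (+ 1 + + j) * + bin i (suc j)
   balanceℤ i j = trans (sym (ZP.pos-* (suc i) (bin (suc i) j))) (trans (cong +_ (bin-balance i j)) (ZP.pos-* (suc j) (bin i (suc j))))

   -- Pascal's rule for the coefficients C(n,i) ph i (W + 2j). As the argument of `ph` moves with j,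
   -- it needs the balance between adjacent binomial coefficients as well.
   hs-AB : ∀ n → hs n A ⊕ hs n B ≋ hs (suc n) F
   hs-AB n = tr (hs-shift n A B) (+c rfl (hs-cong n pascal))
    where
    pascal : ∀ i j → shiftij A B (suc i) j ≋ F (suc i) j
    pascal i zero = *c (const≡ (trans (cong₂ (λ b x → + b * ph i x * (Wt + + 2 * + i + + 4 * + 0)) (bin0 i) refl) (trans (r (ph i (Wt + + 2 * + 0)) Wt (+ i))
      (cong (_*_ (+ 1)) (sym (ph-last i (Wt + + 2 * + 0))))))) rfl
     where r : ∀ p W i → + 1 * p * (W + + 2 * i + + 4 * + 0) ≡ + 1 * (p * (W + + 2 * + 0 + + 2 * i))
           r = ring
    pascal i (suc j) = tr (sm (distribʳ (e ↑ suc i · bol (suc j)) (const a1) (const a2))) (*c (tr (sm (const-+ a1 a2)) (const≡ eq)) rfl)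
     where
     a1 a2 x q : ℤ
     a1 = c i (suc j) * (Wt + + 2 * + i + + 4 * + suc j)
     a2 = c (suc i) j
     x = Wt + + 2 * + j
     q = ph i (x + + 2)
     s : Wt + + 2 * + suc j ≡ x + + 2
     s = r Wt (+ j)
      where r : ∀ W j → W + + 2 * (+ 1 + j) ≡ W + + 2 * j + + 2
            r = ring
     eq : a1 + a2 ≡ + bin (suc i) (suc j) * ph (suc i) (Wt + + 2 * + suc j)
     eq = begin
      + bin i (suc j) * ph i (Wt + + 2 * + suc j) * (Wt + + 2 * + i + + 4 * + suc j) + + bin (suc i) j * (x * q)
       ≡⟨ cong (λ z → + bin i (suc j) * ph i z * (Wt + + 2 * + i + + 4 * + suc j) + + bin (suc i) j * (x * q)) s ⟩
      + bin i (suc j) * q * (Wt + + 2 * + i + + 4 * + suc j) + + bin (suc i) j * (x * q)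
       ≡⟨ r1 (+ bin i (suc j)) q Wt (+ i) (+ j) (+ bin (suc i) j) ⟩
      + 2 * q * ((+ 1 + + j) * + bin i (suc j)) + (+ bin i (suc j) * (x + + 2 + + 2 * + i) + + bin (suc i) j * x) * q
       ≡⟨ cong (λ z → + 2 * q * z + (+ bin i (suc j) * (x + + 2 + + 2 * + i) + + bin (suc i) j * x) * q) (sym (balanceℤ i j)) ⟩
      + 2 * q * ((+ 1 + + i) * + bin (suc i) j) + (+ bin i (suc j) * (x + + 2 + + 2 * + i) + + bin (suc i) j * x) * q
       ≡⟨ r2 q (+ i) (+ bin (suc i) j) (+ bin i (suc j)) x ⟩
      (+ bin i (suc j) + + bin (suc i) j) * (q * (x + + 2 + + 2 * + i))
       ≡⟨ cong (_*_ (+ bin (suc i) (suc j))) (trans (sym (ph-last i (x + + 2))) (cong (ph (suc i)) (sym s))) ⟩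
      + bin (suc i) (suc j) * ph (suc i) (Wt + + 2 * + suc j) ∎
      where
      open ≡-Reasoning
      r1 : ∀ b q W i j b' → b * q * (W + + 2 * i + + 4 * (+ 1 + j)) + b' * ((W + + 2 * j) * q) ≡
        + 2 * q * ((+ 1 + j) * b) + (b * (W + + 2 * j + + 2 + + 2 * i) + b' * (W + + 2 * j)) * q
      r1 = ring
      r2 : ∀ q i b' b x → + 2 * q * ((+ 1 + i) * b') + (b * (x + + 2 + + 2 * i) + b' * x) * q ≡ (b + b') * (q * (x + + 2 + + 2 * i))
      r2 = ring

   hs-last : ∀ n H → hs (suc n) H ≋ hs n (λ i j → H i (suc j)) ⊕ H (suc n) 0
   hs-last zero    H = rfl
   hs-last (suc n) H = tr (+c rfl (hs-last n λ i j → H (suc i) j)) (sm (solve 3 (λ a b c → a :+ b :+ c := a :+ (b :+ c)) rfl (H 0 (suc (suc n))) (hs n (λ i j → H (suc i) (suc j))) (H (suc (suc n)) 0)))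

   -- The E4 terms from D (bol j) and those from the powers of e cancel after an index shift; κ is
   -- chosen to make this happen.
   hs-CG : ∀ n → hs n C ≋ hs n G
   hs-CG zero    = solve 2 (λ k x → k :* (x :* (con (+ 1) :* con (+ 0))) := con (+ 0)) rfl (const (c 0 0 * κ 0)) E4 ⟫
           sm (solve 3 (λ k x b → k :* (x :* (con (+ 0) :* b)) := con (+ 0)) rfl (const (c 0 0 * (+ 2 * + 0))) E4 P)
    where _⟫_ : ∀ {a b c} → a ≋ b → b ≋ c → a ≋ c
          _⟫_ = tr
   hs-CG (suc n) = begin
    hs (suc n) C ≈⟨ hs-last n C ⟩
    hs n (λ i j → C i (suc j)) ⊕ C (suc n) 0 ≈⟨ +c (hs-cong n λ i j → *c (const≡ (eq i j)) rfl)
     (solve 3 (λ k x p → k :* (x :* (p :* con (+ 0))) := con (+ 0)) rfl (const (c (suc n) 0 * κ 0)) E4 (e ↑ suc n)) ⟩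
    hs n (λ i j → G (suc i) j) ⊕ const (+ 0)
     ≈⟨ solve 4 (λ h k x b → h :+ con (+ 0) := k :* (x :* (con (+ 0) :* b)) :+ h) rfl _ (const (c 0 (suc n) * (+ 2 * + 0))) E4 (bol (suc n)) ⟩
    hs (suc n) G ∎
    where
    open ≈-Reasoning
    eq : ∀ i j → c i (suc j) * κ (suc j) ≡ c (suc i) j * (+ 2 * + suc i)
    eq i j = trans (cong (λ z → + bin i (suc j) * ph i z * κ (suc j)) (s Wt (+ j)))
     (trans (r1 (+ bin i (suc j)) (ph i (Wt + + 2 * + j + + 2)) (+ j) (+ v))
     (trans (cong (λ z → + 2 * z * ((Wt + + 2 * + j) * ph i (Wt + + 2 * + j + + 2))) (sym (balanceℤ i j)))
      (r2 (+ i) (+ bin (suc i) j) ((Wt + + 2 * + j) * ph i (Wt + + 2 * + j + + 2)))))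
     where
     s : ∀ W j → W + + 2 * (+ 1 + j) ≡ W + + 2 * j + + 2
     s = ring
     r1 : ∀ b q j v → b * q * (+ 2 * (+ 1 + j) * (+ 2 * (+ 1 + j) + + 4 * v - + 1)) ≡ + 2 * ((+ 1 + j) * b) * ((+ 1 + + 4 * v + + 2 * j) * q)
     r1 = ring
     r2 : ∀ i b y → + 2 * ((+ 1 + i) * b) * y ≡ b * y * (+ 2 * (+ 1 + i))
     r2 = ring

   hs-⊝ : ∀ n H H' → hs n (λ i j → H i j ⊝ H' i j) ≋ hs n H ⊝ hs n H'
   hs-⊝ n H H' = tr (hs-⊕ n H (λ i j → ⊖ H' i j)) (+c rfl (neg n H'))
    where neg : ∀ n H → hs n (λ i j → ⊖ H i j) ≋ ⊖ hs n H
          neg zero    H = rfl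
          neg (suc n) H = tr (+c rfl (neg n λ i j → H (suc i) j)) (solve 2 (λ a b → :- a :- b := :- (a :+ b)) rfl (H 0 (suc n)) _)

  expansion : ∀ n → D^ n (η · P) ≋ η · hs n (λ i j → const (+ bin i j * ph i (Wt + + 2 * + j)) · (e ↑ i · bol j))
  expansion zero    = *c rfl (solve 1 (λ p → p := con (+ 1) :* (con (+ 1) :* p)) rfl P)
  expansion (suc n) = begin
   D (D^ n (η · P)) ≈⟨ D-cong (expansion n) ⟩
   D (η · hs n F) ≈⟨ tr (D-· η _) (+c (*c D-η rfl) (*c rfl (D-hs n F))) ⟩
   e · η · hs n F ⊕ η · hs n (λ i j → D (F i j))
    ≈⟨ solve 4 (λ e h x y → e :* h :* x :+ h :* y := h :* (e :* x :+ y)) rfl e η (hs n F) (hs n (λ i j → D (F i j))) ⟩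
   η · (e · hs n F ⊕ hs n (λ i j → D (F i j)))
    ≈⟨ *c rfl (tr (+c (sm (hs-· n e F)) rfl) (tr (sm (hs-⊕ n (λ i j → e · F i j) (λ i j → D (F i j)))) (hs-cong n term))) ⟩
   η · hs n (λ i j → (A i j ⊕ B i j) ⊕ (C i j ⊝ G i j))
    ≈⟨ *c rfl (tr (hs-⊕ n (λ i j → A i j ⊕ B i j) (λ i j → C i j ⊝ G i j)) (+c (hs-⊕ n A B) (hs-⊝ n C G))) ⟩
   η · ((hs n A ⊕ hs n B) ⊕ (hs n C ⊝ hs n G))
    ≈⟨ *c rfl (+c (hs-AB n) (+c (hs-CG n) rfl)) ⟩
   η · (hs (suc n) F ⊕ (hs n G ⊝ hs n G))
    ≈⟨ *c rfl (solve 2 (λ a b → a :+ (b :- b) := a) rfl (hs (suc n) F) (hs n G)) ⟩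
   η · hs (suc n) F ∎
   where open ≈-Reasoning

  congruence : ∀ {M} n → Mod M (Wt + + 2 * + n - + 2) (+ 0) → SMod M (D^ n (η · P)) (η · bol n)
  congruence {M} n p = ≈M.tr (exact (expansion n)) (≈M.*c ≈M.rfl (≈M.tr (first n p)
    (exact (solve 1 (λ b → con (+ 1) :* (con (+ 1) :* b) := b) rfl (bol n)))))
   where
   module ≈M = SR M
   first : ∀ n → Mod M (Wt + + 2 * + n - + 2) (+ 0) → SMod M (hs n F) (F 0 n)
   first zero    p = ≈M.rfl
   first (suc n) p = ≈M.tr (≈M.+c ≈M.rfl (vanish n 0 refl)) (≈M.+-identityʳ _)
    where
    c≡0 : ∀ i j → i N.+ j ≡ n → Mod M (c (suc i) j) (+ 0)
    c≡0 i j refl = Mod-tr (≡⇒Mod (trans (cong (_*_ (+ bin (suc i) j)) (ph-last i (Wt + + 2 * + j))) (r (+ bin (suc i) j) (ph i (Wt + + 2 * + j)) Wt (+ i) (+ j))))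
     (Mod-tr (Mod-* {a = + bin (suc i) j * ph i (Wt + + 2 * + j)} Mod-refl p) (≡⇒Mod (ZP.*-zeroʳ (+ bin (suc i) j * ph i (Wt + + 2 * + j)))))
     where r : ∀ b q W i j → b * (q * (W + + 2 * j + + 2 * i)) ≡ b * q * (W + + 2 * (+ 1 + (i + j)) - + 2)
           r = ring
    vanish : ∀ l i0 → i0 N.+ l ≡ n → SMod M (hs l (λ i j → F (suc (i0 N.+ i)) j)) (const (+ 0))
    vanish zero    i0 q = ≈M.tr (≈M.*c (Mod⇒const (c≡0 (i0 N.+ 0) 0 (trans (NP.+-identityʳ (i0 N.+ 0)) q))) ≈M.rfl) (≈M.zeroˡ _)
    vanish (suc l) i0 q = ≈M.tr (≈M.+c (≈M.tr (≈M.*c (Mod⇒const (c≡0 (i0 N.+ 0) (suc l) (trans (cong (N._+ suc l) (NP.+-identityʳ i0)) q))) ≈M.rfl) (≈M.zeroˡ _))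
      (≈M.tr (hs-cong l λ i j → ≡⇒SMod λ z → cong (λ t → F (suc t) j z) (NP.+-suc i0 i)) (vanish l (suc i0) (trans (sym (NP.+-suc i0 l)) q)))) (≈M.+-identityˡ _)

open BolIdentity

-- E2 modulo m and a Hasse invariant

module HasseInvariant where

 open Z using (_+_; _*_; -_; _-_)

 open E using ()

 D^-at : ∀ n f N → D^ n f N ≡ (+ N) Z.^ n * f N
 D^-at zero    f N = sym (ZP.*-identityˡ (f N))
 D^-at (suc n) f N = trans (cong (_*_ (+ N)) (D^-at n f N)) (sym (ZP.*-assoc (+ N) ((+ N) Z.^ n) (f N)))

 D^-cong : ∀ {M} n {f g} → SMod M f g → SMod M (D^ n f) (D^ n g)
 D^-cong zero    p = p
 D^-cong (suc n) p = D-cong (D^-cong n p)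

 D^-+ : ∀ m n f → D^ (m N.+ n) f ≡ D^ m (D^ n f)
 D^-+ zero    n f = refl
 D^-+ (suc m) n f = cong D (D^-+ m n f)

 η-cancel : ∀ {M f g} → SMod M (η · f) (η · g) → SMod M f g
 η-cancel {M} {f} {g} p = unit1-cancel Êul Êul-0 (q^-cancel 1 (tr (h f) (tr p (sm (h g)))))
  where
  open SR M
  h : ∀ f → q^ 1 · (Êul · f) ≈ η · f
  h f = tr (sm (*-assoc (q^ 1) Êul f)) (*c (exact (E.sm η-def)) rfl)

 -- A multiplier on the coefficients of η only matters at squares.
 η-multiplier : ∀ {M} (φ ψ : ℕ → ℤ) → (∀ {a b} → Mod M (+ 2 * a) (+ 2 * b) → Mod M a b) →
        (∀ x → Mod M (φ (sq x)) (ψ (sq x))) → ∀ N → Mod M (φ N * η N) (ψ N * η N)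
 η-multiplier {M} φ ψ cancel p N = cancel (Mod-tr (≡⇒Mod (h φ)) (Mod-tr (sumL-Mod (box 1 N) term) (≡⇒Mod (sym (h ψ)))))
  where
  t : Vec ℤ 1 → ℤ
  t v = [ e1 1 v N.≟ N ] * χ (Vec.head v)
  h : ∀ φ → + 2 * (φ N * η N) ≡ sumL (box 1 N) λ v → t v * φ N
  h φ = trans (r (φ N) (η N)) (trans (cong (_* φ N) (trans (sym (const-·-≡ (+ 2) η N)) (sym (SMod-0⇒≡ θη≋2η N)))) (sym (sumL-*ʳ (box 1 N) (φ N) t)))
   where r : ∀ a b → + 2 * (a * b) ≡ + 2 * b * a
         r = ring
  term : ∀ v → Mod M (t v * φ N) (t v * ψ N)
  term (x ∷ []) = go (e1 1 (x ∷ []) N.≟ N)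
   where go : (d : Dec (e1 1 (x ∷ []) ≡ N)) → Mod M ([ d ] * χ x * φ N) ([ d ] * χ x * ψ N)
         go (yes q) = Mod-* {a = + 1 * χ x} Mod-refl (subst (λ n → Mod M (φ n) (ψ n)) (trans (sym (NP.*-identityˡ (sq x))) q) (p x))
         go (no _)  = Mod-refl

 +sq^ : ∀ x n → (+ sq x) Z.^ n ≡ x Z.^ (2 N.* n)
 +sq^ x n = trans (cong (Z._^ n) (trans (+sq x) (cong (_*_ x) (sym (ZP.*-identityʳ x))))) (ZP.^-*-assoc x 2 n)

 module Modular (d : ℕ) (pr : Prime (suc d)) (5≤m : 5 N.≤ suc d) where

  open PrimePowers d pr public

  private
   prime-∤ : ∀ c → 2 N.≤ c → c N.< m → ¬ (c ND.∣ m)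
   prime-∤ c 2≤c c<m c∣m with Prime.prime⇒irreducible pr c∣m
   ... | inj₁ refl = NP.<⇒≱ 2≤c NP.≤-refl
   ... | inj₂ refl = NP.<-irrefl refl c<m

  na-small : ∀ c → 1 N.≤ c → c N.< m → ¬ Mod (+ m) (+ c) (+ 0)
  na-small (suc c) _ c<m p = NP.<⇒≱ c<m (ND.∣⇒≤ (Mod⇒∣ {a = + suc c} p))

  2∤m : ¬ (2 ND.∣ m)
  2∤m = prime-∤ 2 NP.≤-refl (NP.≤-trans (s≤s (s≤s (s≤s z≤n))) 5≤m)

  3∤m : ¬ (3 ND.∣ m)
  3∤m = prime-∤ 3 (s≤s (s≤s z≤n)) (NP.≤-trans (s≤s (s≤s (s≤s (s≤s z≤n)))) 5≤m)

  private
   halve : ∀ n → (∃ λ k → n ≡ 2 N.* k) ⊎ (∃ λ k → n ≡ suc (2 N.* k))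
   halve zero = inj₁ (0 , refl)
   halve (suc n) with halve n
   ... | inj₁ (k , p) = inj₂ (k , cong suc p)
   ... | inj₂ (k , p) = inj₁ (suc k , trans (cong suc p) (sym (NP.*-suc 2 k)))

   d-even : ∃ λ k → d ≡ 2 N.* k
   d-even with halve d
   ... | inj₁ r = r
   ... | inj₂ (k , p) = ⊥-elim (2∤m (ND.divides (suc k) (trans (cong suc p) (trans (sym (NP.*-suc 2 k)) (NP.*-comm 2 (suc k))))))

  opaque

   μ : ℕ
   μ = proj₁ d-even

   d≡2μ : d ≡ 2 N.* μ
   d≡2μ = proj₂ d-even

  +m≡ : + m ≡ + 1 + + 2 * + μ
  +m≡ = cong (_+_ (+ 1)) (trans (cong +_ d≡2μ) (ZP.pos-* 2 μ))

  2≤μ : 2 N.≤ μ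
  2≤μ = NP.*-cancelˡ-≤ 2 (subst (4 N.≤_) d≡2μ (NP.≤-pred 5≤m))

  na-2 : ¬ Mod (+ m) (+ 2) (+ 0)
  na-2 = na-small 2 (s≤s z≤n) (NP.≤-trans (s≤s (s≤s (s≤s z≤n))) 5≤m)

  na-3 : ¬ Mod (+ m) (+ 3) (+ 0)
  na-3 = na-small 3 (s≤s z≤n) (NP.≤-trans (s≤s (s≤s (s≤s (s≤s z≤n)))) 5≤m)

  na-16 : ¬ Mod (+ m) (+ 16) (+ 0)
  na-16 = na-↑ {+ 2} 4 na-2

  na-1728 : ¬ Mod (+ m) (+ 1728) (+ 0)
  na-1728 = na-* {(+ 2) Z.^ 6} {(+ 3) Z.^ 3} (na-↑ {+ 2} 6 na-2) (na-↑ {+ 3} 3 na-3)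

  module Div (L : ℕ) = Division (pw L) (λ {a} p → unit-cancel-Mod L {+ 1728} na-1728 (Mod-tr p (≡⇒Mod (sym (ZP.*-zeroʳ (+ 1728))))))

  cancel-2 : ∀ L {a b} → Mod (pw L) (+ 2 * a) (+ 2 * b) → Mod (pw L) a b
  cancel-2 L = unit-cancel-Mod L {+ 2} na-2

  -- E2 modulo m.

  private
   module Bol0 = Bol (iso-const (+ 1))

  B : Ser
  B = Bol0.bol (suc μ)

  iso-B : Iso (suc μ) B
  iso-B = iso-≡ (NP.+-identityʳ (suc μ)) (Bol0.iso-bol (suc μ))

  -- The coefficients of η live at N = x², where N^(μ+1) = x^(m+1) ≡ x² = N by Fermat. So D η ≡
  -- D^(μ+1) η, and Bol's condition holds for n = μ + 1 because 2μ + 1 = m.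
  e≈B : SMod (pw 1) e B
  e≈B = η-cancel (begin
   η · e ≈⟨ *-comm η e ⟩
   e · η ≈⟨ exact (E.sm D-η) ⟩
   D η ≈⟨ smod (λ N → Mod-tr (η-multiplier (λ N → + N) (λ N → (+ N) Z.^ suc μ) (cancel-2 1) sq-pow N) (≡⇒Mod (sym (D^-at (suc μ) η N)))) ⟩
   D^ (suc μ) η ≈⟨ D^-cong (suc μ) (sm (*-identityʳ η)) ⟩
   D^ (suc μ) (η · const (+ 1)) ≈⟨ Bol0.congruence (suc μ) (Mod-tr (≡⇒Mod wt) (mod (+ 1) (trans (sym (ZP.*-identityˡ (pw 1))) (sym (ZP.+-identityˡ _))))) ⟩
   η · B ∎)
   where
   open SR (pw 1)
   open ≈-Reasoning
   wt : + 1 + + 4 * + 0 + + 2 * + suc μ - + 2 ≡ pw 1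
   wt = trans (h (+ μ)) (trans (sym +m≡) (sym pw-1))
    where h : ∀ μ → + 1 + + 4 * + 0 + + 2 * (+ 1 + μ) - + 2 ≡ + 1 + + 2 * μ
          h = ring
   sq-pow : ∀ x → Mod (pw 1) (+ sq x) ((+ sq x) Z.^ suc μ)
   sq-pow x = Mod-tr (≡⇒Mod (+sq x)) (Mod-tr (Mod-* {a = x} Mod-refl (Mod-sym (subst (λ M → Mod M (x Z.^ m) x) (sym pw-1) (fermat x))))
    (≡⇒Mod (trans (cong (λ k → x Z.^ suc (suc k)) d≡2μ) (trans (cong (x Z.^_) (sym (NP.*-suc 2 μ))) (sym (+sq^ x (suc μ)))))))

  -- A Hasse invariant: a form of half-weight μ = (m−1)/2 congruent to 1.

  private
   dB = iso-D iso-B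
   B' : Ser
   B' = proj₁ dB
   iso-B' : Iso (2 N.+ μ) B'
   iso-B' = proj₁ (proj₂ dB)
   dB' = iso-D iso-B'
   B″ : Ser
   B″ = proj₁ dB'
   iso-B″ : Iso (3 N.+ μ) B″
   iso-B″ = proj₁ (proj₂ dB')

   open SR (pw 1)

   -- 4μ = 2m - 2, so μ contributes only -2 to 4(k + μ) modulo m.
   weight≡ : ∀ k c → + (4 N.* (k N.+ μ)) ≡ c + + 2 * + m → SMod (pw 1) (const (+ (4 N.* (k N.+ μ)))) (const c)
   weight≡ k c p = Mod⇒const (Mod-tr (≡⇒Mod p) (mod (+ 2) (cong (λ z → c + + 2 * z) (sym pw-1))))

   B'≈ : B' ≈ const (- + 2) · E4
   B'≈ = begin
    B' ≈⟨ solve 2 (λ b x → b := (b :+ x) :- x) rfl B' (const (+ (4 N.* suc μ)) · (e · B)) ⟩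
    (B' ⊕ const (+ (4 N.* suc μ)) · (e · B)) ⊝ const (+ (4 N.* suc μ)) · (e · B)
     ≈⟨ +c (tr (exact (E.sm (proj₂ (proj₂ dB)))) (D-cong (sm e≈B))) (-c (*c (weight≡ 1 (+ 2) eq) (*c rfl (sm e≈B)))) ⟩
    D e ⊝ const (+ 2) · (e · e) ≈⟨ +c (exact D-e) rfl ⟩
    (const (+ 2) · e ↑ 2 ⊝ const (+ 2) · E4) ⊝ const (+ 2) · (e · e)
     ≈⟨ solve 2 (λ e a → (con (+ 2) :* e :^ 2 :- con (+ 2) :* a) :- con (+ 2) :* (e :* e) := con (- + 2) :* a) rfl e E4 ⟩
    const (- + 2) · E4 ∎
    where open ≈-Reasoning
          eq : + (4 N.* suc μ) ≡ + 2 + + 2 * + m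
          eq = trans (ZP.pos-* 4 (suc μ)) (trans (h (+ μ)) (cong (λ z → + 2 + + 2 * z) (sym +m≡)))
           where h : ∀ μ → + 4 * (+ 1 + μ) ≡ + 2 + + 2 * (+ 1 + + 2 * μ)
                 h = ring

   E6m : Ser
   E6m = B″ ⊕ const (+ 4) · (B · E4)

   E6m≈ : E6m ≈ const (+ 16) · E6
   E6m≈ = begin
    B″ ⊕ const (+ 4) · (B · E4) ≈⟨ solve 3 (λ b x y → b :+ y := (b :+ x) :- x :+ y) rfl B″ (k · (e · B')) (const (+ 4) · (B · E4)) ⟩
    (B″ ⊕ k · (e · B')) ⊝ k · (e · B') ⊕ const (+ 4) · (B · E4)
     ≈⟨ +c (+c (tr (exact (E.sm (proj₂ (proj₂ dB')))) (tr (D-cong B'≈) (tr (D-const-· (- + 2) E4) (*c rfl (exact D-E4)))))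
       (-c (*c (weight≡ 2 (+ 6) eq) (*c rfl B'≈)))) (*c rfl (*c (sm e≈B) rfl)) ⟩
    const (- + 2) · (const (+ 8) · (e · E4) ⊝ const (+ 8) · E6) ⊝ const (+ 6) · (e · (const (- + 2) · E4)) ⊕ const (+ 4) · (e · E4)
     ≈⟨ solve 3 (λ e a b → con (- + 2) :* (con (+ 8) :* (e :* a) :- con (+ 8) :* b) :- con (+ 6) :* (e :* (con (- + 2) :* a)) :+ con (+ 4) :* (e :* a)
       := con (+ 16) :* b) rfl e E4 E6 ⟩
    const (+ 16) · E6 ∎
    where
    open ≈-Reasoning
    k : Ser
    k = const (+ (4 N.* (2 N.+ μ)))
    eq : + (4 N.* (2 N.+ μ)) ≡ + 6 + + 2 * + m
    eq = trans (ZP.pos-* 4 (2 N.+ μ)) (trans (h (+ μ)) (cong (λ z → + 6 + + 2 * z) (sym +m≡)))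
     where h : ∀ μ → + 4 * (+ 2 + μ) ≡ + 6 + + 2 * (+ 1 + + 2 * μ)
           h = ring

   -- B' and `E6m` are congruent to -2 E4 and 16 E6 but have half-weight larger by μ. So H has
   -- half-weight 6 + μ and is congruent to 16 Δ'; its quotient by Δ' has half-weight μ and is
   -- congruent to 16.
   H : Ser
   H = const (- + 8) · (E4 · (E4 · B')) ⊝ E6 · E6m

   iso-H : Iso (6 N.+ μ) H
   iso-H = iso-⊝ (iso-scale (- + 8) (iso-E4 (iso-E4 iso-B')))
    (iso-E6 (iso-⊕ iso-B″ (iso-scale (+ 4) (iso-≡ (NP.+-comm (suc μ) 2) (iso-· iso-B iso-E4')))))

   H≈ : H ≈ const (+ 16) · Δ'
   H≈ = tr (+c (*c rfl (*c rfl (*c rfl B'≈))) (-c (*c rfl E6m≈)))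
    (tr (solve 2 (λ a b → con (- + 8) :* (a :* (a :* (con (- + 2) :* a))) :- b :* (con (+ 16) :* b) := con (+ 16) :* (a :^ 3 :- b :^ 2)) rfl E4 E6)
     (*c rfl (exact (E.sm Δ'-def))))

   Hasse : Set
   Hasse = ∃ λ A → Iso μ A × SMod (pw 1) A (const (+ 1))

   iso-rest : ∀ {w g} → 6 N.+ μ ≡ 6 N.+ w → Iso w g → Iso μ g
   iso-rest p ig = iso-≡ (sym (NP.+-cancelˡ-≡ 6 _ _ p)) ig

   H≉0 : ¬ (H ≈ const (+ 0))
   H≉0 z = na-* {+ 16} {+ 1728} na-16 na-1728 (subst (λ M → Mod M (+ 16 * + 1728) (+ 0)) pw-1
    (Mod-tr (≡⇒Mod (sym (trans (const-·-≡ (+ 16) Δ' 24) (cong (_*_ (+ 16)) Δ'-24)))) (Mod-tr (at (sm H≈) 24) (at z 24))))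

   g≈16 : ∀ {g} → H ≈ Δ' · g → g ≈ const (+ 16)
   g≈16 {g} q = SMod-diff (Div.Δ'-cancel 1 (tr (distribˡ Δ' g _) (tr (+c (tr (sm q) H≈) rfl)
     (solve 2 (λ d c → c :* d :+ d :* (:- c) := con (+ 0)) rfl Δ' (const (+ 16))))))

   hasse-of : (∃ λ w → ∃ λ g → 6 N.+ μ ≡ 6 N.+ w × Iso w g × H ≈ Δ' ↑ 1 · g) ⊎ H ≈ const (+ 0) → Hasse
   hasse-of (inj₂ z) = ⊥-elim (H≉0 z)
   hasse-of (inj₁ (w , g , w≡ , ig , q)) = const u · g , iso-scale u (iso-rest w≡ ig) ,
     tr (*c rfl (g≈16 (tr q (*c (*-identityʳ Δ') rfl))))
      (tr (*-comm _ _) (tr (sm (const-* (+ 16) u)) (Mod⇒const (proj₂ (unit 1 (+ 16) na-16)))))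
    where u : ℤ
          u = proj₁ (unit 1 (+ 16) na-16)

   Ord-H : Ord (pw 1) 24 H
   Ord-H = Ord-cong 24 (sm H≈) (Ord-·ˡ 24 (Div.OrdM-Δ' 1))

   opaque

    hasse : Hasse
    hasse = hasse-of (Div.divide-Δ' 1 1 iso-H Ord-H)

  opaque

   A : Ser
   A = proj₁ hasse

   iso-A : Iso μ A
   iso-A = proj₁ (proj₂ hasse)

   A≈1 : SMod (+ m) A (const (+ 1))
   A≈1 = subst (λ M → SMod M (proj₁ hasse) (const (+ 1))) pw-1 (proj₂ (proj₂ hasse))

open HasseInvariant

-- A form g with η g congruent to ±η(q^(m²)) modulo m^L

module ModularForms where

 open Z using (_+_; _*_; -_; _-_)

 open E using ()

 private
  χt-* : ∀ (i j : Fin 12) → χt ((toℕ i N.* toℕ j) NM.% 12) ≡ χt (toℕ i) * χt (toℕ j)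
  χt-* = from-yes dec
   where dec : Dec (∀ (i j : Fin 12) → χt ((toℕ i N.* toℕ j) NM.% 12) ≡ χt (toℕ i) * χt (toℕ j))
         dec = Finₚ.all? λ i → Finₚ.all? λ j → χt ((toℕ i N.* toℕ j) NM.% 12) Z.≟ χt (toℕ i) * χt (toℕ j)

 data Unit24 (r : ℕ) : Set where
  by-2  : ∀ k → r ≡ k N.* 2 → Unit24 r
  by-3 : ∀ k → r ≡ k N.* 3 → Unit24 r
  prime-to-6  : ∀ c → r N.* r ≡ 1 N.+ 24 N.* c → χt r * χt r ≡ + 1 → Unit24 r

 unit24 : ∀ r → r N.< 12 → Unit24 r
 unit24 0 _ = by-2 0 refl
 unit24 1 _ = prime-to-6 0 refl refl
 unit24 2 _ = by-2 1 refl
 unit24 3 _ = by-3 1 refl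
 unit24 4 _ = by-2 2 refl
 unit24 5 _ = prime-to-6 1 refl refl
 unit24 6 _ = by-2 3 refl
 unit24 7 _ = prime-to-6 2 refl refl
 unit24 8 _ = by-2 4 refl
 unit24 9 _ = by-3 3 refl
 unit24 10 _ = by-2 5 refl
 unit24 11 _ = prime-to-6 5 refl refl
 unit24 (suc (suc (suc (suc (suc (suc (suc (suc (suc (suc (suc (suc r)))))))))))) p =
  ⊥-elim (NP.<⇒≱ p (NP.m≤m+n 12 r))

 χ-* : ∀ x y → χ (x * y) ≡ χ x * χ y
 χ-* x y = trans (cong (λ n → χt (n NM.% 12)) (ZP.abs-* x y)) (trans (cong χt (NM.%-distribˡ-* a b 12))
   (trans (cong₂ (λ r s → χt ((r N.* s) NM.% 12)) (sym (Finₚ.toℕ-fromℕ< a<)) (sym (Finₚ.toℕ-fromℕ< b<)))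
    (trans (χt-* (Fin.fromℕ< a<) (Fin.fromℕ< b<)) (cong₂ (λ r s → χt r * χt s) (Finₚ.toℕ-fromℕ< a<) (Finₚ.toℕ-fromℕ< b<)))))
  where
  a b : ℕ
  a = Z.∣ x ∣
  b = Z.∣ y ∣
  a< : a NM.% 12 N.< 12
  a< = NM.m%n<n a 12
  b< : b NM.% 12 N.< 12
  b< = NM.m%n<n b 12

 module Forms (d : ℕ) (pr : Prime (suc d)) (5≤m : 5 N.≤ suc d) where

  open Modular d pr 5≤m public

  private
   unit24-m : Unit24 (m NM.% 12)
   unit24-m = unit24 (m NM.% 12) (NM.m%n<n m 12)

   m≡ : m ≡ m NM.% 12 N.+ m NM./ 12 N.* 12
   m≡ = NM.m≡m%n+[m/n]*n m 12

   by : ∀ c → 12 ≡ 12 NM./ 12 N.* 12 → c ND.∣ 12 → c ND.∣ m NM.% 12 → c ND.∣ m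
   by c _ c∣12 c∣r = subst (c ND.∣_) (sym m≡) (ND.∣m∣n⇒∣m+n c∣r (ND.∣-trans c∣12 (ND.n∣m*n (m NM./ 12))))

   square : Unit24 (m NM.% 12) → ∃ λ c → m N.* m ≡ 1 N.+ 24 N.* c
   square (by-2 k p)  = ⊥-elim (2∤m (by 2 refl (ND.divides 6 refl) (ND.divides k p)))
   square (by-3 k p) = ⊥-elim (3∤m (by 3 refl (ND.divides 4 refl) (ND.divides k p)))
   square (prime-to-6 c p _) = c N.+ (m NM.% 12 N.* (m NM./ 12) N.+ 6 N.* (m NM./ 12 N.* (m NM./ 12))) , trans (cong₂ N._*_ m≡ m≡) (trans (h (m NM.% 12) (m NM./ 12)) (trans (cong (N._+ 24 N.* (m NM.% 12 N.* (m NM./ 12) N.+ 6 N.* (m NM./ 12 N.* (m NM./ 12)))) p)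
     (h' c (m NM.% 12 N.* (m NM./ 12) N.+ 6 N.* (m NM./ 12 N.* (m NM./ 12))))))
    where h : ∀ r k → (r N.+ k N.* 12) N.* (r N.+ k N.* 12) ≡ r N.* r N.+ 24 N.* (r N.* k N.+ 6 N.* (k N.* k))
          h = ringN
          h' : ∀ c t → 1 N.+ 24 N.* c N.+ 24 N.* t ≡ 1 N.+ 24 N.* (c N.+ t)
          h' = ringN

   character : Unit24 (m NM.% 12) → χ (+ m) * χ (+ m) ≡ + 1
   character (by-2 k p)  = ⊥-elim (2∤m (by 2 refl (ND.divides 6 refl) (ND.divides k p)))
   character (by-3 k p) = ⊥-elim (3∤m (by 3 refl (ND.divides 4 refl) (ND.divides k p)))
   character (prime-to-6 c _ q) = q

  opaque

   c24 : ℕ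
   c24 = proj₁ (square unit24-m)

   m²≡ : m N.* m ≡ 1 N.+ 24 N.* c24
   m²≡ = proj₂ (square unit24-m)

  εm : ℤ
  εm = χ (+ m)

  εm² : εm * εm ≡ + 1
  εm² = character unit24-m

  pw-pos : ∀ L → pw L ≡ + (m N.^ L)
  pw-pos zero    = refl
  pw-pos (suc L) = trans (cong (_*_ (+ m)) (pw-pos L)) (sym (ZP.pos-* m (m N.^ L)))

  m^>0 : ∀ L → 1 N.≤ m N.^ L
  m^>0 zero    = NP.≤-refl
  m^>0 (suc L) = NP.*-mono-≤ {1} {m} (s≤s z≤n) (m^>0 L)

  n<m^n : ∀ n → n N.< m N.^ n
  n<m^n zero    = NP.≤-refl
  n<m^n (suc n) = NP.≤-trans (NP.≤-trans (s≤s (NP.m≤m+n (suc n) n)) (NP.≤-reflexive (h n)))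
    (NP.*-mono-≤ {2} {m} (s≤s d≥1) (n<m^n n))
   where h : ∀ n → suc (suc n N.+ n) ≡ 2 N.* suc n
         h = ringN

  -- Half-weights of forms modulo m^L are only defined modulo K L.

  K : ℕ → ℕ
  K L = m N.^ L N.* μ

  -- Congruent to 1 modulo m^L, so multiplication by it changes the half-weight by K L and nothing
  -- else.
  one : ℕ → Ser
  one L = A ↑ (m N.^ L)

  iso-one : ∀ L → Iso (K L) (one L)
  iso-one L = iso-↑ (m N.^ L) iso-A

  one≈1 : ∀ L → SMod (pw L) (one L) (const (+ 1))
  one≈1 L = pw-weaken {L} (SR.tr (pw (suc L)) (↑-lift L A≈1) (1-↑ (m N.^ L)))

  private
   -- 2 b L + 1 = m^L
   b : ℕ → ℕ
   b zero    = 0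
   b (suc L) = m N.* b L N.+ μ

   b-eq : ∀ L → m N.^ L ≡ suc (2 N.* b L)
   b-eq zero    = refl
   b-eq (suc L) = trans (cong (m N.*_) (b-eq L)) (trans (h m (b L)) (trans (cong (N._+ 2 N.* (m N.* b L)) (cong suc d≡2μ)) (h' μ (m N.* b L))))
    where h : ∀ m b → m N.* suc (2 N.* b) ≡ m N.+ 2 N.* (m N.* b)
          h = ringN
          h' : ∀ μ y → suc (2 N.* μ) N.+ 2 N.* y ≡ suc (2 N.* (y N.+ μ))
          h' = ringN

   -- a = (m^L + 1)/2 meets Bol's condition 2a - 1 = m^L at half-weight 0. A further a' = K L - a
   -- derivatives meet it again at half-weight a, since 4a + 2a' - 1 = m^L + 2 K L = m^(L+1).
   a a' : ℕ → ℕ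
   a L = suc (b L)
   a' L = K L N.∸ a L

   a≤K : ∀ L → a L N.≤ K L
   a≤K L = NP.≤-trans (s≤s (NP.m≤m+n (b L) _)) (NP.≤-trans (NP.≤-reflexive (sym (b-eq L)))
    (NP.≤-trans (NP.≤-reflexive (sym (NP.*-identityʳ _))) (NP.*-monoʳ-≤ (m N.^ L) (NP.≤-trans (s≤s z≤n) 2≤μ))))

   a+a' : ∀ L → a' L N.+ a L ≡ K L
   a+a' L = NP.m∸n+n≡m (a≤K L)

   2a-1 : ∀ L → + 2 * + a L - + 1 ≡ pw L
   2a-1 L = trans (h (+ b L)) (trans (cong (_+_ (+ 1)) (sym (ZP.pos-* 2 (b L)))) (trans (cong +_ (sym (b-eq L))) (sym (pw-pos L))))
    where h : ∀ b → + 2 * (+ 1 + b) - + 1 ≡ + 1 + + 2 * b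
          h = ring

   module Bol1 = Bol (iso-const (+ 1))
   module Bol2 (L : ℕ) = Bol (Bol1.iso-bol (a L))

   multiple : ∀ {M x} k → x ≡ k * M → Mod M x (+ 0)
   multiple k p = mod k (trans p (sym (ZP.+-identityˡ _)))

  -- D^(K L) η = η · h: two Bol operators, whose orders add up to K L.
  private
   h : ℕ → Ser
   h L = Bol2.bol L (a' L)

   iso-h : ∀ L → Iso (K L) (h L)
   iso-h L = iso-≡ (trans (cong (a' L N.+_) (NP.+-identityʳ (a L))) (a+a' L)) (Bol2.iso-bol L (a' L))

   D^K-η : ∀ L → SMod (pw L) (D^ (K L) η) (η · h L)
   D^K-η L = begin
    D^ (K L) η ≈⟨ ≡⇒SMod (λ n → cong (λ k → D^ k η n) (sym (a+a' L))) ⟩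
    D^ (a' L N.+ a L) η ≈⟨ ≡⇒SMod (λ n → cong (λ f → f n) (D^-+ (a' L) (a L) η)) ⟩
    D^ (a' L) (D^ (a L) η) ≈⟨ D^-cong (a' L) (tr (D^-cong (a L) (sm (*-identityʳ η))) (Bol1.congruence (a L)
     (multiple (+ 1) (trans (trans (r1 (+ a L)) (2a-1 L)) (sym (ZP.*-identityˡ (pw L))))))) ⟩
    D^ (a' L) (η · Bol1.bol (a L)) ≈⟨ Bol2.congruence L (a' L) (multiple (+ m) (trans (trans (cong (λ z → + 1 + + 4 * z + + 2 * + a' L - + 2) (cong +_ (NP.+-identityʳ (a L))))
      (r2 (+ a L) (+ a' L))) (trans (cong₂ _+_ (2a-1 L) (cong (_*_ (+ 2)) (trans (cong +_ (trans (NP.+-comm (a L) (a' L)) (a+a' L))) (trans (ZP.pos-* (m N.^ L) μ) (cong (_* + μ) (sym (pw-pos L)))))))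
      (trans (r3 (pw L) (+ μ)) (cong (_* pw L) (sym +m≡)))))) ⟩
    η · h L ∎
    where
    open SR (pw L)
    open ≈-Reasoning
    r1 : ∀ a → + 1 + + 4 * + 0 + + 2 * a - + 2 ≡ + 2 * a - + 1
    r1 = ring
    r2 : ∀ a a' → + 1 + + 4 * a + + 2 * a' - + 2 ≡ + 2 * a - + 1 + + 2 * (a + a')
    r2 = ring
    r3 : ∀ p μ → p + + 2 * (p * μ) ≡ (+ 1 + + 2 * μ) * p
    r3 = ring

  -- The substitution q ↦ q^(m²).

  vd : ℕ
  vd = d N.+ d N.* suc d

  V : Ser → Ser
  V = sub vd

  opaque

   -- Chosen so that η g is η - D^(K L) η modulo m^L; `one` replaces 1 to make the half-weights
   -- match.
   g : ℕ → Ser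
   g L = one L ⊝ h L

   iso-g : ∀ L → Iso (K L) (g L)
   iso-g L = iso-⊝ (iso-one L) (iso-h L)

   private
    η-g : ∀ L → SMod (pw L) (η · g L) (η ⊝ D^ (K L) η)
    η-g L = tr (solve 3 (λ x y z → x :* (y :- z) := x :* y :- x :* z) rfl η (one L) (h L))
     (+c (tr (*c rfl (one≈1 L)) (*-identityʳ η)) (-c (sm (D^K-η L))))
     where open SR (pw L)

  pw-power : ∀ {x} → Mod (+ m) x (+ 0) → ∀ L n → L N.≤ n → Mod (pw L) (x Z.^ n) (+ 0)
  pw-power {x} p zero n L≤n = multiple (x Z.^ n) (sym (ZP.*-identityʳ _))
  pw-power {x} p (suc L) (suc n) (s≤s L≤n) with p | pw-power p L n L≤n
  ... | mod k e1 | mod l e2 = mod (k * l) (trans (cong₂ _*_ e1 e2) (r k (+ m) l (pw L)))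
   where r : ∀ k m l p → (+ 0 + k * m) * (+ 0 + l * p) ≡ + 0 + k * l * (m * p)
         r = ring

  private
   m∣?_ : ∀ y → Dec (m ND.∣ Z.∣ y ∣)
   m∣? y = m ND.∣? Z.∣ y ∣

   quotient : ∀ {y} → Dec (m ND.∣ Z.∣ y ∣) → ℤ
   quotient {y} (yes p) = Mod.quo (∣⇒Mod {a = y} p)
   quotient (no _)  = + 0

   quotient-* : ∀ {y} (p : m ND.∣ Z.∣ y ∣) → + m * quotient {y} (yes p) ≡ y
   quotient-* {y} p = trans (ZP.*-comm (+ m) _) (trans (sym (ZP.+-identityˡ _)) (sym (Mod.eq (∣⇒Mod {a = y} p))))

   m∣mx : ∀ x → m ND.∣ Z.∣ + m * x ∣
   m∣mx x = subst (m ND.∣_) (sym (ZP.abs-* (+ m) x)) (ND.m∣m*n Z.∣ x ∣)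

   sq-m* : ∀ x → 1 N.* sq (+ m * x) ≡ (suc vd N.* 1) N.* sq x
   sq-m* x = trans (cong (λ n → 1 N.* (n N.* n)) (ZP.abs-* (+ m) x)) (r m Z.∣ x ∣)
    where r : ∀ m x → 1 N.* (m N.* x N.* (m N.* x)) ≡ (m N.* m N.* 1) N.* (x N.* x)
          r = ringN

   -- Substitute m x for the summation variable: multiplicativity of χ brings out εm, and the norm
   -- becomes m² x².
   th-multiples : ∀ N → (sumL (box 1 N) λ v → [ e1 1 v N.≟ N ] * (χ (Vec.head v) * [ m∣? Vec.head v ])) ≡ εm * th (suc vd N.* 1) χ N
   th-multiples N = sym (begin
    εm * th (suc vd N.* 1) χ N ≡⟨ sym (sumL-*ˡ (box 1 N) εm _) ⟩
    sumL (box 1 N) (λ v → εm * ([ e1 (suc vd N.* 1) v N.≟ N ] * χ (Vec.head v)))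
     ≡⟨ sumL-cong (box 1 N) term ⟩
    sumL (box 1 N) (F ∘ G)
     ≡⟨ sumL-bijection _≟ⱽ_ _≟ⱽ_ (box 1 N) (box 1 N) G G⁻ F onx ony ⟩
    sumL (box 1 N) F ∎)
    where
    open ≡-Reasoning
    F : Vec ℤ 1 → ℤ
    F v = [ e1 1 v N.≟ N ] * (χ (Vec.head v) * [ m∣? Vec.head v ])
    G G⁻ : Vec ℤ 1 → Vec ℤ 1
    G (x ∷ []) = + m * x ∷ []
    G⁻ (y ∷ []) = quotient {y} (m∣? y) ∷ []
    term : ∀ v → εm * ([ e1 (suc vd N.* 1) v N.≟ N ] * χ (Vec.head v)) ≡ F (G v)
    term (x ∷ []) = trans (r εm [ e1 (suc vd N.* 1) (x ∷ []) N.≟ N ] (χ x)) (cong₂ _*_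
     ([]-⇔ (e1 (suc vd N.* 1) (x ∷ []) N.≟ N) (e1 1 (+ m * x ∷ []) N.≟ N) (λ p → trans (sq-m* x) p) (λ p → trans (sym (sq-m* x)) p))
     (cong₂ _*_ (sym (χ-* (+ m) x)) (sym ([]-yes (m∣? (+ m * x)) (m∣mx x)))))
     where r : ∀ e t c → e * (t * c) ≡ t * (e * c * + 1)
           r = ring
    proper : ∀ v {n} → e1 1 v ≡ n → InBox n v
    proper v refl = e1-proper {1} (s≤s z≤n) v
    proper' : ∀ v {n} → e1 (suc vd N.* 1) v ≡ n → InBox n v
    proper' v refl = e1-proper {suc vd N.* 1} (s≤s z≤n) v
    G⁻G : ∀ v → G⁻ (G v) ≡ v
    G⁻G (x ∷ []) = cong (_∷ []) (go (m∣? (+ m * x)))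
     where go : (d : Dec (m ND.∣ Z.∣ + m * x ∣)) → quotient {+ m * x} d ≡ x
           go (yes p) = ZP.*-cancelˡ-≡ (+ m) _ x (quotient-* {+ m * x} p)
           go (no ¬p) = ⊥-elim (¬p (m∣mx x))
    onx : ∀ v → F (G v) ≢ + 0 → Enumerates _≟ⱽ_ (box 1 N) (G v) × G⁻ (G v) ≡ v
    onx v nz = box-enumerates N (G v) (proper (G v) ([]*-≢0 (e1 1 (G v) N.≟ N) nz)) , G⁻G v
    ony : ∀ v → F v ≢ + 0 → Enumerates _≟ⱽ_ (box 1 N) (G⁻ v) × G (G⁻ v) ≡ v
    ony (y ∷ []) nz = box-enumerates N _ (proper' (G⁻ (y ∷ [])) (trans (sym (sq-m* (quotient {y} (m∣? y)))) (trans (cong (λ z → 1 N.* sq z) gq) q))) , cong (_∷ []) gq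
     where
     q : e1 1 (y ∷ []) ≡ N
     q = []*-≢0 (e1 1 (y ∷ []) N.≟ N) nz
     go : (d : Dec (m ND.∣ Z.∣ y ∣)) → χ y * [ d ] ≢ + 0 → + m * quotient {y} d ≡ y
     go (yes p) _ = quotient-* {y} p
     go (no _) nz' = ⊥-elim (nz' (ZP.*-zeroʳ (χ y)))
     gq : + m * quotient {y} (m∣? y) ≡ y
     gq = go (m∣? y) (*-≢0 {[ e1 1 (y ∷ []) N.≟ N ]} nz)

  -- At N = x² the multiplier 1 - N^(K L) is 1 - x^(m^L (m-1)). It is 0 for x prime to m by Euler,
  -- and 1 for m | x because the exponent is at least L.
  g-η : ∀ L → SMod (pw L) (η · g L) (const εm · V η)
  g-η L = tr (η-g L) (unit-cancel-const L {+ 2} na-2 (smod λ N → Mod-tr (≡⇒Mod (lhs N)) (Mod-tr (sumL-Mod (box 1 N) (term N)) (≡⇒Mod (trans (th-multiples N) (rhs N))))))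
   where
   open SR (pw L)
   lhs : ∀ N → (const (+ 2) · (η ⊝ D^ (K L) η)) N ≡ sumL (box 1 N) λ v → [ e1 1 v N.≟ N ] * χ (Vec.head v) * (+ 1 - (+ N) Z.^ K L)
   lhs N = trans (const-·-≡ (+ 2) _ N) (trans (cong (_*_ (+ 2)) (trans (⊕-at η _ N) (cong (_+_ (η N)) (trans (⊖-at _ N) (cong -_ (D^-at (K L) η N))))))
    (trans (r (η N) ((+ N) Z.^ K L)) (trans (cong (_* (+ 1 - (+ N) Z.^ K L)) (trans (sym (const-·-≡ (+ 2) η N)) (sym (SMod-0⇒≡ θη≋2η N))))
     (sym (sumL-*ʳ (box 1 N) (+ 1 - (+ N) Z.^ K L) _)))))
    where r : ∀ a b → + 2 * (a - b * a) ≡ + 2 * a * (+ 1 - b)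
          r = ring
   rhs : ∀ N → εm * th (suc vd N.* 1) χ N ≡ (const (+ 2) · (const εm · V η)) N
   rhs N = sym (trans (const-·-≡ (+ 2) _ N) (trans (cong (_*_ (+ 2)) (const-·-≡ εm (V η) N)) (trans (r εm (V η N)) (cong (_*_ εm)
    (trans (sym (const-·-≡ (+ 2) (V η) N)) (trans (sym (SMod-0⇒≡ (E.tr (sub-cong vd θη≋2η) (E.tr (sub-· vd _ η) (E.*c (sub-const vd (+ 2)) E.rfl))) N))
     (SMod-0⇒≡ (sub-th vd 1 χ (s≤s z≤n)) N)))))))
    where r : ∀ e a → + 2 * (e * a) ≡ e * (+ 2 * a)
          r = ring
   2K : 2 N.* K L ≡ m N.^ L N.* d
   2K = trans (r (m N.^ L) μ) (cong (m N.^ L N.*_) (sym d≡2μ))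
    where r : ∀ p μ → 2 N.* (p N.* μ) ≡ p N.* (2 N.* μ)
          r = ringN
   L≤2K : L N.≤ 2 N.* K L
   L≤2K = NP.≤-trans (NP.<⇒≤ (n<m^n L)) (NP.≤-trans (NP.m≤m*n (m N.^ L) d {{N.>-nonZero d≥1}}) (NP.≤-reflexive (sym 2K)))
   indicator : ∀ y (d : Dec (m ND.∣ Z.∣ y ∣)) → Mod (pw L) (+ 1 - (+ sq y) Z.^ K L) [ d ]
   indicator y (yes p) = Mod-tr (Mod-+ {a = + 1} Mod-refl (Mod-neg (Mod-tr (≡⇒Mod (+sq^ y (K L))) (pw-power (∣⇒Mod {a = y} p) L (2 N.* K L) L≤2K)))) Mod-refl
   indicator y (no ¬p) = Mod-+ {a = + 1} Mod-refl (Mod-neg (Mod-tr (≡⇒Mod (trans (+sq^ y (K L)) (cong (y Z.^_) 2K)))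
    (Mod-weaken (+ m) (euler L y λ q → ¬p (Mod⇒∣ q)))))
   term : ∀ N v → Mod (pw L) ([ e1 1 v N.≟ N ] * χ (Vec.head v) * (+ 1 - (+ N) Z.^ K L)) ([ e1 1 v N.≟ N ] * (χ (Vec.head v) * [ m∣? Vec.head v ]))
   term N (y ∷ []) = go (e1 1 (y ∷ []) N.≟ N)
    where go : (d : Dec (e1 1 (y ∷ []) ≡ N)) → Mod (pw L) ([ d ] * χ y * (+ 1 - (+ N) Z.^ K L)) ([ d ] * (χ y * [ m∣? y ]))
          go (yes q) = Mod-tr (Mod-* {a = + 1 * χ y} Mod-refl (subst (λ n → Mod (pw L) (+ 1 - (+ n) Z.^ K L) [ m∣? y ]) (trans (sym (NP.*-identityˡ (sq y))) q) (indicator y (m∣? y))))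
                  (≡⇒Mod (ZP.*-assoc (+ 1) (χ y) [ m∣? y ]))
          go (no _) = Mod-refl

open ModularForms

-- Forms modulo m^L are stable under q ↦ q^(m²) and under D

module QuasiModular where

 open Z using (_+_; _*_; -_; _-_)

 open E using ()

 SMod-scale : ∀ {M f g} N → SMod M f g → SMod (N * M) (const N · f) (const N · g)
 SMod-scale {f = f} {g} N p = smod λ n → Mod-tr (≡⇒Mod (const-·-≡ N f n)) (Mod-tr (Mod-scale N (at p n)) (≡⇒Mod (sym (const-·-≡ N g n))))

 module QuasiForms (d : ℕ) (pr : Prime (suc d)) (5≤m : 5 N.≤ suc d) where

  open Forms d pr 5≤m public

  -- Congruent modulo m^L to a form whose half-weight is v modulo K L.
  record Mf (L v : ℕ) (f : Ser) : Set where
   constructor mf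
   field
    {t}    : ℕ
    {P}    : Ser
    iso    : Iso (v N.+ t N.* K L) P
    approx : SMod (pw L) f P

  mf-via : ∀ L {v w f P} s t → w N.+ s N.* K L ≡ v N.+ t N.* K L → Iso w P → SMod (pw L) f P → Mf L v f
  mf-via L {w = w} {f} {P} s t p i q = mf {t = t} (iso-≡ (trans (NP.+-comm _ w) p) (iso-· (iso-↑ s (iso-one L)) i))
    (tr q (sm (tr (*c (tr (↑-cong s (one≈1 L)) (1-↑ s)) rfl) (*-identityˡ P))))
   where open SR (pw L)

  mf-iso : ∀ L {v f} → Iso v f → Mf L v f
  mf-iso L p = mf {t = 0} (iso-≡ (sym (NP.+-identityʳ _)) p) (SR.rfl (pw L))

  mf-shift : ∀ {L v w f} s t → w N.+ s N.* K L ≡ v N.+ t N.* K L → Mf L w f → Mf L v f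
  mf-shift {L} {v} {w} s t p (mf {t0} i q) = mf-via L s (t N.+ t0) (trans (r1 w t0 s (K L)) (trans (cong (N._+ t0 N.* K L) p) (r2 v t t0 (K L)))) i q
   where r1 : ∀ w t0 s k → w N.+ t0 N.* k N.+ s N.* k ≡ w N.+ s N.* k N.+ t0 N.* k
         r1 = ringN
         r2 : ∀ v t t0 k → v N.+ t N.* k N.+ t0 N.* k ≡ v N.+ (t N.+ t0) N.* k
         r2 = ringN

  mf-≈ : ∀ {L v f g} → SMod (pw L) f g → Mf L v f → Mf L v g
  mf-≈ {L} p (mf {t} i q) = mf {t = t} i (SR.tr (pw L) (SR.sm (pw L) p) q)

  mf-· : ∀ {L v w f g} → Mf L v f → Mf L w g → Mf L (v N.+ w) (f · g)
  mf-· {L} {v} {w} (mf {t} i p) (mf {t'} j q) = mf {t = t N.+ t'} (iso-≡ (r v t w t' (K L)) (iso-· i j)) (SR.*c (pw L) p q)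
   where r : ∀ v t w t' k → (v N.+ t N.* k) N.+ (w N.+ t' N.* k) ≡ v N.+ w N.+ (t N.+ t') N.* k
         r = ringN

  mf-scale : ∀ c {L v f} → Mf L v f → Mf L v (const c · f)
  mf-scale c {L} (mf {t} i p) = mf {t = t} (iso-scale c i) (SR.*c (pw L) (SR.rfl (pw L)) p)

  private
   commonWeight : ∀ v t t' k → v N.+ t N.* k N.+ t' N.* k ≡ v N.+ (t N.+ t') N.* k
   commonWeight = ringN

   lift : ∀ L {v t f} s → Iso (v N.+ t N.* K L) f → ∃ λ P → Iso (v N.+ (t N.+ s) N.* K L) P × SMod (pw L) f P
   lift L {v} {t} {f} s i = one L ↑ s · f , iso-≡ (trans (NP.+-comm (s N.* K L) _) (commonWeight v t s (K L))) (iso-· (iso-↑ s (iso-one L)) i) ,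
     sm (tr (*c (tr (↑-cong s (one≈1 L)) (1-↑ s)) rfl) (*-identityˡ f))
    where open SR (pw L)

  mf-⊕ : ∀ {L v f g} → Mf L v f → Mf L v g → Mf L v (f ⊕ g)
  mf-⊕ {L} {v} (mf {t} i p) (mf {t'} j q) with lift L {v} {t} t' i | lift L {v} {t'} t j
  ... | P , i' , p' | Q , j' , q' = mf {t = t N.+ t'} (iso-⊕ i' (iso-≡ (cong (λ s → v N.+ s N.* K L) (NP.+-comm t' t)) j'))
    (+c (tr p p') (tr q q'))
   where open SR (pw L)

  mf-⊝ : ∀ {L v f g} → Mf L v f → Mf L v g → Mf L v (f ⊝ g)
  mf-⊝ {L} {g = g} p q = mf-⊕ p (mf-≈ (solve 1 (λ g → con (- + 1) :* g := :- g) rfl g) (mf-scale (- + 1) q))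
   where open SR (pw L)

  K-+ : ∀ i L → K (i N.+ L) ≡ m N.^ i N.* K L
  K-+ i L = trans (cong (N._* μ) (NP.^-distribˡ-+-* m i L)) (NP.*-assoc (m N.^ i) (m N.^ L) μ)

  pw-+ : ∀ i L → pw (i N.+ L) ≡ pw i * pw L
  pw-+ i L = ZP.^-distribˡ-+-* (+ m) i L

  mf-weaken : ∀ i {L v f} → Mf (i N.+ L) v f → Mf L v f
  mf-weaken i {L} {v} (mf {t} j p) = mf {t = t N.* m N.^ i} (iso-≡ (cong (v N.+_) (trans (cong (t N.*_) (K-+ i L)) (sym (NP.*-assoc t _ _)))) j)
   (pw-≤ (NP.m≤n+m L i) p)

  mf-unit : ∀ a {L v f} → ¬ Mod (+ m) a (+ 0) → Mf L v (const a · f) → Mf L v f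
  mf-unit a {L} {f = f} na p = mf-≈ (tr (sm (*-assoc _ _ f)) (tr (*c (tr (sm (const-* u a)) (Mod⇒const (Mod-tr (≡⇒Mod (ZP.*-comm u a)) (proj₂ (unit L a na))))) rfl) (*-identityˡ f)))
    (mf-scale u p)
   where open SR (pw L)
         u : ℤ
         u = proj₁ (unit L a na)

  M² : Ser
  M² = const (+ suc vd)

  M²M² : ∀ {M} → SMod M (M² · M²) (const (pw 4))
  M²M² {M} = SR.tr M (SR.sm M (const-* (+ suc vd) (+ suc vd))) (const≡ (trans (cong (λ z → z * z) (ZP.pos-* m m)) (r (+ m))))
   where r : ∀ m → m * m * (m * m) ≡ m * (m * (m * (m * + 1)))
         r = ring

  -- Modulo m^(L+2) half-weights count in steps of K (2 + L) = m² K L, so the form is first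
  -- multiplied by powers of `one L` until t has become t m².
  mf-M² : ∀ {L v f} → Mf L v f → Mf (2 N.+ L) v (M² · f)
  mf-M² {L} {v} {f} (mf {t} i p) with lift L {v} {t} (t N.* vd) i
  ... | P , j , q = mf {t = t} (iso-≡ (cong (v N.+_) (r t vd (K L) (K (2 N.+ L)) (trans (K-+ 2 L) (cong (λ z → m N.* z N.* K L) (NP.*-identityʳ m))))) (iso-scale (+ suc vd) j))
    (subst (λ z → SMod z (M² · f) (M² · P)) (trans (cong (_* pw L) (ZP.pos-* m m)) (ZP.*-assoc (+ m) (+ m) (pw L))) (SMod-scale (+ suc vd) (SR.tr (pw L) p q)))
   where r : ∀ t c k l → l ≡ suc c N.* k → (t N.+ t N.* c) N.* k ≡ t N.* l
         r t c k _ refl = h t c k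
          where h : ∀ t c k → (t N.+ t N.* c) N.* k ≡ t N.* (suc c N.* k)
                h = ringN

  pw≢0 : ∀ i → pw i ≢ + 0
  pw≢0 i p = NP.<⇒≱ (m^>0 i) (NP.≤-reflexive (ZP.+-injective (trans (sym (pw-pos i)) p)))

  -- Z is divisible by m^i as a series, hence as a form; the i levels are the price of the division.
  saturated : ∀ i L {v t f Z} → Iso (v N.+ t N.* K (i N.+ L)) Z → SMod (pw (i N.+ L)) (const (pw i) · f) Z → Mf L v f
  saturated i L {v} {t} {f} {Z} iz p = go (Div.saturate i iz (SR.tr (pw i) (SR.sm (pw i) (pw-≤ (NP.m≤m+n i L) p)) (multiple⇒SMod-0 f)))
   where
   go : (∃ λ Z' → Iso (v N.+ t N.* K (i N.+ L)) Z' × Z ≋ const (pw i) · Z') → Mf L v f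
   go (Z' , iz' , q) = mf {t = t N.* m N.^ i} {P = Z'} (iso-≡ (cong (v N.+_) (trans (cong (t N.*_) (K-+ i L)) (sym (NP.*-assoc t _ _)))) iz')
    (SMod-cancel-const {M = pw L} {N = pw i} (pw≢0 i) (subst (λ z → SMod z (const (pw i) · f) (const (pw i) · Z')) (pw-+ i L) (SR.tr (pw (i N.+ L)) p (exact q))))

  ∂ : ∀ n j t {f} → Iso (j N.+ t N.* K n) f → ∃ λ f' → Iso (suc j N.+ t N.* K n) f' × SMod (pw n) (D f) (f' ⊕ const (+ (4 N.* j)) · (e · f))
  ∂ n j t {f} p with iso-D p
  ... | f' , i , q = f' , i , tr (exact q) (+c rfl (*c (Mod⇒const weight) rfl))
   where open SR (pw n)
         r : ∀ j t q μ → 4 N.* (j N.+ t N.* (q N.* μ)) ≡ 4 N.* j N.+ 4 N.* (t N.* μ) N.* q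
         r = ringN
         weight : Mod (pw n) (+ (4 N.* (j N.+ t N.* K n))) (+ (4 N.* j))
         weight = mod (+ (4 N.* (t N.* μ))) (trans (cong +_ (r j t (m N.^ n) μ)) (cong (_+_ (+ (4 N.* j))) (trans (ZP.pos-* (4 N.* (t N.* μ)) (m N.^ n)) (cong (_*_ (+ (4 N.* (t N.* μ)))) (sym (pw-pos n))))))

  -- g is a unit times a power of Δ' modulo m, because V η ≡ η^(m²) = η · η^(24 c24).

  private
   6c≡ : 6 N.* c24 ≡ suc μ N.* μ
   6c≡ = NP.*-cancelˡ-≡ _ _ 4 (trans (sym (NP.*-assoc 4 6 c24)) (NP.suc-injective (trans (sym m²≡) (trans (cong (λ x → suc x N.* suc x) d≡2μ) (r μ)))))
    where r : ∀ μ → suc (2 N.* μ) N.* suc (2 N.* μ) ≡ suc (4 N.* (suc μ N.* μ))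
          r = ringN

   u : ℤ
   u = (+ 1728) Z.^ c24

   g≈Δ' : ∀ L → SMod (+ m) (const u · g (suc L)) (const εm · Δ' ↑ c24)
   g≈Δ' L = begin
    const u · g (suc L) ≈⟨ *c rfl (η-cancel (begin
     η · g (suc L) ≈⟨ pw⇒M1 {L} (g-η (suc L)) ⟩
     const εm · V η ≈⟨ *c rfl (tr (sm (sub-sub d d vd refl η)) (sm (tr (↑-* η m m) (tr (↑-cong m (frobenius η)) (frobenius (sub d η)))))) ⟩
     const εm · η ↑ (m N.* m) ≈⟨ *c rfl (≡⇒SMod λ i → cong (λ k → (η ↑ k) i) (trans m²≡ (cong suc (NP.*-comm 24 c24)))) ⟩
     const εm · (η · η ↑ (c24 N.* 24)) ≈⟨ solve 3 (λ a b c → a :* (b :* c) := b :* (a :* c)) rfl (const εm) η (η ↑ (c24 N.* 24)) ⟩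
     η · (const εm · η ↑ (c24 N.* 24)) ∎)) ⟩
    const u · (const εm · η ↑ (c24 N.* 24)) ≈⟨ tr (*c (sm (const-↑ (+ 1728) c24)) (*c rfl (↑-* η c24 24)))
     (solve 3 (λ a b c → a :* (b :* c) := b :* (a :* c)) rfl _ (const εm) _) ⟩
    const εm · (const (+ 1728) ↑ c24 · (η ↑ 24) ↑ c24) ≈⟨ *c rfl (tr (sm (·-↑ _ _ c24)) (↑-cong c24 (exact (E.sm Δ'≋η²⁴)))) ⟩
    const εm · Δ' ↑ c24 ∎
    where open SR (+ m)
          open ≈-Reasoning

   C : ℕ → ℕ
   C L = m N.^ L N.* c24

   κ : ℕ → Ser
   κ L = const εm ↑ (m N.^ L) · const u ↑ (m N.^ L)

   Δ'-g : ∀ L n → SMod (pw L) (Δ' ↑ C L) (κ L · g (suc n) ↑ (m N.^ L))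
   Δ'-g L n = begin
    Δ' ↑ C L ≈⟨ ↑-* Δ' q c24 ⟩
    (Δ' ↑ c24) ↑ q ≈⟨ sm (*-identityˡ _) ⟩
    const (+ 1) · (Δ' ↑ c24) ↑ q ≈⟨ *c (tr (sm (1-↑ q)) (tr (↑-cong q (tr (const≡ (sym εm²)) (const-* εm εm))) (·-↑ _ _ q))) rfl ⟩
    const εm ↑ q · const εm ↑ q · (Δ' ↑ c24) ↑ q ≈⟨ tr (*-assoc _ _ _) (*c rfl (sm (·-↑ _ _ q))) ⟩
    const εm ↑ q · (const εm · Δ' ↑ c24) ↑ q ≈⟨ *c rfl (sm (pw-weaken {L} (↑-lift L (g≈Δ' n)))) ⟩
    const εm ↑ q · (const u · g (suc n)) ↑ q ≈⟨ tr (*c rfl (·-↑ _ _ q)) (sm (*-assoc _ _ _)) ⟩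
    κ L · g (suc n) ↑ q ∎
    where open SR (pw L)
          open ≈-Reasoning
          q : ℕ
          q = m N.^ L

   Δ'↑-cancel : ∀ L n {f} → SMod (pw L) (Δ' ↑ n · f) (const (+ 0)) → SMod (pw L) f (const (+ 0))
   Δ'↑-cancel L zero    p = tr (sm (*-identityˡ _)) p
    where open SR (pw L)
   Δ'↑-cancel L (suc n) p = Δ'↑-cancel L n (Div.Δ'-cancel L (tr (sm (*-assoc _ _ _)) p))
    where open SR (pw L)

  -- Δ'^(C L) has half-weight 6 C L = (μ + 1) K L, which is 0 modulo K L. This rests on m² - 1 =
  -- 4μ(μ + 1) = 24 c24.
  Δ'-divide : ∀ L {v f} → Mf L v (Δ' ↑ C L · f) → Mf L v f
  Δ'-divide L {v} {f} (mf {t} {P} i p) = result (Div.divide-Δ' L (C L) i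
    (Ord-cong _ p (Ord-cong _ (*-comm f _) (Ord-·ˡ _ (Ord-↑ 24 (C L) (Div.OrdM-Δ' L))))))
   where
   open SR (pw L)
   result : (∃ λ w → ∃ λ g → v N.+ t N.* K L ≡ C L N.* 6 N.+ w × Iso w g × P ≈ Δ' ↑ C L · g) ⊎ P ≈ const (+ 0) → Mf L v f
   result (inj₂ z) = mf {t = 0} iso-0 (Δ'↑-cancel L (C L) (tr p z))
   result (inj₁ (w , g , w≡ , ig , q)) = mf-via L (suc μ) t (trans (NP.+-comm w _) (trans (cong (N._+ w) (trans (r (m N.^ L) μ) (trans (cong (m N.^ L N.*_) (trans (sym 6c≡) (NP.*-comm 6 c24))) (sym (NP.*-assoc (m N.^ L) c24 6))))) (sym w≡)))
    ig (SMod-diff (Δ'↑-cancel L (C L) (tr (distribˡ _ f _) (tr (+c (tr p q) rfl) (solve 2 (λ d g → d :* g :+ d :* (:- g) := con (+ 0)) rfl (Δ' ↑ C L) g)))))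
    where r : ∀ q μ → suc μ N.* (q N.* μ) ≡ q N.* (suc μ N.* μ)
          r = ringN

  mf-g : ∀ i {L} → Mf L 0 (g (i N.+ L))
  mf-g i {L} = mf-weaken i (mf {t = 1} (iso-≡ (sym (NP.+-identityʳ _)) (iso-g (i N.+ L))) (SR.rfl _))

  -- Multiply g f by g^(m^L - 1): g^(m^L) is a unit times Δ'^(C L) modulo m^L, and by that power of
  -- Δ' one can divide.
  g-divide : ∀ i j {L v f} → i N.+ L ≡ suc j → Mf L v (g (i N.+ L) · f) → Mf L v f
  g-divide i j {L} {v} {f} lvl p = Δ'-divide L (mf-≈ (sm (tr (*c (tr (subst (λ n → SMod (pw L) (Δ' ↑ C L) (κ L · g n ↑ q)) (sym lvl) (Δ'-g L j)) (*c (tr (*c (const-↑ εm q) (const-↑ u q)) (sm (const-* _ _))) pow)) rfl)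
    (solve 4 (λ k a b f → k :* (a :* b) :* f := k :* (b :* (a :* f))) rfl (const (εm Z.^ q * u Z.^ q)) (g (i N.+ L)) (g (i N.+ L) ↑ N.pred q) f)))
    (mf-scale (εm Z.^ q * u Z.^ q) (mf-· (mf-↑ (N.pred q)) p)))
   where
   open SR (pw L)
   q : ℕ
   q = m N.^ L
   pow : g (i N.+ L) ↑ q ≈ g (i N.+ L) · g (i N.+ L) ↑ N.pred q
   pow = ≡⇒SMod λ n → cong (λ k → (g (i N.+ L) ↑ k) n) (h q (m^>0 L))
    where h : ∀ n → 1 N.≤ n → n ≡ suc (N.pred n)
          h (suc n) _ = refl
   mf-↑ : ∀ n → Mf L 0 (g (i N.+ L) ↑ n)
   mf-↑ zero    = mf-iso L (iso-const (+ 1))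
   mf-↑ (suc n) = mf-· (mf-g i) (mf-↑ n)

  private
   module Transform (n : ℕ) where
    open SR (pw n)

    G G' G″ Z2 Z2' Z3 : Ser
    G = g n

    isoG : Iso (0 N.+ 1 N.* K n) G
    isoG = iso-≡ (sym (NP.+-identityʳ _)) (iso-g n)

    dG = ∂ n 0 1 isoG
    G' = proj₁ dG
    dG' = ∂ n 1 1 (proj₁ (proj₂ dG))
    G″ = proj₁ dG'
    Z2 = const (+ 2) · (E4 · (G · G)) ⊕ const (+ 3) · (G' · G') ⊝ G · G″

    isoZ2 : Iso (2 N.+ 2 N.* K n) Z2
    isoZ2 = iso-⊝ (iso-⊕ (iso-≡ (r1 (K n)) (iso-scale (+ 2) (iso-E4 (iso-· isoG isoG)))) (iso-≡ (r2 (K n)) (iso-scale (+ 3) (iso-· (proj₁ (proj₂ dG)) (proj₁ (proj₂ dG))))))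
      (iso-≡ (r3 (K n)) (iso-· isoG (proj₁ (proj₂ dG'))))
     where r1 : ∀ k → 2 N.+ ((0 N.+ 1 N.* k) N.+ (0 N.+ 1 N.* k)) ≡ 2 N.+ 2 N.* k
           r1 = ringN
           r2 : ∀ k → (1 N.+ 1 N.* k) N.+ (1 N.+ 1 N.* k) ≡ 2 N.+ 2 N.* k
           r2 = ringN
           r3 : ∀ k → (0 N.+ 1 N.* k) N.+ (2 N.+ 1 N.* k) ≡ 2 N.+ 2 N.* k
           r3 = ringN

    dZ2 = ∂ n 2 2 isoZ2
    Z2' = proj₁ dZ2
    Z3 = const (+ 10) · (G' · Z2) ⊝ G · Z2'

    isoZ3 : Iso (3 N.+ 3 N.* K n) Z3
    isoZ3 = iso-⊝ (iso-≡ (r1 (K n)) (iso-scale (+ 10) (iso-· (proj₁ (proj₂ dG)) isoZ2))) (iso-≡ (r2 (K n)) (iso-· isoG (proj₁ (proj₂ dZ2))))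
     where r1 : ∀ k → (1 N.+ 1 N.* k) N.+ (2 N.+ 2 N.* k) ≡ 3 N.+ 3 N.* k
           r1 = ringN
           r2 : ∀ k → (0 N.+ 1 N.* k) N.+ (3 N.+ 2 N.* k) ≡ 3 N.+ 3 N.* k
           r2 = ringN

    DG : D G ≈ G'
    DG = tr (proj₂ (proj₂ dG)) (solve 2 (λ g x → g :+ con (+ 0) :* x := g) rfl G' (e · G))

    -- The logarithmic derivative of η g ≡ ±η(q^(m²)); the chain rule puts m² in front of e(q^(m²)).
    eG : e · G ⊕ G' ≈ M² · (V e · G)
    eG = η-cancel (begin
     η · (e · G ⊕ G') ≈⟨ solve 4 (λ h e g g' → h :* (e :* g :+ g') := e :* h :* g :+ h :* g') rfl η e G G' ⟩
     e · η · G ⊕ η · G' ≈⟨ sm (tr (D-· η G) (+c (*c (exact D-η) rfl) (*c rfl DG))) ⟩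
     D (η · G) ≈⟨ D-cong (g-η n) ⟩
     D (const εm · V η) ≈⟨ tr (D-const-· εm (V η)) (*c rfl (tr (D-sub vd η) (*c rfl (tr (sub-cong vd (exact D-η)) (sub-· vd e η))))) ⟩
     const εm · (M² · (V e · V η)) ≈⟨ solve 4 (λ c m x y → c :* (m :* (x :* y)) := m :* (x :* (c :* y))) rfl (const εm) M² (V e) (V η) ⟩
     M² · (V e · (const εm · V η)) ≈⟨ *c rfl (*c rfl (sm (g-η n))) ⟩
     M² · (V e · (η · G)) ≈⟨ solve 4 (λ h m x y → m :* (x :* (h :* y)) := h :* (m :* (x :* y))) rfl η M² (V e) G ⟩
     η · (M² · (V e · G)) ∎)
     where open ≈-Reasoning

    DVe : D (V e) ≈ M² · (const (+ 2) · (V e · V e) ⊝ const (+ 2) · V E4)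
    DVe = tr (D-sub vd e) (*c rfl (tr (sub-cong vd (exact (E.tr D-e (E.solve 2 (λ e a → E.con (+ 2) E.:* e E.:^ 2 E.:- E.con (+ 2) E.:* a E.:= E.con (+ 2) E.:* (e E.:* e) E.:+ E.con (- + 2) E.:* a) E.rfl e E4))))
     (tr (sub-⊕ vd _ _) (tr (+c (tr (sub-· vd _ _) (*c (sub-const vd (+ 2)) (sub-· vd e e))) (tr (sub-· vd _ _) (*c (sub-const vd (- + 2)) rfl)))
      (solve 2 (λ x y → x :+ con (- + 2) :* y := x :- con (+ 2) :* y) rfl (const (+ 2) · (V e · V e)) (V E4))))))

    DVE4 : D (V E4) ≈ M² · (const (+ 8) · (V e · V E4) ⊝ const (+ 8) · V E6)
    DVE4 = tr (D-sub vd E4) (*c rfl (tr (sub-cong vd (exact (E.tr D-E4 (E.solve 2 (λ e a → e E.:- E.con (+ 8) E.:* a E.:= e E.:+ E.con (- + 8) E.:* a) E.rfl (const (+ 8) · (e · E4)) E6))))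
     (tr (sub-⊕ vd _ _) (tr (+c (tr (sub-· vd _ _) (*c (sub-const vd (+ 8)) (sub-· vd e E4))) (tr (sub-· vd _ _) (*c (sub-const vd (- + 8)) rfl)))
      (solve 2 (λ x y → x :+ con (- + 8) :* y := x :- con (+ 8) :* y) rfl (const (+ 8) · (V e · V E4)) (V E6))))))

    T2 : Ser
    T2 = const (+ 2) · (M² · (M² · (G · (G · V E4))))

    -- Differentiating `eG` brings in E4 at q and at q^(m²) through Ramanujan's equation for e. All
    -- terms in e cancel, so the right side is a form. Differentiating once more gives E6.
    E4-transform : T2 ≈ Z2
    E4-transform = begin
     T2 ≈⟨ solve 5 (λ m y w g g' → con (+ 2) :* (m :* (m :* (g :* (g :* w)))) := con (+ 2) :* (m :* (y :* g)) :* (m :* (y :* g)) :+ (m :* (y :* g)) :* g'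
         :- g :* (m :* (m :* (con (+ 2) :* (y :* y) :- con (+ 2) :* w) :* g :+ y :* g'))) rfl M² (V e) (V E4) G G' ⟩
     const (+ 2) · x · x ⊕ x · G' ⊝ G · (M² · (M² · (const (+ 2) · (V e · V e) ⊝ const (+ 2) · V E4) · G ⊕ V e · G'))
      ≈⟨ +c (+c (*c (*c rfl (sm eG)) (sm eG)) (*c (sm eG) rfl)) (-c (*c rfl deriv)) ⟩
     const (+ 2) · (e · G ⊕ G') · (e · G ⊕ G') ⊕ (e · G ⊕ G') · G' ⊝ G · ((const (+ 2) · e ↑ 2 ⊝ const (+ 2) · E4) · G ⊕ e · G' ⊕ (G″ ⊕ const (+ 4) · (e · G')))
      ≈⟨ solve 5 (λ e g g' g″ a → con (+ 2) :* (e :* g :+ g') :* (e :* g :+ g') :+ (e :* g :+ g') :* g' :- g :* ((con (+ 2) :* e :^ 2 :- con (+ 2) :* a) :* g :+ e :* g' :+ (g″ :+ con (+ 4) :* (e :* g')))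
        := con (+ 2) :* (a :* (g :* g)) :+ con (+ 3) :* (g' :* g') :- g :* g″) rfl e G G' G″ E4 ⟩
     Z2 ∎
     where
     open ≈-Reasoning
     x : Ser
     x = M² · (V e · G)
     deriv : M² · (M² · (const (+ 2) · (V e · V e) ⊝ const (+ 2) · V E4) · G ⊕ V e · G') ≈ (const (+ 2) · e ↑ 2 ⊝ const (+ 2) · E4) · G ⊕ e · G' ⊕ (G″ ⊕ const (+ 4) · (e · G'))
     deriv = tr (sm (tr (D-const-· (+ suc vd) (V e · G)) (*c rfl (tr (D-· (V e) G) (+c (*c DVe rfl) (*c rfl DG))))))
      (tr (D-cong (sm eG)) (tr (D-⊕ (e · G) G') (+c (tr (D-· e G) (+c (*c (exact D-e) rfl) (*c rfl DG))) (proj₂ (proj₂ dG')))))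

    E6-transform : const (+ 16) · (M² · (M² · (M² · (G · (G · (G · V E6)))))) ≈ Z3
    E6-transform = begin
     const (+ 16) · (M² · (M² · (M² · (G · (G · (G · V E6))))))
      ≈⟨ solve 6 (λ m y w x g g' → con (+ 16) :* (m :* (m :* (m :* (g :* (g :* (g :* x)))))) := con (+ 8) :* ((m :* (y :* g)) :* (con (+ 2) :* (m :* (m :* (g :* (g :* w))))))
        :+ con (+ 2) :* (g' :* (con (+ 2) :* (m :* (m :* (g :* (g :* w))))))
        :- g :* (con (+ 2) :* (m :* (m :* (g' :* (g :* w) :+ g :* (g' :* w :+ g :* (m :* (con (+ 8) :* (y :* w) :- con (+ 8) :* x)))))))) rfl M² (V e) (V E4) (V E6) G G' ⟩
     const (+ 8) · (M² · (V e · G) · T2) ⊕ const (+ 2) · (G' · T2) ⊝ G · (const (+ 2) · (M² · (M² · (G' · (G · V E4) ⊕ G · (G' · V E4 ⊕ G · (M² · (const (+ 8) · (V e · V E4) ⊝ const (+ 8) · V E6)))))))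
      ≈⟨ +c (+c (*c rfl (*c (sm eG) E4-transform)) (*c rfl (*c rfl E4-transform))) (-c (*c rfl deriv)) ⟩
     const (+ 8) · ((e · G ⊕ G') · Z2) ⊕ const (+ 2) · (G' · Z2) ⊝ G · (Z2' ⊕ const (+ 8) · (e · Z2))
      ≈⟨ solve 5 (λ e g g' z z' → con (+ 8) :* ((e :* g :+ g') :* z) :+ con (+ 2) :* (g' :* z) :- g :* (z' :+ con (+ 8) :* (e :* z)) := con (+ 10) :* (g' :* z) :- g :* z') rfl e G G' Z2 Z2' ⟩
     Z3 ∎
     where
     open ≈-Reasoning
     deriv : const (+ 2) · (M² · (M² · (G' · (G · V E4) ⊕ G · (G' · V E4 ⊕ G · (M² · (const (+ 8) · (V e · V E4) ⊝ const (+ 8) · V E6)))))) ≈ Z2' ⊕ const (+ 8) · (e · Z2)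
     deriv = tr (sm (tr (D-const-· (+ 2) _) (*c rfl (tr (D-const-· (+ suc vd) _) (*c rfl (tr (D-const-· (+ suc vd) _) (*c rfl
       (tr (D-· G _) (+c (*c DG rfl) (*c rfl (tr (D-· G _) (+c (*c DG rfl) (*c rfl DVE4)))))))))))))
      (tr (D-cong E4-transform) (proj₂ (proj₂ dZ2)))

  -- Level 4 + L pays for the factor m⁴ in `E4-transform`; afterwards g is divided out twice.
  VE4 : ∀ L → Mf L 2 (V E4)
  VE4 L = mf-unit (+ 2) na-2 (g-divide 4 _ refl (g-divide 4 _ refl (saturated 4 L {v = 2} {t = 2} isoZ2 (tr (sm regroup) E4-transform))))
   where
   open Transform (4 N.+ L)
   open SR (pw (4 N.+ L))
   regroup : T2 ≈ const (pw 4) · (G · (G · (const (+ 2) · V E4)))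
   regroup = tr (solve 3 (λ m g w → con (+ 2) :* (m :* (m :* (g :* (g :* w)))) := (m :* m) :* (g :* (g :* (con (+ 2) :* w)))) rfl M² G (V E4)) (*c M²M² rfl)

  VE6 : ∀ L → Mf L 3 (V E6)
  VE6 L = mf-unit (+ 16) na-16 (g-divide 6 _ refl (g-divide 6 _ refl (g-divide 6 _ refl (saturated 6 L {v = 3} {t = 3} isoZ3 (tr (sm regroup) E6-transform)))))
   where
   open Transform (6 N.+ L)
   open SR (pw (6 N.+ L))
   regroup : const (+ 16) · (M² · (M² · (M² · (G · (G · (G · V E6)))))) ≈ const (pw 6) · (G · (G · (G · (const (+ 16) · V E6))))
   regroup = tr (solve 3 (λ m g w → con (+ 16) :* (m :* (m :* (m :* (g :* (g :* (g :* w)))))) := (m :* (m :* m)) :* (g :* (g :* (g :* (con (+ 16) :* w))))) rfl M² G (V E6))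
     (*c (tr (*c rfl M²M²) (tr (sm (const-* _ _)) (const≡ (trans (cong (_* pw 4) (ZP.pos-* m m)) (ZP.*-assoc (+ m) (+ m) (pw 4)))))) rfl)

  V-iso : ∀ L {v f} → Iso v f → Mf L v (V f)
  V-iso L (iso-const c) = mf-≈ (SR.sm _ (sub-const vd c)) (mf-iso L (iso-const c))
  V-iso L iso-0         = mf-≈ (SR.sm _ (sub-const vd (+ 0))) (mf-iso L iso-0)
  V-iso L (iso-⊕ p q)   = mf-≈ (SR.sm _ (sub-⊕ vd _ _)) (mf-⊕ (V-iso L p) (V-iso L q))
  V-iso L (iso-E4 p)    = mf-≈ (SR.sm _ (sub-· vd _ _)) (mf-· (VE4 L) (V-iso L p))
  V-iso L (iso-E6 p)    = mf-≈ (SR.sm _ (sub-· vd _ _)) (mf-· (VE6 L) (V-iso L p))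
  V-iso L (iso-≋ q p)   = mf-≈ (sub-cong vd (exact q)) (V-iso L p)

  V-mf : ∀ {L v f} → Mf L v f → Mf L v (V f)
  V-mf {L} {v} (mf {t} i p) = mf-≈ (sub-cong vd (SR.sm _ p)) (mf-shift 0 t (NP.+-identityʳ _) (V-iso L i))

  -- e = m² V e − g'/g: each step of the iteration gains a factor m².
  mf-e : ∀ L → Mf L 1 e
  mf-e L = mf-weaken L (go L)
   where
   step : ∀ L → Mf L 1 e → Mf (2 N.+ L) 1 e
   step L p = g-divide 0 (suc L) refl (mf-≈ (tr (+c (tr (*-assoc _ _ _) (sm eG)) rfl) (solve 3 (λ e g g' → e :* g :+ g' :- g' := g :* e) rfl e G G'))
     (mf-⊝ (mf-· (mf-M² (V-mf p)) (mf {t = 1} isoG rfl)) (mf {t = 1} (proj₁ (proj₂ dG)) rfl)))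
    where
    open Transform (2 N.+ L)
    open SR (pw (2 N.+ L))
   go : ∀ L → Mf (L N.+ L) 1 e
   -- Modulo m^0 = 1 the zero form approximates everything.
   go zero    = mf {t = 0} iso-0 (smod λ n → mod (e n - const (+ 0) n) (sym (h (const (+ 0) n) (e n))))
    where h : ∀ a b → a + (b - a) * + 1 ≡ b
          h = ring
   go (suc L) = subst (λ n → Mf n 1 e) (cong suc (sym (NP.+-suc L L))) (step (L N.+ L) (go L))

  -- The Serre derivative differs from D by a multiple of e f, and e is by now a form modulo m^L.
  mf-D : ∀ {L v f} → Mf L v f → Mf L (suc v) (D f)
  mf-D {L} {v} (mf {t} {P} i p) with iso-D i
  ... | P' , i' , q = mf-≈ (SR.sm _ (SR.tr _ (D-cong p) (exact q)))
   (mf-⊕ (mf {t = t} i' (SR.rfl _)) (mf-scale _ (mf-· (mf-e L) (mf {t = t} i (SR.rfl _)))))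

open QuasiModular

-- A modular form whose coefficients are partition values

module PartitionForm where

 open Z using (_+_; _*_; -_; _-_)

 open E using ()

 π̂-off : ∀ r n → ¬ (24 ND.∣ n) → π̂ r n ≡ + 0
 π̂-off r n ¬p with 24 ND.∣? n
 ... | yes p = ⊥-elim (¬p p)
 ... | no _  = refl

 private
  ceil24 : ∀ r → ∃ λ h → ∃ λ s → h N.* 24 ≡ r N.+ s × s N.< 24
  ceil24 zero = 0 , 0 , refl , s≤s z≤n
  ceil24 (suc r) with ceil24 r
  ... | h , suc s , p , q = h , s , trans p (NP.+-suc r s) , NP.<-trans NP.≤-refl q
  ... | h , zero , p , q = suc h , 23 , trans (cong (24 N.+_) (trans p (NP.+-identityʳ r))) (trans (NP.+-comm 24 r) (NP.+-suc r 23)) , NP.≤-refl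

 module Projection (d : ℕ) (pr : Prime (suc d)) (5≤m : 5 N.≤ suc d) (r : ℕ) where

  open QuasiForms d pr 5≤m public

  private
   π : Ser
   π = π̂ r

   π-cancel : ∀ {M f g} → SMod M (π · f) (π · g) → SMod M f g
   π-cancel = unit-cancel π (Êul ↑ r) (exact (π̂-Êul r))

   D-Êul↑ : ∀ n → D (Êul ↑ n) ≋ const (+ n) · ((e ⊝ const (+ 1)) · Êul ↑ n)
   D-Êul↑ zero    = E.tr (D-const (+ 1)) (E.sm (E.zeroˡ _))
   D-Êul↑ (suc n) = E.tr (D-↑ Êul n) (E.tr (E.*c E.rfl D-Êul)
    (E.solve 4 (λ c p e u → c E.:* p E.:* (e E.:* u) E.:= c E.:* (e E.:* (u E.:* p))) E.rfl (const (+ suc n)) (Êul ↑ n) (e ⊝ const (+ 1)) Êul))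

   D-π : D π ≋ const (+ r) · ((const (+ 1) ⊝ e) · π)
   D-π = unit-cancel (Êul ↑ r) π (tr (*-comm _ π) (π̂-Êul r)) (begin
    Êul ↑ r · D π ≈⟨ solve 3 (λ x p u → u :* x := (x :* u :+ p) :- p) rfl (D π) (π · D (Êul ↑ r)) (Êul ↑ r) ⟩
    (D π · Êul ↑ r ⊕ π · D (Êul ↑ r)) ⊝ π · D (Êul ↑ r) ≈⟨ +c (tr (sm (D-· π (Êul ↑ r))) (tr (D-cong (π̂-Êul r)) (D-const (+ 1)))) (-c (*c rfl (D-Êul↑ r))) ⟩
    const (+ 0) ⊝ π · (const (+ r) · ((e ⊝ const (+ 1)) · Êul ↑ r)) ≈⟨ solve 4 (λ p c e u → con (+ 0) :- p :* (c :* ((e :- con (+ 1)) :* u)) := u :* (c :* ((con (+ 1) :- e) :* p))) rfl π (const (+ r)) e (Êul ↑ r) ⟩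
    Êul ↑ r · (const (+ r) · ((const (+ 1) ⊝ e) · π)) ∎)
    where open E
          open ≈-Reasoning

   z : ℕ → ℤ
   z n = + n - + r

   -- The powers of D - r acting on π f, carried over to f: since D π = r (1 - e) π, one has (D -
   -- r)(π f) = π (D f - r e f). Each application raises the half-weight by 1.
   ∇ : ℕ → Ser → Ser
   ∇ zero    f = f
   ∇ (suc a) f = D (∇ a f) ⊝ const (+ r) · (e · ∇ a f)

   mf-∇ : ∀ a {L v f} → Mf L v f → Mf L (a N.+ v) (∇ a f)
   mf-∇ zero    p = p
   mf-∇ (suc a) {L} p = mf-⊝ (mf-D (mf-∇ a p)) (mf-scale (+ r) (mf-· (mf-e L) (mf-∇ a p)))

   ∇-at : ∀ a f n → (π · ∇ a f) n ≡ z n Z.^ a * (π · f) n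
   ∇-at zero    f n = sym (ZP.*-identityˡ _)
   ∇-at (suc a) f n = trans (SMod-0⇒≡ eq n) (trans (⊕-at _ _ n) (trans (cong (_+_ (+ n * (π · ∇ a f) n)) (trans (⊖-at _ n) (cong -_ (const-·-≡ (+ r) (π · ∇ a f) n))))
     (trans (cong (λ y → + n * y - + r * y) (∇-at a f n)) (h (+ n) (+ r) (z n Z.^ a) ((π · f) n)))))
    where
    open E
    h : ∀ n r x y → n * (x * y) - r * (x * y) ≡ (n - r) * x * y
    h = ring
    eq : π · ∇ (suc a) f ≋ D (π · ∇ a f) ⊝ const (+ r) · (π · ∇ a f)
    eq = tr (solve 5 (λ p x f c e → p :* (x :- c :* (e :* f)) := (c :* ((con (+ 1) :- e) :* p)) :* f :+ p :* x :- c :* (p :* f)) rfl π (D (∇ a f)) (∇ a f) (const (+ r)) e)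
     (+c (sm (tr (D-· π (∇ a f)) (+c (*c D-π rfl) rfl))) rfl)

   multipleOf : ∀ j n → Dec (m N.^ j ND.∣ Z.∣ z n ∣)
   multipleOf j n = m N.^ j ND.∣? Z.∣ z n ∣

   Projects : ℕ → ℕ → Ser → Set
   Projects j L P = ∀ n → Mod (pw L) ((π · P) n) ([ multipleOf j n ] * π n)

   module Step (j L : ℕ) (P : Ser) where

    a L' : ℕ
    -- This multiple of φ(m^L) equals 2 K L, so a derivatives do not change the half-weight modulo K
    -- L. The extra ja levels in L' are used up by the division by m^(ja).
    a = m N.^ L N.* d
    L' = j N.* a N.+ L

    a≡2K : a ≡ 2 N.* K L
    a≡2K = trans (cong (m N.^ L N.*_) d≡2μ) (h (m N.^ L) μ)
     where h : ∀ q μ → q N.* (2 N.* μ) ≡ 2 N.* (q N.* μ)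
           h = ringN

    L≤a : L N.≤ a
    L≤a = NP.≤-trans (NP.<⇒≤ (n<m^n L)) (NP.m≤m*n (m N.^ L) d {{N.>-nonZero d≥1}})

    pw-quotient : ∀ {n} → m N.^ j ND.∣ Z.∣ z n ∣ → ∃ λ k → z n ≡ k * pw j
    pw-quotient {n} p with ∣⇒Mod {m N.^ j} {z n} p
    ... | mod k q = k , trans q (trans (ZP.+-identityˡ _) (cong (_*_ k) (sym (pw-pos j))))

    power : ∀ {n k} → z n ≡ k * pw j → z n Z.^ a ≡ pw (j N.* a) * k Z.^ a
    power {n} {k} q = trans (cong (Z._^ a) q) (trans (^-distrib k (pw j) a) (trans (ZP.*-comm (k Z.^ a) _) (cong (_* k Z.^ a) (ZP.^-*-assoc (+ m) j a))))
     where ^-distrib : ∀ x y n → (x * y) Z.^ n ≡ x Z.^ n * y Z.^ n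
           ^-distrib x y zero    = refl
           ^-distrib x y (suc n) = trans (cong (_*_ (x * y)) (^-distrib x y n)) (h x y (x Z.^ n) (y Z.^ n))
            where h : ∀ x y a b → x * y * (a * b) ≡ x * a * (y * b)
                  h = ring

    Q≡ : Projects j L' P → ∀ n → Mod (pw L') ((π · ∇ a P) n) (z n Z.^ a * ([ multipleOf j n ] * π n))
    Q≡ p n = Mod-tr (≡⇒Mod (∇-at a P n)) (Mod-* {a = z n Z.^ a} Mod-refl (p n))

    -- On the support of π P modulo m^L' the number n - r is divisible by m^j, hence (n - r)^a by
    -- m^(ja); and π is invertible.
    Q≡0 : Projects j L' P → SMod (pw (j N.* a)) (∇ a P) (const (+ 0))
    Q≡0 p = π-cancel (smod λ n → Mod-tr (Mod-weaken (pw L) (subst (λ M → Mod M ((π · ∇ a P) n) (z n Z.^ a * ([ multipleOf j n ] * π n))) (trans (pw-+ (j N.* a) L) (ZP.*-comm (pw (j N.* a)) (pw L))) (Q≡ p n)))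
      (Mod-tr (go n (multipleOf j n)) (≡⇒Mod (sym (trans (SMod-0⇒≡ (E.zeroʳ π) n) (c0 n))))))
     where
     c0 : ∀ n → const (+ 0) n ≡ + 0
     c0 zero    = refl
     c0 (suc n) = refl
     go : ∀ n (d : Dec (m N.^ j ND.∣ Z.∣ z n ∣)) → Mod (pw (j N.* a)) (z n Z.^ a * ([ d ] * π n)) (+ 0)
     go n (no _)  = ≡⇒Mod (ZP.*-zeroʳ (z n Z.^ a))
     go n (yes p) = mod (k Z.^ a * (+ 1 * π n)) (trans (cong (_* (+ 1 * π n)) (power {n} {k} (proj₂ (pw-quotient {n} p)))) (h (pw (j N.* a)) (k Z.^ a) (+ 1 * π n)))
      where k : ℤ
            k = proj₁ (pw-quotient {n} p)
            h : ∀ w k x → w * k * x ≡ + 0 + k * x * w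
            h = ring

    -- For n - r = k m^j the coefficient of π R is k^a π n modulo m^L, that is π n if m does not
    -- divide k and 0 otherwise. Subtracting R leaves the n with m^(j+1) | n - r.
    remainder : Projects j L' P → ∀ R → SMod (pw L') (∇ a P) (const (pw (j N.* a)) · R) → Projects (suc j) L (P ⊝ R)
    remainder p R q n = Mod-tr (≡⇒Mod (trans (SMod-0⇒≡ (E.solve 3 (λ π p r → π E.:* (p E.:- r) E.:= π E.:* p E.:- π E.:* r) E.rfl π P R) n) (trans (⊕-at _ _ n) (cong (_+_ ((π · P) n)) (⊖-at _ n)))))
      (Mod-tr (Mod-+ (Mod-weaken (pw (j N.* a)) (subst (λ M → Mod M ((π · P) n) ([ multipleOf j n ] * π n)) (pw-+ (j N.* a) L) (p n))) (Mod-neg (go (multipleOf j n) R≡))) (cases (multipleOf j n)))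
     where
     R≡ : Mod (pw (j N.* a) * pw L) (pw (j N.* a) * (π · R) n) (z n Z.^ a * ([ multipleOf j n ] * π n))
     R≡ = subst (λ M → Mod M (pw (j N.* a) * (π · R) n) (z n Z.^ a * ([ multipleOf j n ] * π n))) (pw-+ (j N.* a) L)
      (Mod-tr (≡⇒Mod (trans (sym (const-·-≡ (pw (j N.* a)) (π · R) n)) (SMod-0⇒≡ (E.solve 3 (λ c p r → c E.:* (p E.:* r) E.:= p E.:* (c E.:* r)) E.rfl (const (pw (j N.* a))) π R) n)))
       (Mod-tr (Mod-sym (at (SR.*c (pw L') (SR.rfl (pw L') {π}) q) n)) (Q≡ p n)))
     val : Dec (m N.^ j ND.∣ Z.∣ z n ∣) → ℤ
     val (no _)  = + 0
     val (yes p) = (proj₁ (pw-quotient {n} p)) Z.^ a * π n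
     go : (d : Dec (m N.^ j ND.∣ Z.∣ z n ∣)) → Mod (pw (j N.* a) * pw L) (pw (j N.* a) * (π · R) n) (z n Z.^ a * ([ d ] * π n)) → Mod (pw L) ((π · R) n) (val d)
     go (no _)  x = Mod-unscale (pw (j N.* a)) (pw≢0 (j N.* a)) (Mod-tr x (≡⇒Mod (trans (ZP.*-zeroʳ (z n Z.^ a)) (sym (ZP.*-zeroʳ (pw (j N.* a)))))))
     go (yes p) x = Mod-unscale (pw (j N.* a)) (pw≢0 (j N.* a)) (Mod-tr x (≡⇒Mod (trans (cong (_* (+ 1 * π n)) (power {n} {proj₁ (pw-quotient {n} p)} (proj₂ (pw-quotient {n} p))))
       (h (pw (j N.* a)) ((proj₁ (pw-quotient {n} p)) Z.^ a) (π n)))))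
      where h : ∀ w k x → w * k * (+ 1 * x) ≡ w * (k * x)
            h = ring
     cases : (d : Dec (m N.^ j ND.∣ Z.∣ z n ∣)) → Mod (pw L) ([ d ] * π n - val d) ([ multipleOf (suc j) n ] * π n)
     cases (no ¬p) = ≡⇒Mod (cong (_* π n) (sym ([]-no (multipleOf (suc j) n) λ q → ¬p (ND.∣-trans (ND.n∣m*n m) q))))
     cases (yes p) = by (m ND.∣? Z.∣ k ∣)
      where
      k : ℤ
      k = proj₁ (pw-quotient {n} p)
      zk : Z.∣ z n ∣ ≡ Z.∣ k ∣ N.* m N.^ j
      zk = trans (cong Z.∣_∣ (trans (proj₂ (pw-quotient {n} p)) (cong (_*_ k) (pw-pos j)))) (ZP.abs-* k (+ (m N.^ j)))
      by : Dec (m ND.∣ Z.∣ k ∣) → Mod (pw L) (+ 1 * π n - k Z.^ a * π n) ([ multipleOf (suc j) n ] * π n)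
      by (yes m∣k) = Mod-tr (Mod-+ {a = + 1 * π n} Mod-refl (Mod-neg (Mod-* (pw-power (∣⇒Mod {a = k} m∣k) L a L≤a) (Mod-refl {a = π n}))))
       (≡⇒Mod (trans (h (π n)) (cong (_* π n) (sym ([]-yes (multipleOf (suc j) n) (subst (m N.^ suc j ND.∣_) (sym zk) (ND.*-monoˡ-∣ (m N.^ j) m∣k)))))))
       where h : ∀ x → + 1 * x - + 0 * x ≡ + 1 * x
             h = ring
      by (no m∤k) = Mod-tr (Mod-+ {a = + 1 * π n} Mod-refl (Mod-neg (Mod-* (Mod-weaken (+ m) (euler L k λ x → m∤k (Mod⇒∣ x))) (Mod-refl {a = π n}))))
       (≡⇒Mod (trans (h (π n)) (cong (_* π n) (sym ([]-no (multipleOf (suc j) n) λ q → m∤k (ND.*-cancelʳ-∣ (m N.^ j) {{N.>-nonZero (m^>0 j)}} (subst (m N.^ suc j ND.∣_) zk q)))))))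
       where h : ∀ x → + 1 * x - + 1 * x ≡ + 0 * x
             h = ring

   -- Multiplying the n-th coefficient by (n − r)^a, a a multiple of φ(m^L), and dividing by m^(ja)
   -- singles out the n with n − r exactly divisible by m^j.
   project : ∀ j L → ∃ λ P → Mf L 0 P × Projects j L P
   project zero    L = const (+ 1) , mf-iso L (iso-const (+ 1)) , λ n → ≡⇒Mod (trans (SMod-0⇒≡ (E.*-identityʳ π) n)
    (trans (sym (ZP.*-identityˡ (π n))) (cong (_* π n) (sym ([]-yes (multipleOf 0 n) (ND.1∣ _))))))
   project (suc j) L = step (project j (j N.* (m N.^ L N.* d) N.+ L))
    where
    Goal : Set
    Goal = ∃ λ P → Mf L 0 P × Projects (suc j) L P
    step : (∃ λ P → Mf (j N.* (m N.^ L N.* d) N.+ L) 0 P × Projects j (j N.* (m N.^ L N.* d) N.+ L) P) → Goal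
    step (P , p , q) = divided (mf-∇ a p)
     where
     open Step j L P
     divided : Mf L' (a N.+ 0) (∇ a P) → Goal
     divided (mf {t} {Q} iq Q≈) = finish (Div.saturate (j N.* a) iq (SR.tr (pw (j N.* a)) (SR.sm _ (pw-≤ (NP.m≤m+n (j N.* a) L) Q≈)) (Q≡0 q)))
      where
      finish : (∃ λ R → Iso (a N.+ 0 N.+ t N.* K L') R × Q ≋ const (pw (j N.* a)) · R) → Goal
      finish (R , iR , Q≋) = P ⊝ R , mf-⊝ (mf-weaken (j N.* a) p) (mf {t = 2 N.+ t N.* m N.^ (j N.* a)} (iso-≡ weight iR) (SR.rfl (pw L))) ,
        remainder q R (SR.tr _ Q≈ (exact Q≋))
       where
       weight : a N.+ 0 N.+ t N.* K L' ≡ 0 N.+ (2 N.+ t N.* m N.^ (j N.* a)) N.* K L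
       weight = trans (cong₂ N._+_ (trans (NP.+-identityʳ a) a≡2K) (cong (t N.*_) (K-+ (j N.* a) L))) (h (K L) t (m N.^ (j N.* a)))
        where h : ∀ k t q → 2 N.* k N.+ t N.* (q N.* k) ≡ (2 N.+ t N.* q) N.* k
              h = ringN

  -- As r < m^k, no n < r has m^k | r - n. So π P, supported on multiples of 24, vanishes modulo m^k
  -- below 24h = r + s, the first multiple of 24 that is at least r. Then P ≡ Δ'^h g, and Δ'^h is a
  -- constant times η^r η^s, where η^r cancels π up to q^r.
  partition-form : ∀ k → r N.< m N.^ k → ∃ λ s → ∃ λ w → ∃ λ P → Iso (suc w) P ×
          (∀ x → Mod (pw k) ((η ↑ s · P) (m N.^ k N.* x)) (+ pr24 r (m N.^ k N.* x N.+ r)))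
  partition-form k r<m^k = start (project k k) (ceil24 r)
   where
   open SR (pw k)
   Goal : Set
   Goal = ∃ λ s → ∃ λ w → ∃ λ P → Iso (suc w) P × (∀ x → Mod (pw k) ((η ↑ s · P) (m N.^ k N.* x)) (+ pr24 r (m N.^ k N.* x N.+ r)))
   start : (∃ λ P → Mf k 0 P × Projects k k P) → (∃ λ h → ∃ λ s → h N.* 24 ≡ r N.+ s × s N.< 24) → Goal
   start (P1 , mf {t} {P} iP P1≈P , proj) (h , s , h≡ , s<24) = result (Div.divide-Δ' k h iP (Ord-cong _ (sm P≈) (Ord-·ˡ _ ord)))
    where
    P≈ : P ≈ Êul ↑ r · (π · P)
    P≈ = sm (tr (solve 3 (λ a b c → a :* (b :* c) := (b :* a) :* c) rfl (Êul ↑ r) π P) (tr (*c (exact (π̂-Êul r)) rfl) (*-identityˡ P)))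
    f≡ : ∀ n → Mod (pw k) ((π · P) n) ([ multipleOf k n ] * π n)
    f≡ n = Mod-tr (at (*c (rfl {π}) (sm P1≈P)) n) (proj n)
    below : ∀ n → n N.< r → ¬ (m N.^ k ND.∣ Z.∣ z n ∣)
    below n n<r p = NP.<⇒≱ r<m^k (NP.≤-trans (ND.∣⇒≤ {{N.>-nonZero (NP.m<n⇒0<n∸m n<r)}} (subst (m N.^ k ND.∣_) (trans (cong Z.∣_∣ (ZP.[+m]-[+n]≡m⊖n n r)) (ZP.∣⊖∣-≤ (NP.<⇒≤ n<r))) p)) (NP.m∸n≤m r n))
    ord : Ord (pw k) (h N.* 24) (π · P)
    ord n n< = Mod-tr (f≡ n) (go (24 ND.∣? n))
     where
     go : Dec (24 ND.∣ n) → Mod (pw k) ([ multipleOf k n ] * π n) (+ 0)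
     go (no ¬p) = ≡⇒Mod (trans (cong (_*_ [ multipleOf k n ]) (π̂-off r n ¬p)) (ZP.*-zeroʳ [ multipleOf k n ]))
     go (yes (ND.divides q refl)) = ≡⇒Mod (cong (_* π (q N.* 24)) ([]-no (multipleOf k (q N.* 24)) (below (q N.* 24) (NP.+-cancelˡ-< 24 _ _
      (NP.≤-<-trans (NP.*-monoˡ-≤ 24 (NP.*-cancelʳ-< 24 q h n<)) (subst (N._< 24 N.+ r) (sym h≡) (subst (r N.+ s N.<_) (NP.+-comm r 24) (NP.+-monoʳ-< r s<24))))))))
    coefficient : ∀ {P″} → q^ r · (η ↑ s · P″) ≈ π · P → ∀ x → Mod (pw k) ((η ↑ s · P″) (m N.^ k N.* x)) (+ pr24 r (m N.^ k N.* x N.+ r))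
    coefficient {P″} p x = Mod-tr (≡⇒Mod (sym (trans (SMod-0⇒≡ (q^-· r (η ↑ s · P″)) (r N.+ N)) (sh-at r (η ↑ s · P″) N)))) (Mod-tr (at p (r N.+ N)) (Mod-tr (f≡ (r N.+ N))
      (≡⇒Mod (trans (cong (_* π (r N.+ N)) ([]-yes (multipleOf k (r N.+ N)) (subst (λ y → m N.^ k ND.∣ Z.∣ y ∣) (sym (hz (+ r) (+ N))) (ND.m∣m*n x)))) (trans (ZP.*-identityˡ _) (cong π (NP.+-comm r N)))))))
     where
     N : ℕ
     N = m N.^ k N.* x
     hz : ∀ r n → (r + n) - r ≡ n
     hz = ring
    η↑r : η ↑ r ≈ q^ r · Êul ↑ r
    η↑r = tr (↑-cong r (exact η-def)) (tr (·-↑ (q^ 1) Êul r) (*c (tr (q^-↑ 1 r) (≡⇒SMod λ i → cong (λ n → q^ n i) (NP.*-identityʳ r))) rfl))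
    c : ℤ
    c = (+ 1728) Z.^ h
    Δ'↑h : Δ' ↑ h ≈ const c · (q^ r · Êul ↑ r · η ↑ s)
    Δ'↑h = tr (↑-cong h (exact Δ'≋η²⁴)) (tr (·-↑ _ _ h) (*c (const-↑ (+ 1728) h) (tr (sm (↑-* η h 24)) (tr (≡⇒SMod λ i → cong (λ n → (η ↑ n) i) h≡)
     (tr (↑-+ η r s) (*c η↑r rfl))))))
    result : (∃ λ w → ∃ λ g → t N.* K k ≡ h N.* 6 N.+ w × Iso w g × P ≈ Δ' ↑ h · g) ⊎ P ≈ const (+ 0) → Goal
    result (inj₂ P≈0) = s , 0 , const (+ 0) , iso-0 , coefficient (tr (solve 2 (λ x y → x :* (y :* con (+ 0)) := con (+ 0)) rfl (q^ r) (η ↑ s)) (sm (tr (*c rfl P≈0) (zeroʳ π))))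
    -- The factor `one k` ensures positive weight and thus at least four variables in the theta
    -- series, so that ℓ^(n-2) is an integer.
    result (inj₁ (w , g , _ , ig , P≈g)) = s , N.pred (K k) N.+ w , const c · (one k · g) , iso-≡ (cong (N._+ w) (pos (K k) K≥1)) (iso-scale c (iso-· (iso-one k) ig)) , coefficient (sm (begin
      π · P ≈⟨ *c rfl (tr P≈g (*c Δ'↑h rfl)) ⟩
      π · (const c · (q^ r · Êul ↑ r · η ↑ s) · g) ≈⟨ solve 6 (λ p c q u y g → p :* (c :* (q :* u :* y) :* g) := (p :* u) :* (q :* (y :* (c :* (con (+ 1) :* g))))) rfl π (const c) (q^ r) (Êul ↑ r) (η ↑ s) g ⟩
      (π · Êul ↑ r) · (q^ r · (η ↑ s · (const c · (const (+ 1) · g)))) ≈⟨ *c (exact (π̂-Êul r)) (*c rfl (*c rfl (*c rfl (*c (sm (one≈1 k)) rfl)))) ⟩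
      const (+ 1) · (q^ r · (η ↑ s · (const c · (one k · g)))) ≈⟨ *-identityˡ _ ⟩
      q^ r · (η ↑ s · (const c · (one k · g))) ∎))
     where
     open ≈-Reasoning
     K≥1 : 1 N.≤ K k
     K≥1 = NP.*-mono-≤ (m^>0 k) (NP.≤-trans (s≤s z≤n) 2≤μ)
     pos : ∀ n → 1 N.≤ n → n ≡ suc (N.pred n)
     pos (suc n) _ = refl

open PartitionForm

-- Positive definite quadratic forms on ℤⁿ

module QuadraticForms where

 open Z using (_+_; _*_; -_; _-_)

 V : ℕ → Set
 V = Vec ℤ

 infixl 6 _⊞_
 infixr 7 _⊙_

 _⊞_ : ∀ {n} → V n → V n → V n
 []      ⊞ []      = []
 (x ∷ u) ⊞ (y ∷ v) = x + y ∷ u ⊞ v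

 _⊙_ : ∀ {n} → ℤ → V n → V n
 c ⊙ []      = []
 c ⊙ (x ∷ u) = c * x ∷ c ⊙ u

 𝟎 : ∀ {n} → V n
 𝟎 {zero}  = []
 𝟎 {suc n} = + 0 ∷ 𝟎

 basis : ∀ {n} → Fin n → V n
 basis zero    = + 1 ∷ 𝟎
 basis (suc i) = + 0 ∷ basis i

 record Linear {n} (φ : V n → ℤ) : Set where
  field
   add   : ∀ u v → φ (u ⊞ v) ≡ φ u + φ v
   scale : ∀ c u → φ (c ⊙ u) ≡ c * φ u
 open Linear public

 record LinearMap {m n} (f : V m → V n) : Set where
  field
   map-add   : ∀ u v → f (u ⊞ v) ≡ f u ⊞ f v
   map-scale : ∀ c u → f (c ⊙ u) ≡ c ⊙ f u
 open LinearMap public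

 linear-∘ : ∀ {m n φ} {f : V m → V n} → Linear φ → LinearMap f → Linear (φ ∘ f)
 linear-∘ {φ = φ} p q = record { add = λ u v → trans (cong φ (map-add q u v)) (add p _ _) ; scale = λ c u → trans (cong φ (map-scale q c u)) (scale p c _) }

 linearMap-∘ : ∀ {l m n} {f : V m → V n} {g : V l → V m} → LinearMap f → LinearMap g → LinearMap (f ∘ g)
 linearMap-∘ {f = f} p q = record { map-add = λ u v → trans (cong f (map-add q u v)) (map-add p _ _) ; map-scale = λ c u → trans (cong f (map-scale q c u)) (map-scale p c _) }

 module _ where
  private
   variable n : ℕ

  ⊞-identityˡ : (u : V n) → 𝟎 ⊞ u ≡ u
  ⊞-identityˡ []      = refl
  ⊞-identityˡ (x ∷ u) = cong₂ _∷_ (ZP.+-identityˡ x) (⊞-identityˡ u)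

  ⊙-zeroˡ : (u : V n) → + 0 ⊙ u ≡ 𝟎
  ⊙-zeroˡ []      = refl
  ⊙-zeroˡ (x ∷ u) = cong (+ 0 ∷_) (⊙-zeroˡ u)

  ⊙-zeroʳ : ∀ c → c ⊙ 𝟎 {n} ≡ 𝟎
  ⊙-zeroʳ {zero}  c = refl
  ⊙-zeroʳ {suc n} c = cong₂ _∷_ (ZP.*-zeroʳ c) (⊙-zeroʳ c)

  ⊙-assoc : ∀ a b (u : V n) → a ⊙ b ⊙ u ≡ (a * b) ⊙ u
  ⊙-assoc a b []      = refl
  ⊙-assoc a b (x ∷ u) = cong₂ _∷_ (sym (ZP.*-assoc a b x)) (⊙-assoc a b u)

  ⊙-identity : (u : V n) → + 1 ⊙ u ≡ u
  ⊙-identity []      = refl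
  ⊙-identity (x ∷ u) = cong₂ _∷_ (ZP.*-identityˡ x) (⊙-identity u)

  ⊙-distribˡ : ∀ a (u v : V n) → a ⊙ (u ⊞ v) ≡ a ⊙ u ⊞ a ⊙ v
  ⊙-distribˡ a []      []      = refl
  ⊙-distribˡ a (x ∷ u) (y ∷ v) = cong₂ _∷_ (ZP.*-distribˡ-+ a x y) (⊙-distribˡ a u v)

  ⊙-distribʳ : ∀ a b (u : V n) → (a + b) ⊙ u ≡ a ⊙ u ⊞ b ⊙ u
  ⊙-distribʳ a b []      = refl
  ⊙-distribʳ a b (x ∷ u) = cong₂ _∷_ (ZP.*-distribʳ-+ x a b) (⊙-distribʳ a b u)

  ⊞-interchange : (a b c d : V n) → (a ⊞ b) ⊞ (c ⊞ d) ≡ (a ⊞ c) ⊞ (b ⊞ d)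
  ⊞-interchange [] [] [] [] = refl
  ⊞-interchange (x ∷ a) (y ∷ b) (z ∷ c) (w ∷ d) = cong₂ _∷_ (h x y z w) (⊞-interchange a b c d)
   where h : ∀ x y z w → (x + y) + (z + w) ≡ (x + z) + (y + w)
         h = ring

  ⊙-comm : ∀ a b (u : V n) → a ⊙ b ⊙ u ≡ b ⊙ a ⊙ u
  ⊙-comm a b u = trans (⊙-assoc a b u) (trans (cong (_⊙ u) (ZP.*-comm a b)) (sym (⊙-assoc b a u)))

  ⊙-cancel : ∀ c {u v : V n} → c ≢ + 0 → c ⊙ u ≡ c ⊙ v → u ≡ v
  ⊙-cancel c {[]}    {[]}    nz p = refl
  ⊙-cancel c {x ∷ u} {y ∷ v} nz p = cong₂ _∷_ (ZP.*-cancelˡ-≡ c x y {{Z.≢-nonZero nz}} (cong Vec.head p)) (⊙-cancel c nz (cong Vec.tail p))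

  cons-split : ∀ x (v : V n) → x ∷ v ≡ (x ⊙ basis zero) ⊞ (+ 0 ∷ v)
  cons-split x v = cong₂ _∷_ (sym (trans (ZP.+-identityʳ _) (ZP.*-identityʳ x))) (sym (trans (cong (_⊞ v) (⊙-zeroʳ x)) (⊞-identityˡ v)))

  linear-0 : ∀ {φ : V n → ℤ} → Linear φ → φ 𝟎 ≡ + 0
  linear-0 {φ = φ} p = trans (cong φ (sym (⊙-zeroˡ 𝟎))) (scale p (+ 0) 𝟎)

  head-linear : Linear {suc n} Vec.head
  head-linear = record { add = λ { (x ∷ _) (y ∷ _) → refl } ; scale = λ { c (x ∷ _) → refl } }

  tail-linear : LinearMap {suc n} Vec.tail
  tail-linear = record { map-add = λ { (_ ∷ _) (_ ∷ _) → refl } ; map-scale = λ { c (_ ∷ _) → refl } }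

  0∷-linear : LinearMap {n} (+ 0 ∷_)
  0∷-linear = record { map-add = λ u v → refl ; map-scale = λ c u → cong (_∷ c ⊙ u) (sym (ZP.*-zeroʳ c)) }

  lookup-linear : (i : Fin n) → Linear λ v → Vec.lookup v i
  lookup-linear zero    = record { add = λ { (_ ∷ _) (_ ∷ _) → refl } ; scale = λ { c (_ ∷ _) → refl } }
  lookup-linear (suc i) = record { add = λ { (_ ∷ u) (_ ∷ v) → add (lookup-linear i) u v } ; scale = λ { c (_ ∷ u) → scale (lookup-linear i) c u } }

  linear-ext : ∀ {φ ψ : V n → ℤ} → Linear φ → Linear ψ → (∀ i → φ (basis i) ≡ ψ (basis i)) → ∀ v → φ v ≡ ψ v
  linear-ext {zero} {φ} {ψ} p q eq [] = trans (linear-0 p) (sym (linear-0 q))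
  linear-ext {suc n} {φ} {ψ} p q eq (x ∷ v) = trans (expand p) (trans (cong₂ (λ a b → x * a + b) (eq zero)
    (linear-ext (linear-∘ p 0∷-linear) (linear-∘ q 0∷-linear) (eq ∘ suc) v)) (sym (expand q)))
   where expand : ∀ {φ} → Linear φ → φ (x ∷ v) ≡ x * φ (basis zero) + φ (+ 0 ∷ v)
         expand {φ} p = trans (cong φ (cons-split x v)) (trans (add p _ _) (cong (_+ φ (+ 0 ∷ v)) (scale p x _)))

 -- A positive definite form on ℤⁿ; the dual lattice is contained in N0⁻¹ ℤⁿ.
 record Form (N0 n : ℕ) : Set where
  field
   B      : V n → V n → ℤ
   linear : ∀ z → Linear λ x → B x z
   symm   : ∀ x y → B x y ≡ B y x
   nonneg : ∀ x → + 0 Z.≤ B x x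
   dual   : ∀ φ → Linear φ → ∃ λ c → ∀ y → B c y ≡ + N0 * φ y

  Q : V n → ℤ
  Q x = B x x

  linearʳ : ∀ z → Linear (B z)
  linearʳ z = record { add = λ u v → trans (symm z _) (trans (add (linear z) u v) (cong₂ _+_ (symm u z) (symm v z)))
           ; scale = λ c u → trans (symm z _) (trans (scale (linear z) c u) (cong (_*_ c) (symm u z))) }

  B-comb : ∀ a b a' b' u v u' v' → B (a ⊙ u ⊞ b ⊙ v) (a' ⊙ u' ⊞ b' ⊙ v') ≡ a * a' * B u u' + a * b' * B u v' + b * a' * B v u' + b * b' * B v v'
  B-comb a b a' b' u v u' v' = trans (add (linear _) _ _) (trans (cong₂ _+_ (trans (scale (linear _) a u) (cong (_*_ a) (right u))) (trans (scale (linear _) b v) (cong (_*_ b) (right v))))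
    (h a b a' b' (B u u') (B u v') (B v u') (B v v')))
   where right : ∀ w → B w (a' ⊙ u' ⊞ b' ⊙ v') ≡ a' * B w u' + b' * B w v'
         right w = trans (add (linearʳ w) _ _) (cong₂ _+_ (scale (linearʳ w) a' u') (scale (linearʳ w) b' v'))
         h : ∀ a b a' b' x y z w → a * (a' * x + b' * y) + b * (a' * z + b' * w) ≡ a * a' * x + a * b' * y + b * a' * z + b * b' * w
         h = ring

  Q-comb : ∀ a b u v → Q (a ⊙ u ⊞ b ⊙ v) ≡ a * a * Q u + + 2 * (a * b * B u v) + b * b * Q v
  Q-comb a b u v = trans (B-comb a b a b u v u v) (trans (cong (λ z → a * a * Q u + a * b * B u v + b * a * z + b * b * Q v) (symm v u)) (h a b (Q u) (B u v) (Q v)))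
   where h : ∀ a b x y z → a * a * x + a * b * y + b * a * y + b * b * z ≡ a * a * x + + 2 * (a * b * y) + b * b * z
         h = ring

  Q-scale : ∀ a u → Q (a ⊙ u) ≡ a * a * Q u
  Q-scale a u = trans (scale (linear _) a u) (trans (cong (_*_ a) (scale (linearʳ u) a u)) (sym (ZP.*-assoc a a _)))

  -- Expand 0 ≤ Q (s y - c) for the vector c that represents N0 φ. Definiteness, and the bound on
  -- the coordinates of y by Q y, both come from this inequality.
  pairing-bound : ∀ s φ (p : Linear φ) y → + 2 * (s * (+ N0 * φ y)) Z.≤ s * s * Q y + Q (proj₁ (dual φ p))
  pairing-bound s φ p y with dual φ p
  ... | c , eq = subst (Z._≤ s * s * Q y + Q c) (h2 s (+ N0 * φ y) (Q y) (Q c))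
   (ZP.≤-trans (ZP.+-monoʳ-≤ (+ 2 * (s * (+ N0 * φ y))) (subst (+ 0 Z.≤_) (trans (Q-comb s (- + 1) y c) (trans (cong (λ z → s * s * Q y + + 2 * (s * - + 1 * z) + - + 1 * - + 1 * Q c) (trans (symm y c) (eq y))) (h1 s (+ N0 * φ y) (Q y) (Q c)))) (nonneg (s ⊙ y ⊞ - + 1 ⊙ c))))
    (ZP.≤-reflexive (h3 s (+ N0 * φ y) (Q y) (Q c))))
   where
   h1 : ∀ s x q c → s * s * q + + 2 * (s * - + 1 * x) + - + 1 * - + 1 * c ≡ s * s * q + c - + 2 * (s * x)
   h1 = ring
   h2 : ∀ s x q c → + 2 * (s * x) + + 0 ≡ + 2 * (s * x)
   h2 s x q c = ZP.+-identityʳ _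
   h3 : ∀ s x q c → + 2 * (s * x) + (s * s * q + c - + 2 * (s * x)) ≡ s * s * q + c
   h3 = ring

 sumF : ∀ {n} → (Fin n → ℕ) → ℕ
 sumF {zero}  f = 0
 sumF {suc n} f = f zero N.+ sumF (f ∘ suc)

 ≤-sumF : ∀ {n} (f : Fin n → ℕ) i → f i N.≤ sumF f
 ≤-sumF f zero    = NP.m≤m+n _ _
 ≤-sumF f (suc i) = NP.≤-trans (≤-sumF (f ∘ suc) i) (NP.m≤n+m _ _)

 AllV-lookup : ∀ {A : Set} {P : A → Set} {n} {v : Vec A n} → (∀ i → P (Vec.lookup v i)) → AllV P v
 AllV-lookup {v = []}    p = []
 AllV-lookup {v = x ∷ v} p = p zero ∷ AllV-lookup (p ∘ suc)

 ∣i∣≤ : ∀ {N K} z → 1 N.≤ N → + 2 * (+ N * z) Z.≤ + K → + 2 * (- + 1 * (+ N * z)) Z.≤ + K → Z.∣ z ∣ N.≤ K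
 ∣i∣≤ {N} {K} (+ n) 1≤N p _ = NP.≤-trans (NP.m≤n*m n (2 N.* N) {{N.>-nonZero (NP.*-mono-≤ (s≤s {0} {1} z≤n) 1≤N)}})
  (Z.drop‿+≤+ (subst (Z._≤ + K) (trans (cong (_*_ (+ 2)) (sym (ZP.pos-* N n))) (trans (sym (ZP.pos-* 2 (N N.* n))) (cong +_ (sym (NP.*-assoc 2 N n))))) p))
 ∣i∣≤ {N} {K} -[1+ n ] 1≤N _ p = ∣i∣≤ {N} {K} (+ suc n) 1≤N (subst (Z._≤ + K) (h (+ N) (+ suc n)) p) (subst (Z._≤ + K) (sym (trans (h' (+ N) (+ suc n))
   (cong -_ (trans (cong (_* + suc n) (sym (ZP.pos-* 2 N))) (sym (ZP.pos-* (2 N.* N) (suc n))))))) ZP.neg-≤-pos)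
  where h : ∀ N x → + 2 * (- + 1 * (N * - x)) ≡ + 2 * (N * x)
        h = ring
        h' : ∀ N x → + 2 * (- + 1 * (N * x)) ≡ - (+ 2 * N * x)
        h' = ring

 module _ {N0 n} (𝔽 : Form N0 n) (1≤N0 : 1 N.≤ N0) where
  open Form 𝔽

  bound : ℕ → ℕ
  bound N = N N.+ sumF λ i → Z.∣ Q (proj₁ (dual _ (lookup-linear {n} i))) ∣

  in-bound : ∀ {N y} → Q y ≡ + N → InBox (bound N) y
  in-bound {N} {y} q = AllV-lookup λ i → NP.≤-trans (one i) (NP.+-monoʳ-≤ N (≤-sumF _ i))
   where
   one : ∀ i → Z.∣ Vec.lookup y i ∣ N.≤ N N.+ Z.∣ Q (proj₁ (dual _ (lookup-linear {n} i))) ∣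
   one i = ∣i∣≤ {N0} _ 1≤N0 (subst2 (trans (cong (_*_ (+ 2)) (ZP.*-identityˡ _)) refl) (right (+ 1) refl) (pairing-bound (+ 1) _ (lookup-linear i) y))
     (subst2 refl (right (- + 1) refl) (pairing-bound (- + 1) _ (lookup-linear i) y))
    where
    subst2 : ∀ {a b c d} → a ≡ b → c ≡ d → a Z.≤ c → b Z.≤ d
    subst2 refl refl x = x
    right : ∀ s → s * s ≡ + 1 → s * s * Q y + Q (proj₁ (dual _ (lookup-linear i))) ≡ + (N N.+ Z.∣ Q (proj₁ (dual _ (lookup-linear {n} i))) ∣)
    right s e = cong₂ _+_ (trans (cong (_* Q y) e) (trans (ZP.*-identityˡ _) q)) (sym (ZP.0≤i⇒+∣i∣≡i (nonneg _)))

  reps : (V n → ℤ) → ℕ → ℤ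
  reps w N = sumL (box n (bound N)) λ y → [ Q y Z.≟ + N ] * w y

open QuadraticForms

-- Hermite reduction: finitely many reduced Gram matrices

module HermiteReduction where

 open Z using (_+_; _*_; -_; _-_)

 record LIso (n : ℕ) : Set where
  field
   to from     : V n → V n
   to-linear   : LinearMap to
   from-linear : LinearMap from
   to-from     : ∀ x → to (from x) ≡ x
   from-to     : ∀ x → from (to x) ≡ x
 open LIso public

 id-iso : ∀ {n} → LIso n
 id-iso = record { to = λ x → x ; from = λ x → x ; to-linear = l ; from-linear = l ; to-from = λ _ → refl ; from-to = λ _ → refl }
  where l : ∀ {n} → LinearMap {n} (λ x → x)
        l = record { map-add = λ _ _ → refl ; map-scale = λ _ _ → refl }

 _∙_ : ∀ {n} → LIso n → LIso n → LIso n
 h ∙ g = record { to = to h ∘ to g ; from = from g ∘ from h ; to-linear = linearMap-∘ (to-linear h) (to-linear g) ; from-linear = linearMap-∘ (from-linear g) (from-linear h)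
  ; to-from = λ x → trans (cong (to h) (to-from g _)) (to-from h x) ; from-to = λ x → trans (cong (from g) (from-to h _)) (from-to g x) }

 swap-iso : ∀ {n} → LIso (suc (suc n))
 swap-iso = record { to = s ; from = s ; to-linear = l ; from-linear = l ; to-from = i ; from-to = i }
  where s : ∀ {n} → V (suc (suc n)) → V (suc (suc n))
        s (x ∷ y ∷ v) = y ∷ x ∷ v
        l : ∀ {n} → LinearMap (s {n})
        l = record { map-add = λ { (_ ∷ _ ∷ _) (_ ∷ _ ∷ _) → refl } ; map-scale = λ { c (_ ∷ _ ∷ _) → refl } }
        i : ∀ {n} (x : V (suc (suc n))) → s (s x) ≡ x
        i (_ ∷ _ ∷ _) = refl

 block-iso : ∀ {n φ} → Linear φ → LIso n → LIso (suc n)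
 block-iso {n} {φ} p h = record { to = t ; from = f ; to-linear = record { map-add = ta ; map-scale = ts } ; from-linear = record { map-add = fa ; map-scale = fs } ; to-from = tf ; from-to = ft }
  where
  t f : V (suc n) → V (suc n)
  t (x ∷ v) = x + φ v ∷ to h v
  f (x ∷ v) = x - φ (from h v) ∷ from h v
  r1 : ∀ x y a b → (x + y) + (a + b) ≡ (x + a) + (y + b)
  r1 = ring
  r2 : ∀ x y a b → (x + y) - (a + b) ≡ (x - a) + (y - b)
  r2 = ring
  r3 : ∀ c x a → c * x - c * a ≡ c * (x - a)
  r3 = ring
  r4 : ∀ x a → x - a + a ≡ x
  r4 = ring
  r5 : ∀ x a → x + a - a ≡ x
  r5 = ring
  q : Linear (φ ∘ from h)
  q = linear-∘ p (from-linear h)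
  ta : ∀ u v → t (u ⊞ v) ≡ t u ⊞ t v
  ta (x ∷ u) (y ∷ v) = cong₂ _∷_ (trans (cong (_+_ (x + y)) (add p u v)) (r1 x y _ _)) (map-add (to-linear h) u v)
  ts : ∀ c u → t (c ⊙ u) ≡ c ⊙ t u
  ts c (x ∷ u) = cong₂ _∷_ (trans (cong (_+_ (c * x)) (scale p c u)) (sym (ZP.*-distribˡ-+ c x _))) (map-scale (to-linear h) c u)
  fa : ∀ u v → f (u ⊞ v) ≡ f u ⊞ f v
  fa (x ∷ u) (y ∷ v) = cong₂ _∷_ (trans (cong (λ z → x + y - z) (add q u v)) (r2 x y _ _)) (map-add (from-linear h) u v)
  fs : ∀ c u → f (c ⊙ u) ≡ c ⊙ f u
  fs c (x ∷ u) = cong₂ _∷_ (trans (cong (λ z → c * x - z) (scale q c u)) (r3 c x _)) (map-scale (from-linear h) c u)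
  tf : ∀ x → t (f x) ≡ x
  tf (x ∷ v) = cong₂ _∷_ (r4 x _) (to-from h v)
  ft : ∀ x → f (t x) ≡ x
  ft (x ∷ v) = cong₂ _∷_ (trans (cong (λ z → x + φ v - φ z) (from-to h v)) (r5 x _)) (from-to h v)

 pull : ∀ {N0 n} → Form N0 n → LIso n → Form N0 n
 pull {N0} {n} 𝔽 h = record
  { B = λ x y → B (to h x) (to h y) ; linear = λ z → linear-∘ (linear (to h z)) (to-linear h) ; symm = λ x y → symm _ _ ; nonneg = λ x → nonneg _ ; dual = d }
  where
  open Form 𝔽
  d : ∀ φ → Linear φ → ∃ λ c → ∀ y → B (to h c) (to h y) ≡ + N0 * φ y
  d φ p with dual (φ ∘ from h) (linear-∘ p (from-linear h))
  ... | c , eq = from h c , λ y → trans (cong (λ c → B c (to h y)) (to-from h c)) (trans (eq (to h y)) (cong (λ z → + N0 * φ z) (from-to h y)))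

 -- The form on the projection orthogonal to the first basis vector, multiplied by a to keep the
 -- values integral; the denominator of the dual lattice becomes a N0.
 module Schur {N0 n} (𝔽 : Form N0 (suc n)) (a : ℕ) (1≤a : 1 N.≤ a) (a≡ : Form.Q 𝔽 (basis zero) ≡ + a) where
  open Form 𝔽

  β : V n → ℤ
  β v = B (basis zero) (+ 0 ∷ v)

  β-linear : Linear β
  β-linear = linear-∘ (linearʳ (basis zero)) 0∷-linear

  S : V n → V n → ℤ
  S x y = + a * B (+ 0 ∷ x) (+ 0 ∷ y) - β x * β y

  schur : Form (a N.* N0) n
  schur = record { B = S ; linear = λ z → record { add = λ u v → trans (cong₂ (λ x y → + a * x - y * β z) (add (L z) u v) (add β-linear u v)) (r1 (+ a) _ _ (β u) (β v) (β z))
                          ; scale = λ c u → trans (cong₂ (λ x y → + a * x - y * β z) (scale (L z) c u) (scale β-linear c u)) (r2 (+ a) c _ (β u) (β z)) }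
   ; symm = λ x y → cong₂ _-_ (cong (_*_ (+ a)) (symm _ _)) (ZP.*-comm (β x) (β y)) ; nonneg = nn ; dual = d }
   where
   L : ∀ z → Linear (λ x → B (+ 0 ∷ x) (+ 0 ∷ z))
   L z = linear-∘ (linear (+ 0 ∷ z)) 0∷-linear
   r1 : ∀ a x x' y y' z → a * (x + x') - (y + y') * z ≡ (a * x - y * z) + (a * x' - y' * z)
   r1 = ring
   r2 : ∀ a c x y z → a * (c * x) - c * y * z ≡ c * (a * x - y * z)
   r2 = ring
   nn : ∀ x → + 0 Z.≤ S x x
   nn x = ZP.*-cancelˡ-≤-pos (+ 0) (S x x) (+ a) {{Z.positive (Z.+<+ 1≤a)}} (subst (Z._≤ + a * S x x) (sym (ZP.*-zeroʳ (+ a))) (subst (+ 0 Z.≤_)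
     (trans (Q-comb (+ a) (- β x) (+ 0 ∷ x) (basis zero)) (trans (cong₂ (λ y z → + a * + a * Q (+ 0 ∷ x) + + 2 * (+ a * - β x * y) + - β x * - β x * z) (symm _ _) a≡) (r (+ a) (β x) (Q (+ 0 ∷ x)))))
     (nonneg (+ a ⊙ (+ 0 ∷ x) ⊞ (- β x) ⊙ basis zero))))
    where r : ∀ a b q → a * a * q + + 2 * (a * - b * b) + - b * - b * a ≡ a * (a * q - b * b)
          r = ring
   d : ∀ φ → Linear φ → ∃ λ c → ∀ y → S c y ≡ + (a N.* N0) * φ y
   d φ p = from-dual (dual (φ ∘ Vec.tail) (linear-∘ p tail-linear))
    where
    from-dual : (∃ λ c → ∀ y → B c y ≡ + N0 * φ (Vec.tail y)) → ∃ λ c → ∀ y → S c y ≡ + (a N.* N0) * φ y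
    from-dual (c1 ∷ t , eq) = t , λ y → trans (cong (λ z → + a * B (+ 0 ∷ t) (+ 0 ∷ y) - z * β y) βt) (trans (r2' (+ a) c1 (B (+ 0 ∷ t) (+ 0 ∷ y)) (β y))
      (trans (cong (_*_ (+ a)) (trans (sym (expand (+ 0 ∷ y))) (eq (+ 0 ∷ y)))) (trans (sym (ZP.*-assoc (+ a) (+ N0) (φ y))) (cong (_* φ y) (sym (ZP.pos-* a N0))))))
     where
     expand : ∀ y → B (c1 ∷ t) y ≡ c1 * B (basis zero) y + B (+ 0 ∷ t) y
     expand y = trans (cong (λ c → B c y) (cons-split c1 t)) (trans (add (linear y) _ _) (cong (_+ B (+ 0 ∷ t) y) (scale (linear y) c1 _)))
     βt : β t ≡ - (c1 * + a)
     βt = trans (symm _ _) (trans (r1' (c1 * Q (basis zero)) (B (+ 0 ∷ t) (basis zero))) (trans (cong (_- c1 * Q (basis zero)) (trans (sym (expand (basis zero))) (trans (eq (basis zero)) (trans (cong (_*_ (+ N0)) (linear-0 p)) (ZP.*-zeroʳ (+ N0))))))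
       (trans (ZP.+-identityˡ _) (cong (λ z → - (c1 * z)) a≡))))
      where r1' : ∀ x y → y ≡ x + y - x
            r1' = ring
     r2' : ∀ a c x b → a * x - - (c * a) * b ≡ a * (c * b + x)
     r2' = ring

 e0-positive : ∀ {N0 n} (𝔽 : Form N0 (suc n)) → 1 N.≤ N0 → ∃ λ a → 1 N.≤ a × Form.Q 𝔽 (basis zero) ≡ + a
 e0-positive {N0} {n} 𝔽 1≤N0 = go (Q (basis zero)) refl (nonneg (basis zero))
  where
  open Form 𝔽
  go : ∀ q → Q (basis zero) ≡ q → + 0 Z.≤ q → ∃ λ a → 1 N.≤ a × Q (basis zero) ≡ + a
  go (+ suc a) p _ = suc a , s≤s z≤n , p
  -- If the first basis vector had norm 0, the bound with s = Q c + 1 would read 2 (Q c + 1) N0 ≤ Q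
  -- c.
  go (+ zero) p _ = ⊥-elim (NP.<⇒≱ (s≤s (NP.≤-refl {α})) (NP.≤-trans (NP.m≤n*m (suc α) (2 N.* N0) {{N.>-nonZero (NP.*-mono-≤ (s≤s {0} {1} z≤n) 1≤N0)}})
    (Z.drop‿+≤+ (subst2' lhs rhs (pairing-bound (+ suc α) Vec.head head-linear (basis zero))))))
   where
   c : V (suc n)
   c = proj₁ (dual Vec.head head-linear)
   α : ℕ
   α = Z.∣ Q c ∣
   lhs : + 2 * (+ suc α * (+ N0 * + 1)) ≡ + (2 N.* N0 N.* suc α)
   lhs = trans (h (+ suc α) (+ N0)) (trans (cong (_* + suc α) (sym (ZP.pos-* 2 N0))) (sym (ZP.pos-* (2 N.* N0) (suc α))))
    where h : ∀ a n → + 2 * (a * (n * + 1)) ≡ + 2 * n * a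
          h = ring
   rhs : + suc α * + suc α * Q (basis zero) + Q c ≡ + α
   rhs = trans (cong₂ _+_ (trans (cong (_*_ (+ suc α * + suc α)) p) (ZP.*-zeroʳ (+ suc α * + suc α))) (sym (ZP.0≤i⇒+∣i∣≡i (nonneg c)))) (ZP.+-identityˡ (+ α))
   subst2' : ∀ {a b c d} → a ≡ b → c ≡ d → a Z.≤ c → b Z.≤ d
   subst2' refl refl x = x

 round : ∀ a b → 1 N.≤ a → ∃ λ s → 2 N.* Z.∣ + a * s + b ∣ N.≤ a
 round a b 1≤a = go (2 N.* r N.≤? a)
  where
  instance nz : N.NonZero a
           nz = N.>-nonZero 1≤a
  r : ℕ
  r = b ZM.%ℕ a
  q : ℤ
  q = b ZM./ℕ a
  eq : b ≡ + r + q * + a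
  eq = ZM.a≡a%ℕn+[a/ℕn]*n b a
  h1 : ∀ a r q → a * - q + (r + q * a) ≡ r
  h1 = ring
  h2 : ∀ a r q → a * (- q - + 1) + (r + q * a) ≡ r - a
  h2 = ring
  go : Dec (2 N.* r N.≤ a) → ∃ λ s → 2 N.* Z.∣ + a * s + b ∣ N.≤ a
  go (yes p) = - q , subst (λ z → 2 N.* Z.∣ z ∣ N.≤ a) (sym (trans (cong (_+_ (+ a * - q)) eq) (h1 (+ a) (+ r) q))) p
  go (no ¬p) = - q - + 1 , subst (λ z → 2 N.* z N.≤ a) (sym (trans (cong Z.∣_∣ (trans (cong (_+_ (+ a * (- q - + 1))) eq) (h2 (+ a) (+ r) q)))
    (trans (cong Z.∣_∣ (ZP.[+m]-[+n]≡m⊖n r a)) (ZP.∣⊖∣-≤ (NP.<⇒≤ r<a))))) (subst (N._≤ a) (sym (NP.*-distribˡ-∸ 2 a r))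
     (NP.≤-trans (NP.∸-monoʳ-≤ (2 N.* a) (NP.<⇒≤ (NP.≰⇒> ¬p))) (NP.≤-reflexive (trans (cong (λ z → a N.+ z N.∸ a) (NP.+-identityʳ a)) (NP.m+n∸m≡n a a)))))
   where r<a : r N.< a
         r<a = ZM.n%ℕd<d b a

 dot : ∀ {n} → (Fin n → ℤ) → V n → ℤ
 dot s []      = + 0
 dot s (x ∷ v) = s zero * x + dot (s ∘ suc) v

 dot-linear : ∀ {n} (s : Fin n → ℤ) → Linear (dot s)
 dot-linear {zero}  s = record { add = λ { [] [] → refl } ; scale = λ { c [] → sym (ZP.*-zeroʳ c) } }
 dot-linear {suc n} s = record { add = λ { (x ∷ u) (y ∷ v) → trans (cong (_+_ (s zero * (x + y))) (add (dot-linear (s ∘ suc)) u v)) (h1 (s zero) x y _ _) }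
                ; scale = λ { c (x ∷ u) → trans (cong (_+_ (s zero * (c * x))) (scale (dot-linear (s ∘ suc)) c u)) (h2 c (s zero) x _) } }
  where h1 : ∀ s x y a b → s * (x + y) + (a + b) ≡ (s * x + a) + (s * y + b)
        h1 = ring
        h2 : ∀ c s x a → s * (c * x) + c * a ≡ c * (s * x + a)
        h2 = ring

 dot-basis : ∀ {n} (s : Fin n → ℤ) i → dot s (basis i) ≡ s i
 dot-basis s zero    = trans (cong₂ _+_ (ZP.*-identityʳ (s zero)) (linear-0 (dot-linear (s ∘ suc)))) (ZP.+-identityʳ (s zero))
 dot-basis s (suc i) = trans (cong₂ _+_ (ZP.*-zeroʳ (s zero)) (dot-basis (s ∘ suc) i)) (ZP.+-identityˡ _)

 entryBound : ℕ → ℕ → ℕ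
 entryBound zero    N0 = N0
 entryBound (suc n) N0 = (2 N.^ suc n N.* N0) N.* (2 N.^ suc n N.* N0) N.+ entryBound n ((2 N.^ suc n N.* N0) N.* N0)

 entryBound-mono : ∀ n {x y} → x N.≤ y → entryBound n x N.≤ entryBound n y
 entryBound-mono zero    p = p
 entryBound-mono (suc n) p = NP.+-mono-≤ (NP.*-mono-≤ q q) (entryBound-mono n (NP.*-mono-≤ q p))
  where q = NP.*-monoʳ-≤ (2 N.^ suc n) p

 Reduced : ∀ n → ℕ → (V (suc n) → V (suc n) → ℤ) → Set
 Reduced n N0 B = B (basis zero) (basis zero) Z.≤ + (2 N.^ n N.* N0) × (∀ i j → Z.∣ B (basis i) (basis j) ∣ N.≤ entryBound n N0)

 -- Write e0, e1, ... for the basis and a for Q e0. Reduce the Schur complement, shift the other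
 -- basis vectors by rounding so that 2 |B(e0, ei)| ≤ a, and exchange e0 with e1 while e1 is
 -- shorter; a decreases each time. At the end a is bounded, and with the complement it bounds all
 -- entries.
 reduce : ∀ n {N0} → 1 N.≤ N0 → (𝔽 : Form N0 (suc n)) → ∃ λ h → Reduced n N0 (Form.B (pull 𝔽 h))
 reduce zero {N0} 1≤N0 𝔽 = id-iso , go (e0-positive 𝔽 1≤N0) (dual Vec.head head-linear)
  where
  open Form 𝔽
  go : (∃ λ a → 1 N.≤ a × Q (basis zero) ≡ + a) → (∃ λ c → ∀ y → B c y ≡ + N0 * Vec.head y) → Reduced 0 N0 B
  go (a , _ , a≡) (c ∷ [] , eq) = subst (Z._≤ + (1 N.* N0)) (sym a≡) (Z.+≤+ (subst (a N.≤_) (sym (NP.*-identityˡ N0)) a≤)) , entry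
   where
   a∣ : + N0 ≡ c * + a
   a∣ = sym (trans (cong (_*_ c) (sym a≡)) (trans (sym (scale (linear (basis zero)) c (basis zero))) (trans (cong (λ z → B (z ∷ []) (basis zero)) (ZP.*-identityʳ c)) (trans (eq (basis zero)) (ZP.*-identityʳ (+ N0))))))
   a≤ : a N.≤ N0
   a≤ = ND.∣⇒≤ {{N.>-nonZero 1≤N0}} (ND.divides Z.∣ c ∣ (trans (cong Z.∣_∣ a∣) (ZP.abs-* c (+ a))))
   entry : ∀ i j → Z.∣ B (basis {1} i) (basis j) ∣ N.≤ N0
   entry zero zero = subst (N._≤ N0) (sym (cong Z.∣_∣ a≡)) a≤
 reduce (suc n) {N0} 1≤N0 𝔽0 = start (e0-positive 𝔽0 1≤N0)
  where
  bd : ℕ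
  bd = 2 N.^ suc n N.* N0
  Result : Form N0 (suc (suc n)) → Set
  Result 𝔽 = ∃ λ h → Reduced (suc n) N0 (Form.B (pull 𝔽 h))
  go : ∀ A (𝔽 : Form N0 (suc (suc n))) a → a N.≤ A → 1 N.≤ a → Form.Q 𝔽 (basis zero) ≡ + a → Result 𝔽
  go zero 𝔽 a a≤A 1≤a _ = ⊥-elim (NP.<⇒≱ 1≤a a≤A)
  go (suc A) 𝔽 a a≤A 1≤a a≡ = inner (reduce n (NP.*-mono-≤ 1≤a 1≤N0) schur)
   where
   open Schur 𝔽 a 1≤a a≡
   open Form 𝔽
   inner : (∃ λ h → Reduced n (a N.* N0) (Form.B (pull schur h))) → Result 𝔽
   inner (h , S00≤ , S≤) = continue (C N.≤? a) (a N.≤? C)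
    where
    s : Fin (suc n) → ℤ
    s i = proj₁ (round a (β (to h (basis i))) 1≤a)
    g : LIso (suc (suc n))
    g = block-iso (dot-linear s) h
    module G = Form (pull 𝔽 g)
    p : V (suc n) → ℤ
    p v = G.B (basis zero) (+ 0 ∷ v)
    g0 : ∀ v → to g (+ 0 ∷ v) ≡ (dot s v ⊙ basis zero) ⊞ (+ 1 ⊙ (+ 0 ∷ to h v))
    g0 v = trans (cong (_∷ to h v) (ZP.+-identityˡ (dot s v))) (trans (cons-split (dot s v) (to h v)) (cong ((dot s v ⊙ basis zero) ⊞_) (sym (⊙-identity _))))
    ge : to g (basis zero) ≡ basis zero
    ge = cong₂ _∷_ (cong (_+_ (+ 1)) (linear-0 (dot-linear s))) (trans (cong (to h) (sym (⊙-zeroˡ 𝟎))) (trans (map-scale (to-linear h) (+ 0) 𝟎) (⊙-zeroˡ _)))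
    p≡ : ∀ v → p v ≡ + a * dot s v + β (to h v)
    p≡ v = trans (cong₂ B ge (g0 v)) (trans (add (linearʳ _) _ _) (cong₂ _+_ (trans (scale (linearʳ _) (dot s v) _) (trans (cong (_*_ (dot s v)) a≡) (ZP.*-comm (dot s v) (+ a)))) (trans (scale (linearʳ _) (+ 1) _) (ZP.*-identityˡ _))))
    key : ∀ u v → + a * G.B (+ 0 ∷ u) (+ 0 ∷ v) ≡ p u * p v + S (to h u) (to h v)
    key u v = trans (cong (_*_ (+ a)) (trans (cong₂ B (g0 u) (g0 v)) (trans (B-comb (dot s u) (+ 1) (dot s v) (+ 1) _ _ _ _)
      (cong₂ (λ x y → dot s u * dot s v * x + dot s u * + 1 * β (to h v) + + 1 * dot s v * y + + 1 * + 1 * B (+ 0 ∷ to h u) (+ 0 ∷ to h v)) a≡ (symm _ _)))))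
     (trans (r (+ a) (dot s u) (dot s v) (β (to h u)) (β (to h v)) (B (+ 0 ∷ to h u) (+ 0 ∷ to h v))) (cong (_+ S (to h u) (to h v)) (cong₂ _*_ (sym (p≡ u)) (sym (p≡ v)))))
     where r : ∀ a x y b c q → a * (x * y * a + x * + 1 * c + + 1 * y * b + + 1 * + 1 * q) ≡ (a * x + b) * (a * y + c) + (a * q - b * c)
           r = ring
    p≤ : ∀ i → 2 N.* Z.∣ p (basis i) ∣ N.≤ a
    p≤ i = subst (λ z → 2 N.* Z.∣ z ∣ N.≤ a) (sym (trans (p≡ (basis i)) (cong (λ z → + a * z + β (to h (basis i))) (dot-basis s i)))) (proj₂ (round a (β (to h (basis i))) 1≤a))
    p≤' : ∀ i → Z.∣ p (basis i) ∣ N.≤ a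
    p≤' i = NP.≤-trans (NP.m≤m+n _ _) (p≤ i)
    C : ℕ
    C = Z.∣ G.Q (basis (suc zero)) ∣
    C≡ : G.Q (basis (suc zero)) ≡ + C
    C≡ = sym (ZP.0≤i⇒+∣i∣≡i (G.nonneg (basis (suc zero))))
    a≡' : G.Q (basis zero) ≡ + a
    a≡' = trans (cong₂ B ge ge) a≡

    -- The norm C of the second vector satisfies a C = P² + S with S ≤ 2^n a N0. As a ≤ C and 2P ≤
    -- a, this gives 4a² ≤ a² + 4 · 2^n a N0, which bounds a.
    small-a : a N.≤ C → a N.≤ bd
    small-a a≤C = NP.*-cancelˡ-≤ 2 (NP.≤-trans (NP.m≤n+m (2 N.* a) a) (NP.*-cancelˡ-≤ a {{N.>-nonZero 1≤a}} (NP.+-cancelˡ-≤ (a N.* a) _ _ ineq)))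
     where
     P : ℕ
     P = Z.∣ p (basis zero) ∣
     aC≤ : a N.* C N.≤ P N.* P N.+ 2 N.^ n N.* (a N.* N0)
     aC≤ = Z.drop‿+≤+ (ZP.≤-trans (ZP.≤-reflexive (trans (ZP.pos-* a C) (trans (cong (_*_ (+ a)) (sym C≡)) (key (basis zero) (basis zero)))))
      (ZP.≤-trans (ZP.+-monoʳ-≤ (p (basis zero) * p (basis zero)) S00≤) (ZP.≤-reflexive (cong (_+ + (2 N.^ n N.* (a N.* N0))) (sym (+sq' (p (basis zero))))))))
      where +sq' : ∀ x → + (Z.∣ x ∣ N.* Z.∣ x ∣) ≡ x * x
            +sq' (+ n) = ZP.pos-* n n
            +sq' -[1+ n ] = refl
     ineq : a N.* a N.+ a N.* (a N.+ 2 N.* a) N.≤ a N.* a N.+ a N.* (2 N.* bd)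
     ineq = NP.≤-trans (NP.≤-reflexive (h1 a)) (NP.≤-trans (NP.*-monoʳ-≤ 4 (NP.≤-trans (NP.*-monoʳ-≤ a a≤C) aC≤)) (NP.≤-trans (NP.≤-reflexive (h2 P (2 N.^ n) a N0))
       (NP.+-monoˡ-≤ _ (NP.*-mono-≤ (p≤ zero) (p≤ zero)))))
      where h1 : ∀ a → a N.* a N.+ a N.* (a N.+ 2 N.* a) ≡ 4 N.* (a N.* a)
            h1 = ringN
            h2 : ∀ P q a N → 4 N.* (P N.* P N.+ q N.* (a N.* N)) ≡ 2 N.* P N.* (2 N.* P) N.+ a N.* (2 N.* (2 N.* q N.* N))
            h2 = ringN

    reduced : a N.≤ bd → Reduced (suc n) N0 G.B
    reduced a≤X = subst (Z._≤ + bd) (sym a≡') (Z.+≤+ a≤X) , entry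
     where
     bd≥1 : 1 N.≤ bd
     bd≥1 = NP.≤-trans 1≤a a≤X
     bd≤ : ∀ {y} → y N.≤ a → y N.≤ entryBound (suc n) N0
     bd≤ y≤a = NP.≤-trans (NP.≤-trans y≤a a≤X) (NP.≤-trans (NP.m≤m*n bd bd {{N.>-nonZero bd≥1}}) (NP.m≤m+n _ _))
     entry : ∀ i j → Z.∣ G.B (basis i) (basis j) ∣ N.≤ entryBound (suc n) N0
     entry zero zero = bd≤ (NP.≤-reflexive (cong Z.∣_∣ a≡'))
     entry zero (suc j) = bd≤ (p≤' j)
     entry (suc i) zero = bd≤ (subst (λ z → Z.∣ z ∣ N.≤ a) (G.symm (basis zero) (basis (suc i))) (p≤' i))
     entry (suc i) (suc j) = NP.≤-trans (NP.m≤n*m _ a {{N.>-nonZero 1≤a}}) (NP.≤-trans (NP.≤-reflexive (trans (sym (ZP.abs-* (+ a) _)) (cong Z.∣_∣ (key (basis i) (basis j)))))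
      (NP.≤-trans (ZP.∣i+j∣≤∣i∣+∣j∣ (p (basis i) * p (basis j)) _) (NP.+-mono-≤ (NP.≤-trans (NP.≤-reflexive (ZP.abs-* (p (basis i)) _)) (NP.*-mono-≤ (NP.≤-trans (p≤' i) a≤X) (NP.≤-trans (p≤' j) a≤X)))
       (NP.≤-trans (S≤ i j) (entryBound-mono n (NP.*-monoˡ-≤ N0 a≤X))))))

    continue : Dec (C N.≤ a) → Dec (a N.≤ C) → Result 𝔽
    continue _ (yes a≤C) = g , reduced (small-a a≤C)
    continue _ (no a≰C) = prepend (go A (pull (pull 𝔽 g) swap-iso) C (NP.≤-pred (NP.≤-trans (NP.≰⇒> a≰C) a≤A)) C≥1 C≡)
     where
     prepend : Result (pull (pull 𝔽 g) swap-iso) → Result 𝔽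
     prepend (k , r) = (g ∙ swap-iso) ∙ k , r
     C≥1 : 1 N.≤ C
     C≥1 with e0-positive (pull (pull 𝔽 g) swap-iso) 1≤N0
     ... | c , 1≤c , eq = subst (1 N.≤_) (ZP.+-injective (trans (sym eq) C≡)) 1≤c
  start : (∃ λ a → 1 N.≤ a × Form.Q 𝔽0 (basis zero) ≡ + a) → Result 𝔽0
  start (a , 1≤a , a≡) = go a 𝔽0 a NP.≤-refl 1≤a a≡

 reps-change : ∀ {N0 N0' n} (𝔽 : Form N0 n) (1≤N0 : 1 N.≤ N0) (𝔽' : Form N0' n) (1≤N0' : 1 N.≤ N0') (σ σ⁻ : V n → V n) (w : V n → ℤ) (N N' : ℕ) →
  (∀ u → Form.Q 𝔽 (σ u) ≡ + N → Form.Q 𝔽' u ≡ + N') → (∀ u → Form.Q 𝔽' u ≡ + N' → Form.Q 𝔽 (σ u) ≡ + N) →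
  (∀ u → σ⁻ (σ u) ≡ u) → (∀ y → Form.Q 𝔽 y ≡ + N → w y ≢ + 0 → σ (σ⁻ y) ≡ y) → reps 𝔽 1≤N0 w N ≡ reps 𝔽' 1≤N0' (w ∘ σ) N'
 reps-change {n = n} 𝔽 p 𝔽' p' σ σ⁻ w N N' f b i s = sym (trans (sumL-cong (box n (bound 𝔽' p' N')) λ u → cong (_* w (σ u)) ([]-⇔ (Form.Q 𝔽' u Z.≟ + N') (Form.Q 𝔽 (σ u) Z.≟ + N) (b u) (f u)))
  (sumL-bijection _≟ⱽ_ _≟ⱽ_ (box n (bound 𝔽' p' N')) (box n (bound 𝔽 p N)) σ σ⁻ F onx ony))
  where
  F : V n → ℤ
  F y = [ Form.Q 𝔽 y Z.≟ + N ] * w y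
  *-≢0ʳ : ∀ {a b} → a * b ≢ + 0 → b ≢ + 0
  *-≢0ʳ {a} nz refl = nz (ZP.*-zeroʳ a)
  onx : ∀ u → F (σ u) ≢ + 0 → Enumerates _≟ⱽ_ (box n (bound 𝔽 p N)) (σ u) × σ⁻ (σ u) ≡ u
  onx u nz = box-enumerates _ (σ u) (in-bound 𝔽 p ([]*-≢0 (Form.Q 𝔽 (σ u) Z.≟ + N) nz)) , i u
  ony : ∀ y → F y ≢ + 0 → Enumerates _≟ⱽ_ (box n (bound 𝔽' p' N')) (σ⁻ y) × σ (σ⁻ y) ≡ y
  ony y nz = box-enumerates _ (σ⁻ y) (in-bound 𝔽' p' (f (σ⁻ y) (trans (cong (Form.Q 𝔽) ret) q))) , ret
   where q : Form.Q 𝔽 y ≡ + N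
         q = []*-≢0 (Form.Q 𝔽 y Z.≟ + N) nz
         ret : σ (σ⁻ y) ≡ y
         ret = s y q (*-≢0ʳ {[ Form.Q 𝔽 y Z.≟ + N ]} nz)

open HermiteReduction

-- Residue classes, lines over 𝔽_ℓ and the count of isotropic lines

module ResidueClasses where

 open Z using (_+_; _*_; -_; _-_)

 opaque

  mod? : ∀ M a b → Dec (Mod (+ M) a b)
  mod? M a b = go (M ND.∣? Z.∣ a - b ∣)
   where go : Dec (M ND.∣ Z.∣ a - b ∣) → Dec (Mod (+ M) a b)
         go (yes p) = yes (Mod-diff (∣⇒Mod {a = a - b} p))
         go (no ¬p) = no λ q → ¬p (Mod⇒∣ {a = a - b} (Mod-- q))

 Cong : ∀ {n} → ℤ → V n → V n → Set
 Cong M u v = ∃ λ w → u ≡ v ⊞ M ⊙ w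

 module _ {M : ℤ} where

  Cong-∷ : ∀ {n x y} {u v : V n} → Mod M x y → Cong M u v → Cong M (x ∷ u) (y ∷ v)
  Cong-∷ {y = y} (mod k p) (w , q) = k ∷ w , cong₂ _∷_ (trans p (cong (_+_ y) (ZP.*-comm k M))) q

  Cong-head : ∀ {n x y} {u v : V n} → Cong M (x ∷ u) (y ∷ v) → Mod M x y
  Cong-head {y = y} (k ∷ w , p) = mod k (trans (cong Vec.head p) (cong (_+_ y) (ZP.*-comm M k)))

  Cong-tail : ∀ {n x y} {u v : V n} → Cong M (x ∷ u) (y ∷ v) → Cong M u v
  Cong-tail (k ∷ w , p) = w , cong Vec.tail p

  private variable n : ℕ

  Cong-refl : {u : V n} → Cong M u u
  Cong-refl {u = []}    = [] , refl
  Cong-refl {u = x ∷ u} = Cong-∷ Mod-refl Cong-refl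

  Cong-≡ : {u v : V n} → u ≡ v → Cong M u v
  Cong-≡ refl = Cong-refl

  Cong-sym : {u v : V n} → Cong M u v → Cong M v u
  Cong-sym {u = []}    {[]}    p = p
  Cong-sym {u = x ∷ u} {y ∷ v} p = Cong-∷ (Mod-sym (Cong-head p)) (Cong-sym (Cong-tail p))

  Cong-trans : {u v w : V n} → Cong M u v → Cong M v w → Cong M u w
  Cong-trans {u = []}    {[]}    {[]}    p q = p
  Cong-trans {u = x ∷ u} {y ∷ v} {z ∷ w} p q = Cong-∷ (Mod-tr (Cong-head p) (Cong-head q)) (Cong-trans (Cong-tail p) (Cong-tail q))

  Cong-⊞ : {u v u' v' : V n} → Cong M u v → Cong M u' v' → Cong M (u ⊞ u') (v ⊞ v')
  Cong-⊞ {u = []}    {[]}    {[]}     {[]}     p q = p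
  Cong-⊞ {u = x ∷ u} {y ∷ v} {x' ∷ u'} {y' ∷ v'} p q = Cong-∷ (Mod-+ (Cong-head p) (Cong-head q)) (Cong-⊞ (Cong-tail p) (Cong-tail q))

  Cong-⊙ : ∀ {a b} {u v : V n} → Mod M a b → Cong M u v → Cong M (a ⊙ u) (b ⊙ v)
  Cong-⊙ {u = []}    {[]}    p q = q
  Cong-⊙ {u = x ∷ u} {y ∷ v} p q = Cong-∷ (Mod-* p (Cong-head q)) (Cong-⊙ p (Cong-tail q))

  Cong-φ : ∀ {φ : V n → ℤ} {u v} → Linear φ → Cong M u v → Mod M (φ u) (φ v)
  Cong-φ {φ = φ} {v = v} p (w , refl) = mod (φ w) (trans (add p _ _) (cong (_+_ (φ v)) (trans (scale p M w) (ZP.*-comm M (φ w)))))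

  Cong-multiple : (u : V n) → Cong M (M ⊙ u) 𝟎
  Cong-multiple u = u , sym (⊞-identityˡ _)

  Cong-0 : {u : V n} → Cong M u 𝟎 → ∃ λ w → u ≡ M ⊙ w
  Cong-0 (w , p) = w , trans p (⊞-identityˡ _)

 opaque

  cong? : ∀ {n} M (u v : V n) → Dec (Cong (+ M) u v)
  cong? M []      []      = yes Cong-refl
  cong? M (x ∷ u) (y ∷ v) = go (mod? M x y) (cong? M u v)
   where go : Dec (Mod (+ M) x y) → Dec (Cong (+ M) u v) → Dec (Cong (+ M) (x ∷ u) (y ∷ v))
         go (yes p) (yes q) = yes (Cong-∷ p q)
         go (no ¬p) _       = no (¬p ∘ Cong-head)
         go _       (no ¬q) = no (¬q ∘ Cong-tail)

 module ResidueSystem (d : ℕ) where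

  ℓ : ℕ
  ℓ = suc d

  Λ : ℤ
  Λ = + ℓ

  small-≡ : ∀ {k r} → k N.< ℓ → r N.< ℓ → Mod Λ (+ k) (+ r) → k ≡ r
  small-≡ {k} {r} k<ℓ r<ℓ p = go (NP.≤-total k r)
   where
   le : ∀ {a b} → a N.≤ b → b N.< ℓ → Mod Λ (+ a) (+ b) → a ≡ b
   le {a} {b} a≤b b<ℓ q = NP.≤-antisym a≤b (NP.m∸n≡0⇒m≤n (multiple-< (b N.∸ a) (NP.≤-<-trans (NP.m∸n≤m b a) b<ℓ)
     (subst (ℓ ND.∣_) (trans (cong Z.∣_∣ (ZP.[+m]-[+n]≡m⊖n a b)) (ZP.∣⊖∣-≤ a≤b)) (Mod⇒∣ {a = + a - + b} (Mod-- q)))))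
    where multiple-< : ∀ x → x N.< ℓ → ℓ ND.∣ x → x ≡ 0
          multiple-< zero    _ _ = refl
          multiple-< (suc x) q p = ⊥-elim (NP.<⇒≱ q (ND.∣⇒≤ p))
   go : k N.≤ r ⊎ r N.≤ k → k ≡ r
   go (inj₁ k≤r) = le k≤r r<ℓ p
   go (inj₂ r≤k) = sym (le r≤k k<ℓ (Mod-sym p))

  %-Mod : ∀ z → Mod Λ z (+ (z ZM.%ℕ ℓ))
  %-Mod z = mod (z ZM./ℕ ℓ) (ZM.a≡a%ℕn+[a/ℕn]*n z ℓ)

  %-cong : ∀ {x y} → Mod Λ x y → x ZM.%ℕ ℓ ≡ y ZM.%ℕ ℓ
  %-cong {x} {y} p = small-≡ (ZM.n%ℕd<d x ℓ) (ZM.n%ℕd<d y ℓ) (Mod-tr (Mod-sym (%-Mod x)) (Mod-tr p (%-Mod y)))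

  residue : ℤ → Fin ℓ
  residue z = Fin.fromℕ< (ZM.n%ℕd<d z ℓ)

  residue⇒Mod : ∀ {x y} → residue x ≡ residue y → Mod Λ x y
  residue⇒Mod {x} {y} p = Mod-tr (%-Mod x) (Mod-tr (≡⇒Mod (cong +_ (trans (sym (Finₚ.toℕ-fromℕ< (ZM.n%ℕd<d x ℓ))) (trans (cong toℕ p) (Finₚ.toℕ-fromℕ< (ZM.n%ℕd<d y ℓ)))))) (Mod-sym (%-Mod y)))

  Mod⇒residue : ∀ {x y} → Mod Λ x y → residue x ≡ residue y
  Mod⇒residue {x} {y} p = Finₚ.fromℕ<-cong _ _ (%-cong p) (ZM.n%ℕd<d x ℓ) (ZM.n%ℕd<d y ℓ)

  res : ℕ → List ℤ
  res zero    = []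
  res (suc k) = + k ∷ res k

  res-unique : ∀ z → sumL (res ℓ) (λ x → [ mod? ℓ x z ]) ≡ + 1
  res-unique z = trans (go ℓ NP.≤-refl) ([]-yes (r N.<? ℓ) (ZM.n%ℕd<d z ℓ))
   where
   r : ℕ
   r = z ZM.%ℕ ℓ
   z≡r : Mod Λ z (+ r)
   z≡r = %-Mod z
   same : ∀ k → k N.< ℓ → Mod Λ (+ k) z → k ≡ r
   same k k<ℓ p = small-≡ k<ℓ (ZM.n%ℕd<d z ℓ) (Mod-tr p z≡r)
   term : ∀ k → k N.< ℓ → [ mod? ℓ (+ k) z ] ≡ [ k N.≟ r ]
   term k k<ℓ = []-⇔ (mod? ℓ (+ k) z) (k N.≟ r) (same k k<ℓ) λ { refl → Mod-sym z≡r }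
   step : ∀ k → Dec (k ≡ r) → [ k N.≟ r ] + [ r N.<? k ] ≡ [ r N.<? suc k ]
   step k (yes refl) = trans (cong₂ _+_ ([]-yes (k N.≟ k) refl) ([]-no (k N.<? k) (NP.<-irrefl refl))) (sym ([]-yes (k N.<? suc k) NP.≤-refl))
   step k (no k≢r) = trans (cong₂ _+_ ([]-no (k N.≟ r) k≢r) refl) (trans (ZP.+-identityˡ _) ([]-⇔ (r N.<? k) (r N.<? suc k) (λ p → NP.<-trans p NP.≤-refl)
    λ p → NP.≤∧≢⇒< (NP.≤-pred p) (k≢r ∘ sym)))
   go : ∀ k → k N.≤ ℓ → sumL (res k) (λ x → [ mod? ℓ x z ]) ≡ [ r N.<? k ]
   go zero    _ = sym ([]-no (r N.<? 0) λ ())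
   go (suc k) p = trans (cong₂ _+_ (term k p) (go k (NP.<⇒≤ p))) (step k (k N.≟ r))

  all : ∀ n → List (V n)
  all n = vecs (res ℓ) n

  all-unique : ∀ {n} (z : V n) → sumL (all n) (λ v → [ cong? ℓ v z ]) ≡ + 1
  all-unique []      = cong (_+ + 0) ([]-yes (cong? ℓ [] []) Cong-refl)
  all-unique {suc n} (z ∷ zs) = trans (sumL-vecs (res ℓ) n λ v → [ cong? ℓ v (z ∷ zs) ]) (trans (sumL-cong (res ℓ) λ x → trans (sumL-cong (all n) λ v → sym
    ([]-× (mod? ℓ x z) (cong? ℓ v zs) (cong? ℓ (x ∷ v) (z ∷ zs)) Cong-∷ λ p → Cong-head p , Cong-tail p)) (trans (sumL-*ˡ (all n) [ mod? ℓ x z ] λ v → [ cong? ℓ v zs ])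
     (trans (cong (_*_ [ mod? ℓ x z ]) (all-unique zs)) (ZP.*-identityʳ [ mod? ℓ x z ])))) (res-unique z))

  Periodic : ∀ {n} → (V n → ℤ) → Set
  Periodic f = ∀ {u v} → Cong Λ u v → f u ≡ f v

  -- τ permutes residue classes but not the chosen representatives, so the sum passes through all
  -- pairs with u ≡ τ v.
  permute : ∀ {n} (f : V n → ℤ) → Periodic f → (τ τ⁻ : V n → V n) → (∀ u v → Cong Λ u (τ v) → Cong Λ v (τ⁻ u)) → (∀ u v → Cong Λ v (τ⁻ u) → Cong Λ u (τ v)) →
       sumL (all n) (f ∘ τ) ≡ sumL (all n) f
  permute {n} f per τ τ⁻ p q = trans (sumL-cong (all n) λ v → sym (trans (sumL-cong (all n) λ u → []-cong-* (cong? ℓ u (τ v)) per)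
    (trans (sumL-*ʳ (all n) (f (τ v)) _) (trans (cong (_* f (τ v)) (all-unique (τ v))) (ZP.*-identityˡ _)))))
   (trans (sumL-swap (all n) (all n) λ v u → [ cong? ℓ u (τ v) ] * f u) (sumL-cong (all n) λ u → trans (sumL-cong (all n) λ v → cong (_* f u) ([]-⇔ (cong? ℓ u (τ v)) (cong? ℓ v (τ⁻ u)) (p u v) (q u v)))
    (trans (sumL-*ʳ (all n) (f u) _) (trans (cong (_* f u) (all-unique (τ⁻ u))) (ZP.*-identityˡ _)))))

  translate : ∀ {n} (f : V n → ℤ) → Periodic f → ∀ w → sumL (all n) (λ v → f (v ⊞ w)) ≡ sumL (all n) f
  translate f per w = permute f per (_⊞ w) (_⊞ - + 1 ⊙ w)
    (λ u v p → Cong-trans (Cong-≡ (sym (h1 v w))) (Cong-⊞ (Cong-sym p) (Cong-refl {u = - + 1 ⊙ w})))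
    (λ u v p → Cong-trans (Cong-≡ (sym (h2 u w))) (Cong-⊞ (Cong-sym p) (Cong-refl {u = w})))
   where h1 : ∀ {n} (v w : V n) → (v ⊞ w) ⊞ - + 1 ⊙ w ≡ v
         h1 []      []      = refl
         h1 (x ∷ v) (y ∷ w) = cong₂ _∷_ (r x y) (h1 v w)
          where r : ∀ x y → x + y + - + 1 * y ≡ x
                r = ring
         h2 : ∀ {n} (v w : V n) → (v ⊞ - + 1 ⊙ w) ⊞ w ≡ v
         h2 []      []      = refl
         h2 (x ∷ v) (y ∷ w) = cong₂ _∷_ (r x y) (h2 v w)
          where r : ∀ x y → x + - + 1 * y + y ≡ x
                r = ring

 module Residues (d : ℕ) (pr : Prime (suc d)) where

  open PrimePowers d pr using (unit; pw-1; d≥1)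
  open ResidueSystem d public

  opaque

   unit-mod : ∀ a → ¬ Mod Λ a (+ 0) → ∃ λ u → Mod Λ (a * u) (+ 1)
   unit-mod a na = proj₁ (unit 1 a na) , subst (λ M → Mod M (a * proj₁ (unit 1 a na)) (+ 1)) pw-1 (proj₂ (unit 1 a na))

  unit-⊙ : ∀ {n a b} (u : V n) → Mod Λ (a * b) (+ 1) → Cong Λ (a ⊙ b ⊙ u) u
  unit-⊙ {a = a} {b} u p = Cong-trans (Cong-≡ (⊙-assoc a b u)) (Cong-trans (Cong-⊙ p Cong-refl) (Cong-≡ (⊙-identity u)))

  dilate : ∀ {n} (f : V n → ℤ) → Periodic f → ∀ a → ¬ Mod Λ a (+ 0) → sumL (all n) (λ v → f (a ⊙ v)) ≡ sumL (all n) f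
  dilate f per a na = permute f per (a ⊙_) (b ⊙_) (λ u v p → Cong-sym (Cong-trans (Cong-⊙ (Mod-refl {a = b}) p) (unit-⊙ v (Mod-tr (≡⇒Mod (ZP.*-comm b a)) ab))))
    (λ u v p → Cong-sym (Cong-trans (Cong-⊙ (Mod-refl {a = a}) p) (unit-⊙ u ab)))
   where b = proj₁ (unit-mod a na)
         ab = proj₂ (unit-mod a na)

  -- Lines in 𝔽_ℓⁿ, represented by vectors whose first nonzero coordinate is 1.

  record Line (n : ℕ) : Set where
   constructor line
   field
    vec    : V n
    pivot  : V n → ℤ
    linear : Linear pivot
    pivot≡ : pivot vec ≡ + 1
  open Line public

  line0 : ∀ {n} → Line n → Line (suc n)
  line0 L = line (+ 0 ∷ vec L) (pivot L ∘ Vec.tail) (linear-∘ (linear L) tail-linear) (pivot≡ L)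

  line1 : ∀ {n} → V n → Line (suc n)
  line1 v = line (+ 1 ∷ v) Vec.head head-linear refl

  lines : ∀ n → List (Line n)
  lines zero    = []
  lines (suc n) = List.map line0 (lines n) ++ List.map line1 (all n)

  sumL-lines : ∀ n (f : Line (suc n) → ℤ) → sumL (lines (suc n)) f ≡ sumL (lines n) (f ∘ line0) + sumL (all n) (f ∘ line1)
  sumL-lines n f = trans (sumL-++ (List.map line0 (lines n)) _ f) (cong₂ _+_ (sumL-map line0 (lines n) f) (sumL-map line1 (all n) f))

  small-nonzero : ∀ k → suc k N.≤ d → ¬ Mod Λ (+ suc k) (+ 0)
  small-nonzero k k<d p = NP.<⇒≱ (s≤s k<d) (ND.∣⇒≤ (Mod⇒∣ {a = + suc k} p))

  -- Every nonzero class lies on one line, and each line has d = ℓ - 1 nonzero multiples, on which f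
  -- is constant.
  sum-lines : ∀ n (f : V n → ℤ) → Periodic f → (∀ a v → ¬ Mod Λ a (+ 0) → f (a ⊙ v) ≡ f v) → f 𝟎 ≡ + 0 → sumL (all n) f ≡ + d * sumL (lines n) (f ∘ vec)
  sum-lines zero    f per inv f0 = trans (ZP.+-identityʳ _) (trans f0 (sym (ZP.*-zeroʳ (+ d))))
  sum-lines (suc n) f per inv f0 = trans (sumL-vecs (res ℓ) n f) (trans (go d NP.≤-refl) (trans (cong (_+_ (+ d * H)) (sum-lines n (λ v → f (+ 0 ∷ v)) (λ p → per (Cong-∷ Mod-refl p))
    (λ a v na → trans (cong (λ z → f (z ∷ a ⊙ v)) (sym (ZP.*-zeroʳ a))) (inv a (+ 0 ∷ v) na)) f0)) (trans (h (+ d) H _) (cong (_*_ (+ d)) (sym (sumL-lines n (f ∘ vec)))))))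
   where
   h : ∀ d x y → d * x + d * y ≡ d * (y + x)
   h = ring
   G : ℤ → ℤ
   G x = sumL (all n) λ v → f (x ∷ v)
   H : ℤ
   H = G (+ 1)
   G-unit : ∀ k → suc k N.≤ d → G (+ suc k) ≡ H
   G-unit k k<d = trans (sym (dilate (λ v → f (+ suc k ∷ v)) (λ p → per (Cong-∷ Mod-refl p)) (+ suc k) na)) (sumL-cong (all n) λ v →
     trans (cong (λ z → f (z ∷ + suc k ⊙ v)) (sym (ZP.*-identityʳ (+ suc k)))) (inv (+ suc k) (+ 1 ∷ v) na))
    where na = small-nonzero k k<d
   go : ∀ k → k N.≤ d → sumL (res (suc k)) G ≡ + k * H + G (+ 0)
   go zero    _ = trans (ZP.+-identityʳ (G (+ 0))) (sym (trans (cong (_+ G (+ 0)) (ZP.*-zeroˡ H)) (ZP.+-identityˡ _)))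
   go (suc k) p = trans (cong₂ _+_ (G-unit k p) (go k (NP.<⇒≤ p))) (r (+ k) H (G (+ 0)))
    where r : ∀ k x y → x + (k * x + y) ≡ (+ 1 + k) * x + y
          r = ring

  line-unique : ∀ n y → ¬ Cong Λ y 𝟎 → sumL (lines n) (λ L → [ cong? ℓ y (pivot L y ⊙ vec L) ]) ≡ + 1
  line-unique zero    [] ¬p = ⊥-elim (¬p Cong-refl)
  line-unique (suc n) (y ∷ ys) ¬p = trans (sumL-lines n _) (go (mod? ℓ y (+ 0)))
   where
   f₀ : Line n → ℤ
   f₀ L = [ cong? ℓ (y ∷ ys) (pivot L ys ⊙ (+ 0 ∷ vec L)) ]
   f1 : V n → ℤ
   f1 v = [ cong? ℓ (y ∷ ys) (y ⊙ (+ 1 ∷ v)) ]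
   go : Dec (Mod Λ y (+ 0)) → sumL (lines n) f₀ + sumL (all n) f1 ≡ + 1
   go (yes y≡0) = cong₂ _+_ (trans (sumL-cong (lines n) λ L → []-⇔ (cong? ℓ (y ∷ ys) (pivot L ys ⊙ (+ 0 ∷ vec L))) (cong? ℓ ys (pivot L ys ⊙ vec L)) Cong-tail
      (λ q → Cong-∷ (Mod-tr y≡0 (≡⇒Mod (sym (ZP.*-zeroʳ (pivot L ys))))) q)) (line-unique n ys (λ q → ¬p (Cong-∷ y≡0 q))))
     (sumL-0 (all n) λ v → []-no (cong? ℓ (y ∷ ys) (y ⊙ (+ 1 ∷ v))) λ q → ¬p (Cong-∷ y≡0 (Cong-trans (Cong-tail q) (Cong-trans (Cong-⊙ y≡0 (Cong-refl {u = v})) (Cong-≡ (⊙-zeroˡ v))))))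
   go (no y≢0) = cong₂ _+_ (sumL-0 (lines n) λ L → []-no (cong? ℓ (y ∷ ys) (pivot L ys ⊙ (+ 0 ∷ vec L))) λ q → y≢0 (Mod-tr (Cong-head q) (≡⇒Mod (ZP.*-zeroʳ (pivot L ys)))))
     (trans (sumL-cong (all n) λ v → []-⇔ (cong? ℓ (y ∷ ys) (y ⊙ (+ 1 ∷ v))) (cong? ℓ v (b ⊙ ys))
       (λ q → Cong-sym (Cong-trans (Cong-⊙ (Mod-refl {a = b}) (Cong-tail q)) (unit-⊙ v (Mod-tr (≡⇒Mod (ZP.*-comm b y)) yb))))
       (λ q → Cong-∷ (≡⇒Mod (sym (ZP.*-identityʳ y))) (Cong-sym (Cong-trans (Cong-⊙ (Mod-refl {a = y}) q) (unit-⊙ ys yb))))) (all-unique (b ⊙ ys)))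
    where b = proj₁ (unit-mod y y≢0)
          yb = proj₂ (unit-mod y y≢0)

  cardinality : ∀ n → sumL (all n) (λ _ → + 1) ≡ Λ Z.^ n
  cardinality zero    = refl
  cardinality (suc n) = trans (sumL-vecs (res ℓ) n _) (trans (sumL-cong (res ℓ) λ _ → trans (cardinality n) (sym (ZP.*-identityˡ _))) (trans (sumL-*ʳ (res ℓ) (Λ Z.^ n) λ _ → + 1) (cong (_* Λ Z.^ n) (count ℓ))))
   where count : ∀ k → sumL (res k) (λ _ → + 1) ≡ + k
         count zero    = refl
         count (suc k) = cong (_+_ (+ 1)) (count k)

  private
   average : ∀ {n} (f : V n → ℤ) → Periodic f → ∀ w → Λ * sumL (all n) f ≡ sumL (all n) λ v → sumL (res ℓ) λ s → f (v ⊞ s ⊙ w)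
   average {n} f per w = trans (trans (cong (_* sumL (all n) f) (sym (count ℓ))) (trans (sym (sumL-*ʳ (res ℓ) (sumL (all n) f) λ _ → + 1)) (sumL-cong (res ℓ) λ s → trans (ZP.*-identityˡ _) (sym (translate f per (s ⊙ w))))))
     (sumL-swap (res ℓ) (all n) λ s v → f (v ⊞ s ⊙ w))
    where count : ∀ k → sumL (res k) (λ _ → + 1) ≡ + k
          count zero    = refl
          count (suc k) = cong (_+_ (+ 1)) (count k)

   affine-unique : ∀ a c → ¬ Mod Λ a (+ 0) → sumL (res ℓ) (λ s → [ mod? ℓ (c + s * a) (+ 0) ]) ≡ + 1
   affine-unique a c na = trans (sumL-cong (res ℓ) λ s → []-⇔ (mod? ℓ (c + s * a) (+ 0)) (mod? ℓ s (- (b * c)))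
      (λ p → Mod-tr (Mod-sym (Mod-tr (Mod-* {a = s} Mod-refl ab) (≡⇒Mod (ZP.*-identityʳ s)))) (Mod-tr (≡⇒Mod (h1 s a b c)) (Mod-tr (Mod-+ (Mod-* {a = b} Mod-refl p) (Mod-refl {a = - (b * c)})) (≡⇒Mod (h2 b c)))))
      (λ p → Mod-tr (Mod-+ {a = c} Mod-refl (Mod-* p (Mod-refl {a = a}))) (Mod-tr (≡⇒Mod (h3 a b c)) (Mod-tr (Mod-+ {a = c} Mod-refl (Mod-neg (Mod-* ab (Mod-refl {a = c})))) (≡⇒Mod (h4 c)))))) (res-unique (- (b * c)))
    where b = proj₁ (unit-mod a na)
          ab = proj₂ (unit-mod a na)
          h1 : ∀ s a b c → s * (a * b) ≡ b * (c + s * a) + - (b * c)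
          h1 = ring
          h2 : ∀ b c → b * + 0 + - (b * c) ≡ - (b * c)
          h2 = ring
          h3 : ∀ a b c → c + - (b * c) * a ≡ c + - (a * b * c)
          h3 = ring
          h4 : ∀ c → c + - (+ 1 * c) ≡ + 0
          h4 = ring

  -- Average over the translates v + s y: φ(v) + s φ(y) vanishes for exactly one residue s.
  hyperplane : ∀ {n φ} → Linear φ → (y : V n) → ¬ Mod Λ (φ y) (+ 0) → Λ * sumL (all n) (λ v → [ mod? ℓ (φ v) (+ 0) ]) ≡ Λ Z.^ n
  hyperplane {n} {φ} p y ny = trans (average (λ v → [ mod? ℓ (φ v) (+ 0) ]) (λ {u} {v} q → []-⇔ (mod? ℓ (φ u) (+ 0)) (mod? ℓ (φ v) (+ 0)) (Mod-tr (Mod-sym (Cong-φ p q))) (Mod-tr (Cong-φ p q))) y)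
   (trans (sumL-cong (all n) λ v → trans (sumL-cong (res ℓ) λ s → cong (λ z → [ mod? ℓ z (+ 0) ]) (trans (add p v (s ⊙ y)) (cong (_+_ (φ v)) (scale p s y)))) (affine-unique (φ y) (φ v) ny)) (cardinality n))

  module _ {N0 n} (𝔽 : Form N0 n) where
   open Form 𝔽 hiding (linear)

   Q-Cong : ∀ {M u v} → Cong M u v → Mod M (Q u) (Q v)
   Q-Cong {u = u} {v} p = Mod-tr (Cong-φ (linearʳ u) p) (Mod-tr (≡⇒Mod (symm u v)) (Cong-φ (linearʳ v) p))

   -- Along v + s x the form is Q v + 2 s B(v, x) modulo ℓ, with exactly one zero s if B(v, x) is a
   -- unit; so averaging leaves the complement of a hyperplane. The factor ℓ² avoids the exponent n
   -- - 2.
   isotropic-off-hyperplane : ∀ x y → ¬ Mod Λ (+ 2) (+ 0) → Mod Λ (Q x) (+ 0) → ¬ Mod Λ (B y x) (+ 0) →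
    Λ * Λ * sumL (lines n) (λ L → [ mod? ℓ (Q (vec L)) (+ 0) ] * (+ 1 - [ mod? ℓ (B (vec L) x) (+ 0) ])) ≡ Λ Z.^ n
   isotropic-off-hyperplane x y na2 Qx By = ZP.*-cancelˡ-≡ (+ d) _ _ {{Z.≢-nonZero d≢0}} (begin
    + d * (Λ * Λ * sumL (lines n) (f ∘ vec)) ≡⟨ h1 (+ d) Λ (sumL (lines n) (f ∘ vec)) ⟩
    Λ * (Λ * (+ d * sumL (lines n) (f ∘ vec))) ≡⟨ cong (λ z → Λ * (Λ * z)) (sym (sum-lines n f per invar f0)) ⟩
    Λ * (Λ * sumL (all n) f) ≡⟨ cong (_*_ Λ) (trans (average f per x) (sumL-cong (all n) inner)) ⟩
    Λ * sumL (all n) (λ v → + 1 - z v) ≡⟨ cong (_*_ Λ) (trans (sumL-+ (all n) (λ _ → + 1) (λ v → - z v)) (cong₂ _+_ (cardinality n) (trans (sumL-cong (all n) λ v → sym (ZP.-1*i≡-i (z v))) (trans (sumL-*ˡ (all n) (- + 1) z) (ZP.-1*i≡-i _))))) ⟩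
    Λ * (Λ Z.^ n - sumL (all n) z) ≡⟨ h2 Λ (Λ Z.^ n) (sumL (all n) z) ⟩
    Λ * Λ Z.^ n - Λ * sumL (all n) z ≡⟨ cong (_-_ (Λ * Λ Z.^ n)) (hyperplane φl y By) ⟩
    Λ * Λ Z.^ n - Λ Z.^ n ≡⟨ h3 (+ d) (Λ Z.^ n) ⟩
    + d * Λ Z.^ n ∎)
    where
    open ≡-Reasoning
    φl = Form.linear 𝔽 x
    z f : V n → ℤ
    z v = [ mod? ℓ (B v x) (+ 0) ]
    f v = [ mod? ℓ (Q v) (+ 0) ] * (+ 1 - z v)
    d≢0 : + d ≢ + 0
    d≢0 p = NP.<⇒≱ d≥1 (NP.≤-reflexive (ZP.+-injective p))
    iff : ∀ {a b} → Mod Λ a b → [ mod? ℓ a (+ 0) ] ≡ [ mod? ℓ b (+ 0) ]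
    iff {a} {b} p = []-⇔ (mod? ℓ a (+ 0)) (mod? ℓ b (+ 0)) (Mod-tr (Mod-sym p)) (Mod-tr p)
    per : Periodic f
    per p = cong₂ (λ a b → a * (+ 1 - b)) (iff (Q-Cong p)) (iff (Cong-φ φl p))
    unit-iff : ∀ a b → ¬ Mod Λ a (+ 0) → [ mod? ℓ (a * b) (+ 0) ] ≡ [ mod? ℓ b (+ 0) ]
    unit-iff a b na = []-⇔ (mod? ℓ (a * b) (+ 0)) (mod? ℓ b (+ 0)) (cases ∘ euclid pr {a} {b}) (λ p → Mod-tr (Mod-* {a = a} Mod-refl p) (≡⇒Mod (ZP.*-zeroʳ a)))
     where cases : Mod Λ a (+ 0) ⊎ Mod Λ b (+ 0) → Mod Λ b (+ 0)
           cases (inj₁ p) = ⊥-elim (na p)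
           cases (inj₂ p) = p
    invar : ∀ a v → ¬ Mod Λ a (+ 0) → f (a ⊙ v) ≡ f v
    invar a v na = cong₂ (λ x y → x * (+ 1 - y)) (trans (cong (λ t → [ mod? ℓ t (+ 0) ]) (trans (Q-scale a v) (ZP.*-assoc a a (Q v)))) (trans (unit-iff a _ na) (unit-iff a _ na)))
     (trans (cong (λ t → [ mod? ℓ t (+ 0) ]) (scale φl a v)) (unit-iff a _ na))
    f0 : f 𝟎 ≡ + 0
    f0 = trans (cong (λ t → [ mod? ℓ (Q 𝟎) (+ 0) ] * (+ 1 - t)) ([]-yes (mod? ℓ (B 𝟎 x) (+ 0)) (≡⇒Mod (linear-0 φl)))) (ZP.*-zeroʳ [ mod? ℓ (Q 𝟎) (+ 0) ])
    inner : ∀ v → sumL (res ℓ) (λ s → f (v ⊞ s ⊙ x)) ≡ + 1 - z v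
    inner v = trans (sumL-cong (res ℓ) λ s → cong₂ (λ a b → a * (+ 1 - b)) (iff (Mod-tr (≡⇒Mod (trans (cong (λ u → Q (u ⊞ s ⊙ x)) (sym (⊙-identity v))) (Q-comb (+ 1) s v x)))
       (Mod-tr (Mod-+ {a = + 1 * + 1 * Q v + + 2 * (+ 1 * s * B v x)} Mod-refl (Mod-* {a = s * s} Mod-refl Qx)) (≡⇒Mod (r1 (Q v) s (B v x))))))
      (iff (Mod-tr (≡⇒Mod (trans (add φl v (s ⊙ x)) (cong (_+_ (B v x)) (scale φl s x)))) (Mod-tr (Mod-+ {a = B v x} Mod-refl (Mod-* {a = s} Mod-refl Qx)) (≡⇒Mod (r2 s (B v x)))))))
     (trans (sumL-*ʳ (res ℓ) (+ 1 - z v) λ s → [ mod? ℓ (Q v + s * (+ 2 * B v x)) (+ 0) ]) (by (mod? ℓ (B v x) (+ 0))))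
     where
     r1 : ∀ q s b → + 1 * + 1 * q + + 2 * (+ 1 * s * b) + s * s * + 0 ≡ q + s * (+ 2 * b)
     r1 = ring
     r2 : ∀ s b → b + s * + 0 ≡ b
     r2 = ring
     by : (e : Dec (Mod Λ (B v x) (+ 0))) → sumL (res ℓ) (λ s → [ mod? ℓ (Q v + s * (+ 2 * B v x)) (+ 0) ]) * (+ 1 - [ e ]) ≡ + 1 - [ e ]
     by (yes _) = ZP.*-zeroʳ (sumL (res ℓ) λ s → [ mod? ℓ (Q v + s * (+ 2 * B v x)) (+ 0) ])
     by (no nb) = cong (_* (+ 1 - + 0)) (affine-unique (+ 2 * B v x) (Q v) λ p → cases (euclid pr {+ 2} p))
      where cases : Mod Λ (+ 2) (+ 0) ⊎ Mod Λ (B v x) (+ 0) → ⊥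
            cases (inj₁ p) = na2 p
            cases (inj₂ p) = nb p
    h1 : ∀ d l x → d * (l * l * x) ≡ l * (l * (d * x))
    h1 = ring
    h2 : ∀ l x y → l * (x - y) ≡ l * x - l * y
    h2 = ring
    h3 : ∀ d x → (+ 1 + d) * x - x ≡ d * x
    h3 = ring

open ResidueClasses

-- Bases of sublattices and the ℓ-neighbours of a form

module NeighbourLattices where

 open Z using (_+_; _*_; -_; _-_)

 ⊞-cancelˡ : ∀ {n} (u : V n) {v w} → u ⊞ v ≡ u ⊞ w → v ≡ w
 ⊞-cancelˡ []      {[]}    {[]}    p = refl
 ⊞-cancelˡ (x ∷ u) {y ∷ v} {z ∷ w} p = cong₂ _∷_ (trans (h x y) (trans (cong (λ t → Vec.head t - x) p) (sym (h x z)))) (⊞-cancelˡ u (cong Vec.tail p))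
  where h : ∀ x y → y ≡ x + y - x
        h = ring

 -- A basis of a sublattice Λ of ℤⁿ: the first coordinates of its elements form an ideal, whose
 -- generator is the least positive element.

 record Sublattice {n} (Λ : V n → Set) : Set where
  field
   closed-⊞ : ∀ {u v} → Λ u → Λ v → Λ (u ⊞ v)
   closed-⊙ : ∀ c {u} → Λ u → Λ (c ⊙ u)
   index    : ℕ
   index≥1  : 1 N.≤ index
   deep     : ∀ v → Λ (+ index ⊙ v)

 record Basis {n} (Λ : V n → Set) : Set where
  field
   σ          : V n → V n
   σ-linear   : LinearMap σ
   inside     : ∀ u → Λ (σ u)
   coordinates : ∀ y → Λ y → ∃ λ u → σ u ≡ y
   injective  : ∀ {u v} → σ u ≡ σ v → u ≡ v

 private
  Generator : ∀ {n} → (V (suc n) → Set) → Set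
  Generator Λ = ∃ λ d → ∃ λ w → 1 N.≤ d × Λ (+ d ∷ w) × (∀ y z → Λ (y ∷ z) → ∃ λ k → y ≡ k * + d)

  -- Descent: a first coordinate not divisible by d leaves a smaller positive remainder. Whether an
  -- element with such a coordinate exists is not decided, hence the double negation.
  generator : ∀ {n Λ} → Sublattice {suc n} Λ → ∀ D d w → d N.≤ D → 1 N.≤ d → Λ (+ d ∷ w) → ¬ ¬ Generator Λ
  generator S zero    d w d≤D 1≤d _ _ = NP.<⇒≱ 1≤d d≤D
  generator {Λ = Λ} S (suc D) d w d≤D 1≤d Λw none = none (d , w , 1≤d , Λw , divides)
   where
   open Sublattice S
   instance nz : N.NonZero d
            nz = N.>-nonZero 1≤d
   divides : ∀ y z → Λ (y ∷ z) → ∃ λ k → y ≡ k * + d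
   divides y z Λy = q , remainder (y ZM.%ℕ d) refl (ZM.n%ℕd<d y d)
    where
    q : ℤ
    q = y ZM./ℕ d
    eq : y ≡ + (y ZM.%ℕ d) + q * + d
    eq = ZM.a≡a%ℕn+[a/ℕn]*n y d
    h : ∀ r q d → r + q * d + - q * d ≡ r
    h = ring
    remainder : ∀ r → y ZM.%ℕ d ≡ r → r N.< d → y ≡ q * + d
    remainder zero    p _   = trans eq (trans (cong (λ r → + r + q * + d) p) (ZP.+-identityˡ _))
    remainder (suc r) p r<d = ⊥-elim (generator S D (suc r) (z ⊞ (- q) ⊙ w) (NP.≤-pred (NP.≤-trans r<d d≤D)) (s≤s z≤n)
     (subst (λ x → Λ (x ∷ z ⊞ (- q) ⊙ w)) (trans (cong (_+ - q * + d) (trans eq (cong (λ r → + r + q * + d) p))) (h (+ suc r) q (+ d))) (closed-⊞ Λy (closed-⊙ (- q) Λw))) none)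

 lattice-basis : ∀ n {Λ} → Sublattice {n} Λ → ¬ ¬ Basis Λ
 lattice-basis zero {Λ} S none = none record { σ = λ u → u ; σ-linear = record { map-add = λ _ _ → refl ; map-scale = λ _ _ → refl } ; inside = λ { [] → Sublattice.deep S [] }
  ; coordinates = λ y _ → y , refl ; injective = λ p → p }
 lattice-basis (suc n) {Λ} S none = generator S index index (+ index ⊙ 𝟎) NP.≤-refl index≥1 (subst (λ x → Λ (x ∷ + index ⊙ 𝟎)) (ZP.*-identityʳ (+ index)) (deep (+ 1 ∷ 𝟎))) λ G → lattice-basis n tail-lattice λ T → none (extend G T)
  where
  open Sublattice S
  tail-lattice : Sublattice (λ v → Λ (+ 0 ∷ v))
  tail-lattice = record { closed-⊞ = closed-⊞ ; closed-⊙ = λ c {u} p → subst (λ x → Λ (x ∷ c ⊙ u)) (ZP.*-zeroʳ c) (closed-⊙ c p) ; index = index ; index≥1 = index≥1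
   ; deep = λ v → subst (λ x → Λ (x ∷ + index ⊙ v)) (ZP.*-zeroʳ (+ index)) (deep (+ 0 ∷ v)) }
  extend : Generator Λ → Basis (λ v → Λ (+ 0 ∷ v)) → Basis Λ
  extend (d , w , 1≤d , Λw , div) T = record { σ = σ ; σ-linear = record { map-add = ad ; map-scale = sc } ; inside = ins ; coordinates = co ; injective = inj }
   where
   module T = Basis T
   σ : V (suc n) → V (suc n)
   σ (x ∷ u) = x * + d ∷ x ⊙ w ⊞ T.σ u
   ad : ∀ u v → σ (u ⊞ v) ≡ σ u ⊞ σ v
   ad (x ∷ u) (y ∷ v) = cong₂ _∷_ (ZP.*-distribʳ-+ (+ d) x y) (trans (cong₂ _⊞_ (⊙-distribʳ x y w) (map-add T.σ-linear u v)) (⊞-interchange _ _ _ _))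
   sc : ∀ c u → σ (c ⊙ u) ≡ c ⊙ σ u
   sc c (x ∷ u) = cong₂ _∷_ (ZP.*-assoc c x (+ d)) (trans (cong₂ _⊞_ (sym (⊙-assoc c x w)) (map-scale T.σ-linear c u)) (sym (⊙-distribˡ c _ _)))
   ins : ∀ u → Λ (σ u)
   ins (x ∷ u) = subst (λ y → Λ (y ∷ x ⊙ w ⊞ T.σ u)) (ZP.+-identityʳ _) (closed-⊞ (closed-⊙ x Λw) (T.inside u))
   co : ∀ y → Λ y → ∃ λ u → σ u ≡ y
   co (y ∷ z) Λy = k ∷ u , cong₂ _∷_ (sym y≡) (trans (cong (k ⊙ w ⊞_) u≡) (h k z w))
    where
    k : ℤ
    k = proj₁ (div y z Λy)
    y≡ : y ≡ k * + d
    y≡ = proj₂ (div y z Λy)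
    r : ∀ k d → k * d + - k * d ≡ + 0
    r = ring
    pre : ∃ λ u → T.σ u ≡ z ⊞ (- k) ⊙ w
    pre = T.coordinates (z ⊞ (- k) ⊙ w) (subst (λ x → Λ (x ∷ z ⊞ (- k) ⊙ w)) (trans (cong (_+ - k * + d) y≡) (r k (+ d))) (closed-⊞ Λy (closed-⊙ (- k) Λw)))
    u : V n
    u = proj₁ pre
    u≡ : T.σ u ≡ z ⊞ (- k) ⊙ w
    u≡ = proj₂ pre
    h : ∀ {n} k (z w : V n) → k ⊙ w ⊞ (z ⊞ (- k) ⊙ w) ≡ z
    h k []      []      = refl
    h k (z ∷ zs) (w ∷ ws) = cong₂ _∷_ (r' k z w) (h k zs ws)
     where r' : ∀ k z w → k * w + (z + - k * w) ≡ z
           r' = ring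
   inj : ∀ {u v} → σ u ≡ σ v → u ≡ v
   inj {x ∷ u} {y ∷ v} p = go (ZP.*-cancelʳ-≡ x y (+ d) {{N.>-nonZero 1≤d}} (cong Vec.head p))
    where go : x ≡ y → x ∷ u ≡ y ∷ v
          go refl = cong (x ∷_) (T.injective (⊞-cancelˡ (x ⊙ w) (cong Vec.tail p)))

 Cong-lookup : ∀ {M n} {u v : V n} → (∀ i → Mod M (Vec.lookup u i) (Vec.lookup v i)) → Cong M u v
 Cong-lookup {u = []}    {[]}    p = Cong-refl
 Cong-lookup {u = x ∷ u} {y ∷ v} p = Cong-∷ (p zero) (Cong-lookup (p ∘ suc))

 Cong-map : ∀ {M m n} {f : V m → V n} {u v} → LinearMap f → Cong M u v → Cong M (f u) (f v)
 Cong-map {M} {f = f} p (w , refl) = f w , trans (map-add p _ _) (cong (f _ ⊞_) (map-scale p M w))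

 module Neighbours (d : ℕ) (pr : Prime (suc d)) (na2 : ¬ Mod (+ suc d) (+ 2) (+ 0)) {N0 n : ℕ} (naN : ¬ Mod (+ suc d) (+ N0) (+ 0)) (𝔽 : Form N0 n) where

  open Residues d pr public
  open Form 𝔽 public hiding (linear)

  ℓℓ : ℤ
  ℓℓ = Λ * Λ

  module _ (L : Line n) (iso : Mod Λ (Q (vec L)) (+ 0)) where

   private
    π : V n → ℤ
    π = pivot L
    π-linear : Linear π
    π-linear = linear L
    c₀ : V n
    c₀ = proj₁ (dual π π-linear)
    c0≡ : ∀ y → B c₀ y ≡ + N0 * π y
    c0≡ = proj₂ (dual π π-linear)
    2N0 : ∃ λ u → Mod Λ (+ 2 * + N0 * u) (+ 1)
    2N0 = unit-mod (+ 2 * + N0) λ p → cases (euclid pr {+ 2} p)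
     where cases : Mod Λ (+ 2) (+ 0) ⊎ Mod Λ (+ N0) (+ 0) → ⊥
           cases (inj₁ p) = na2 p
           cases (inj₂ p) = naN p
    b t : ℤ
    b = Mod.quo iso
    t = - (b * proj₁ 2N0)
    -- A lift of the isotropic line with Q ẽ ≡ 0 modulo ℓ², as in Hensel's lemma: B(c₀, vec L) = N0
    -- is a unit, and t solves b + 2 N0 t ≡ 0 modulo ℓ.
    ẽ : V n
    ẽ = + 1 ⊙ vec L ⊞ (Λ * t) ⊙ c₀

   e≡v : Cong Λ ẽ (vec L)
   e≡v = Cong-trans (Cong-⊞ (Cong-≡ (⊙-identity (vec L))) (Cong-trans (Cong-≡ (sym (⊙-assoc Λ t c₀))) (Cong-multiple (t ⊙ c₀)))) (Cong-≡ (u⊞𝟎 (vec L)))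
    where u⊞𝟎 : ∀ {n} (u : V n) → u ⊞ 𝟎 ≡ u
          u⊞𝟎 []      = refl
          u⊞𝟎 (x ∷ u) = cong₂ _∷_ (ZP.+-identityʳ x) (u⊞𝟎 u)

   Qe : Mod ℓℓ (Q ẽ) (+ 0)
   Qe = Mod-tr (≡⇒Mod (trans (Q-comb (+ 1) (Λ * t) (vec L) c₀) (trans (cong₂ (λ x y → + 1 * + 1 * x + + 2 * (+ 1 * (Λ * t) * y) + Λ * t * (Λ * t) * Q c₀)
     (trans (Mod.eq iso) (ZP.+-identityˡ (b * Λ))) (trans (symm _ _) (trans (c0≡ (vec L)) (trans (cong (_*_ (+ N0)) (pivot≡ L)) (ZP.*-identityʳ (+ N0)))))) (r1 b Λ t (+ N0) (Q c₀)))))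
    (Mod-tr (Mod-+ (Mod-scale Λ lin) (Mod-multiple (t * t * Q c₀))) (≡⇒Mod (r2 Λ)))
    where
    r1 : ∀ b l t n q → + 1 * + 1 * (b * l) + + 2 * (+ 1 * (l * t) * n) + l * t * (l * t) * q ≡ l * (b + + 2 * n * t) + t * t * q * (l * l)
    r1 = ring
    r2 : ∀ l → l * + 0 + + 0 ≡ + 0
    r2 = ring
    lin : Mod Λ (b + + 2 * + N0 * t) (+ 0)
    lin = Mod-tr (≡⇒Mod (r3 b (+ N0) (proj₁ 2N0))) (Mod-tr (Mod-+ {a = b} Mod-refl (Mod-neg (Mod-* {a = b} Mod-refl (proj₂ 2N0)))) (≡⇒Mod (r4 b)))
     where r3 : ∀ b n u → b + + 2 * n * - (b * u) ≡ b + - (b * (+ 2 * n * u))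
           r3 = ring
           r4 : ∀ b → b + - (b * + 1) ≡ + 0
           r4 = ring

   πe : Mod Λ (π ẽ) (+ 1)
   πe = Mod-tr (Cong-φ π-linear e≡v) (≡⇒Mod (pivot≡ L))

   -- ℓ times the ℓ-neighbour of ℤⁿ at the line L.
   In : V n → Set
   In y = Cong Λ y (π y ⊙ ẽ) × Mod ℓℓ (B ẽ y) (+ 0)

   in? : ∀ y → Dec (In y)
   in? y = go (cong? ℓ y (π y ⊙ ẽ)) (mod? (ℓ N.* ℓ) (B ẽ y) (+ 0))
    where go : Dec (Cong Λ y (π y ⊙ ẽ)) → Dec (Mod ℓℓ (B ẽ y) (+ 0)) → Dec (In y)
          go (yes p) (yes q) = yes (p , q)
          go (no ¬p) _       = no (¬p ∘ proj₁)
          go _       (no ¬q) = no (¬q ∘ proj₂)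

   private
    Mod-ℓ : ∀ {a} → Mod ℓℓ (Λ * a) (+ 0) → Mod Λ a (+ 0)
    Mod-ℓ p = Mod-unscale Λ (λ ()) (Mod-tr p (≡⇒Mod (sym (ZP.*-zeroʳ Λ))))

    B-e : ∀ x m → B ẽ (x ⊙ ẽ ⊞ Λ ⊙ m) ≡ x * Q ẽ + Λ * B ẽ m
    B-e x m = trans (add (linearʳ ẽ) _ _) (cong₂ _+_ (scale (linearʳ ẽ) x ẽ) (scale (linearʳ ẽ) Λ m))

   -- With `In-decompose` this identifies `In` with the vectors x ẽ + ℓ m where m is orthogonal to ẽ
   -- modulo ℓ; on these B is visibly divisible by ℓ².
   In-compose : ∀ x m → Mod Λ (B ẽ m) (+ 0) → In (x ⊙ ẽ ⊞ Λ ⊙ m)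
   In-compose x m p = Cong-trans (Cong-⊞ (Cong-refl {u = x ⊙ ẽ}) (Cong-multiple m)) (Cong-trans (Cong-≡ (trans (cong (x ⊙ ẽ ⊞_) (sym (⊙-zeroˡ ẽ))) (trans (sym (⊙-distribʳ x (+ 0) ẽ)) (cong (_⊙ ẽ) (ZP.+-identityʳ x)))))
      (Cong-⊙ (Mod-sym (Mod-tr (≡⇒Mod (trans (add π-linear _ _) (cong₂ _+_ (scale π-linear x ẽ) (scale π-linear Λ m)))) (Mod-tr (Mod-+ (Mod-* {a = x} Mod-refl πe) (Mod-tr (≡⇒Mod (ZP.*-comm Λ (π m))) (Mod-multiple (π m)))) (≡⇒Mod (r x))))) Cong-refl)) ,
     Mod-tr (≡⇒Mod (B-e x m)) (Mod-tr (Mod-+ (Mod-* {a = x} Mod-refl Qe) (Mod-scale Λ p)) (≡⇒Mod (r2 x Λ)))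
    where r : ∀ x → x * + 1 + + 0 ≡ x
          r = ring
          r2 : ∀ x l → x * + 0 + l * + 0 ≡ + 0
          r2 = ring

   In-decompose : ∀ {y} → In y → ∃ λ x → ∃ λ m → y ≡ x ⊙ ẽ ⊞ Λ ⊙ m × Mod Λ (B ẽ m) (+ 0)
   In-decompose {y} ((m , y≡) , p) = π y , m , y≡ , Mod-ℓ (Mod-tr (Mod-tr (≡⇒Mod (r (π y * Q ẽ) (Λ * B ẽ m))) (Mod-+ (Mod-tr (≡⇒Mod (trans (sym (B-e (π y) m)) (cong (B ẽ) (sym y≡)))) p) (Mod-neg (Mod-* {a = π y} Mod-refl Qe)))) (≡⇒Mod (r2 (π y))))
    where r : ∀ a b → b ≡ a + b - a
          r = ring
          r2 : ∀ x → + 0 - x * + 0 ≡ + 0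
          r2 = ring

   In-lattice : Sublattice In
   In-lattice = record
    { closed-⊞ = λ {u} {v} p q → Cong-trans (Cong-⊞ (proj₁ p) (proj₁ q)) (Cong-≡ (trans (sym (⊙-distribʳ (π u) (π v) ẽ)) (cong (_⊙ ẽ) (sym (add π-linear u v))))) ,
                Mod-tr (≡⇒Mod (add (linearʳ ẽ) u v)) (Mod-+ (proj₂ p) (proj₂ q))
    ; closed-⊙ = λ c {u} p → Cong-trans (Cong-⊙ (Mod-refl {a = c}) (proj₁ p)) (Cong-≡ (trans (⊙-assoc c (π u) ẽ) (cong (_⊙ ẽ) (sym (scale π-linear c u))))) ,
              Mod-tr (≡⇒Mod (scale (linearʳ ẽ) c u)) (Mod-tr (Mod-* {a = c} Mod-refl (proj₂ p)) (≡⇒Mod (ZP.*-zeroʳ c)))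
    ; index = ℓ N.* ℓ ; index≥1 = s≤s z≤n
    ; deep = λ v → subst In (trans (cong₂ _⊞_ (⊙-zeroˡ ẽ) (⊙-assoc Λ Λ v)) (⊞-identityˡ _)) (In-compose (+ 0) (Λ ⊙ v) (Mod-tr (≡⇒Mod (trans (scale (linearʳ ẽ) Λ v) (ZP.*-comm Λ _))) (Mod-multiple (B ẽ v)))) }

   In-B : ∀ {y y'} → In y → In y' → Mod ℓℓ (B y y') (+ 0)
   In-B {y} {y'} p q = go (In-decompose p) (In-decompose q)
    where
    go : (∃ λ x → ∃ λ m → y ≡ x ⊙ ẽ ⊞ Λ ⊙ m × Mod Λ (B ẽ m) (+ 0)) → (∃ λ x → ∃ λ m → y' ≡ x ⊙ ẽ ⊞ Λ ⊙ m × Mod Λ (B ẽ m) (+ 0)) → Mod ℓℓ (B y y') (+ 0)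
    go (x , m , refl , p) (x' , m' , refl , p') = Mod-tr (≡⇒Mod (trans (B-comb x Λ x' Λ ẽ m ẽ m') (trans (cong (λ z → x * x' * Q ẽ + x * Λ * B ẽ m' + Λ * x' * z + Λ * Λ * B m m') (symm m ẽ)) (r1 x x' Λ (Q ẽ) (B ẽ m') (B ẽ m) (B m m')))))
      (Mod-tr (Mod-+ (Mod-+ (Mod-* {a = x * x'} Mod-refl Qe) (Mod-scale Λ (Mod-+ (Mod-* {a = x} Mod-refl p') (Mod-* {a = x'} Mod-refl p)))) (Mod-multiple (B m m'))) (≡⇒Mod (r2 x x' Λ)))
     where r1 : ∀ x x' l q b b' c → x * x' * q + x * l * b + l * x' * b' + l * l * c ≡ x * x' * q + l * (x * b + x' * b') + c * (l * l)
           r1 = ring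
           r2 : ∀ x x' l → x * x' * + 0 + l * (x * + 0 + x' * + 0) + + 0 ≡ + 0
           r2 = ring

   In-nonzero⇒ : ∀ {y} → In y → Cong Λ y (π y ⊙ vec L)
   In-nonzero⇒ (p , _) = Cong-trans p (Cong-⊙ Mod-refl e≡v)

   -- For y = x ẽ + ℓ m the condition on Q y says 2 x B(ẽ, m) ≡ 0 modulo ℓ, and x is a unit because
   -- y is not divisible by ℓ.
   In-nonzero⇐ : ∀ {y} → ¬ Cong Λ y 𝟎 → Mod ℓℓ (Q y) (+ 0) → Cong Λ y (π y ⊙ vec L) → In y
   In-nonzero⇐ {y} nz Qy p = go (Cong-trans p (Cong-⊙ Mod-refl (Cong-sym e≡v)))
    where
    x : ℤ
    x = π y
    go : Cong Λ y (x ⊙ ẽ) → In y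
    go (m , y≡) = subst In (sym y≡) (In-compose x m (cases (euclid pr {+ 2 * x} (Mod-ℓ (Mod-tr (Mod-tr (≡⇒Mod (r1 x Λ (B ẽ m) (Q ẽ) (Q m))) (Mod-+ (Mod-+ (Mod-tr (≡⇒Mod (trans (sym (Q-comb x Λ ẽ m)) (cong Q (sym y≡)))) Qy)
      (Mod-neg (Mod-* {a = x * x} Mod-refl Qe))) (Mod-neg (Mod-multiple (Q m))))) (≡⇒Mod (r2 x)))))))
     where
     r1 : ∀ x l b q q' → l * (+ 2 * x * b) ≡ x * x * q + + 2 * (x * l * b) + l * l * q' + - (x * x * q) + - (q' * (l * l))
     r1 = ring
     r2 : ∀ x → + 0 + - (x * x * + 0) + - + 0 ≡ + 0
     r2 = ring
     x≢0 : ¬ Mod Λ x (+ 0)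
     x≢0 q = nz (Cong-trans p (Cong-trans (Cong-⊙ q Cong-refl) (Cong-≡ (⊙-zeroˡ (vec L)))))
     cases : Mod Λ (+ 2 * x) (+ 0) ⊎ Mod Λ (B ẽ m) (+ 0) → Mod Λ (B ẽ m) (+ 0)
     cases (inj₂ q) = q
     cases (inj₁ q) = ⊥-elim (cases' (euclid pr {+ 2} q))
      where cases' : Mod Λ (+ 2) (+ 0) ⊎ Mod Λ x (+ 0) → ⊥
            cases' (inj₁ q) = na2 q
            cases' (inj₂ q) = x≢0 q

   In-multiple⇒ : ∀ {x} → In (Λ ⊙ x) → Mod Λ (B (vec L) x) (+ 0)
   In-multiple⇒ {x} (_ , p) = Mod-tr (Mod-sym (Cong-φ (Form.linear 𝔽 x) e≡v)) (Mod-ℓ (Mod-tr (≡⇒Mod (sym (scale (linearʳ ẽ) Λ x))) p))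

   In-multiple⇐ : ∀ {x} → Mod Λ (B (vec L) x) (+ 0) → In (Λ ⊙ x)
   In-multiple⇐ {x} p = subst In (trans (cong (_⊞ Λ ⊙ x) (⊙-zeroˡ ẽ)) (⊞-identityˡ _)) (In-compose (+ 0) x (Mod-tr (Cong-φ (Form.linear 𝔽 x) e≡v) p))

   module Neighbour (basis : Basis In) where
    open Basis basis public

    -- ℓ² times the inverse of σ, as an integral map. Modulo 12, where ℓ² will be 1, it is the
    -- inverse itself and transports residue classes to the neighbour.
    s : V n → V n
    s y = proj₁ (coordinates (ℓℓ ⊙ y) (Sublattice.deep In-lattice y))

    σ-s : ∀ y → σ (s y) ≡ ℓℓ ⊙ y
    σ-s y = proj₂ (coordinates (ℓℓ ⊙ y) (Sublattice.deep In-lattice y))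

    s-linear : LinearMap s
    s-linear = record
     { map-add = λ u v → injective (trans (σ-s _) (trans (⊙-distribˡ ℓℓ u v) (sym (trans (map-add σ-linear (s u) (s v)) (cong₂ _⊞_ (σ-s u) (σ-s v))))))
     ; map-scale = λ c u → injective (trans (σ-s _) (trans (⊙-comm ℓℓ c u) (sym (trans (map-scale σ-linear c (s u)) (cong (c ⊙_) (σ-s u)))))) }

    s-σ : ∀ u → s (σ u) ≡ ℓℓ ⊙ u
    s-σ u = injective (trans (σ-s _) (sym (map-scale σ-linear ℓℓ u)))

    opaque

     B' : V n → V n → ℤ
     B' u v = Mod.quo (In-B (inside u) (inside v))

     B'-eq : ∀ u v → ℓℓ * B' u v ≡ B (σ u) (σ v)
     B'-eq u v = trans (ZP.*-comm ℓℓ (B' u v)) (trans (sym (ZP.+-identityˡ _)) (sym (Mod.eq (In-B (inside u) (inside v)))))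

    private
     cancel : ∀ {a b} → ℓℓ * a ≡ ℓℓ * b → a ≡ b
     cancel {a} {b} = ZP.*-cancelˡ-≡ ℓℓ a b

     -- A functional φ on the neighbour gives φ ∘ s on ℤⁿ, represented by some c. The point is that
     -- c lies in `In` and so has coordinates in the neighbour; thus the same N0 serves for the
     -- neighbour, and the set of forms considered stays finite.
     module Dual (φ : V n → ℤ) (p : Linear φ) where

      Φ-linear : Linear (φ ∘ s)
      Φ-linear = linear-∘ p s-linear
      c : V n
      c = proj₁ (dual (φ ∘ s) Φ-linear)
      c≡ : ∀ y → B c y ≡ + N0 * φ (s y)
      c≡ = proj₂ (dual (φ ∘ s) Φ-linear)

      Φ-σ : ∀ u → φ (s (σ u)) ≡ ℓℓ * φ u
      Φ-σ u = trans (cong φ (s-σ u)) (scale p ℓℓ u)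

      Φ-In : ∀ y → In y → Mod ℓℓ (φ (s y)) (+ 0)
      Φ-In y q = go (coordinates y q)
       where go : (∃ λ u → σ u ≡ y) → Mod ℓℓ (φ (s y)) (+ 0)
             go (u , p) = Mod-tr (≡⇒Mod (trans (cong (φ ∘ s) (sym p)) (trans (Φ-σ u) (ZP.*-comm ℓℓ (φ u))))) (Mod-multiple (φ u))

      Φ-⊥ : ∀ y → Mod Λ (B ẽ y) (+ 0) → Mod Λ (φ (s y)) (+ 0)
      Φ-⊥ y q = Mod-ℓ (Mod-tr (≡⇒Mod (sym (scale Φ-linear Λ y))) (Φ-In (Λ ⊙ y) (subst In (trans (cong (_⊞ Λ ⊙ y) (⊙-zeroˡ ẽ)) (⊞-identityˡ _)) (In-compose (+ 0) y q))))

      uN : ∃ λ u → Mod Λ (+ N0 * u) (+ 1)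
      uN = unit-mod (+ N0) naN
      a : ℤ
      a = proj₁ uN * B c c₀

      -- B c vanishes modulo ℓ on the hyperplane B e = 0.
      proportional : ∀ y → Mod Λ (B c y) (a * B ẽ y)
      proportional y = Mod-diff (Mod-tr (≡⇒Mod (trans (r1 (B c y) (proj₁ uN) (B c c₀) (B ẽ y)) (sym (trans (cong (B c) (cong (_⊞ k ⊙ c₀) (sym (⊙-identity y)))) (trans (add (linearʳ c) _ _) (cong₂ _+_ (scale (linearʳ c) (+ 1) y) (scale (linearʳ c) k c₀)))))))
        (Mod-tr (≡⇒Mod (c≡ (y ⊞ k ⊙ c₀))) (Mod-tr (Mod-* {a = + N0} Mod-refl (Φ-⊥ (y ⊞ k ⊙ c₀) vanish)) (≡⇒Mod (ZP.*-zeroʳ (+ N0))))))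
       where
       k : ℤ
       k = - (proj₁ uN * B ẽ y)
       r1 : ∀ x u y z → x - u * y * z ≡ + 1 * x + - (u * z) * y
       r1 = ring
       Bec0 : Mod Λ (B ẽ c₀) (+ N0)
       Bec0 = Mod-tr (≡⇒Mod (trans (symm ẽ c₀) (c0≡ ẽ))) (Mod-tr (Mod-* {a = + N0} Mod-refl πe) (≡⇒Mod (ZP.*-identityʳ (+ N0))))
       vanish : Mod Λ (B ẽ (y ⊞ k ⊙ c₀)) (+ 0)
       vanish = Mod-tr (≡⇒Mod (trans (add (linearʳ ẽ) _ _) (cong (_+_ (B ẽ y)) (scale (linearʳ ẽ) k c₀)))) (Mod-tr (Mod-+ {a = B ẽ y} Mod-refl (Mod-* {a = k} Mod-refl Bec0))
        (Mod-tr (≡⇒Mod (r2 (B ẽ y) (proj₁ uN) (+ N0))) (Mod-tr (Mod-+ {a = B ẽ y} Mod-refl (Mod-neg (Mod-* {a = B ẽ y} Mod-refl (proj₂ uN)))) (≡⇒Mod (r3 (B ẽ y))))))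
        where r2 : ∀ b u n → b + - (u * b) * n ≡ b + - (b * (n * u))
              r2 = ring
              r3 : ∀ b → b + - (b * + 1) ≡ + 0
              r3 = ring

      c≡ae : Cong Λ c (a ⊙ ẽ)
      c≡ae = Cong-lookup λ i → cancel-N (coordinate i)
       where
       cancel-N : ∀ {x y} → Mod Λ (+ N0 * x) (+ N0 * y) → Mod Λ x y
       cancel-N {x} {y} q = Mod-tr (Mod-sym (one x)) (Mod-tr (Mod-* {a = proj₁ uN} Mod-refl q) (one y))
        where one : ∀ x → Mod Λ (proj₁ uN * (+ N0 * x)) x
              one x = Mod-tr (≡⇒Mod (r (proj₁ uN) (+ N0) x)) (Mod-tr (Mod-* (proj₂ uN) (Mod-refl {a = x})) (≡⇒Mod (ZP.*-identityˡ x)))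
               where r : ∀ u n x → u * (n * x) ≡ n * u * x
                     r = ring
       coordinate : ∀ i → Mod Λ (+ N0 * Vec.lookup c i) (+ N0 * Vec.lookup (a ⊙ ẽ) i)
       coordinate i = Mod-tr (≡⇒Mod (sym (trans (symm c cᵢ) (cᵢ≡ c)))) (Mod-tr (proportional cᵢ) (≡⇒Mod (trans (sym (scale (linear' cᵢ) a ẽ)) (trans (symm _ cᵢ) (cᵢ≡ (a ⊙ ẽ))))))
        where cᵢ = proj₁ (dual _ (lookup-linear {n} i))
              cᵢ≡ = proj₂ (dual _ (lookup-linear {n} i))
              linear' = Form.linear 𝔽

      c-In : In c
      c-In = Cong-trans c≡ae (Cong-⊙ (Mod-sym (Mod-tr (Cong-φ π-linear c≡ae) (Mod-tr (≡⇒Mod (scale π-linear a ẽ)) (Mod-tr (Mod-* {a = a} Mod-refl πe) (≡⇒Mod (ZP.*-identityʳ a)))))) Cong-refl) ,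
       Mod-tr (≡⇒Mod (trans (symm ẽ c) (c≡ ẽ))) (Mod-tr (Mod-* {a = + N0} Mod-refl (Φ-In ẽ e-In)) (≡⇒Mod (ZP.*-zeroʳ (+ N0))))
       where e-In : In ẽ
             e-In = Cong-trans (Cong-≡ (sym (⊙-identity ẽ))) (Cong-⊙ (Mod-sym πe) Cong-refl) , Qe

      result : ∃ λ c' → ∀ y → B' c' y ≡ + N0 * φ y
      result = go (coordinates c c-In)
       where
       r : ∀ n l x → n * (l * x) ≡ l * (n * x)
       r = ring
       go : (∃ λ u → σ u ≡ c) → ∃ λ c' → ∀ y → B' c' y ≡ + N0 * φ y
       go (c' , q) = c' , λ y → cancel (trans (B'-eq c' y) (trans (cong (λ z → B z (σ y)) q) (trans (c≡ (σ y)) (trans (cong (_*_ (+ N0)) (Φ-σ y)) (r (+ N0) ℓℓ (φ y))))))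

    neighbour : Form N0 n
    neighbour = record
     { B = B'
     ; linear = λ z → record { add = λ u v → cancel (trans (B'-eq _ z) (trans (cong (λ x → B x (σ z)) (map-add σ-linear u v)) (trans (add (Form.linear 𝔽 (σ z)) _ _) (sym (trans (ZP.*-distribˡ-+ ℓℓ (B' u z) (B' v z)) (cong₂ _+_ (B'-eq u z) (B'-eq v z)))))))
                 ; scale = λ k u → cancel (trans (B'-eq _ z) (trans (cong (λ x → B x (σ z)) (map-scale σ-linear k u)) (trans (scale (Form.linear 𝔽 (σ z)) k _) (trans (cong (_*_ k) (sym (B'-eq u z))) (r k ℓℓ (B' u z)))))) }
     ; symm = λ u v → cancel (trans (B'-eq u v) (trans (symm _ _) (sym (B'-eq v u))))
     ; nonneg = λ u → ZP.*-cancelˡ-≤-pos (+ 0) (B' u u) ℓℓ (subst (Z._≤ ℓℓ * B' u u) (sym (ZP.*-zeroʳ ℓℓ)) (subst (+ 0 Z.≤_) (sym (B'-eq u u)) (nonneg (σ u))))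
     ; dual = λ φ p → Dual.result φ p }
     where r : ∀ k l x → k * (l * x) ≡ l * (k * x)
           r = ring

open NeighbourLattices

-- The neighbour relation between theta series

module EichlerRelation where

 open Z using (_+_; _*_; -_; _-_)

 combine : {A : Set} → List (ℤ × A) → (A → ℤ) → ℤ
 combine T f = sumL T λ (k , o) → k * f o

 module _ {N0 n} (𝔽 : Form N0 n) (1≤N0 : 1 N.≤ N0) where
  open Form 𝔽

  reps-cong : ∀ {w w'} N → (∀ y → Q y ≡ + N → w y ≡ w' y) → reps 𝔽 1≤N0 w N ≡ reps 𝔽 1≤N0 w' N
  reps-cong N p = sumL-cong (box n (bound 𝔽 1≤N0 N)) λ y → []-cong-* (Q y Z.≟ + N) (p y)

  reps-+ : ∀ w w' N → reps 𝔽 1≤N0 (λ y → w y + w' y) N ≡ reps 𝔽 1≤N0 w N + reps 𝔽 1≤N0 w' N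
  reps-+ w w' N = trans (sumL-cong (box n (bound 𝔽 1≤N0 N)) λ y → ZP.*-distribˡ-+ [ Q y Z.≟ + N ] (w y) (w' y)) (sumL-+ (box n (bound 𝔽 1≤N0 N)) _ _)

  reps-*ˡ : ∀ c w N → reps 𝔽 1≤N0 (λ y → c * w y) N ≡ c * reps 𝔽 1≤N0 w N
  reps-*ˡ c w N = trans (sumL-cong (box n (bound 𝔽 1≤N0 N)) λ y → h [ Q y Z.≟ + N ] c (w y)) (sumL-*ˡ (box n (bound 𝔽 1≤N0 N)) c _)
   where h : ∀ a b c → a * (b * c) ≡ b * (a * c)
         h = ring

  reps-sumL : ∀ {A : Set} (xs : List A) (f : A → V n → ℤ) N → reps 𝔽 1≤N0 (λ y → sumL xs λ x → f x y) N ≡ sumL xs λ x → reps 𝔽 1≤N0 (f x) N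
  reps-sumL xs f N = trans (sumL-cong (box n (bound 𝔽 1≤N0 N)) λ y → sym (sumL-*ˡ xs [ Q y Z.≟ + N ] λ x → f x y)) (sumL-swap (box n (bound 𝔽 1≤N0 N)) xs λ y x → [ Q y Z.≟ + N ] * f x y)

  reps-0 : ∀ w N → (∀ y → Q y ≡ + N → w y ≡ + 0) → reps 𝔽 1≤N0 w N ≡ + 0
  reps-0 w N p = trans (reps-cong N p) (sumL-0 (box n (bound 𝔽 1≤N0 N)) λ y → ZP.*-zeroʳ [ Q y Z.≟ + N ])

 module Eichler (d : ℕ) (pr : Prime (suc d)) (na2 : ¬ Mod (+ suc d) (+ 2) (+ 0)) (ℓ²≡1 : Mod (+ 12) (+ suc d * + suc d) (+ 1)) {N0 n : ℕ} (1≤N0 : 1 N.≤ N0)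
  (naN : ¬ Mod (+ suc d) (+ N0) (+ 0)) (D : ℤ) (D≡ : + suc d * + suc d * D ≡ (+ suc d) Z.^ n) where

  class : V n → V n → ℤ
  class c y = [ cong? 12 y c ]

  Obj : Set
  Obj = Form N0 n × V n

  F : Obj → ℕ → ℤ
  F (𝔽 , c) N = reps 𝔽 1≤N0 (class c) N


  module _ (𝔽 : Form N0 n) (c : V n) where

   open Neighbours d pr na2 naN 𝔽

   N⁺ : ℕ → ℕ
   N⁺ N = ℓ N.* ℓ N.* N

   +N⁺ : ∀ N → + N⁺ N ≡ ℓℓ * + N
   +N⁺ N = ZP.pos-* (ℓ N.* ℓ) N

   -- Plays the role of F(N/ℓ²): if y = ℓ² w has norm ℓ² N, then w has norm N/ℓ². In this form it is
   -- 0 when ℓ² does not divide N.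
   F⁻ : ℕ → ℤ
   F⁻ N = reps 𝔽 1≤N0 (λ y → class c y * [ cong? (ℓ N.* ℓ) y 𝟎 ]) (N⁺ N)

   cancel-ℓℓ : ∀ {a b} → ℓℓ * a ≡ ℓℓ * b → a ≡ b
   cancel-ℓℓ {a} {b} = ZP.*-cancelˡ-≡ ℓℓ a b

   private
    iso? : ∀ L → Dec (Mod Λ (Q (vec L)) (+ 0))
    iso? L = mod? ℓ (Q (vec L)) (+ 0)

   indicator : ∀ L → Dec (Mod Λ (Q (vec L)) (+ 0)) → V n → ℤ
   indicator L (yes p) y = [ in? L p y ]
   indicator L (no _)  y = + 0

   t : ℤ
   t = sumL (lines n) λ L → [ iso? L ]

   private
    a b : V n → ℤ
    a y = [ cong? ℓ y 𝟎 ]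
    b y = [ cong? (ℓ N.* ℓ) y 𝟎 ]

    multiples : V n → ℤ
    multiples y = sumL (lines n) λ L → indicator L (iso? L) y

    ℓℓ⇒ℓ : ∀ {y : V n} → Cong ℓℓ y 𝟎 → Cong Λ y 𝟎
    ℓℓ⇒ℓ (w , p) = Λ ⊙ w , trans p (cong (𝟎 ⊞_) (sym (⊙-assoc Λ Λ w)))

    -- Modulo ℓ such a y lies on exactly one line, and this line is isotropic since ℓ² | Q y; only
    -- its neighbour contains y.
    nonmultiple : ∀ N y → Q y ≡ + N⁺ N → ¬ Cong Λ y 𝟎 → multiples y ≡ + 1
    nonmultiple N y q nz = trans (sumL-cong (lines n) λ L → on L (iso? L)) (line-unique n y nz)
     where
     Qy : Mod ℓℓ (Q y) (+ 0)
     Qy = Mod-tr (≡⇒Mod (trans q (trans (+N⁺ N) (ZP.*-comm ℓℓ (+ N))))) (Mod-multiple (+ N))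
     on : ∀ L (i : Dec (Mod Λ (Q (vec L)) (+ 0))) → indicator L i y ≡ [ cong? ℓ y (pivot L y ⊙ vec L) ]
     on L (yes p) = []-⇔ (in? L p y) (cong? ℓ y (pivot L y ⊙ vec L)) (In-nonzero⇒ L p) (In-nonzero⇐ L p nz Qy)
     on L (no ¬p) = sym ([]-no (cong? ℓ y (pivot L y ⊙ vec L)) λ r → excluded r (euclid pr {x * x} (Mod-tr (≡⇒Mod (sym (Q-scale x (vec L)))) (Mod-tr (Mod-sym (Q-Cong 𝔽 r)) (Mod-weaken Λ Qy)))))
      where
      x : ℤ
      x = pivot L y
      excluded : Cong Λ y (x ⊙ vec L) → Mod Λ (x * x) (+ 0) ⊎ Mod Λ (Q (vec L)) (+ 0) → ⊥
      excluded r (inj₂ p) = ¬p p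
      excluded r (inj₁ p) = nz (Cong-trans r (Cong-trans (Cong-⊙ (both (euclid pr {x} p)) Cong-refl) (Cong-≡ (⊙-zeroˡ (vec L)))))
       where both : Mod Λ x (+ 0) ⊎ Mod Λ x (+ 0) → Mod Λ x (+ 0)
             both (inj₁ p) = p
             both (inj₂ p) = p

    off : V n → ℤ
    off x = sumL (lines n) λ L → [ iso? L ] * (+ 1 - [ mod? ℓ (B (vec L) x) (+ 0) ])

    -- ℓ x lies in the neighbour at L exactly when L is orthogonal to x modulo ℓ, so of the t
    -- isotropic lines those counted by `off` are lost.
    multiple : ∀ x → multiples (Λ ⊙ x) ≡ t - off x
    multiple x = trans (sumL-cong (lines n) λ L → trans (on L (iso? L)) (h [ iso? L ] [ mod? ℓ (B (vec L) x) (+ 0) ]))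
      (trans (sumL-+ (lines n) (λ L → [ iso? L ]) _) (cong (_+_ t) (trans (sumL-*ˡ (lines n) (- + 1) λ L → [ iso? L ] * (+ 1 - [ mod? ℓ (B (vec L) x) (+ 0) ])) (ZP.-1*i≡-i _))))
     where
     on : ∀ L (i : Dec (Mod Λ (Q (vec L)) (+ 0))) → indicator L i (Λ ⊙ x) ≡ [ i ] * [ mod? ℓ (B (vec L) x) (+ 0) ]
     on L (yes p) = trans ([]-⇔ (in? L p (Λ ⊙ x)) (mod? ℓ (B (vec L) x) (+ 0)) (In-multiple⇒ L p) (In-multiple⇐ L p)) (sym (ZP.*-identityˡ _))
     on L (no ¬p) = sym (ZP.*-zeroˡ [ mod? ℓ (B (vec L) x) (+ 0) ])
     h : ∀ i z → i * z ≡ i + - + 1 * (i * (+ 1 - z))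
     h = ring

    off-nonzero : ∀ x → Mod Λ (Q x) (+ 0) → ¬ Cong Λ x 𝟎 → off x ≡ D
    off-nonzero x Qx nz = cancel-ℓℓ (trans (isotropic-off-hyperplane 𝔽 x y na2 Qx By) (sym D≡))
     where
     coordinate : ∃ λ i → ¬ Mod Λ (Vec.lookup x i) (+ 0)
     coordinate = Finₚ.¬∀⟶∃¬ n (λ i → Mod Λ (Vec.lookup x i) (+ 0)) (λ i → mod? ℓ (Vec.lookup x i) (+ 0)) λ all → nz (Cong-lookup λ i → Mod-tr (all i) (≡⇒Mod (sym (linear-0 (lookup-linear i)))))
     y : V n
     y = proj₁ (dual _ (lookup-linear (proj₁ coordinate)))
     By : ¬ Mod Λ (B y x) (+ 0)
     By p = cases (euclid pr {+ N0} (Mod-tr (≡⇒Mod (sym (proj₂ (dual _ (lookup-linear (proj₁ coordinate))) x))) p))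
      where cases : Mod Λ (+ N0) (+ 0) ⊎ Mod Λ (Vec.lookup x (proj₁ coordinate)) (+ 0) → ⊥
            cases (inj₁ q) = naN q
            cases (inj₂ q) = proj₂ coordinate q

    off-zero : ∀ x → Cong Λ x 𝟎 → off x ≡ + 0
    off-zero x p = sumL-0 (lines n) λ L → trans (cong (λ z → [ iso? L ] * (+ 1 - z)) ([]-yes (mod? ℓ (B (vec L) x) (+ 0)) (Mod-tr (Cong-φ (linearʳ (vec L)) p) (≡⇒Mod (linear-0 (linearʳ (vec L))))))) (ZP.*-zeroʳ [ iso? L ])

    -- The corrections 1 - t + D on ℓℤⁿ and -D on ℓ²ℤⁿ bring the multiplicities 1, t - D and t to 1.
    -- The second value requires Q x ≡ 0 modulo ℓ for y = ℓ x, which is where ℓ | N enters.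
    count : ∀ N → Mod Λ (+ N) (+ 0) → ∀ y → Q y ≡ + N⁺ N → multiples y + (+ 1 - t + D) * a y + - D * b y ≡ + 1
    count N ℓ∣N y q = go (cong? ℓ y 𝟎)
     where
     go : Dec (Cong Λ y 𝟎) → multiples y + (+ 1 - t + D) * a y + - D * b y ≡ + 1
     go (no nz) = trans (cong₂ _+_ (cong₂ _+_ (nonmultiple N y q nz) (cong (_*_ (+ 1 - t + D)) ([]-no (cong? ℓ y 𝟎) nz))) (cong (_*_ (- D)) ([]-no (cong? (ℓ N.* ℓ) y 𝟎) (nz ∘ ℓℓ⇒ℓ)))) (h t D)
      where h : ∀ t D → + 1 + (+ 1 - t + D) * + 0 + - D * + 0 ≡ + 1
            h = ring
     go (yes z) = divided (Cong-0 z)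
      where
      divided : (∃ λ x → y ≡ Λ ⊙ x) → multiples y + (+ 1 - t + D) * a y + - D * b y ≡ + 1
      divided (x , y≡) = trans (cong₂ (λ u v → u + (+ 1 - t + D) * v + - D * b y) (trans (cong multiples y≡) (multiple x)) ([]-yes (cong? ℓ y 𝟎) z)) (inner (cong? ℓ x 𝟎))
       where
       Qx : Mod Λ (Q x) (+ 0)
       Qx = Mod-tr (≡⇒Mod (cancel-ℓℓ (trans (sym (Q-scale Λ x)) (trans (cong Q (sym y≡)) (trans q (+N⁺ N)))))) ℓ∣N
       inner : Dec (Cong Λ x 𝟎) → t - off x + (+ 1 - t + D) * + 1 + - D * b y ≡ + 1
       inner (yes p) = trans (cong₂ (λ u v → t - u + (+ 1 - t + D) * + 1 + - D * v) (off-zero x p) ([]-yes (cong? (ℓ N.* ℓ) y 𝟎) (subst (λ v → Cong ℓℓ v 𝟎) (sym y≡) (twice p)))) (h t D)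
        where h : ∀ t D → t - + 0 + (+ 1 - t + D) * + 1 + - D * + 1 ≡ + 1
              h = ring
              twice : Cong Λ x 𝟎 → Cong ℓℓ (Λ ⊙ x) 𝟎
              twice p with Cong-0 p
              ... | w , refl = w , trans (⊙-assoc Λ Λ w) (sym (⊞-identityˡ _))
       inner (no nz) = trans (cong₂ (λ u v → t - u + (+ 1 - t + D) * + 1 + - D * v) (off-nonzero x Qx nz) ([]-no (cong? (ℓ N.* ℓ) y 𝟎) (nz ∘ once))) (h t D)
        where h : ∀ t D → t - D + (+ 1 - t + D) * + 1 + - D * + 0 ≡ + 1
              h = ring
              once : Cong ℓℓ y 𝟎 → Cong Λ x 𝟎
              once p = w , trans (⊙-cancel Λ (λ ()) (trans (sym y≡) (trans (proj₂ (Cong-0 p)) (sym (⊙-assoc Λ Λ w))))) (sym (⊞-identityˡ _))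
               where w = proj₁ (Cong-0 p)

    ℓ²-class : ∀ (u : V n) → Cong (+ 12) (ℓℓ ⊙ u) u
    ℓ²-class u = Cong-trans (Cong-⊙ ℓ²≡1 Cong-refl) (Cong-≡ (⊙-identity u))

   -- σ carries the vectors of norm N of the neighbour to those of norm ℓ² N in `In`. A line that is
   -- not isotropic contributes nothing and is recorded with coefficient 0.
   neighbour-reps : ∀ L → ¬ ¬ ∃ λ k → ∃ λ o → ∀ N → k * F o N ≡ reps 𝔽 1≤N0 (λ y → class c y * indicator L (iso? L) y) (N⁺ N)
   neighbour-reps L = go (iso? L)
    where
    go : (i : Dec (Mod Λ (Q (vec L)) (+ 0))) → ¬ ¬ ∃ λ k → ∃ λ o → ∀ N → k * F o N ≡ reps 𝔽 1≤N0 (λ y → class c y * indicator L i y) (N⁺ N)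
    go (no _) none = none (+ 0 , (𝔽 , c) , λ N → sym (reps-0 𝔽 1≤N0 (λ y → class c y * + 0) (N⁺ N) λ y _ → ZP.*-zeroʳ (class c y)))
    go (yes p) none = lattice-basis n (In-lattice L p) λ basis → none (+ 1 , from-basis basis)
     where
     from-basis : Basis (In L p) → ∃ λ o → ∀ N → + 1 * F o N ≡ reps 𝔽 1≤N0 (λ y → class c y * [ in? L p y ]) (N⁺ N)
     from-basis basis = (neighbour , s c) , λ N → trans (ZP.*-identityˡ _) (sym (trans
       (reps-change 𝔽 1≤N0 neighbour 1≤N0 σ (λ y → σ⁻ y (in? L p y)) (λ y → class c y * [ in? L p y ]) (N⁺ N) N
        (λ u q → cancel-ℓℓ (trans (B'-eq u u) (trans q (+N⁺ N)))) (λ u q → trans (sym (B'-eq u u)) (trans (cong (_*_ ℓℓ) q) (sym (+N⁺ N))))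
        (λ u → left u (in? L p (σ u))) (λ y _ nz → right y (in? L p y) (λ z → nz (trans (cong (_*_ (class c y)) z) (ZP.*-zeroʳ (class c y))))))
       (reps-cong neighbour 1≤N0 {w' = class (s c)} N λ u _ → trans (cong (_*_ (class c (σ u))) ([]-yes (in? L p (σ u)) (inside u))) (trans (ZP.*-identityʳ _)
        ([]-⇔ (cong? 12 (σ u) c) (cong? 12 u (s c)) (λ r → Cong-trans (Cong-sym (ℓ²-class u)) (Cong-trans (Cong-≡ (sym (s-σ u))) (Cong-map s-linear r)))
         (λ r → Cong-trans (Cong-map σ-linear r) (Cong-trans (Cong-≡ (σ-s c)) (ℓ²-class c))))))))
      where
      open Neighbour L p basis
      σ⁻ : ∀ y → Dec (In L p y) → V n
      σ⁻ y (yes i) = proj₁ (coordinates y i)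
      σ⁻ y (no _)  = y
      left : ∀ u (i : Dec (In L p (σ u))) → σ⁻ (σ u) i ≡ u
      left u (yes i) = injective (proj₂ (coordinates (σ u) i))
      left u (no ¬i) = ⊥-elim (¬i (inside u))
      right : ∀ y (i : Dec (In L p y)) → [ i ] ≢ + 0 → σ (σ⁻ y i) ≡ y
      right y (yes i) _ = proj₂ (coordinates y i)
      right y (no _) nz = ⊥-elim (nz refl)

   private
    collect : ∀ (Ls : List (Line n)) → ¬ ¬ ∃ λ T → ∀ N → combine T (λ o → F o N) ≡ sumL Ls λ L → reps 𝔽 1≤N0 (λ y → class c y * indicator L (iso? L) y) (N⁺ N)
    collect []       none = none ([] , λ N → refl)
    collect (L ∷ Ls) none = neighbour-reps L λ (k , o , p) → collect Ls λ (T , q) → none ((k , o) ∷ T , λ N → cong₂ _+_ (p N) (q N))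

    multiples-reps : ∀ k → + k ≢ + 0 → ∀ {c'} N N' → + N ≡ + k * + k * + N' → (∀ u → Cong (+ 12) (+ k ⊙ u) c → Cong (+ 12) u c') → (∀ u → Cong (+ 12) u c' → Cong (+ 12) (+ k ⊙ u) c) →
            reps 𝔽 1≤N0 (λ y → class c y * [ cong? k y 𝟎 ]) N ≡ F (𝔽 , c') N'
    multiples-reps k k≢0 {c'} N N' N≡ ⇒ ⇐ = trans (reps-change 𝔽 1≤N0 𝔽 1≤N0 (+ k ⊙_) (λ y → divide y (cong? k y 𝟎)) (λ y → class c y * [ cong? k y 𝟎 ]) N N'
       (λ u q → cancel (cancel (trans (sym (ZP.*-assoc (+ k) (+ k) (Q u))) (trans (sym (Q-scale (+ k) u)) (trans q (trans N≡ (ZP.*-assoc (+ k) (+ k) (+ N')))))))) (λ u q → trans (Q-scale (+ k) u) (trans (cong (_*_ (+ k * + k)) q) (sym N≡)))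
       (λ u → left u (cong? k (+ k ⊙ u) 𝟎)) (λ y _ nz → right y (cong? k y 𝟎) (λ z → nz (trans (cong (_*_ (class c y)) z) (ZP.*-zeroʳ (class c y))))))
      (reps-cong 𝔽 1≤N0 {w' = class c'} N' λ u _ → trans (cong (_*_ (class c (+ k ⊙ u))) ([]-yes (cong? k (+ k ⊙ u) 𝟎) (Cong-multiple u))) (trans (ZP.*-identityʳ _)
       ([]-⇔ (cong? 12 (+ k ⊙ u) c) (cong? 12 u c') (⇒ u) (⇐ u))))
     where
     cancel : ∀ {a b} → + k * a ≡ + k * b → a ≡ b
     cancel {a} {b} = ZP.*-cancelˡ-≡ (+ k) a b {{Z.≢-nonZero k≢0}}
     divide : ∀ y → Dec (Cong (+ k) y 𝟎) → V n
     divide y (yes p) = proj₁ (Cong-0 p)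
     divide y (no _)  = y
     left : ∀ u (i : Dec (Cong (+ k) (+ k ⊙ u) 𝟎)) → divide (+ k ⊙ u) i ≡ u
     left u (yes p) = ⊙-cancel (+ k) k≢0 (sym (proj₂ (Cong-0 p)))
     left u (no ¬p) = ⊥-elim (¬p (Cong-multiple u))
     right : ∀ y (i : Dec (Cong (+ k) y 𝟎)) → [ i ] ≢ + 0 → + k ⊙ divide y i ≡ y
     right y (yes p) _ = sym (proj₂ (Cong-0 p))
     right y (no _) nz = ⊥-elim (nz refl)

    dilated : ∀ N → reps 𝔽 1≤N0 (λ y → class c y * a y) (N⁺ N) ≡ F (𝔽 , Λ ⊙ c) N
    dilated N = multiples-reps ℓ (λ ()) (N⁺ N) N (+N⁺ N) (λ u r → Cong-trans (Cong-sym (ℓ²-class u)) (Cong-trans (Cong-≡ (sym (⊙-assoc Λ Λ u))) (Cong-⊙ (Mod-refl {a = Λ}) r)))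
     (λ u r → Cong-trans (Cong-⊙ (Mod-refl {a = Λ}) r) (Cong-trans (Cong-≡ (⊙-assoc Λ Λ c)) (ℓ²-class c)))

   -- Each vector of norm ℓ²N lies in 1, t − D or t of the neighbours.
   relation : ¬ ¬ ∃ λ T → ∀ N → Mod Λ (+ N) (+ 0) → F (𝔽 , c) (N⁺ N) ≡ combine T (λ o → F o N) - D * F⁻ N
   relation none = collect (lines n) λ (T , p) → none ((+ 1 - t + D , (𝔽 , Λ ⊙ c)) ∷ T , λ N ℓ∣N → begin
     F (𝔽 , c) (N⁺ N)
      ≡⟨ reps-cong 𝔽 1≤N0 (N⁺ N) (λ y q → trans (sym (ZP.*-identityʳ (class c y))) (trans (cong (_*_ (class c y)) (sym (count N ℓ∣N y q))) (h (class c y) (multiples y) (+ 1 - t + D) (a y) D (b y)))) ⟩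
     reps 𝔽 1≤N0 (λ y → (class c y * multiples y + (+ 1 - t + D) * (class c y * a y)) + - D * (class c y * b y)) (N⁺ N)
      ≡⟨ trans (reps-+ 𝔽 1≤N0 _ _ (N⁺ N)) (cong₂ _+_ (trans (reps-+ 𝔽 1≤N0 _ _ (N⁺ N)) (cong₂ _+_ (trans (reps-cong 𝔽 1≤N0 (N⁺ N) (λ y _ → sym (sumL-*ˡ (lines n) (class c y) λ L → indicator L (iso? L) y)))
        (trans (reps-sumL 𝔽 1≤N0 (lines n) (λ L y → class c y * indicator L (iso? L) y) (N⁺ N)) (sym (p N)))) (trans (reps-*ˡ 𝔽 1≤N0 (+ 1 - t + D) _ (N⁺ N)) (cong (_*_ (+ 1 - t + D)) (dilated N))))) (reps-*ˡ 𝔽 1≤N0 (- D) _ (N⁺ N))) ⟩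
     combine T (λ o → F o N) + (+ 1 - t + D) * F (𝔽 , Λ ⊙ c) N + - D * F⁻ N
      ≡⟨ h' (combine T λ o → F o N) ((+ 1 - t + D) * F (𝔽 , Λ ⊙ c) N) D (F⁻ N) ⟩
     (+ 1 - t + D) * F (𝔽 , Λ ⊙ c) N + combine T (λ o → F o N) - D * F⁻ N ∎)
    where
    open ≡-Reasoning
    h : ∀ w m k a D b → w * (m + k * a + - D * b) ≡ (w * m + k * (w * a)) + - D * (w * b)
    h = ring
    h' : ∀ s k D f → s + k + - D * f ≡ k + s - D * f
    h' = ring

   F⁻-square : ∀ N → F⁻ (N⁺ N) ≡ F (𝔽 , c) N
   F⁻-square N = multiples-reps (ℓ N.* ℓ) (λ ()) (N⁺ (N⁺ N)) N (trans (+N⁺ (N⁺ N)) (trans (cong (_*_ ℓℓ) (+N⁺ N)) (sym (ZP.*-assoc ℓℓ ℓℓ (+ N)))))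
    (λ u → Cong-trans (Cong-sym (ℓ²-class u))) (λ u → Cong-trans (ℓ²-class u))

   F⁻-simple : ∀ N → ¬ Mod Λ (+ N) (+ 0) → F⁻ (ℓ N.* N) ≡ + 0
   F⁻-simple N nℓ = reps-0 𝔽 1≤N0 (λ y → class c y * b y) (N⁺ (ℓ N.* N)) λ y q → trans (cong (_*_ (class c y)) ([]-no (cong? (ℓ N.* ℓ) y 𝟎) λ p → nℓ (divisible q (Cong-0 p)))) (ZP.*-zeroʳ (class c y))
    where
    divisible : ∀ {y} → Q y ≡ + N⁺ (ℓ N.* N) → (∃ λ w → y ≡ ℓℓ ⊙ w) → Mod Λ (+ N) (+ 0)
    divisible q (w , refl) = mod (Q w) (trans (ZP.*-cancelˡ-≡ Λ _ _ (trans (sym (ZP.pos-* ℓ N)) (trans (cancel-ℓℓ (trans (sym (+N⁺ (ℓ N.* N))) (trans (sym q) (trans (Q-scale ℓℓ w) (ZP.*-assoc ℓℓ ℓℓ (Q w)))))) (h Λ (Q w))))) (sym (ZP.+-identityˡ _)))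
     where h : ∀ l q → l * l * q ≡ l * (q * l)
           h = ring

open EichlerRelation

-- Periodicity of invertible recurrences on a finite set

module FiniteDynamics where

 open Z using (_+_; _*_; -_; _-_)

 combine-Mod : ∀ {A : Set} {M} (T : List (ℤ × A)) {f g : A → ℤ} → (∀ o → Mod M (f o) (g o)) → Mod M (combine T f) (combine T g)
 combine-Mod T p = sumL-Mod T λ (k , o) → Mod-* {a = k} Mod-refl (p o)

 module Periodic {S : ℕ} (s : ℕ → Fin S) (det : ∀ j k → s j ≡ s k → s (suc j) ≡ s (suc k)) (back : ∀ j k → s (suc j) ≡ s (suc k) → s j ≡ s k) where

  private
   back-+ : ∀ i a b → s (i N.+ a) ≡ s (i N.+ b) → s a ≡ s b
   back-+ zero    a b p = p
   back-+ (suc i) a b p = back-+ i a b (back _ _ p)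

   det-+ : ∀ i a b → s a ≡ s b → s (i N.+ a) ≡ s (i N.+ b)
   det-+ zero    a b p = p
   det-+ (suc i) a b p = det _ _ (det-+ i a b p)

   multiples : ∀ p → s p ≡ s 0 → ∀ c → s (c N.* p) ≡ s 0
   multiples p q zero    = refl
   multiples p q (suc c) = trans (det-+ p (c N.* p) 0 (multiples p q c)) (trans (cong s (NP.+-identityʳ p)) q)

   divides-! : ∀ p → 1 N.≤ p → p N.≤ S → p ND.∣ S !
   divides-! (suc p) _ p≤S = ND.∣-trans (ND.m∣m*n (p !)) (ND.m≤n⇒m!∣n! p≤S)

  -- By pigeonhole two of the first S + 1 states agree, `back` moves the repetition to the start,
  -- and its length, at most S, divides S!. So one period fits all sequences.
  period : ∀ c → s (c N.* S !) ≡ s 0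
  period c = go (Finₚ.pigeonhole NP.≤-refl (s ∘ toℕ {suc S}))
   where
   go : (∃ λ i → ∃ λ j → i Fin.< j × s (toℕ i) ≡ s (toℕ j)) → s (c N.* S !) ≡ s 0
   go (i , j , i<j , eq) = fin (divides-! p (NP.m<n⇒0<n∸m i<j) (NP.≤-trans (NP.m∸n≤m (toℕ j) (toℕ i)) (NP.≤-pred (Finₚ.toℕ<n j))))
    where
    p : ℕ
    p = toℕ j N.∸ toℕ i
    sp : s p ≡ s 0
    sp = sym (back-+ (toℕ i) 0 p (trans (cong s (NP.+-identityʳ (toℕ i))) (trans eq (cong s (sym (NP.m+[n∸m]≡n (NP.<⇒≤ i<j)))))))
    fin : p ND.∣ S ! → s (c N.* S !) ≡ s 0
    fin (ND.divides q e!) = trans (cong s (trans (cong (c N.*_) e!) (sym (NP.*-assoc c q p)))) (multiples p sp (c N.* q))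

 -- Finiteness of the index set is what allows the double negations to be gathered into one.
 ¬¬-choice : ∀ n {P : Fin n → Set} → (∀ i → ¬ ¬ P i) → ¬ ¬ (∀ i → P i)
 ¬¬-choice zero    p none = none λ ()
 ¬¬-choice (suc n) p none = p zero λ p0 → ¬¬-choice n (p ∘ suc) λ ps → none λ { zero → p0 ; (suc i) → ps i }

 private
  funToFin-cong : ∀ {m n} {f g : Fin m → Fin n} → (∀ i → f i ≡ g i) → Fin.funToFin f ≡ Fin.funToFin g
  funToFin-cong {zero}  p = refl
  funToFin-cong {suc m} p = cong₂ Fin.combine (p zero) (funToFin-cong (p ∘ suc))

  funToFin-injective : ∀ {m n} (f g : Fin m → Fin n) → Fin.funToFin f ≡ Fin.funToFin g → ∀ i → f i ≡ g i
  funToFin-injective f g p i = trans (sym (Finₚ.finToFun-funToFin f i)) (trans (cong (λ z → Fin.finToFun z i) p) (Finₚ.finToFun-funToFin g i))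

 module Dynamics {Obj : Set} (q : ℕ) (code : Obj → Fin q) (h : ℕ) (D D⁻¹ : ℤ) (D-unit : Mod (+ suc h) (D * D⁻¹) (+ 1))
  (Rel : Obj → List (ℤ × Obj) → Set) (rel : ∀ o → ¬ ¬ ∃ (Rel o)) where

  open ResidueSystem h using (residue; residue⇒Mod; Mod⇒residue)

  H : ℤ
  H = + suc h

  -- One representative with a relation suffices for each code that occurs, since its values
  -- determine those of all objects with the same code.
  Table : Fin q → Set
  Table i = (∃ λ o → code o ≡ i × ∃ (Rel o)) ⊎ (∀ o → code o ≢ i)

  tables : ¬ ¬ (∀ i → Table i)
  tables = ¬¬-choice q λ i none → none (inj₂ λ o p → rel o λ t → none (inj₁ (o , p , t)))

  record Solution (u : ℕ → Obj → ℤ) : Set where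
   field
    compatible : ∀ j o o' → code o ≡ code o' → Mod H (u j o) (u j o')
    recurrence : ∀ j o T → Rel o T → Mod H (u (suc (suc j)) o) (combine T (u (suc j)) - D * u j o)

  states : ℕ
  states = (suc h N.^ q) N.* (suc h N.^ q)

  opaque

   period : ℕ
   period = states !

   period≥1 : 1 N.≤ period
   period≥1 = NP.1≤n! states

  module _ (tab : ∀ i → Table i) {u : ℕ → Obj → ℤ} (sol : Solution u) where
   open Solution sol

   private
    value : ∀ {i} → Table i → (Obj → ℤ) → ℤ
    value (inj₁ (o , _)) f = f o
    value (inj₂ _)       f = + 0

    residues : ℕ → Fin q → Fin (suc h)
    residues j i = residue (value (tab i) (u j))

    row : ℕ → Fin (suc h N.^ q)
    row j = Fin.funToFin (residues j)

    -- Two consecutive rows, as the recurrence has order two.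
    state : ℕ → Fin states
    state j = Fin.combine (row (suc j)) (row j)

    row⇒ : ∀ j k → row j ≡ row k → ∀ o → Mod H (u j o) (u k o)
    row⇒ j k p o = go (tab (code o)) (residue⇒Mod (funToFin-injective (residues j) (residues k) p (code o)))
     where go : (t : Table (code o)) → Mod H (value t (u j)) (value t (u k)) → Mod H (u j o) (u k o)
           go (inj₁ (o' , c , _)) r = Mod-tr (compatible j o o' (sym c)) (Mod-tr r (compatible k o' o c))
           go (inj₂ none) _ = ⊥-elim (none o refl)

    ⇒row : ∀ j k → (∀ o T → Rel o T → Mod H (u j o) (u k o)) → row j ≡ row k
    ⇒row j k p = funToFin-cong λ i → Mod⇒residue (go (tab i))
     where go : ∀ {i} (t : Table i) → Mod H (value t (u j)) (value t (u k))
           go (inj₁ (o , _ , T , r)) = p o T r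
           go (inj₂ _) = Mod-refl

    det : ∀ j k → state j ≡ state k → state (suc j) ≡ state (suc k)
    det j k p = cong₂ Fin.combine (⇒row (suc (suc j)) (suc (suc k)) λ o T r → Mod-tr (recurrence j o T r)
       (Mod-tr (Mod-+ (combine-Mod T (row⇒ (suc j) (suc k) (proj₁ eqs))) (Mod-neg (Mod-* {a = D} Mod-refl (row⇒ j k (proj₂ eqs) o)))) (Mod-sym (recurrence k o T r)))) (proj₁ eqs)
     where eqs = Finₚ.combine-injective (row (suc j)) (row j) (row (suc k)) (row k) p

    -- D is a unit modulo H, so u j is recovered from u (j + 1) and u (j + 2).
    back : ∀ j k → state (suc j) ≡ state (suc k) → state j ≡ state k
    back j k p = cong₂ Fin.combine (proj₂ eqs) (⇒row j k λ o T r → cancel (Mod-tr (≡⇒Mod (h1 (combine T (u (suc j))) (D * u j o))) (Mod-tr (Mod-+ (combine-Mod T (row⇒ (suc j) (suc k) (proj₂ eqs)))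
       (Mod-neg (Mod-tr (Mod-sym (recurrence j o T r)) (Mod-tr (row⇒ (suc (suc j)) (suc (suc k)) (proj₁ eqs) o) (recurrence k o T r))))) (≡⇒Mod (sym (h1 (combine T (u (suc k))) (D * u k o)))))))
     where
     eqs = Finₚ.combine-injective (row (suc (suc j))) (row (suc j)) (row (suc (suc k))) (row (suc k)) p
     h1 : ∀ c x → x ≡ c - (c - x)
     h1 = ring
     cancel : ∀ {a b} → Mod H (D * a) (D * b) → Mod H a b
     cancel {a} {b} r = Mod-tr (Mod-sym (one a)) (Mod-tr (Mod-* {a = D⁻¹} Mod-refl r) (one b))
      where one : ∀ x → Mod H (D⁻¹ * (D * x)) x
            one x = Mod-tr (≡⇒Mod (h2 D⁻¹ D x)) (Mod-tr (Mod-* D-unit (Mod-refl {a = x})) (≡⇒Mod (ZP.*-identityˡ x)))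
             where h2 : ∀ d D x → d * (D * x) ≡ D * d * x
                   h2 = ring

   opaque
    unfolding period

    periodic : ∀ c o → Mod H (u (c N.* period) o) (u 0 o)
    periodic c o = row⇒ (c N.* period) 0 (proj₂ (Finₚ.combine-injective (row (suc (c N.* period))) (row (c N.* period)) (row 1) (row 0) (Periodic.period state det back c))) o

 -- Forms and classes are recorded by the Gram matrix of a reduced basis and the coordinates of the class.
 module Code {N0 n : ℕ} (1≤N0 : 1 N.≤ N0) where

  private
   C : ℕ
   C = entryBound n N0
   -- Entries lie between -C and C and are therefore determined by their residues modulo 2C + 1.
   module Entry = ResidueSystem (C N.+ C)
   module Twelve = ResidueSystem 11

   iso : Form N0 (suc n) → LIso (suc n)
   iso 𝔽 = proj₁ (reduce n 1≤N0 𝔽)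

   gram : Form N0 (suc n) → Fin (suc n) → Fin (suc n) → ℤ
   gram 𝔽 i j = Form.B (pull 𝔽 (iso 𝔽)) (basis i) (basis j)

   bounded-≡ : ∀ {x y} → Z.∣ x ∣ N.≤ C → Z.∣ y ∣ N.≤ C → Mod (+ suc (C N.+ C)) x y → x ≡ y
   bounded-≡ {x} {y} p q r = ZP.i-j≡0⇒i≡j x y (ZP.∣i∣≡0⇒i≡0 (multiple-≤ Z.∣ x - y ∣ (NP.≤-trans (ZP.∣i-j∣≤∣i∣+∣j∣ x y) (NP.+-mono-≤ p q)) (Mod⇒∣ {a = x - y} (Mod-- r))))
    where multiple-≤ : ∀ z → z N.≤ C N.+ C → suc (C N.+ C) ND.∣ z → z ≡ 0
          multiple-≤ zero    _ _ = refl
          multiple-≤ (suc z) p q = ⊥-elim (NP.<⇒≱ (s≤s p) (ND.∣⇒≤ q))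

  private
   entry : Form N0 (suc n) → Fin (suc n) → Fin (suc n) → Fin (suc (C N.+ C))
   entry 𝔽 i j = Entry.residue (gram 𝔽 i j)
   row : Form N0 (suc n) → Fin (suc n) → Fin (suc (C N.+ C) N.^ suc n)
   row 𝔽 i = Fin.funToFin (entry 𝔽 i)
   coord : Form N0 (suc n) → V (suc n) → Fin (suc n) → Fin 12
   coord 𝔽 c i = Twelve.residue (Vec.lookup (from (iso 𝔽) c) i)

  opaque

   codes : ℕ
   codes = ((suc (C N.+ C) N.^ suc n) N.^ suc n) N.* 12 N.^ suc n

   code : Form N0 (suc n) × V (suc n) → Fin codes
   code (𝔽 , c) = Fin.combine (Fin.funToFin (row 𝔽)) (Fin.funToFin (coord 𝔽 c))

  theta : Form N0 (suc n) × V (suc n) → ℕ → ℤ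
  theta (𝔽 , c) N = reps 𝔽 1≤N0 (λ y → [ cong? 12 y c ]) N

  private
   reduced-theta : ∀ 𝔽 c N → theta (𝔽 , c) N ≡ theta (pull 𝔽 (iso 𝔽) , from (iso 𝔽) c) N
   reduced-theta 𝔽 c N = trans (reps-change 𝔽 1≤N0 (pull 𝔽 h) 1≤N0 (to h) (from h) (λ y → [ cong? 12 y c ]) N N (λ u p → p) (λ u p → p) (from-to h) (λ y _ _ → to-from h y))
     (reps-cong (pull 𝔽 h) 1≤N0 N λ u _ → []-⇔ (cong? 12 (to h u) c) (cong? 12 u (from h c)) (λ p → Cong-trans (Cong-≡ (sym (from-to h u))) (Cong-map (from-linear h) p))
      (λ p → Cong-trans (Cong-map (to-linear h) p) (Cong-≡ (to-from h c))))
    where h = iso 𝔽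

  opaque
   unfolding code

   -- Equal codes give equal Gram matrices in reduced coordinates, hence by bilinearity the same
   -- form, and classes congruent modulo 12.
   code-theta : ∀ o o' → code o ≡ code o' → ∀ N → theta o N ≡ theta o' N
   code-theta (𝔽 , c) (𝔽' , c') p N = trans (reduced-theta 𝔽 c N) (trans (trans (reps-change (pull 𝔽 (iso 𝔽)) 1≤N0 (pull 𝔽' (iso 𝔽')) 1≤N0 (λ u → u) (λ u → u) (λ y → [ cong? 12 y (from (iso 𝔽) c) ]) N N
      (λ u q → trans (sym (same u u)) q) (λ u q → trans (same u u) q) (λ _ → refl) (λ _ _ _ → refl))
     (reps-cong (pull 𝔽' (iso 𝔽')) 1≤N0 N λ y _ → []-⇔ (cong? 12 y (from (iso 𝔽) c)) (cong? 12 y (from (iso 𝔽') c')) (λ r → Cong-trans r classes) (λ r → Cong-trans r (Cong-sym classes))))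
     (sym (reduced-theta 𝔽' c' N)))
    where
    parts : Fin.funToFin (row 𝔽) ≡ Fin.funToFin (row 𝔽') × Fin.funToFin (coord 𝔽 c) ≡ Fin.funToFin (coord 𝔽' c')
    parts = Finₚ.combine-injective (Fin.funToFin (row 𝔽)) (Fin.funToFin (coord 𝔽 c)) (Fin.funToFin (row 𝔽')) (Fin.funToFin (coord 𝔽' c')) p
    entries : ∀ i j → gram 𝔽 i j ≡ gram 𝔽' i j
    entries i j = bounded-≡ (proj₂ (proj₂ (reduce n 1≤N0 𝔽)) i j) (proj₂ (proj₂ (reduce n 1≤N0 𝔽')) i j) (Entry.residue⇒Mod (funToFin-injective (entry 𝔽 i) (entry 𝔽' i) (funToFin-injective (row 𝔽) (row 𝔽') (proj₁ parts) i) j))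
    classes : Cong (+ 12) (from (iso 𝔽) c) (from (iso 𝔽') c')
    classes = Cong-lookup λ i → Twelve.residue⇒Mod (funToFin-injective (coord 𝔽 c) (coord 𝔽' c') (proj₂ parts) i)
    same : ∀ u v → Form.B (pull 𝔽 (iso 𝔽)) u v ≡ Form.B (pull 𝔽' (iso 𝔽')) u v
    same u v = linear-ext (Form.linear (pull 𝔽 (iso 𝔽)) v) (Form.linear (pull 𝔽' (iso 𝔽')) v) (λ i → linear-ext (Form.linearʳ (pull 𝔽 (iso 𝔽)) (basis i)) (Form.linearʳ (pull 𝔽' (iso 𝔽')) (basis i)) (entries i) v) u

open FiniteDynamics

-- Powers of η times modular forms as combinations of theta series

module ThetaRepresentation where

 open Z using (_+_; _*_; -_; _-_)

 open E using ()

 coef : Bool → ℕ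
 coef true  = 1
 coef false = 6

 coef-≥1 : ∀ b → 1 N.≤ coef b
 coef-≥1 true  = s≤s z≤n
 coef-≥1 false = s≤s z≤n

 norm : ∀ {n} → Vec Bool n → V n → ℕ
 norm []       v = 0
 norm (b ∷ bs) v = e1 (coef b) (Vec.head v ∷ []) N.+ norm bs (Vec.tail v)

 norm-proper : ∀ {n} (bs : Vec Bool n) → Proper (norm bs)
 norm-proper []       []      = []
 norm-proper (b ∷ bs) (x ∷ v) with e1-proper (coef-≥1 b) (x ∷ [])
 ... | p ∷ [] = NP.≤-trans p (NP.m≤m+n _ _) ∷ InBox-mono (NP.m≤n+m _ _) (norm-proper bs v)

 opaque

  -- The coefficient 1 belongs to factors η and 6 to factors X or Y. Both divide 6, so 6 times any
  -- functional is represented by an integral vector.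
  diag : ∀ {n} → Vec Bool n → Form 6 n
  diag [] = record { B = λ _ _ → + 0 ; linear = λ _ → record { add = λ _ _ → refl ; scale = λ c _ → sym (ZP.*-zeroʳ c) } ; symm = λ _ _ → refl ; nonneg = λ _ → Z.+≤+ z≤n
   ; dual = λ φ p → [] , λ { [] → sym (trans (cong (_*_ (+ 6)) (linear-0 p)) refl) } }
  diag {suc n} (b ∷ bs) = record
   { B = B ; linear = λ z → record { add = λ { (x ∷ u) (y ∷ v) → trans (cong (_+_ (+ coef b * (x + y) * Vec.head z)) (add (R.linear (Vec.tail z)) u v)) (r1 (+ coef b) x y (Vec.head z) _ _) }
                   ; scale = λ { c (x ∷ u) → trans (cong (_+_ (+ coef b * (c * x) * Vec.head z)) (scale (R.linear (Vec.tail z)) c u)) (r2 (+ coef b) c x (Vec.head z) _) } }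
   ; symm = λ x y → cong₂ _+_ (r3 (+ coef b) (Vec.head x) (Vec.head y)) (R.symm _ _)
   ; nonneg = λ x → ZP.+-mono-≤ (subst (+ 0 Z.≤_) (square b (Vec.head x)) (Z.+≤+ z≤n)) (R.nonneg _)
   ; dual = λ φ p → + coef (not b) * φ (basis zero) ∷ proj₁ (R.dual (φ ∘ (+ 0 ∷_)) (linear-∘ p 0∷-linear)) , λ { (y ∷ v) → trans
     (cong₂ _+_ (trans (r4 (+ coef b) (+ coef (not b)) (φ (basis zero)) y) (cong (_* (y * φ (basis zero))) (coef-not b))) (proj₂ (R.dual (φ ∘ (+ 0 ∷_)) (linear-∘ p 0∷-linear)) v))
     (trans (sym (ZP.*-distribˡ-+ (+ 6) (y * φ (basis zero)) (φ (+ 0 ∷ v)))) (cong (_*_ (+ 6)) (sym (trans (cong φ (cons-split y v)) (trans (add p _ _) (cong (_+ φ (+ 0 ∷ v)) (scale p y _))))))) } }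
   where
   module R = Form (diag bs)
   B : V (suc n) → V (suc n) → ℤ
   B x y = + coef b * Vec.head x * Vec.head y + R.B (Vec.tail x) (Vec.tail y)
   r1 : ∀ c x y z a b → c * (x + y) * z + (a + b) ≡ (c * x * z + a) + (c * y * z + b)
   r1 = ring
   r2 : ∀ b c x z a → b * (c * x) * z + c * a ≡ c * (b * x * z + a)
   r2 = ring
   r3 : ∀ b x y → b * x * y ≡ b * y * x
   r3 = ring
   r4 : ∀ b c f y → b * (c * f) * y ≡ b * c * (y * f)
   r4 = ring
   square : ∀ b x → + (coef b N.* sq x) ≡ + coef b * x * x
   square b x = trans (ZP.pos-* (coef b) (sq x)) (trans (cong (_*_ (+ coef b)) (+sq x)) (sym (ZP.*-assoc (+ coef b) x x)))
   coef-not : ∀ b → + coef b * + coef (not b) ≡ + 6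
   coef-not true  = refl
   coef-not false = refl

  diag-Q : ∀ {n} (bs : Vec Bool n) v → Form.Q (diag bs) v ≡ + norm bs v
  diag-Q []       v = refl
  diag-Q (b ∷ bs) v = cong₂ _+_ (trans (ZP.*-assoc (+ coef b) (Vec.head v) (Vec.head v)) (trans (cong (_*_ (+ coef b)) (sym (+sq (Vec.head v)))) (sym (ZP.pos-* (coef b) (sq (Vec.head v)))))) (diag-Q bs (Vec.tail v))

 Periodic12 : ∀ {n} → (V n → ℤ) → Set
 Periodic12 w = ∀ {u v} → Cong (+ 12) u v → w u ≡ w v

 record Theta {n} (bs : Vec Bool n) (f : Ser) : Set where
  constructor theta-series
  field
   weight   : V n → ℤ
   periodic : Periodic12 weight
   series   : f ≋ θ n (norm bs) weight

 module _ {n} {bs : Vec Bool n} where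

  Theta-≋ : ∀ {f g} → f ≋ g → Theta bs f → Theta bs g
  Theta-≋ p (theta-series w per q) = theta-series w per (E.tr (E.sm p) q)

  Theta-⊕ : ∀ {f g} → Theta bs f → Theta bs g → Theta bs (f ⊕ g)
  Theta-⊕ (theta-series w per q) (theta-series w' per' q') = theta-series (λ v → w v + w' v) (λ p → cong₂ _+_ (per p) (per' p)) (E.tr (E.+c q q') (E.sm (θ-⊕ n (norm bs) w w')))

  Theta-scale : ∀ c {f} → Theta bs f → Theta bs (const c · f)
  Theta-scale c (theta-series w per q) = theta-series (λ v → c * w v) (λ p → cong (_*_ c) (per p)) (E.tr (E.*c E.rfl q) (≡⇒≋ λ N → trans (const-·-≡ c (θ n (norm bs) w) N)
    (trans (sym (sumL-*ˡ (box n N) c λ v → [ norm bs v N.≟ N ] * w v)) (sumL-cong (box n N) λ v → h c [ norm bs v N.≟ N ] (w v)))))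
   where h : ∀ c a b → c * (a * b) ≡ a * (c * b)
         h = ring

  Theta-0 : Theta bs (const (+ 0))
  Theta-0 = theta-series (λ _ → + 0) (λ _ → refl) (≡⇒≋ λ N → trans (z N) (sym (sumL-0 (box n N) λ v → ZP.*-zeroʳ [ norm bs v N.≟ N ])))
   where z : ∀ N → const (+ 0) N ≡ + 0
         z zero    = refl
         z (suc N) = refl

  Theta-th : ∀ b {w₀ : ℤ → ℤ} → (∀ {x y} → Mod (+ 12) x y → w₀ x ≡ w₀ y) → ∀ {f} → Theta bs f → Theta (b ∷ bs) (th (coef b) w₀ · f)
  Theta-th b {w₀} per0 (theta-series w per q) = theta-series (λ v → w₀ (Vec.head v) * w (Vec.tail v)) (λ { {_ ∷ _} {_ ∷ _} p → cong₂ _*_ (per0 (Cong-head p)) (per (Cong-tail p)) })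
   (E.tr (E.*c E.rfl q) (θ-· n (e1-proper (coef-≥1 b)) (norm-proper bs) (w₀ ∘ Vec.head) w))

 ev-periodic : ∀ {x y} → Mod (+ 12) x y → ev x ≡ ev y
 ev-periodic {x} {y} (mod k p) = trans (cong ev (trans p (r1 y k))) (trans (ev-diff (y + + 6 * k) (+ 6 * k)) (cong ev (r2 y k)))
  where r1 : ∀ y k → y + k * + 12 ≡ (y + + 6 * k) + + 6 * k
        r1 = ring
        r2 : ∀ y k → (y + + 6 * k) - + 6 * k ≡ y
        r2 = ring

 χ-periodic : ∀ {x y} → Mod (+ 12) x y → χ x ≡ χ y
 χ-periodic {x} {y} p = trans (χ-% x) (trans (cong χt (ResidueSystem.%-cong 11 p)) (sym (χ-% y)))
  where
  reflect : ∀ (i : Fin 12) → χt (toℕ i) ≡ χt ((12 N.∸ toℕ i) NM.% 12)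
  reflect = from-yes dec
   where dec : Dec (∀ (i : Fin 12) → χt (toℕ i) ≡ χt ((12 N.∸ toℕ i) NM.% 12))
         dec = Finₚ.all? λ i → χt (toℕ i) Z.≟ χt ((12 N.∸ toℕ i) NM.% 12)
  χ-% : ∀ z → χ z ≡ χt (z ZM.%ℕ 12)
  χ-% (+ n) = refl
  χ-% -[1+ n ] = trans (trans (cong χt (sym (Finₚ.toℕ-fromℕ< r<))) (reflect (Fin.fromℕ< r<))) (trans (cong (λ k → χt ((12 N.∸ k) NM.% 12)) (Finₚ.toℕ-fromℕ< r<)) (cong χt
    (trans (ResidueSystem.small-≡ 11 (NM.m%n<n (12 N.∸ r) 12) (ZM.n%ℕd<d -[1+ n ] 12) (Mod-tr (Mod-sym (ResidueSystem.%-Mod 11 (+ (12 N.∸ r)))) (Mod-tr negate (ResidueSystem.%-Mod 11 -[1+ n ])))) refl)))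
   where
   r : ℕ
   r = suc n NM.% 12
   r< : r N.< 12
   r< = NM.m%n<n (suc n) 12
   negate : Mod (+ 12) (+ (12 N.∸ r)) -[1+ n ]
   negate = Mod-tr (≡⇒Mod (sym (trans (ZP.[+m]-[+n]≡m⊖n 12 r) (ZP.⊖-≥ (NP.<⇒≤ r<))))) (Mod-tr (Mod-+ {b = + 0} (mod (+ 1) refl) (Mod-neg (Mod-sym (ResidueSystem.%-Mod 11 (+ suc n))))) (≡⇒Mod (ZP.+-identityˡ -[1+ n ])))

 sixes : ∀ {n} k → Vec Bool n → Vec Bool (k N.+ n)
 sixes zero    bs = bs
 sixes (suc k) bs = false ∷ sixes k bs

 module _ {n} {bs : Vec Bool n} {f : Ser} where

  private
   mX : ∀ {n} {bs : Vec Bool n} {f} → Theta bs f → Theta (false ∷ bs) (X · f)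
   mX p = Theta-≋ (E.*c (E.sm (≡⇒≋ X-th)) E.rfl) (Theta-th false {ev} ev-periodic p)

   mY : ∀ {n} {bs : Vec Bool n} {f} → Theta bs f → Theta (false ∷ bs) (Y · f)
   mY p = Theta-≋ (E.*c (E.sm (≡⇒≋ Y-th)) E.rfl) (Theta-th false {od} (λ q → cong (λ z → + 1 - z) (ev-periodic q)) p)

   X⁴ Y⁴ : Ser
   X⁴ = X ↑ 4
   Y⁴ = Y ↑ 4

   mX⁴ : ∀ {n} {bs : Vec Bool n} {f} → Theta bs f → Theta (sixes 4 bs) (X⁴ · f)
   mX⁴ {f = f} p = Theta-≋ (E.solve 2 (λ x f → x E.:* (x E.:* (x E.:* (x E.:* f))) E.:= x E.:^ 4 E.:* f) E.rfl X f) (mX (mX (mX (mX p))))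

   mY⁴ : ∀ {n} {bs : Vec Bool n} {f} → Theta bs f → Theta (sixes 4 bs) (Y⁴ · f)
   mY⁴ {f = f} p = Theta-≋ (E.solve 2 (λ x f → x E.:* (x E.:* (x E.:* (x E.:* f))) E.:= x E.:^ 4 E.:* f) E.rfl Y f) (mY (mY (mY (mY p))))

  Theta-E4 : Theta bs f → Theta (sixes 8 bs) (E4 · f)
  Theta-E4 p = Theta-≋ (E.tr (E.solve 3 (λ x y f → x E.:* (x E.:* f) E.:+ E.con (+ 14) E.:* (x E.:* (y E.:* f)) E.:+ y E.:* (y E.:* f)
    E.:= (x E.:^ 2 E.:+ E.con (+ 14) E.:* (x E.:* y) E.:+ y E.:^ 2) E.:* f) E.rfl X⁴ Y⁴ f) (E.*c (E.sm E4-def) E.rfl))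
   (Theta-⊕ (Theta-⊕ (mX⁴ (mX⁴ p)) (Theta-scale (+ 14) (mX⁴ (mY⁴ p)))) (mY⁴ (mY⁴ p)))

  Theta-E6 : Theta bs f → Theta (sixes 12 bs) (E6 · f)
  Theta-E6 p = Theta-≋ (E.tr (E.solve 3 (λ x y f → x E.:* (x E.:* (x E.:* f)) E.:+ E.con (- + 33) E.:* (x E.:* (x E.:* (y E.:* f))) E.:+ E.con (- + 33) E.:* (x E.:* (y E.:* (y E.:* f))) E.:+ y E.:* (y E.:* (y E.:* f))
    E.:= (x E.:^ 3 E.:- E.con (+ 33) E.:* (x E.:^ 2 E.:* y) E.:- E.con (+ 33) E.:* (x E.:* y E.:^ 2) E.:+ y E.:^ 3) E.:* f) E.rfl X⁴ Y⁴ f) (E.*c (E.sm E6-def) E.rfl))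
   (Theta-⊕ (Theta-⊕ (Theta-⊕ (mX⁴ (mX⁴ (mX⁴ p))) (Theta-scale (- + 33) (mX⁴ (mX⁴ (mY⁴ p))))) (Theta-scale (- + 33) (mX⁴ (mY⁴ (mY⁴ p))))) (mY⁴ (mY⁴ (mY⁴ p))))

 -- E4 has degree 8 and E6 degree 12 in X and Y, so half-weight v always costs 4v variables; the
 -- terms of an isobaric sum therefore share one quadratic form.
 Theta-iso : ∀ {v f} → Iso v f → ∀ {n} {bs : Vec Bool n} {g} → Theta bs g → Theta (sixes (v N.* 4) bs) (f · g)
 Theta-iso (iso-const c) q = Theta-scale c q
 Theta-iso iso-0         q = Theta-≋ (E.sm (E.zeroˡ _)) Theta-0
 Theta-iso (iso-⊕ p p')  q = Theta-≋ (E.sm (E.distribʳ _ _ _)) (Theta-⊕ (Theta-iso p q) (Theta-iso p' q))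
 Theta-iso (iso-E4 p)    q = Theta-≋ (E.sm (E.*-assoc _ _ _)) (Theta-E4 (Theta-iso p q))
 Theta-iso (iso-E6 p)    q = Theta-≋ (E.sm (E.*-assoc _ _ _)) (Theta-E6 (Theta-iso p q))
 Theta-iso (iso-≋ r p)   q = Theta-≋ (E.*c r E.rfl) (Theta-iso p q)

 -- The power of 2 comes from θ = 2η in each factor; it is a unit modulo m^k and will be cancelled.
 Theta-η : ∀ s → Theta (Vec.replicate s true) (const ((+ 2) Z.^ s) · η ↑ s)
 Theta-η zero    = theta-series (λ _ → + 1) (λ _ → refl) (≡⇒≋ λ N → trans (SMod-0⇒≡ (E.*-identityˡ (const (+ 1))) N) (one N))
  where one : ∀ N → const (+ 1) N ≡ [ 0 N.≟ N ] * + 1 + + 0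
        one zero    = refl
        one (suc N) = refl
 Theta-η (suc s) = Theta-≋ (E.tr (E.*c θη≋2η E.rfl) (E.tr (E.solve 4 (λ a h b y → a E.:* h E.:* (b E.:* y) E.:= (a E.:* b) E.:* (h E.:* y)) E.rfl (const (+ 2)) η (const ((+ 2) Z.^ s)) (η ↑ s))
   (E.*c (E.sm (const-* (+ 2) ((+ 2) Z.^ s))) E.rfl))) (Theta-th true {χ} χ-periodic (Theta-η s))

 -- A weight of period 12 is a combination of indicators of classes modulo 12, which is how the
 -- objects `(𝔽 , c)` arise.
 Theta-classes : ∀ {n} (bs : Vec Bool n) {w} → Periodic12 w → ∀ N → θ n (norm bs) w N ≡ sumL (ResidueSystem.all 11 n) λ c → w c * reps (diag bs) (s≤s z≤n) (λ y → [ cong? 12 y c ]) N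
 Theta-classes {n} bs {w} per N = trans (box-extend n _ (λ v nz → inb v ([]*-≢0 (norm bs v N.≟ N) nz)) (λ v nz → in-bound (diag bs) (s≤s z≤n) (trans (diag-Q bs v) (cong +_ ([]*-≢0 (norm bs v N.≟ N) nz)))))
  (trans (sumL-cong (box n (bound (diag bs) (s≤s z≤n) N)) λ v → cong₂ _*_ ([]-⇔ (norm bs v N.≟ N) (Form.Q (diag bs) v Z.≟ + N) (λ p → trans (diag-Q bs v) (cong +_ p)) (λ p → ZP.+-injective (trans (sym (diag-Q bs v)) p))) (expand v))
  (trans (reps-sumL (diag bs) (s≤s z≤n) classes (λ c y → w c * [ cong? 12 y c ]) N) (sumL-cong classes λ c → reps-*ˡ (diag bs) (s≤s z≤n) (w c) (λ y → [ cong? 12 y c ]) N)))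
  where
  classes : List (V n)
  classes = ResidueSystem.all 11 n
  inb : ∀ v {N} → norm bs v ≡ N → InBox N v
  inb v refl = norm-proper bs v
  expand : ∀ v → w v ≡ sumL classes λ c → w c * [ cong? 12 v c ]
  expand v = sym (trans (sumL-cong classes λ c → trans (ZP.*-comm (w c) _) (trans (cong (_* w c) ([]-⇔ (cong? 12 v c) (cong? 12 c v) Cong-sym Cong-sym)) ([]-cong-* (cong? 12 c v) per)))
   (trans (sumL-*ʳ classes (w v) λ c → [ cong? 12 c v ]) (trans (cong (_* w v) (ResidueSystem.all-unique 11 v)) (ZP.*-identityˡ (w v)))))

 Theta-combination : ∀ {n} {bs : Vec Bool n} {f} → Theta bs f → ∃ λ (T : List (ℤ × (Form 6 n × V n))) → ∀ N → f N ≡ combine T λ (𝔽 , c) → reps 𝔽 (s≤s z≤n) (λ y → [ cong? 12 y c ]) N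
 Theta-combination {n} {bs} (theta-series w per p) = List.map (λ c → w c , diag bs , c) (ResidueSystem.all 11 n) , λ N → trans (SMod-0⇒≡ p N)
  (trans (Theta-classes bs per N) (sym (sumL-map (λ c → w c , diag bs , c) (ResidueSystem.all 11 n) λ (k , (𝔽 , c)) → k * reps 𝔽 (s≤s z≤n) (λ y → [ cong? 12 y c ]) N)))

open ThetaRepresentation

-- Congruences along the powers of ℓ

module HeckePeriodicity where

 open Z using (_+_; _*_; -_; _-_)

 prime-≡ : ∀ {p q} → Prime p → Prime q → p ND.∣ q → p ≡ q
 prime-≡ {p} pp pq p∣q with Prime.prime⇒irreducible pq p∣q
 ... | inj₁ refl = ⊥-elim (Prime.¬prime[1] pp)
 ... | inj₂ p≡q = p≡q

 -- The interface between the two halves of the proof: κ G is a combination of theta series, and G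
 -- takes the partition values at multiples of the modulus m^k, written as `suc h`. Dℓ is ℓ to the
 -- number of variables minus 2.
 record HeckeData (l h r : ℕ) : Set where
  field
   {n}         : ℕ
   Dℓ Dℓ⁻¹ κ   : ℤ
   Dℓ≡         : + suc l * + suc l * Dℓ ≡ (+ suc l) Z.^ suc n
   Dℓ-unit     : Mod (+ suc h) (Dℓ * Dℓ⁻¹) (+ 1)
   κ-cancel    : ∀ {a b} → Mod (+ suc h) (κ * a) (κ * b) → Mod (+ suc h) a b
   G           : ℕ → ℤ
   T0          : List (ℤ × (Form 6 (suc n) × V (suc n)))
   G-expansion : ∀ N → κ * G N ≡ combine T0 λ (𝔽 , c) → reps 𝔽 (s≤s z≤n) (λ y → [ cong? 12 y c ]) N
   G-partition : ∀ x → Mod (+ suc h) (G (suc h N.* x)) (+ pr24 r (suc h N.* x N.+ r))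

 module Hecke (l : ℕ) (prℓ : Prime (suc l)) (na2 : ¬ Mod (+ suc l) (+ 2) (+ 0)) (na6 : ¬ Mod (+ suc l) (+ 6) (+ 0)) (ℓ²≡1 : Mod (+ 12) (+ suc l * + suc l) (+ 1))
  (h r : ℕ) (ℓ∤M : ¬ Mod (+ suc l) (+ suc h) (+ 0)) (𝔻 : HeckeData l h r) where

  open HeckeData 𝔻

  private
   ℓ M : ℕ
   ℓ = suc l
   M = suc h

   open Eichler l prℓ na2 ℓ²≡1 {6} {suc n} (s≤s z≤n) na6 Dℓ Dℓ≡
   open Code {6} {n} (s≤s z≤n)

   Rel : Obj → List (ℤ × Obj) → Set
   Rel (𝔽 , c) T = ∀ N → Mod (+ ℓ) (+ N) (+ 0) → F (𝔽 , c) (N⁺ 𝔽 c N) ≡ combine T (λ o → F o N) - Dℓ * F⁻ 𝔽 c N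

   open Dynamics codes code h Dℓ Dℓ⁻¹ Dℓ-unit Rel (λ (𝔽 , c) → relation 𝔽 c)

   iterate : ℕ → ℕ → ℕ
   iterate zero    N = N
   iterate (suc j) N = ℓ N.* ℓ N.* iterate j N

   iterate-^ : ∀ j N → iterate j N ≡ ℓ N.^ (2 N.* j) N.* N
   iterate-^ zero    N = sym (NP.+-identityʳ N)
   iterate-^ (suc j) N = trans (cong (ℓ N.* ℓ N.*_) (iterate-^ j N)) (trans (a ℓ (ℓ N.^ (2 N.* j)) N) (cong (λ e → ℓ N.^ e N.* N) (sym (NP.*-suc 2 j))))
    where a : ∀ l p N → l N.* l N.* (p N.* N) ≡ l N.* (l N.* p) N.* N
          a = ringN

   ℓ∣ : ∀ x → Mod (+ ℓ) (+ (ℓ N.* x)) (+ 0)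
   ℓ∣ x = Mod-tr (≡⇒Mod (trans (ZP.pos-* ℓ x) (ZP.*-comm (+ ℓ) (+ x)))) (Mod-multiple (+ x))

   ℓ²∣ : ∀ x → Mod (+ ℓ) (+ (ℓ N.* ℓ N.* x)) (+ 0)
   ℓ²∣ x = subst (λ y → Mod (+ ℓ) (+ y) (+ 0)) (sym (NP.*-assoc ℓ ℓ x)) (ℓ∣ (ℓ N.* x))

   exact-step : ∀ {a b c} (T : List (ℤ × Obj)) {f : Obj → ℤ} → a ≡ combine T f - Dℓ * b → b ≡ c → Mod (+ suc h) a (combine T f - Dℓ * c)
   exact-step T p refl = ≡⇒Mod p

   -- The relation at ℓ^(2j+2) N, which ℓ divides, becomes a recurrence of order two because F⁻
   -- there is F at ℓ^(2j) N.
   along : ∀ N → Solution (λ j o → F o (iterate j N))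
   along N = record { compatible = λ j o o' p → ≡⇒Mod (code-theta o o' p (iterate j N))
    ; recurrence = λ j (𝔽 , c) T rel → exact-step T (rel (iterate (suc j) N) (ℓ²∣ (iterate j N))) (F⁻-square 𝔽 c (iterate j N)) }

   -- For N prime to ℓ the sequence F(ℓ^(2j−1) N) satisfies the recurrence from j = 0 on, with first term 0.
   odd-powers : ℕ → ℕ → Obj → ℤ
   odd-powers N zero    o = + 0
   odd-powers N (suc j) o = F o (iterate j (ℓ N.* N))

   odd : ∀ N → ¬ Mod (+ ℓ) (+ N) (+ 0) → Solution (odd-powers N)
   odd N nℓ = record { compatible = com ; recurrence = rec }
    where
    com : ∀ j o o' → code o ≡ code o' → Mod (+ suc h) (odd-powers N j o) (odd-powers N j o')
    com zero    o o' p = Mod-refl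
    com (suc j) o o' p = ≡⇒Mod (code-theta o o' p (iterate j (ℓ N.* N)))
    rec : ∀ j o T → Rel o T → Mod (+ suc h) (odd-powers N (suc (suc j)) o) (combine T (odd-powers N (suc j)) - Dℓ * odd-powers N j o)
    rec zero    (𝔽 , c) T rel = exact-step T (rel (ℓ N.* N) (ℓ∣ N)) (F⁻-simple 𝔽 c N nℓ)
    rec (suc j) o T rel = Solution.recurrence (along (ℓ N.* N)) j o T rel

   -- A congruence is decidable, hence may be derived from the doubly negated existence of the
   -- tables.
   stable : ∀ a b → ((∀ i → Table i) → Mod (+ M) a b) → Mod (+ M) a b
   stable a b f = decidable-stable (mod? M a b) λ none → tables λ tab → none (f tab)

   G-periodic : ∀ N → Mod (+ M) (G (iterate period N)) (G N)
   G-periodic N = stable (G (iterate period N)) (G N) λ tab → κ-cancel {G (iterate period N)} {G N} (Mod-tr (≡⇒Mod (G-expansion (iterate period N)))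
    (Mod-tr (combine-Mod T0 λ o → subst (λ t → Mod (+ M) (F o (iterate t N)) (F o N)) (NP.*-identityˡ period) (periodic tab (along N) 1 o)) (≡⇒Mod (sym (G-expansion N)))))

   G-vanishes : ∀ N → ¬ Mod (+ ℓ) (+ N) (+ 0) → ∀ μ j → μ N.* period ≡ suc j → Mod (+ M) (G (iterate j (ℓ N.* N))) (+ 0)
   G-vanishes N nℓ μ j eq = stable (G N') (+ 0) λ tab → κ-cancel {G N'} {+ 0} (Mod-tr (≡⇒Mod (G-expansion N'))
     (Mod-tr (combine-Mod T0 λ o → subst (λ t → Mod (+ M) (odd-powers N t o) (+ 0)) eq (periodic tab (odd N nℓ) μ o))
      (≡⇒Mod (trans (sumL-0 T0 λ (k , o) → ZP.*-zeroʳ k) (sym (ZP.*-zeroʳ (κ)))))))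
    where
    N' : ℕ
    N' = iterate j (ℓ N.* N)

  exponent : ℕ
  exponent = period

  exponent≥1 : 1 N.≤ exponent
  exponent≥1 = period≥1

  vanishing : ∀ μ x → 1 N.≤ μ → Coprime.Coprime x ℓ → M ND.∣ pr24 r (M N.* ℓ N.^ (2 N.* μ N.* period N.∸ 1) N.* x N.+ r)
  vanishing μ x 1≤μ cop = Mod⇒∣ {a = + pr24 r (M N.* ℓ N.^ (2 N.* μ N.* period N.∸ 1) N.* x N.+ r)}
    (subst (λ y → Mod (+ M) (+ pr24 r (y N.+ r)) (+ 0)) (sym (NP.*-assoc M (ℓ N.^ (2 N.* μ N.* period N.∸ 1)) x))
     (Mod-tr (Mod-sym (G-partition (ℓ N.^ (2 N.* μ N.* period N.∸ 1) N.* x))) (subst (λ y → Mod (+ M) (G y) (+ 0)) index (G-vanishes N nℓ μ j eq))))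
   where
   N j : ℕ
   N = M N.* x
   -- The exponent 2μK - 1 is 2j + 1 with j = μK - 1, so the value belongs to the term of index μK
   -- of `odd-powers`, where the sequence returns to its initial 0.
   j = N.pred (μ N.* period)
   eq : μ N.* period ≡ suc j
   eq = sym (NP.suc-pred (μ N.* period) {{N.>-nonZero (NP.*-mono-≤ 1≤μ period≥1)}})
   nℓ : ¬ Mod (+ ℓ) (+ N) (+ 0)
   nℓ p = cases (euclid prℓ {+ M} {+ x} (subst (λ z → Mod (+ ℓ) z (+ 0)) (ZP.pos-* M x) p))
    where
    cases : Mod (+ ℓ) (+ M) (+ 0) ⊎ Mod (+ ℓ) (+ x) (+ 0) → ⊥
    cases (inj₁ q) = ℓ∤M q
    cases (inj₂ q) = Prime.¬prime[1] (subst Prime (cop (Mod⇒∣ {a = + x} q , ND.∣-refl)) prℓ)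
   index : iterate j (ℓ N.* N) ≡ M N.* (ℓ N.^ (2 N.* μ N.* period N.∸ 1) N.* x)
   index = trans (iterate-^ j (ℓ N.* N)) (trans (a (ℓ N.^ (2 N.* j)) ℓ (M) x) (cong (λ e → M N.* (ℓ N.^ e N.* x)) (sym (trans (cong (N._∸ 1) (trans (NP.*-assoc 2 μ period) (trans (cong (2 N.*_) eq) (NP.*-suc 2 j)))) refl))))
    where a : ∀ p l q x → p N.* (l N.* (q N.* x)) ≡ q N.* (l N.* p N.* x)
          a = ringN

  periodicity : ∀ i x → pr24 r (M N.* ℓ N.^ i N.* x N.+ r) ≡ pr24 r (M N.* ℓ N.^ (2 N.* period N.+ i) N.* x N.+ r) [mod M ]
  periodicity i x = Mod⇒∣ {a = + A - + B} (Mod-- (Mod-tr (Mod-sym (value i)) (Mod-tr (Mod-sym (G-periodic (M N.* (ℓ N.^ i N.* x))))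
    (subst (λ y → Mod (+ M) (G y) (+ B)) index (value (2 N.* period N.+ i))))))
   where
   A B : ℕ
   A = pr24 r (M N.* ℓ N.^ i N.* x N.+ r)
   B = pr24 r (M N.* ℓ N.^ (2 N.* period N.+ i) N.* x N.+ r)
   value : ∀ i → Mod (+ M) (G (M N.* (ℓ N.^ i N.* x))) (+ pr24 r (M N.* ℓ N.^ i N.* x N.+ r))
   value i = subst (λ y → Mod (+ M) (G (M N.* (ℓ N.^ i N.* x))) (+ pr24 r (y N.+ r))) (sym (NP.*-assoc (M) (ℓ N.^ i) x)) (G-partition (ℓ N.^ i N.* x))
   index : M N.* (ℓ N.^ (2 N.* period N.+ i) N.* x) ≡ iterate period (M N.* (ℓ N.^ i N.* x))
   index = trans (cong (λ z → M N.* (z N.* x)) (NP.^-distribˡ-+-* ℓ (2 N.* period) i)) (trans (a (M) (ℓ N.^ (2 N.* period)) (ℓ N.^ i) x) (sym (iterate-^ period _)))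
    where a : ∀ q p e x → q N.* (p N.* e N.* x) ≡ p N.* (q N.* (e N.* x))
          a = ringN

 module Prime24 {ℓ : ℕ} (prℓ : Prime ℓ) (ℓ≢2 : ℓ ≢ 2) (ℓ≢3 : ℓ ≢ 3) where

  private
   prime2 : Prime 2
   prime2 = from-yes (Prime.prime? 2)

   prime3 : Prime 3
   prime3 = from-yes (Prime.prime? 3)

  na2 : ¬ Mod (+ ℓ) (+ 2) (+ 0)
  na2 q = ℓ≢2 (prime-≡ prℓ prime2 (Mod⇒∣ {a = + 2} q))

  na6 : ¬ Mod (+ ℓ) (+ 6) (+ 0)
  na6 q = cases (euclid prℓ {+ 2} {+ 3} q)
   where cases : Mod (+ ℓ) (+ 2) (+ 0) ⊎ Mod (+ ℓ) (+ 3) (+ 0) → ⊥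
         cases (inj₁ p) = na2 p
         cases (inj₂ p) = ℓ≢3 (prime-≡ prℓ prime3 (Mod⇒∣ {a = + 3} p))

  ℓ²≡1 : Mod (+ 12) (+ ℓ * + ℓ) (+ 1)
  ℓ²≡1 = go (unit24 (ℓ NM.% 12) (NM.m%n<n ℓ 12))
   where
   ℓ≡ : Mod (+ 12) (+ ℓ) (+ (ℓ NM.% 12))
   ℓ≡ = ResidueSystem.%-Mod 11 (+ ℓ)
   factor : ∀ c → c ND.∣ 12 → c ND.∣ ℓ NM.% 12 → c ND.∣ ℓ
   factor c c∣12 c∣r = subst (c ND.∣_) (sym (NM.m≡m%n+[m/n]*n ℓ 12)) (ND.∣m∣n⇒∣m+n c∣r (ND.∣-trans c∣12 (ND.n∣m*n (ℓ NM./ 12))))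
   go : Unit24 (ℓ NM.% 12) → Mod (+ 12) (+ ℓ * + ℓ) (+ 1)
   go (by-2 c p)  = ⊥-elim (ℓ≢2 (sym (prime-≡ prime2 prℓ (factor 2 (ND.divides 6 refl) (ND.divides c p)))))
   go (by-3 c p) = ⊥-elim (ℓ≢3 (sym (prime-≡ prime3 prℓ (factor 3 (ND.divides 4 refl) (ND.divides c p)))))
   go (prime-to-6 c p _) = Mod-tr (Mod-* ℓ≡ ℓ≡) (mod (+ (2 N.* c)) (trans (sym (ZP.pos-* (ℓ NM.% 12) (ℓ NM.% 12))) (trans (cong +_ (trans p (cong suc (h c)))) (cong (_+_ (+ 1)) (ZP.pos-* (2 N.* c) 12)))))
    where h : ∀ c → 24 N.* c ≡ 2 N.* c N.* 12
          h = ringN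

 exponents : ∀ m k r ℓ → Prime m → 5 N.≤ m → r N.< m N.^ k → Prime ℓ → ℓ ≢ 2 → ℓ ≢ 3 → ℓ ≢ m →
  ∃ λ K → 1 N.≤ K × (∀ μ n → 1 N.≤ μ → Coprime.Coprime n ℓ → m N.^ k ND.∣ pr24 r (m N.^ k N.* ℓ N.^ (2 N.* μ N.* K N.∸ 1) N.* n N.+ r)) ×
     (∀ i n → pr24 r (m N.^ k N.* ℓ N.^ i N.* n N.+ r) ≡ pr24 r (m N.^ k N.* ℓ N.^ (2 N.* K N.+ i) N.* n N.+ r) [mod m N.^ k ])
 exponents zero    k r ℓ pm 5≤m r< pℓ ≢2 ≢3 ≢m = ⊥-elim (NP.<⇒≱ 5≤m z≤n)
 exponents (suc d) k r zero pm 5≤m r< pℓ ≢2 ≢3 ≢m = ⊥-elim (Prime.¬prime[0] pℓ)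
 exponents (suc d) k r (suc l) pm 5≤m r< pℓ ≢2 ≢3 ≢m = go (suc d N.^ k) refl (partition-form k r<)
  where
  open Projection d pm 5≤m r using (pw; pw-pos; m^>0; na-2; na-↑; unit; unit-cancel-Mod; partition-form)
  open Prime24 pℓ ≢2 ≢3
  Goal : ℕ → Set
  Goal M = ∃ λ K → 1 N.≤ K × (∀ μ n → 1 N.≤ μ → Coprime.Coprime n (suc l) → M ND.∣ pr24 r (M N.* suc l N.^ (2 N.* μ N.* K N.∸ 1) N.* n N.+ r)) ×
     (∀ i n → pr24 r (M N.* suc l N.^ i N.* n N.+ r) ≡ pr24 r (M N.* suc l N.^ (2 N.* K N.+ i) N.* n N.+ r) [mod M ])
  ℓ∤^ : ∀ i → ¬ Mod (+ suc l) (+ (suc d N.^ i)) (+ 0)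
  ℓ∤^ zero    q = Prime.¬prime[1] (subst Prime (ND.∣1⇒≡1 (Mod⇒∣ {a = + 1} q)) pℓ)
  ℓ∤^ (suc i) q with euclid pℓ {+ suc d} {+ (suc d N.^ i)} (subst (λ z → Mod (+ suc l) z (+ 0)) (ZP.pos-* (suc d) (suc d N.^ i)) q)
  ... | inj₁ q' = ≢m (prime-≡ pℓ pm (Mod⇒∣ {a = + suc d} q'))
  ... | inj₂ q' = ℓ∤^ i q'
  -- The modulus m^k is generalised to M so that it can be matched as a successor.
  go : ∀ M → suc d N.^ k ≡ M → (∃ λ s → ∃ λ w → ∃ λ P → Iso (suc w) P × (∀ x → Mod (pw k) ((η ↑ s · P) (suc d N.^ k N.* x)) (+ pr24 r (suc d N.^ k N.* x N.+ r)))) → Goal M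
  go zero M≡ _ = ⊥-elim (NP.<⇒≱ (m^>0 k) (NP.≤-reflexive M≡))
  go (suc h) M≡ (s , w , P , iP , G-part) = exponent , exponent≥1 , vanishing , periodicity
   where
   H≡ : pw k ≡ + suc h
   H≡ = trans (pw-pos k) (cong +_ M≡)
   Dℓ : ℤ
   -- The theta series have 4(w + 1) + s variables, two more than this exponent. The power is a unit
   -- modulo m^k as ℓ ≠ m.
   Dℓ = (+ suc l) Z.^ (2 N.+ (w N.* 4 N.+ s))
   Dℓ-inverse : ∃ λ u → Mod (pw k) (Dℓ * u) (+ 1)
   Dℓ-inverse = unit k Dℓ (na-↑ (2 N.+ (w N.* 4 N.+ s)) λ q → ≢m (sym (prime-≡ pm pℓ (Mod⇒∣ {a = + suc l} q))))
   G : Ser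
   G = η ↑ s · P
   G-theta : Theta (sixes (suc w N.* 4) (Vec.replicate s true)) (const ((+ 2) Z.^ s) · G)
   G-theta = Theta-≋ (E.solve 3 (λ p c y → p E.:* (c E.:* y) E.:= c E.:* (y E.:* p)) E.rfl P (const ((+ 2) Z.^ s)) (η ↑ s)) (Theta-iso iP (Theta-η s))
   opaque
    𝔻 : HeckeData l h r
    𝔻 = record { n = 3 N.+ (w N.* 4 N.+ s) ; Dℓ = Dℓ ; Dℓ⁻¹ = proj₁ Dℓ-inverse ; κ = (+ 2) Z.^ s ; Dℓ≡ = ZP.*-assoc (+ suc l) (+ suc l) Dℓ
     ; Dℓ-unit = subst (λ M → Mod M (Dℓ * proj₁ Dℓ-inverse) (+ 1)) H≡ (proj₂ Dℓ-inverse)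
     ; κ-cancel = λ {a} {b} p → subst (λ M → Mod M a b) H≡ (unit-cancel-Mod k (na-↑ s na-2) (subst (λ M → Mod M ((+ 2) Z.^ s * a) ((+ 2) Z.^ s * b)) (sym H≡) p))
     ; G = G ; T0 = proj₁ (Theta-combination G-theta) ; G-expansion = λ N → trans (sym (const-·-≡ ((+ 2) Z.^ s) G N)) (proj₂ (Theta-combination G-theta) N)
     ; G-partition = λ x → subst (λ M → Mod (+ M) (G (M N.* x)) (+ pr24 r (M N.* x N.+ r))) M≡ (subst (λ N → Mod N (G (suc d N.^ k N.* x)) (+ pr24 r (suc d N.^ k N.* x N.+ r))) (pw-pos k) (G-part x)) }
   open Hecke l pℓ na2 na6 ℓ²≡1 h r (subst (λ M → ¬ Mod (+ suc l) (+ M) (+ 0)) M≡ (ℓ∤^ k)) 𝔻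

open HeckePeriodicity

open import Data.Nat using (_+_; _*_; _∸_; _^_; _≤_; _<_)
open import Data.Nat.Divisibility using (_∣_)
open import Data.Nat.Coprimality using (Coprime)

theorem4p1 : (m k r ℓ : ℕ) → Prime m → 5 ≤ m → 1 ≤ k → Odd r → 1 ≤ r → r < m ^ k →
  Prime ℓ → ℓ ≢ 2 → ℓ ≢ 3 → ℓ ≢ m →
  (Σ ℕ λ K → 1 ≤ K × ((μ n : ℕ) → 1 ≤ μ → 1 ≤ n → Coprime n ℓ →
    m ^ k ∣ pr24 r (m ^ k * ℓ ^ (2 * μ * K ∸ 1) * n + r)))
  × (Σ ℕ λ M → 1 ≤ M × ((i n : ℕ) →
    pr24 r (m ^ k * ℓ ^ i * n + r) ≡ pr24 r (m ^ k * ℓ ^ (2 * M + i) * n + r) [mod m ^ k ]))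
theorem4p1 m k r ℓ pm 5≤m _ _ _ r<m^k pℓ ℓ≢2 ℓ≢3 ℓ≢m = conclude (exponents m k r ℓ pm 5≤m r<m^k pℓ ℓ≢2 ℓ≢3 ℓ≢m)
 where conclude = λ (K , K≥1 , vanishes , periodic) → (K , K≥1 , λ μ n 1≤μ _ → vanishes μ n 1≤μ) , (K , K≥1 , periodic)
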